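{- Let $\alpha$ be a quadratic irrational real algebraic number. There are constants $K, C > 0$ depending only on $\alpha$ such that for every $r \ge 1$, every $\alpha$-PA sentence $S$ with $r$ alternating quantifier blocks can be decided in time at most $$K \cdot 2^{2^{\cdot^{\cdot^{\cdot^{2^{C\,\ell(S)}}}}}} \quad (\text{tower of height } r).$$
   Context: For a real number $\alpha$, an $\alpha$-PA sentence ($\alpha$-Presburger sentence) is a statement $Q_1 \mathbf{x}_1 \in \mathbb{Z}^{n_1} \dots Q_r \mathbf{x}_r \in \mathbb{Z}^{n_r}\ \Phi(\mathbf{x}_1,\dots,\mathbf{x}_r)$, where $Q_1,\dots,Q_r \in \{\forall,\exists\}$ are $r$ alternating quantifiers, $\mathbf{x}_1,\dots,\mathbf{x}_r$ are blocks of integer variables, and $\Phi$ is a Boolean combination of linear inequalities in $\mathbf{x}_1,\dots,\mathbf{x}_r$ with coefficients and constant terms in $\mathbb{Z}[\alpha]$. Deciding a sentence means determining whether it is true. A real algebraic number $\alpha$ of degree $d$ is given by its defining $\mathbb{Z}[x]$-polynomial of degree $d$ together with a rational interval singling out a unique root; it is called quadratic if $d=2$. Elements of $\mathbb{Z}[\alpha]$ are represented as $c_0 + c_1\alpha + \dots + c_{d-1}\alpha^{d-1}$ with $c_i \in \mathbb{Z}$. The encoding length $\ell(S)$ of an $\alpha$-PA sentence $S$ is the total bit length of all symbols in $S$, with integer coefficients and constants written in binary. Tower of height $r$: with $T_1(x) = 2^x$ and $T_{j+1}(x) = 2^{T_j(x)}$, the displayed bound is $K \cdot T_r(C\,\ell(S))$.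 -}

module Defs where

open import Data.Bool.Base using (Bool; true; false)
open import Data.Digit using (Bit; toDigits)
open import Data.Fin.Base using (Fin; zero; suc; toℕ)
open import Data.Integer.Base as ℤ using (ℤ; +_; -[1+_])
open import Data.List.Base as List using (List; []; _∷_; _++_; length; concatMap; foldr)
open import Data.Maybe.Base using (Maybe; just; nothing)
open import Data.Nat.Base as ℕ using (ℕ; zero; suc)
import Data.Nat.Properties as ℕ
open import Data.Product.Base using (∃-syntax; _×_; _,_; proj₁)
open import Data.Rational.Base as ℚ using (ℚ; 0ℚ; 1ℚ; ∣_∣)
import Data.Rational.Properties as ℚ
open import Data.Rational.Solver using (module +-*-Solver)
open import Data.Sum.Base using (_⊎_; inj₁; inj₂)
open import Data.Vec.Base as Vec using (Vec; []; _∷_; lookup)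
open import Relation.Binary.PropositionalEquality
  using (_≡_; _≢_; refl; sym; trans; cong; cong₂; subst)
open import Relation.Nullary using (¬_)
open import Relation.Nullary.Reflects using (Reflects)

------------------------------------------------------------------------
-- Real numbers: Cauchy sequences of rationals, with equality and order
-- being those of the limits.  The lemmas only serve to show that sums and
-- products of Cauchy sequences are Cauchy.

EventuallyClose : (ℕ → ℚ) → ℚ → Set
EventuallyClose x ε =
  ∃[ N ] (∀ m n → N ℕ.≤ m → N ℕ.≤ n → ∣ x m ℚ.- x n ∣ ℚ.≤ ε)

record ℝ : Set where
  constructor mkℝ
  field
    seq    : ℕ → ℚ
    cauchy : ∀ ε → 0ℚ ℚ.< ε → EventuallyClose seq ε

open ℝ public

infix 4 _≈ᴿ_ _≤ᴿ_ _<ᴿ_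

_≈ᴿ_ : ℝ → ℝ → Set
x ≈ᴿ y = ∀ ε → 0ℚ ℚ.< ε →
  ∃[ N ] (∀ n → N ℕ.≤ n → ∣ seq x n ℚ.- seq y n ∣ ℚ.≤ ε)

_≤ᴿ_ : ℝ → ℝ → Set
x ≤ᴿ y = ∀ ε → 0ℚ ℚ.< ε →
  ∃[ N ] (∀ n → N ℕ.≤ n → seq x n ℚ.≤ seq y n ℚ.+ ε)

_<ᴿ_ : ℝ → ℝ → Set
x <ᴿ y = ∃[ ε ] (0ℚ ℚ.< ε × ∃[ N ] (∀ n → N ℕ.≤ n → seq x n ℚ.+ ε ℚ.≤ seq y n))

fromℚ : ℚ → ℝ
fromℚ q = mkℝ (λ _ → q) λ ε 0<ε → 0 , λ _ _ _ _ →
  subst (ℚ._≤ ε) (sym (cong ∣_∣ (ℚ.+-inverseʳ q))) (ℚ.<⇒≤ 0<ε)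

fromℤ : ℤ → ℝ
fromℤ i = fromℚ (i ℚ./ 1)

private
  module _ (B : ℚ) (1≤B : 1ℚ ℚ.≤ B) where

    0<B : 0ℚ ℚ.< B
    0<B = ℚ.<-≤-trans (ℚ.positive⁻¹ 1ℚ) 1≤B

    fraction : ∀ ε → 0ℚ ℚ.< ε → ∃[ δ ] (0ℚ ℚ.< δ × B ℚ.* δ ≡ ε)
    fraction ε 0<ε = (ℚ.1/ B) ℚ.* ε , ℚ.positive⁻¹ _ , eq
      where
      instance
        posB = ℚ.positive 0<B
        nzB  = ℚ.pos⇒nonZero B
        posε = ℚ.positive 0<ε
        pos1/B = ℚ.1/pos⇒pos B
        posδ = ℚ.pos*pos⇒pos (ℚ.1/ B) ε
      eq : B ℚ.* ((ℚ.1/ B) ℚ.* ε) ≡ ε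
      eq = trans (sym (ℚ.*-assoc B (ℚ.1/ B) ε))
          (trans (cong (ℚ._* ε) (ℚ.*-inverseʳ B)) (ℚ.*-identityˡ ε))

  1≤p+q : ∀ {p q} → 1ℚ ℚ.≤ p → 0ℚ ℚ.≤ q → 1ℚ ℚ.≤ p ℚ.+ q
  1≤p+q {p} {q} 1≤p 0≤q = begin
    1ℚ         ≡⟨ ℚ.+-identityʳ 1ℚ ⟨
    1ℚ ℚ.+ 0ℚ  ≤⟨ ℚ.+-mono-≤ 1≤p 0≤q ⟩
    p ℚ.+ q    ∎
    where open ℚ.≤-Reasoning

  +-split : ∀ a b c d → (a ℚ.+ b) ℚ.- (c ℚ.+ d) ≡ (a ℚ.- c) ℚ.+ (b ℚ.- d)
  +-split = solve 4 (λ a b c d → (a :+ b) :- (c :+ d) := (a :- c) :+ (b :- d)) refl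
    where open +-*-Solver

  *-split : ∀ a b c d → a ℚ.* b ℚ.- c ℚ.* d ≡ a ℚ.* (b ℚ.- d) ℚ.+ d ℚ.* (a ℚ.- c)
  *-split = solve 4 (λ a b c d → a :* b :- c :* d := a :* (b :- d) :+ d :* (a :- c)) refl
    where open +-*-Solver

  difference : ∀ a b → a ≡ (a ℚ.- b) ℚ.+ b
  difference = solve 2 (λ a b → a := (a :- b) :+ b) refl
    where open +-*-Solver

  *-bound : ∀ {p q r s} → ∣ p ∣ ℚ.≤ q → ∣ r ∣ ℚ.≤ s → ∣ p ℚ.* r ∣ ℚ.≤ q ℚ.* s
  *-bound {p} {q} {r} {s} p≤q r≤s = begin
    ∣ p ℚ.* r ∣      ≡⟨ ℚ.∣p*q∣≡∣p∣*∣q∣ p r ⟩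
    ∣ p ∣ ℚ.* ∣ r ∣  ≤⟨ ℚ.*-monoʳ-≤-nonNeg ∣ r ∣ {{ℚ.∣-∣-nonNeg r}} p≤q ⟩
    q ℚ.* ∣ r ∣      ≤⟨ ℚ.*-monoˡ-≤-nonNeg q {{ℚ.nonNegative (ℚ.≤-trans (ℚ.0≤∣p∣ p) p≤q)}} r≤s ⟩
    q ℚ.* s          ∎
    where open ℚ.≤-Reasoning

  eventually-bounded : (x : ℝ) →
    ∃[ B ] (1ℚ ℚ.≤ B × ∃[ N ] (∀ n → N ℕ.≤ n → ∣ seq x n ∣ ℚ.≤ B))
  eventually-bounded x with cauchy x 1ℚ (ℚ.positive⁻¹ 1ℚ)
  ... | N , close = 1ℚ ℚ.+ ∣ seq x N ∣ , 1≤p+q ℚ.≤-refl (ℚ.0≤∣p∣ (seq x N)) , N , bound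
    where
    open ℚ.≤-Reasoning
    bound : ∀ n → N ℕ.≤ n → ∣ seq x n ∣ ℚ.≤ 1ℚ ℚ.+ ∣ seq x N ∣
    bound n N≤n = begin
      ∣ seq x n ∣                               ≡⟨ cong ∣_∣ (difference (seq x n) (seq x N)) ⟩
      ∣ (seq x n ℚ.- seq x N) ℚ.+ seq x N ∣     ≤⟨ ℚ.∣p+q∣≤∣p∣+∣q∣ (seq x n ℚ.- seq x N) (seq x N) ⟩
      ∣ seq x n ℚ.- seq x N ∣ ℚ.+ ∣ seq x N ∣   ≤⟨ ℚ.+-monoˡ-≤ ∣ seq x N ∣ (close n N N≤n ℕ.≤-refl) ⟩
      1ℚ ℚ.+ ∣ seq x N ∣                        ∎

  +-estimate : ∀ a b c d {δ} → ∣ a ℚ.- c ∣ ℚ.≤ δ → ∣ b ℚ.- d ∣ ℚ.≤ δ →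
               ∣ (a ℚ.+ b) ℚ.- (c ℚ.+ d) ∣ ℚ.≤ (1ℚ ℚ.+ 1ℚ) ℚ.* δ
  +-estimate a b c d {δ} ac bd = begin
    ∣ (a ℚ.+ b) ℚ.- (c ℚ.+ d) ∣   ≡⟨ cong ∣_∣ (+-split a b c d) ⟩
    ∣ (a ℚ.- c) ℚ.+ (b ℚ.- d) ∣   ≤⟨ ℚ.∣p+q∣≤∣p∣+∣q∣ (a ℚ.- c) (b ℚ.- d) ⟩
    ∣ a ℚ.- c ∣ ℚ.+ ∣ b ℚ.- d ∣   ≤⟨ ℚ.+-mono-≤ ac bd ⟩
    δ ℚ.+ δ                       ≡⟨ cong₂ ℚ._+_ (ℚ.*-identityˡ δ) (ℚ.*-identityˡ δ) ⟨
    1ℚ ℚ.* δ ℚ.+ 1ℚ ℚ.* δ         ≡⟨ ℚ.*-distribʳ-+ δ 1ℚ 1ℚ ⟨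
    (1ℚ ℚ.+ 1ℚ) ℚ.* δ             ∎
    where open ℚ.≤-Reasoning

  *-estimate : ∀ a b c d {A B δ} → ∣ a ∣ ℚ.≤ A → ∣ d ∣ ℚ.≤ B →
               ∣ a ℚ.- c ∣ ℚ.≤ δ → ∣ b ℚ.- d ∣ ℚ.≤ δ →
               ∣ a ℚ.* b ℚ.- c ℚ.* d ∣ ℚ.≤ (A ℚ.+ B) ℚ.* δ
  *-estimate a b c d {A} {B} {δ} a≤A d≤B ac bd = begin
    ∣ a ℚ.* b ℚ.- c ℚ.* d ∣                        ≡⟨ cong ∣_∣ (*-split a b c d) ⟩
    ∣ a ℚ.* (b ℚ.- d) ℚ.+ d ℚ.* (a ℚ.- c) ∣        ≤⟨ ℚ.∣p+q∣≤∣p∣+∣q∣ (a ℚ.* (b ℚ.- d)) (d ℚ.* (a ℚ.- c)) ⟩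
    ∣ a ℚ.* (b ℚ.- d) ∣ ℚ.+ ∣ d ℚ.* (a ℚ.- c) ∣    ≤⟨ ℚ.+-mono-≤ (*-bound {a} {A} {b ℚ.- d} {δ} a≤A bd)
                                                                (*-bound {d} {B} {a ℚ.- c} {δ} d≤B ac) ⟩
    A ℚ.* δ ℚ.+ B ℚ.* δ                            ≡⟨ ℚ.*-distribʳ-+ δ A B ⟨
    (A ℚ.+ B) ℚ.* δ                                ∎
    where open ℚ.≤-Reasoning

  +-cauchy : (x y : ℝ) → ∀ ε → 0ℚ ℚ.< ε →
             EventuallyClose (λ n → seq x n ℚ.+ seq y n) ε
  +-cauchy x y ε 0<ε =
    let δ , 0<δ , 2δ≡ε = fraction (1ℚ ℚ.+ 1ℚ) (1≤p+q ℚ.≤-refl (ℚ.<⇒≤ (ℚ.positive⁻¹ 1ℚ))) ε 0<ε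
        M , closeˣ     = cauchy x δ 0<δ
        N , closeʸ     = cauchy y δ 0<δ
    in M ℕ.+ N , λ m n L≤m L≤n →
      subst (∣ (seq x m ℚ.+ seq y m) ℚ.- (seq x n ℚ.+ seq y n) ∣ ℚ.≤_) 2δ≡ε
        (+-estimate (seq x m) (seq y m) (seq x n) (seq y n)
          (closeˣ m n (ℕ.m+n≤o⇒m≤o M L≤m) (ℕ.m+n≤o⇒m≤o M L≤n))
          (closeʸ m n (ℕ.m+n≤o⇒n≤o M L≤m) (ℕ.m+n≤o⇒n≤o M L≤n)))

  *-cauchy : (x y : ℝ) → ∀ ε → 0ℚ ℚ.< ε →
             EventuallyClose (λ n → seq x n ℚ.* seq y n) ε
  *-cauchy x y ε 0<ε =
    let A , 1≤A , I , boundˣ = eventually-bounded x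
        B , 1≤B , J , boundʸ = eventually-bounded y
        δ , 0<δ , [A+B]δ≡ε   = fraction (A ℚ.+ B) (1≤p+q 1≤A (ℚ.<⇒≤ (0<B B 1≤B))) ε 0<ε
        M , closeˣ           = cauchy x δ 0<δ
        N , closeʸ           = cauchy y δ 0<δ
    in (I ℕ.+ J) ℕ.+ (M ℕ.+ N) , λ m n L≤m L≤n →
      let IJ≤m = ℕ.m+n≤o⇒m≤o (I ℕ.+ J) L≤m
          IJ≤n = ℕ.m+n≤o⇒m≤o (I ℕ.+ J) L≤n
          MN≤m = ℕ.m+n≤o⇒n≤o (I ℕ.+ J) L≤m
          MN≤n = ℕ.m+n≤o⇒n≤o (I ℕ.+ J) L≤n
      in subst (∣ seq x m ℚ.* seq y m ℚ.- seq x n ℚ.* seq y n ∣ ℚ.≤_) [A+B]δ≡ε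
        (*-estimate (seq x m) (seq y m) (seq x n) (seq y n)
          (boundˣ m (ℕ.m+n≤o⇒m≤o I IJ≤m)) (boundʸ n (ℕ.m+n≤o⇒n≤o I IJ≤n))
          (closeˣ m n (ℕ.m+n≤o⇒m≤o M MN≤m) (ℕ.m+n≤o⇒m≤o M MN≤n))
          (closeʸ m n (ℕ.m+n≤o⇒n≤o M MN≤m) (ℕ.m+n≤o⇒n≤o M MN≤n)))

infixl 6 _+ᴿ_
infixl 7 _*ᴿ_

_+ᴿ_ : ℝ → ℝ → ℝ
x +ᴿ y = mkℝ (λ n → seq x n ℚ.+ seq y n) (+-cauchy x y)

_*ᴿ_ : ℝ → ℝ → ℝ
x *ᴿ y = mkℝ (λ n → seq x n ℚ.* seq y n) (*-cauchy x y)

-- For an irrational α, having an integer quadratic polynomial vanishing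
-- at α is the same as being algebraic of degree exactly 2.
record QuadraticIrrational (α : ℝ) : Set where
  field
    a b c      : ℤ
    a≢0        : a ≢ + 0
    root       : fromℤ a *ᴿ (α *ᴿ α) +ᴿ fromℤ b *ᴿ α +ᴿ fromℤ c ≈ᴿ fromℤ (+ 0)
    irrational : ∀ q → ¬ (α ≈ᴿ fromℚ q)

------------------------------------------------------------------------
-- α-Presburger sentences

-- Syntax only: the real number denoted is Truth.⟦_⟧ below.
record ℤ[α] : Set where
  constructor _+_·α
  field
    c₀ c₁ : ℤ

data Inequality : Set where
  le lt : Inequality

-- n is the number of variables in scope.  The constructor
-- atom ((a₁ , i₁) ∷ … ∷ (aₖ , iₖ) ∷ []) le b  stands for
-- a₁ x_{i₁} + … + aₖ x_{iₖ} ≤ b.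
data Formula (n : ℕ) : Set where
  atom     : List (ℤ[α] × Fin n) → Inequality → ℤ[α] → Formula n
  and or   : Formula n → Formula n → Formula n
  not      : Formula n → Formula n

data Quantifier : Set where
  all ex : Quantifier

dual : Quantifier → Quantifier
dual all = ex
dual ex  = all

-- Prenex Q n r: a prenex formula with n free variables and r alternating
-- quantifier blocks, the outermost of which (if any) is a Q-block.  A
-- block of m variables binds the indices 0, …, m - 1 and shifts the
-- indices of the variables already in scope by m.
data Prenex : Quantifier → ℕ → ℕ → Set where
  matrix : ∀ {Q n} → Formula n → Prenex Q n 0
  block  : ∀ {Q n r} (m : ℕ) .{{_ : ℕ.NonZero m}} →
           Prenex (dual Q) (m ℕ.+ n) r → Prenex Q n (suc r)

record Sentence (r : ℕ) : Set where
  constructor sentence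
  field
    outermost : Quantifier
    prenex    : Prenex outermost 0 r

module Truth (α : ℝ) where

  ⟦_⟧ : ℤ[α] → ℝ
  ⟦ c₀ + c₁ ·α ⟧ = fromℤ c₀ +ᴿ fromℤ c₁ *ᴿ α

  linear : ∀ {n} → Vec ℤ n → List (ℤ[α] × Fin n) → ℝ
  linear ρ = foldr (λ (a , i) s → ⟦ a ⟧ *ᴿ fromℤ (lookup ρ i) +ᴿ s) (fromℤ (+ 0))

  holds : Inequality → ℝ → ℝ → Set
  holds le = _≤ᴿ_
  holds lt = _<ᴿ_

  formula : ∀ {n} → Vec ℤ n → Formula n → Set
  formula ρ (atom t R b) = holds R (linear ρ t) ⟦ b ⟧
  formula ρ (and φ ψ)    = formula ρ φ × formula ρ ψ
  formula ρ (or φ ψ)     = formula ρ φ ⊎ formula ρ ψ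
  formula ρ (not φ)      = ¬ formula ρ φ

  prenex : ∀ {Q n r} → Vec ℤ n → Prenex Q n r → Set
  prenex       ρ (matrix φ)  = formula ρ φ
  prenex {all} ρ (block m S) = (x : Vec ℤ m) → prenex (x Vec.++ ρ) S
  prenex {ex}  ρ (block m S) = ∃[ x ] prenex (Vec._++_ {m = m} x ρ) S

infix 4 _⊨_

_⊨_ : ∀ {r} → ℝ → Sentence r → Set
α ⊨ S = Truth.prenex α [] (Sentence.prenex S)

------------------------------------------------------------------------
-- Sentences as words

data Symbol : Set where
  ‵∀ ‵∃ ‵x ‵0 ‵1 ‵- ‵+ ‵α ‵⟨ ‵⟩ ‵≤ ‵< ‵∧ ‵∨ ‵¬ : Symbol

bits : Symbol → List Bool
bits ‵∀ = false ∷ false ∷ false ∷ false ∷ []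
bits ‵∃ = false ∷ false ∷ false ∷ true  ∷ []
bits ‵x = false ∷ false ∷ true  ∷ false ∷ []
bits ‵0 = false ∷ false ∷ true  ∷ true  ∷ []
bits ‵1 = false ∷ true  ∷ false ∷ false ∷ []
bits ‵- = false ∷ true  ∷ false ∷ true  ∷ []
bits ‵+ = false ∷ true  ∷ true  ∷ false ∷ []
bits ‵α = false ∷ true  ∷ true  ∷ true  ∷ []
bits ‵⟨ = true  ∷ false ∷ false ∷ false ∷ []
bits ‵⟩ = true  ∷ false ∷ false ∷ true  ∷ []
bits ‵≤ = true  ∷ false ∷ true  ∷ false ∷ []
bits ‵< = true  ∷ false ∷ true  ∷ true  ∷ []
bits ‵∧ = true  ∷ true  ∷ false ∷ false ∷ []
bits ‵∨ = true  ∷ true  ∷ false ∷ true  ∷ []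
bits ‵¬ = true  ∷ true  ∷ true  ∷ false ∷ []

-- Binary digits are written least significant first.
module Write where

  bit : Bit → Symbol
  bit zero       = ‵0
  bit (suc zero) = ‵1

  nat : ℕ → List Symbol
  nat n = List.map bit (proj₁ (toDigits 2 n))

  int : ℤ → List Symbol
  int (+ n)    = nat n
  int -[1+ n ] = ‵- ∷ nat (suc n)

  coeff : ℤ[α] → List Symbol
  coeff (c₀ + c₁ ·α) = ‵⟨ ∷ int c₀ ++ ‵+ ∷ int c₁ ++ ‵α ∷ ‵⟩ ∷ []

  inequality : Inequality → Symbol
  inequality le = ‵≤
  inequality lt = ‵<

  -- Connectives are written in prefix notation, which needs no parentheses.
  formula : ∀ {n} → Formula n → List Symbol
  formula (atom t R b) =
    concatMap (λ (a , i) → coeff a ++ ‵x ∷ nat (toℕ i)) t ++ inequality R ∷ coeff b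
  formula (and φ ψ)    = ‵∧ ∷ formula φ ++ formula ψ
  formula (or φ ψ)     = ‵∨ ∷ formula φ ++ formula ψ
  formula (not φ)      = ‵¬ ∷ formula φ

  quantifier : Quantifier → Symbol
  quantifier all = ‵∀
  quantifier ex  = ‵∃

  -- A block is its quantifier followed by one ‵x for each bound variable.
  prenex : ∀ {Q n r} → Prenex Q n r → List Symbol
  prenex     (matrix φ)  = formula φ
  prenex {Q} (block m S) = quantifier Q ∷ List.replicate m ‵x ++ prenex S

encode : ∀ {r} → Sentence r → List Bool
encode S = concatMap bits (Write.prenex (Sentence.prenex S))

ℓ : ∀ {r} → Sentence r → ℕ
ℓ S = length (encode S)

------------------------------------------------------------------------
-- Deterministic multitape Turing machines

data Letter (g : ℕ) : Set where
  blank : Letter g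
  bit   : Bool → Letter g
  aux   : Fin g → Letter g

data Move : Set where
  left stay right : Move

record TM : Set where
  field
    workTapes auxLetters states : ℕ
    start : Fin states

  tapes : ℕ
  tapes = suc workTapes

  Γ : Set
  Γ = Letter auxLetters

  field
    -- A transition either halts with an answer, or enters a new state,
    -- writing a letter and moving the head on each tape.
    δ : Fin states → Vec Γ tapes → Bool ⊎ (Fin states × Vec (Γ × Move) tapes)

-- A two-way infinite tape: the cells to the left of the head (nearest
-- first), the scanned cell, and the cells to the right (nearest first).
-- All unlisted cells are blank.
record Tape (g : ℕ) : Set where
  constructor tape
  field
    before : List (Letter g)
    head   : Letter g
    after  : List (Letter g)

move : ∀ {g} → Move → Tape g → Tape g
move left  (tape []       h rs)       = tape [] blank (h ∷ rs)
move left  (tape (l ∷ ls) h rs)       = tape ls l (h ∷ rs)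
move stay  t                          = t
move right (tape ls       h [])       = tape (h ∷ ls) blank []
move right (tape ls       h (r ∷ rs)) = tape (h ∷ ls) r rs

act : ∀ {g} → Letter g × Move → Tape g → Tape g
act (a , d) (tape ls _ rs) = move d (tape ls a rs)

load : ∀ {g} → List Bool → Tape g
load []       = tape [] blank []
load (b ∷ bs) = tape [] (bit b) (List.map bit bs)

module _ (M : TM) where
  open TM M

  Config : Set
  Config = Fin states × Vec (Tape auxLetters) tapes

  step : Config → Bool ⊎ Config
  step (q , ts) with δ q (Vec.map Tape.head ts)
  ... | inj₁ answer         = inj₁ answer
  ... | inj₂ (q′ , actions) = inj₂ (q′ , Vec.zipWith act actions ts)

  initial : List Bool → Config
  initial w = start , load w ∷ Vec.replicate workTapes (load [])

  run : ℕ → Config → Maybe Bool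
  run zero    c = nothing
  run (suc t) c with step c
  ... | inj₁ answer = just answer
  ... | inj₂ c′     = run t c′

  -- On input w, M halts within t steps with the truth value of P.
  DecidesWithin : List Bool → ℕ → Set → Set
  DecidesWithin w t P = ∃[ answer ] (run t (initial w) ≡ just answer × Reflects P answer)

-- tower r x has r twos: tower 1 x = 2 ^ x.
tower : ℕ → ℕ → ℕ
tower zero    x = x
tower (suc r) x = 2 ℕ.^ tower r x

{-# OPTIONS --safe #-}
module Submission where

-- Let β = X + Y √D be a Pell unit.  Integers are written in the numeration system with
-- weights U k, where βᵏ⁺¹ - β⁻ᵏ⁻¹ = 2 Y √D U k, and a letter of a word carries one digit
-- for each variable.  A finite automaton checks an inequality by carrying two elements of
-- ℤ[√D] up to rounding, one multiplied by β and one by β⁻¹ at each letter; both stay in a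
-- box of size exponential in ℓ, so there are only exponentially many states.  The atoms of
-- the matrix are claimed true or false in advance and all claims are checked in parallel.
-- Each quantifier block but the outermost is eliminated by projection and determinization,
-- at the cost of one exponential, and the outermost one by a reachability test.  All this
-- is computed by loop programs on unary stacks in time polynomial in the size of the last
-- automaton, and these programs are compiled to Turing machines.

open import Defs
open import Algebra.Definitions using (Congruent₁)
open import Data.Bool.Base as Bool using (Bool; true; false; if_then_else_; T; _∧_; _∨_)
open import Data.Digit using (Bit; toDigits; fromDigits)
open import Data.Empty using (⊥; ⊥-elim)
open import Data.Fin.Base as Fin using (Fin; zero; suc; toℕ; _↑ˡ_; _↑ʳ_)
import Data.Fin.Properties as Fin
open import Data.Integer.Base as Z using (0ℤ; 1ℤ; ℤ; -[1+_]; _⊖_)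
import Data.Integer.Properties as Z
open import Data.Integer.Solver renaming (module +-*-Solver to Z-Solver)
open import Data.Rational.Base as Q using (ℚ; mkℚ; 0ℚ; 1ℚ; ½)
import Data.Rational.Properties as Q
open import Data.Rational.Solver renaming (module +-*-Solver to ℚ-Solver)
import Data.Nat.Coprimality as Coprime
open import Data.List.Base as List using (List; []; _∷_; _++_; _ʳ++_; length; map; replicate; reverse)
import Data.List.Properties as List
open import Data.List.Properties using (++-assoc; ++-identityʳ; length-++; length-drop; length-map; length-replicate; length-reverse; length-take; map-++; map-cong; map-replicate; map-∘; reverse-involutive; reverse-map; take++drop≡id; ʳ++-defn; ʳ++-ʳ++)
import Data.List.Relation.Unary.All.Properties as AllP
open import Data.List.Relation.Unary.All as All using (All; []; _∷_)
open import Data.Maybe.Base using (Maybe; just; nothing)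
open import Data.Nat.Base as ℕ using (ℕ; zero; suc; _+_; _*_; _∸_; _^_; _≤_; _<_; z≤n; s≤s; _≤ᵇ_; _≡ᵇ_; NonZero)
import Data.Nat.DivMod as DM
import Data.Nat.Divisibility as DV
import Data.Nat.Properties as ℕ
open import Data.Nat.Properties hiding (module ≤-Reasoning) renaming (≤-reflexive to ≡⇒≤)
open import Data.Nat.Solver renaming (module +-*-Solver to ℕ-Solver)
open import Data.Product.Base using (Σ; Σ-syntax; ∃; ∃₂; ∃-syntax; _×_; _,_) renaming (proj₁ to fst; proj₂ to snd)
open import Data.Sum.Base as Sum using (_⊎_) renaming (inj₁ to in1; inj₂ to in2)
open import Data.Unit.Base using (⊤; tt)
open import Data.Vec.Base as Vec using (Vec; []; _∷_; lookup)
import Data.Vec.Properties as Vec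
open import Function.Base using (_∘_; id; case_of_)
open import Relation.Binary.PropositionalEquality using (_≡_; _≢_; _≗_; refl; sym; cong; subst; module ≡-Reasoning) renaming (trans to tr; cong₂ to cong2; subst₂ to subst2)
open import Relation.Binary.Definitions using (tri<; tri≈; tri>)
open import Relation.Nullary using (¬_; Dec; yes; no; contradiction)
open import Relation.Nullary.Reflects using (Reflects; ofʸ; ofⁿ; _×-reflects_; _⊎-reflects_; ¬-reflects)

-- Stack programs

-- The tower has height `r` only because the automaton of the matrix is singly exponential in the
-- length. Multiplication by β expands an element by at least 2 and contracts its conjugate by as
-- much, so value and conjugate can both be kept bounded; this leaves finitely many elements
-- although ℤ[√D] is dense in the reals. Since the automata compare only up to ≼, a value above the
-- box may be lowered to its edge, while one below it never recovers; hence accepting runs stay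
-- inside. The boxes of the atoms are multiplied, and as distinct atoms occupy distinct parts of the
-- text, the product is exponential in the length and not in its square. The guesses make these
-- automata nondeterministic, so complementing one would already cost an exponential; claims avoid
-- this, because the negation of an inequality is an inequality of the same kind. Projection has its
-- own obstacle: a witness may have more digits than the word it extends. Finally, all is
-- constructive: acceptance and rejection are matched with two separate statements.

infixr 5 _﹔_

data Cmd : Set where
 skip : Cmd
 push : ℕ -> Bool -> Cmd
 _﹔_ : Cmd -> Cmd -> Cmd
 branch : ℕ -> Cmd -> (Bool -> Cmd) -> Cmd
 loop : ℕ -> (Bool -> Cmd) -> Cmd

Store : Set
Store = ℕ -> List Bool

-- Stores are functions and are compared only pointwise, so a changed store is given by its value at
-- one stack and a frame condition.
record Update (i : ℕ) (s : List Bool) (σ σ' : Store) : Set where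
 constructor update
 field
  at : σ' i ≡ s
  frame : ∀ j -> j ≢ i -> σ' j ≡ σ j

open Update public

-- branch and loop pop the stack; branch has a separate exit for the empty
-- stack, loop leaves when the stack is empty.  The last index is the exact
-- number of steps of the machine below.
data Exec : Cmd -> Store -> Store -> ℕ -> Set where
 skip : ∀ {σ σ'} -> (∀ j -> σ' j ≡ σ j) -> Exec skip σ σ' 1
 push : ∀ {i b σ σ'} -> Update i (b ∷ σ i) σ σ' -> Exec (push i b) σ σ' 1
 _﹔_ : ∀ {c d σ σ1 σ' t1 t2} -> Exec c σ σ1 t1 -> Exec d σ1 σ' t2 -> Exec (c ﹔ d) σ σ' (t1 + t2)
 branch∅ : ∀ {i c d σ σ' t} -> σ i ≡ [] -> Exec c σ σ' t -> Exec (branch i c d) σ σ' (2 + t)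
 branch:: : ∀ {i c d b s σ σ1 σ' t} -> σ i ≡ b ∷ s -> Update i s σ σ1 -> Exec (d b) σ1 σ' t -> Exec (branch i c d) σ σ' (2 + t)
 loop∅ : ∀ {i d σ σ'} -> σ i ≡ [] -> (∀ j -> σ' j ≡ σ j) -> Exec (loop i d) σ σ' 2
 loop:: : ∀ {i d b s σ σ1 σ2 σ' t1 t2} -> σ i ≡ b ∷ s -> Update i s σ σ1 -> Exec (d b) σ1 σ2 t1 -> Exec (loop i d) σ2 σ' t2 -> Exec (loop i d) σ σ' (2 + (t1 + t2))

-- An upper bound for the stacks that occur. Sums in place of maxima let a bound for a compound
-- command split into bounds for its parts.
width : Cmd -> ℕ
width skip = 0
width (push i b) = suc i
width (c ﹔ d) = width c + width d
width (branch i c d) = suc i + (width c + (width (d false) + width (d true)))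
width (loop i d) = suc i + (width (d false) + width (d true))

m+n<=o=>either : ∀ (f : Bool -> ℕ) {o} -> f false + f true ≤ o -> ∀ b -> f b ≤ o
m+n<=o=>either f p false = m+n≤o⇒m≤o (f false) p
m+n<=o=>either f p true = m+n≤o⇒n≤o (f false) p

-- The control states of the compiled machine are the positions in the program. A stack lies to the
-- left of a blank scanned cell, so a test takes two states: `pop` moves onto the top symbol, `top`
-- reads and erases it. These are the two extra steps in `Exec`.
data State : Cmd -> Set where
 skip : State skip
 push : ∀ {i b} -> State (push i b)
 inl : ∀ {c d} -> State c -> State (c ﹔ d)
 inr : ∀ {c d} -> State d -> State (c ﹔ d)
 pop top : ∀ {i c d} -> State (branch i c d)
 in∅ : ∀ {i c d} -> State c -> State (branch i c d)
 in:: : ∀ {i c d} b -> State (d b) -> State (branch i c d)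
 popl topl : ∀ {i d} -> State (loop i d)
 inˡ : ∀ {i d} b -> State (d b) -> State (loop i d)

entry : ∀ c -> State c
entry skip = skip
entry (push i b) = push
entry (c ﹔ d) = inl (entry c)
entry (branch i c d) = pop
entry (loop i d) = popl

♯ : Cmd -> ℕ
♯ skip = 1
♯ (push i b) = 1
♯ (c ﹔ d) = ♯ c + ♯ d
♯ (branch i c d) = 2 + (♯ c + (♯ (d false) + ♯ (d true)))
♯ (loop i d) = 2 + (♯ (d false) + ♯ (d true))

toFin : ∀ {c} -> State c -> Fin (♯ c)
toFin skip = zero
toFin push = zero
toFin {c ﹔ d} (inl s) = toFin s ↑ˡ ♯ d
toFin {c ﹔ d} (inr s) = ♯ c ↑ʳ toFin s
toFin {branch i c d} pop = zero
toFin {branch i c d} top = suc zero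
toFin {branch i c d} (in∅ s) = suc (suc (toFin s ↑ˡ _))
toFin {branch i c d} (in:: false s) = suc (suc (♯ c ↑ʳ (toFin s ↑ˡ _)))
toFin {branch i c d} (in:: true s) = suc (suc (♯ c ↑ʳ (♯ (d false) ↑ʳ toFin s)))
toFin {loop i d} popl = zero
toFin {loop i d} topl = suc zero
toFin {loop i d} (inˡ false s) = suc (suc (toFin s ↑ˡ _))
toFin {loop i d} (inˡ true s) = suc (suc (♯ (d false) ↑ʳ toFin s))

fromFin : ∀ c -> Fin (♯ c) -> State c
fromFin skip _ = skip
fromFin (push i b) _ = push
fromFin (c ﹔ d) k = Sum.[ inl ∘ fromFin c , inr ∘ fromFin d ] (Fin.splitAt (♯ c) k)
fromFin (branch i c d) zero = pop
fromFin (branch i c d) (suc zero) = top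
fromFin (branch i c d) (suc (suc k)) = Sum.[ in∅ ∘ fromFin c , Sum.[ in:: false ∘ fromFin (d false) , in:: true ∘ fromFin (d true) ] ∘ Fin.splitAt (♯ (d false)) ] (Fin.splitAt (♯ c) k)
fromFin (loop i d) zero = popl
fromFin (loop i d) (suc zero) = topl
fromFin (loop i d) (suc (suc k)) = Sum.[ inˡ false ∘ fromFin (d false) , inˡ true ∘ fromFin (d true) ] (Fin.splitAt (♯ (d false)) k)

fromFin-toFin : ∀ {c} (s : State c) -> fromFin c (toFin s) ≡ s
fromFin-toFin skip = refl
fromFin-toFin push = refl
fromFin-toFin {c ﹔ d} (inl s) rewrite Fin.splitAt-↑ˡ (♯ c) (toFin s) (♯ d) = cong inl (fromFin-toFin s)
fromFin-toFin {c ﹔ d} (inr s) rewrite Fin.splitAt-↑ʳ (♯ c) (♯ d) (toFin s) = cong inr (fromFin-toFin s)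
fromFin-toFin {branch i c d} pop = refl
fromFin-toFin {branch i c d} top = refl
fromFin-toFin {branch i c d} (in∅ s) rewrite Fin.splitAt-↑ˡ (♯ c) (toFin s) (♯ (d false) + ♯ (d true)) = cong in∅ (fromFin-toFin s)
fromFin-toFin {branch i c d} (in:: false s) rewrite Fin.splitAt-↑ʳ (♯ c) (♯ (d false) + ♯ (d true)) (toFin s ↑ˡ ♯ (d true))
  | Fin.splitAt-↑ˡ (♯ (d false)) (toFin s) (♯ (d true)) = cong (in:: false) (fromFin-toFin s)
fromFin-toFin {branch i c d} (in:: true s) rewrite Fin.splitAt-↑ʳ (♯ c) (♯ (d false) + ♯ (d true)) (♯ (d false) ↑ʳ toFin s)
  | Fin.splitAt-↑ʳ (♯ (d false)) (♯ (d true)) (toFin s) = cong (in:: true) (fromFin-toFin s)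
fromFin-toFin {loop i d} popl = refl
fromFin-toFin {loop i d} topl = refl
fromFin-toFin {loop i d} (inˡ false s) rewrite Fin.splitAt-↑ˡ (♯ (d false)) (toFin s) (♯ (d true)) = cong (inˡ false) (fromFin-toFin s)
fromFin-toFin {loop i d} (inˡ true s) rewrite Fin.splitAt-↑ʳ (♯ (d false)) (♯ (d true)) (toFin s) = cong (inˡ true) (fromFin-toFin s)

Cell : Set
Cell = Letter 0

module Flow (K : ℕ) where
 Heads Actions Tapes : Set
 Heads = Vec Cell K
 Actions = Vec (Cell × Move) K
 Tapes = Vec (Tape 0) K
 scanned : ∀ {k} -> Vec Cell k -> ℕ -> Cell
 scanned [] i = blank
 scanned (x ∷ xs) zero = x
 scanned (x ∷ xs) (suc i) = scanned xs i
 actOn : ∀ {k} -> ℕ -> Cell × Move -> Vec Cell k -> Vec (Cell × Move) k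
 actOn i a [] = []
 actOn zero a (x ∷ xs) = a ∷ Vec.map (_, stay) xs
 actOn (suc i) a (x ∷ xs) = (x , stay) ∷ actOn i a xs
 popAt : ℕ -> Heads -> Actions
 popAt i = actOn i (blank , left)
 clearAt : ℕ -> Heads -> Actions
 clearAt i = actOn i (blank , stay)
 idle : Heads -> Actions
 idle = Vec.map (_, stay)
 onTop : {A : Set} -> Cell -> A -> (Bool -> A) -> A
 onTop (bit b) n f = f b
 onTop _ n f = n
 -- Transfers a transition of a subprogram to the whole: inner states are wrapped by `f`, and
 -- leaving the subprogram continues at `k`, where `nothing` means leaving the whole as well.
 embed : ∀ {c e} -> (State c -> State e) -> Maybe (State e) -> Maybe (State c) × Actions -> Maybe (State e) × Actions
 embed f k (just s , a) = just (f s) , a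
 embed f k (nothing , a) = k , a
 next : ∀ {c} -> State c -> Heads -> Maybe (State c) × Actions
 next skip h = nothing , idle h
 next {push i b} push h = nothing , actOn i (bit b , right) h
 next {c ﹔ d} (inl s) h = embed inl (just (inr (entry d))) (next s h)
 next {c ﹔ d} (inr s) h = embed inr nothing (next s h)
 next {branch i c d} pop h = just top , popAt i h
 next {branch i c d} top h = just (onTop (scanned h i) (in∅ (entry c)) (\ b -> in:: b (entry (d b)))) , clearAt i h
 next {branch i c d} (in∅ s) h = embed in∅ nothing (next s h)
 next {branch i c d} (in:: b s) h = embed (in:: b) nothing (next s h)
 next {loop i d} popl h = just topl , popAt i h
 next {loop i d} topl h = onTop (scanned h i) nothing (\ b -> just (inˡ b (entry (d b)))) , clearAt i h
 next {loop i d} (inˡ b s) h = embed (inˡ b) (just popl) (next s h)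
 heads : Tapes -> Heads
 heads = Vec.map Tape.head
 apply : Actions -> Tapes -> Tapes
 apply = Vec.zipWith act
 -- The step that leaves the program is counted and already acts on the tapes, so that lengths add
 -- up under composition.
 data Path {c : Cmd} (s : State c) (ts : Tapes) : ℕ -> Tapes -> Set where
  exit : ∀ {a} -> next s (heads ts) ≡ (nothing , a) -> Path s ts 1 (apply a ts)
  go : ∀ {s' a n ts'} -> next s (heads ts) ≡ (just s' , a) -> Path s' (apply a ts) n ts' -> Path s ts (suc n) ts'
 embed-last : ∀ {c e} (f : State c -> State e) -> (∀ s h -> next (f s) h ≡ embed f nothing (next s h)) -> ∀ {s ts n ts'} -> Path s ts n ts' -> Path (f s) ts n ts'
 embed-last f hyp (exit eq) = exit (tr (hyp _ _) (cong (embed f nothing) eq))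
 embed-last f hyp (go eq p) = go (tr (hyp _ _) (cong (embed f nothing) eq)) (embed-last f hyp p)
 embed-then : ∀ {c e} (f : State c -> State e) {s0 : State e} -> (∀ s h -> next (f s) h ≡ embed f (just s0) (next s h)) -> ∀ {s ts n ts1 m ts'} -> Path s ts n ts1 -> Path s0 ts1 m ts' ->
  Path (f s) ts (n + m) ts'
 embed-then f hyp (exit eq) q = go (tr (hyp _ _) (cong (embed f _) eq)) q
 embed-then f hyp (go eq p) q = go (tr (hyp _ _) (cong (embed f _) eq)) (embed-then f hyp p q)
 -- The tape of a stack: its symbols to the left of a blank scanned cell.
 OnTape : List Bool -> Tape 0 -> Set
 OnTape s t = ∃[ m ] t ≡ tape (map bit s) blank (replicate m blank)
 OnTapes : Store -> Tapes -> Set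
 OnTapes σ ts = ∀ j -> OnTape (σ (toℕ j)) (lookup ts j)
 -- The tape between the two steps of a pop, with the top symbol, if there is one, under the head.
 Scans : List Bool -> Tape 0 -> Set
 Scans [] t = OnTape [] t
 Scans (b ∷ s) t = ∃[ m ] t ≡ tape (map bit s) (bit b) (replicate m blank)
 apply-idle : ∀ {k} (ts : Vec (Tape 0) k) -> Vec.zipWith act (Vec.map (_, stay) (Vec.map Tape.head ts)) ts ≡ ts
 apply-idle [] = refl
 apply-idle (t ∷ ts) = cong (t ∷_) (apply-idle ts)
 lookup-at : ∀ {k} (ts : Vec (Tape 0) k) j a -> lookup (Vec.zipWith act (actOn (toℕ j) a (Vec.map Tape.head ts)) ts) j ≡ act a (lookup ts j)
 lookup-at (t ∷ ts) zero a = refl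
 lookup-at (t ∷ ts) (suc j) a = lookup-at ts j a
 lookup-off : ∀ {k} (ts : Vec (Tape 0) k) i j a -> toℕ j ≢ i -> lookup (Vec.zipWith act (actOn i a (Vec.map Tape.head ts)) ts) j ≡ lookup ts j
 lookup-off (t ∷ ts) zero zero a j/=i = contradiction refl j/=i
 lookup-off (t ∷ ts) zero (suc j) a j/=i = cong (\ ts' -> lookup ts' j) (apply-idle ts)
 lookup-off (t ∷ ts) (suc i) zero a j/=i = refl
 lookup-off (t ∷ ts) (suc i) (suc j) a j/=i = lookup-off ts i j a (j/=i ∘ cong suc)
 scanned-lookup : ∀ {k} (ts : Vec (Tape 0) k) j -> scanned (Vec.map Tape.head ts) (toℕ j) ≡ Tape.head (lookup ts j)
 scanned-lookup (t ∷ ts) zero = refl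
 scanned-lookup (t ∷ ts) (suc j) = scanned-lookup ts j
 pop-tape : ∀ {s t} -> OnTape s t -> Scans s (act (blank , left) t)
 pop-tape {[]} (m , refl) = suc m , refl
 pop-tape {b ∷ s} (m , refl) = suc m , refl
 OnTapes-update : ∀ {σ σ' s ts a} (j : Fin K) -> Update (toℕ j) s σ σ' -> OnTape s (act a (lookup ts j)) -> OnTapes σ ts -> OnTapes σ' (apply (actOn (toℕ j) a (heads ts)) ts)
 OnTapes-update {σ} {σ'} {s} {ts} {a} j u on rest k with k Fin.≟ j
 ... | yes refl = subst2 OnTape (sym (at u)) (sym (lookup-at ts k a)) on
 ... | no k/=j = subst2 OnTape (sym (frame u _ (k/=j ∘ Fin.toℕ-injective))) (sym (lookup-off ts (toℕ j) k a (k/=j ∘ Fin.toℕ-injective))) (rest k)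
 OnTapes-cong : ∀ {σ σ' ts} -> (∀ j -> σ' j ≡ σ j) -> OnTapes σ ts -> OnTapes σ' ts
 OnTapes-cong eq on j = subst (\ s -> OnTape s _) (sym (eq (toℕ j))) (on j)
 module Pop {σ σ' : Store} {s ts} (j : Fin K) (on : OnTapes σ ts) (u : Update (toℕ j) s σ σ') where
  i : ℕ
  i = toℕ j
  ts1 ts2 : Tapes
  ts1 = apply (popAt i (heads ts)) ts
  ts2 = apply (clearAt i (heads ts1)) ts1
  scans : Scans (σ i) (lookup ts1 j)
  scans = subst (Scans (σ i)) (sym (lookup-at ts j (blank , left))) (pop-tape (on j))
  off : ∀ k -> k ≢ j -> lookup ts2 k ≡ lookup ts k
  off k k/=j = tr (lookup-off ts1 i k _ (k/=j ∘ Fin.toℕ-injective)) (lookup-off ts i k _ (k/=j ∘ Fin.toℕ-injective))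
  clear-tape : ∀ s' {t} -> Scans s' t -> (s' ≡ [] × s ≡ [] ⊎ ∃[ b ] s' ≡ b ∷ s) -> OnTape s (act (blank , stay) t)
  clear-tape [] (m , refl) (in1 (refl , refl)) = m , refl
  clear-tape (b ∷ s) (m , refl) (in2 (b , refl)) = m , refl
  on2 : (σ i ≡ [] × s ≡ [] ⊎ ∃[ b ] σ i ≡ b ∷ s) -> OnTapes σ' ts2
  on2 shape k with k Fin.≟ j
  ... | yes refl = subst2 OnTape (sym (at u)) (sym (lookup-at ts1 k (blank , stay))) (clear-tape (σ i) scans shape)
  ... | no k/=j = subst2 OnTape (sym (frame u _ (k/=j ∘ Fin.toℕ-injective))) (sym (off k k/=j)) (on k)
  onTop-∅ : ∀ {A : Set} {n : A} {f} -> σ i ≡ [] -> onTop (scanned (heads ts1) i) n f ≡ n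
  onTop-∅ eq with σ i | scans
  onTop-∅ refl | .[] | m , e rewrite scanned-lookup ts1 j | e = refl
  onTop-:: : ∀ {A : Set} {n : A} {f b} -> σ i ≡ b ∷ s -> onTop (scanned (heads ts1) i) n f ≡ f b
  onTop-:: eq with σ i | scans
  onTop-:: refl | _ | m , e rewrite scanned-lookup ts1 j | e = refl
 keep : ∀ {σ i s} -> σ i ≡ s -> Update i s σ σ
 keep eq = update eq (\ _ _ -> refl)
 index : ∀ {i} -> i < K -> ∃[ j ] toℕ j ≡ i
 index i<K = Fin.fromℕ< i<K , Fin.toℕ-fromℕ< i<K
 simulate : ∀ {c σ σ' t ts} -> Exec c σ σ' t -> width c ≤ K -> OnTapes σ ts -> ∃[ ts' ] (Path (entry c) ts t ts' × OnTapes σ' ts')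
 simulate {σ = σ} {ts = ts} (skip eq) w on = _ , exit refl , OnTapes-cong {ts = apply (idle (heads ts)) ts} eq (subst (OnTapes σ) (sym (apply-idle ts)) on)
 simulate {push i b} {ts = ts} (push u) w on with index w
 ... | j , refl with on j
 ... | m , e = _ , exit refl , OnTapes-update {ts = ts} j u (pushed m e) on
  where
  pushed : ∀ {s t} m -> t ≡ tape (map bit s) blank (replicate m blank) -> OnTape (b ∷ s) (act (bit b , right) t)
  pushed zero refl = 0 , refl
  pushed (suc m) refl = m , refl
 simulate {c ﹔ d} (p ﹔ q) w on = let
   ts1 , path1 , on1 = simulate p (m+n≤o⇒m≤o (width c) w) on
   ts2 , path2 , on2 = simulate q (m+n≤o⇒n≤o (width c) w) on1
  in ts2 , embed-then inl (\ _ _ -> refl) path1 (embed-last inr (\ _ _ -> refl) path2) , on2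
 simulate {branch i c d} {σ} {ts = ts} (branch∅ eq p) w on with index (m+n≤o⇒m≤o (suc i) w)
 ... | j , refl = let
   open Pop {σ} {σ} {ts = ts} j on (keep eq)
   w' = m+n≤o⇒n≤o (suc (toℕ j)) w
   ts' , path , on' = simulate p (m+n≤o⇒m≤o (width c) w') (on2 (in1 (eq , refl)))
  in ts' , go refl (go (cong (\ s -> just s , _) (onTop-∅ eq)) (embed-last in∅ (\ _ _ -> refl) path)) , on'
 simulate {branch i c d} {ts = ts} (branch:: {b = b} eq u p) w on with index (m+n≤o⇒m≤o (suc i) w)
 ... | j , refl = let
   open Pop {ts = ts} j on u
   w' = m+n≤o⇒n≤o (width c) (m+n≤o⇒n≤o (suc (toℕ j)) w)
   ts' , path , on' = simulate p (m+n<=o=>either (width ∘ d) w' b) (on2 (in2 (_ , eq)))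
  in ts' , go refl (go (cong (\ s -> just s , _) (onTop-:: eq)) (embed-last (in:: b) (\ _ _ -> refl) path)) , on'
 simulate {loop i d} {σ} {σ'} {ts = ts} (loop∅ eq same) w on with index (m+n≤o⇒m≤o (suc i) w)
 ... | j , refl = let
   open Pop {σ} {σ'} {ts = ts} j on (update (tr (same _) eq) (\ k _ -> same k))
  in ts2 , go refl (exit (cong (\ s -> s , _) (onTop-∅ eq))) , on2 (in1 (eq , refl))
 simulate {loop i d} {ts = ts} (loop:: {b = b} eq u p q) w on with index (m+n≤o⇒m≤o (suc i) w)
 ... | j , refl = let
   open Pop {ts = ts} j on u
   w' = m+n≤o⇒n≤o (suc (toℕ j)) w
   _ , path1 , on3 = simulate p (m+n<=o=>either (width ∘ d) w' b) (on2 (in2 (_ , eq)))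
   ts' , path2 , on' = simulate q w on3
  in ts' , go refl (go (cong (\ s -> s , _) (onTop-:: eq)) (embed-then (inˡ b) (\ _ _ -> refl) path1 path2)) , on'

-- The machine first moves to the end of its input, which turns the input tape
-- into a stack holding the reversed word, then runs the program, and finally
-- answers whether stack o is nonempty.
module Decider (c : Cmd) (o : ℕ) where
 open Flow (suc (width c + o)) public
 data Stage : Set where
  scan : Stage
  work : State c -> Stage
  out test : Stage
 stages : ℕ
 stages = 3 + ♯ c
 code : Stage -> Fin stages
 code scan = zero
 code out = suc zero
 code test = suc (suc zero)
 code (work s) = suc (suc (suc (toFin s)))
 decode : Fin stages -> Stage
 decode zero = scan
 decode (suc zero) = out
 decode (suc (suc zero)) = test
 decode (suc (suc (suc k))) = work (fromFin c k)
 decode-code : ∀ s -> decode (code s) ≡ s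
 decode-code scan = refl
 decode-code (work s) = cong work (fromFin-toFin s)
 decode-code out = refl
 decode-code test = refl
 afterWork : Maybe (State c) × Actions -> Bool ⊎ (Stage × Actions)
 afterWork (just s , a) = in2 (work s , a)
 afterWork (nothing , a) = in2 (out , a)
 afterScan : Cell -> Heads -> Bool ⊎ (Stage × Actions)
 afterScan blank h = in2 (work (entry c) , idle h)
 afterScan (bit b) h = in2 (scan , actOn 0 (bit b , right) h)
 afterScan (aux ())
 transition : Stage -> Heads -> Bool ⊎ (Stage × Actions)
 transition scan h = afterScan (scanned h 0) h
 transition (work s) h = afterWork (next s h)
 transition out h = in2 (test , popAt o h)
 transition test h = in1 (onTop (scanned h o) false (\ _ -> true))
 machine : TM
 machine = record { workTapes = width c + o ; auxLetters = 0 ; states = stages ; start = code scan ; δ = \ q h -> Sum.map₂ (\ (s , a) -> code s , a) (transition (decode q) h) }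
 config : Stage -> Tapes -> Config machine
 config s ts = code s , ts
 run-halt : ∀ {s ts b} n -> transition s (heads ts) ≡ in1 b -> run machine (suc n) (config s ts) ≡ just b
 run-halt {s} n eq rewrite decode-code s | eq = refl
 run-step : ∀ {s ts s' a} n -> transition s (heads ts) ≡ in2 (s' , a) -> run machine (suc n) (config s ts) ≡ run machine n (config s' (apply a ts))
 run-step {s} n eq rewrite decode-code s | eq = refl
 run-path : ∀ {s ts t ts'} n -> Path {c} s ts t ts' -> run machine (t + n) (config (work s) ts) ≡ run machine n (config out ts')
 run-path {s} n (exit eq) = run-step {work s} n (cong afterWork eq)
 run-path {s} n (go {n = t} eq p) = tr (run-step {work s} (t + n) (cong afterWork eq)) (run-path n p)
 input : List Bool -> Store
 input s zero = s
 input s (suc _) = []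
 cons-tape : List Cell -> List Bool -> Tape 0
 cons-tape ls [] = tape ls blank []
 cons-tape ls (b ∷ w) = tape ls (bit b) (map bit w)
 run-scan : ∀ n w s {ts} -> ts ≡ cons-tape (map bit s) w ∷ Vec.replicate (width c + o) (load []) -> ∃[ ts' ] (OnTapes (input (w ʳ++ s)) ts' ×
   run machine (suc (length w) + n) (config scan ts) ≡ run machine n (config (work (entry c)) ts'))
 run-scan n [] s {ts} refl = apply (idle (heads ts)) ts , on , refl
  where
  on : OnTapes (input s) (apply (idle (heads ts)) ts)
  on zero = 0 , refl
  on (suc j) = 0 , tr (cong (\ ts -> lookup ts j) (apply-idle (Vec.replicate _ (load [])))) (Vec.lookup-replicate j (load []))
 run-scan n (b ∷ w) s refl = let
   ts' , on , eq = run-scan n w (b ∷ s) (cong2 _∷_ (moved w) (apply-idle (Vec.replicate _ (load []))))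
  in ts' , on , eq
  where
  moved : ∀ w -> move right (tape (map bit s) (bit b) (map bit w)) ≡ cons-tape (bit b ∷ map bit s) w
  moved [] = refl
  moved (_ ∷ _) = refl
 load-cons : ∀ w -> load w ≡ cons-tape [] w
 load-cons [] = refl
 load-cons (_ ∷ _) = refl
 nonempty : List Bool -> Bool
 nonempty [] = false
 nonempty (_ ∷ _) = true
 popped : ∀ {σ ts} (j : Fin (suc (width c + o))) -> OnTapes σ ts -> onTop (scanned (heads (apply (popAt (toℕ j) (heads ts)) ts)) (toℕ j)) false (\ _ -> true) ≡ nonempty (σ (toℕ j))
 popped {σ} {ts} j on = answer (σ i) refl
  where
  i = toℕ j
  rest : List Bool
  rest = List.drop 1 (σ i)
  at' : (if i ≡ᵇ i then rest else σ i) ≡ rest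
  at' with i ≡ᵇ i | ≡⇒≡ᵇ i i refl
  ... | true | _ = refl
  frame' : ∀ k -> k ≢ i -> (if k ≡ᵇ i then rest else σ k) ≡ σ k
  frame' k k/=i with k ≡ᵇ i in eq
  ... | true = contradiction (≡ᵇ⇒≡ k i (subst T (sym eq) tt)) k/=i
  ... | false = refl
  open Pop {σ} {\ k -> if k ≡ᵇ i then rest else σ k} {s = rest} {ts = ts} j on (update at' frame') using (ts1; onTop-∅; onTop-::)
  answer : ∀ s -> σ i ≡ s -> onTop (scanned (heads ts1) i) false (\ _ -> true) ≡ nonempty s
  answer [] eq = onTop-∅ eq
  answer (b ∷ s) eq = onTop-:: (tr eq (cong (\ z -> b ∷ List.drop 1 z) (sym eq)))
 run-out : ∀ n {σ ts} -> OnTapes σ ts -> run machine (2 + n) (config out ts) ≡ just (nonempty (σ o))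
 run-out n {σ} {ts} on with index {o} (s≤s (m≤n+m o (width c)))
 ... | j , eq = tr (run-step {out} {ts} (suc n) refl) (run-halt {test} {apply (popAt o (heads ts)) ts} n (cong in1
  (subst (\ i -> onTop (scanned (heads (apply (popAt i (heads ts)) ts)) i) false (\ _ -> true) ≡ nonempty (σ i)) eq (popped {σ} {ts} j on))))
 run-mono : ∀ {n m s b} -> run machine n s ≡ just b -> n ≤ m -> run machine m s ≡ just b
 run-mono {suc n} {suc m} {s} eq (s≤s n≤m) with step machine s
 ... | in1 _ = eq
 ... | in2 _ = run-mono {n} eq n≤m
 decides : ∀ w {σ' t} -> Exec c (input (reverse w)) σ' t -> ∀ {m} -> length w + t + 3 ≤ m -> run machine m (initial machine w) ≡ just (nonempty (σ' o))
 decides w {σ'} {t} p {m} fits = run-mono {n = suc (length w) + (t + (2 + 0))} (tr eq (tr (run-path (2 + 0) path) (run-out 0 {σ'} {fst simulated} on'))) (subst (_≤ m) arith fits)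
  where
  arith : length w + t + 3 ≡ suc (length w) + (t + 2)
  arith = tr (+-suc (length w + t) 2) (cong suc (+-assoc (length w) t 2))
  scanned-input = run-scan (t + (2 + 0)) w [] (cong (_∷ _) (load-cons w))
  ts = fst scanned-input
  eq = snd (snd scanned-input)
  on0 : OnTapes (input (reverse w)) ts
  on0 zero = fst (snd scanned-input) zero
  on0 (suc j) = fst (snd scanned-input) (suc j)
  simulated = simulate p (≤-trans (m≤m+n _ o) (n≤1+n _)) on0
  path = fst (snd simulated)
  on' = snd (snd simulated)

-- Elementary programs: clearing, moving and duplicating stacks

set : ℕ -> List Bool -> Store -> Store
set i s σ j = if j ≡ᵇ i then s else σ j

=b-refl : ∀ n -> (n ≡ᵇ n) ≡ true
=b-refl zero = refl
=b-refl (suc n) = =b-refl n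

/==>=b-false : ∀ {m n} -> m ≢ n -> (m ≡ᵇ n) ≡ false
/==>=b-false {m} {n} m≢n with m ≡ᵇ n in eq
... | true = contradiction (≡ᵇ⇒≡ m n (subst T (sym eq) tt)) m≢n
... | false = refl

upd-set : ∀ i s σ -> Update i s σ (set i s σ)
upd-set i s σ = update (cong (if_then s else σ i) (=b-refl i)) (\ j j/=i -> cong (if_then s else σ j) (/==>=b-false j/=i))

clear : ℕ -> Cmd
clear i = loop i (\ _ -> skip)

clear-exec : ∀ i s {σ} -> σ i ≡ s -> ∃[ σ' ] (Exec (clear i) σ σ' (2 + 3 * length s) × Update i [] σ σ')
clear-exec i [] {σ} eq = σ , loop∅ eq (\ _ -> refl) , update eq (\ _ _ -> refl)
clear-exec i (b ∷ s) {σ} eq with upd-set i s σ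
... | u with clear-exec i s {set i s σ} (at u)
... | σ' , p , u' = σ' , subst (Exec (clear i) σ σ') (time s) (loop:: eq u (skip (\ _ -> refl)) p) , update (at u') (\ j j/=i -> tr (frame u' j j/=i) (frame u j j/=i))
 where
 time : ∀ s -> 2 + (1 + (2 + 3 * length s)) ≡ 2 + 3 * length (b ∷ s)
 time s = cong (\ t -> 2 + t) (sym (*-suc 3 (length s)))

transfer : ℕ -> ℕ -> Cmd
transfer i j = loop i (push j)

record Transferred (i j : ℕ) (s : List Bool) (σ σ' : Store) : Set where
 field
  source : σ' i ≡ []
  target : σ' j ≡ s ʳ++ σ j
  others : ∀ k -> k ≢ i -> k ≢ j -> σ' k ≡ σ k

transfer-exec : ∀ {i j} s {σ} -> i ≢ j -> σ i ≡ s -> ∃[ σ' ] (Exec (transfer i j) σ σ' (2 + 3 * length s) × Transferred i j s σ σ')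
transfer-exec [] {σ} i≢j eq = σ , loop∅ eq (\ _ -> refl) , record { source = eq ; target = refl ; others = \ _ _ _ -> refl }
transfer-exec {i} {j} (b ∷ s) {σ} i≢j eq = σ' , subst (Exec (transfer i j) σ σ') time (loop:: eq u (push v) (fst (snd rest))) , record { source = source
  ; target = tr target (cong (s ʳ++_) (tr (at v) (cong (b ∷_) (frame u j (i≢j ∘ sym))))) ; others = \ k k/=i k/=j -> tr (others k k/=i k/=j) (tr (frame v k k/=j) (frame u k k/=i)) }
 where
 σ1 = set i s σ
 u = upd-set i s σ
 σ2 = set j (b ∷ σ1 j) σ1
 v = upd-set j (b ∷ σ1 j) σ1
 rest = transfer-exec s {σ2} i≢j (tr (frame v i i≢j) (at u))
 σ' = fst rest
 open Transferred (snd (snd rest))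
 time : 2 + (1 + (2 + 3 * length s)) ≡ 2 + 3 * length (b ∷ s)
 time = cong (\ t -> 2 + t) (sym (*-suc 3 (length s)))

fork : ℕ -> ℕ -> ℕ -> Cmd
fork i j k = loop i (\ b -> push j b ﹔ push k b)

record Forked (i j k : ℕ) (s : List Bool) (σ σ' : Store) : Set where
 field
  source : σ' i ≡ []
  first : σ' j ≡ s ʳ++ σ j
  second : σ' k ≡ s ʳ++ σ k
  others : ∀ l -> l ≢ i -> l ≢ j -> l ≢ k -> σ' l ≡ σ l

fork-exec : ∀ {i j k} s {σ} -> i ≢ j -> i ≢ k -> j ≢ k -> σ i ≡ s -> ∃[ σ' ] (Exec (fork i j k) σ σ' (2 + 4 * length s) × Forked i j k s σ σ')
fork-exec [] {σ} i≢j i≢k j≢k eq = σ , loop∅ eq (\ _ -> refl) , record { source = eq ; first = refl ; second = refl ; others = \ _ _ _ _ -> refl }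
fork-exec {i} {j} {k} (b ∷ s) {σ} i≢j i≢k j≢k eq = σ' , subst (Exec (fork i j k) σ σ') time (loop:: eq u (push v ﹔ push w) (fst (snd rest))) , record { source = source
  ; first = tr first (cong (s ʳ++_) (tr (frame w j j≢k) (tr (at v) (cong (b ∷_) (frame u j (i≢j ∘ sym)))))) ; second = tr second (cong (s ʳ++_)
   (tr (at w) (cong (b ∷_) (tr (frame v k (j≢k ∘ sym)) (frame u k (i≢k ∘ sym)))))) ; others = \ l l/=i l/=j l/=k -> tr (others l l/=i l/=j l/=k)
   (tr (frame w l l/=k) (tr (frame v l l/=j) (frame u l l/=i))) }
 where
 σ1 = set i s σ
 u = upd-set i s σ
 σ2 = set j (b ∷ σ1 j) σ1
 v = upd-set j (b ∷ σ1 j) σ1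
 σ3 = set k (b ∷ σ2 k) σ2
 w = upd-set k (b ∷ σ2 k) σ2
 rest = fork-exec s {σ3} i≢j i≢k j≢k (tr (frame w i i≢k) (tr (frame v i i≢j) (at u)))
 σ' = fst rest
 open Forked (snd (snd rest))
 time : 2 + (2 + (2 + 4 * length s)) ≡ 2 + 4 * length (b ∷ s)
 time = cong (\ t -> 2 + t) (sym (*-suc 4 (length s)))

reverse-ʳ++ : ∀ {A : Set} (s t : List A) -> reverse s ʳ++ t ≡ s ++ t
reverse-ʳ++ s t = tr (ʳ++-defn (reverse s)) (cong (_++ t) (reverse-involutive s))

-- Growth of a stack is bounded by the running time, so that the size of a
-- computed value never needs a separate estimate.
update-length : ∀ {i s σ σ'} j -> Update i s σ σ' -> length s ≤ suc (length (σ i)) -> length (σ' j) ≤ suc (length (σ j))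
update-length {i} {s} {σ} {σ'} j u s<= with j ℕ.≟ i
... | yes refl = subst (_≤ _) (cong length (sym (at u))) s<=
... | no j/=i = subst (_≤ _) (cong length (sym (frame u j j/=i))) (n≤1+n _)

pop-length : ∀ {i b s σ σ'} j -> σ i ≡ b ∷ s -> Update i s σ σ' -> length (σ' j) ≤ length (σ j)
pop-length {i} {b} {s} {σ} {σ'} j eq u with j ℕ.≟ i
... | yes refl = subst2 _≤_ (cong length (sym (at u))) (cong length (sym eq)) (n≤1+n _)
... | no j/=i = ≡⇒≤ (cong length (frame u j j/=i))

<=-two : ∀ {m n t} -> m ≤ n + t -> m ≤ n + (2 + t)
<=-two {m} {n} {t} p = ≤-trans p (+-monoʳ-≤ n (m≤n+m t 2))

<=-chain : ∀ {l m n} t1 {t2} -> l ≤ m + t2 -> m ≤ n + t1 -> l ≤ n + (t1 + t2)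
<=-chain {l} {m} {n} t1 {t2} p q = ≤-trans p (≤-trans (+-monoˡ-≤ t2 q) (≡⇒≤ (+-assoc n t1 t2)))

exec-length : ∀ {c σ σ' t} -> Exec c σ σ' t -> ∀ j -> length (σ' j) ≤ length (σ j) + t
exec-length (skip eq) j = ≤-trans (≡⇒≤ (cong length (eq j))) (m≤m+n _ _)
exec-length {push i b} {σ} {σ'} (push u) j = subst (length (σ' j) ≤_) (+-comm 1 (length (σ j))) (update-length j u ≤-refl)
exec-length {σ = σ} (_﹔_ {t1 = t1} p q) j = <=-chain {n = length (σ j)} t1 (exec-length q j) (exec-length p j)
exec-length {σ = σ} (branch∅ _ p) j = <=-two {n = length (σ j)} (exec-length p j)
exec-length {σ = σ} (branch:: eq u p) j = <=-two {n = length (σ j)} (≤-trans (exec-length p j) (+-monoˡ-≤ _ (pop-length j eq u)))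
exec-length (loop∅ _ eq) j = ≤-trans (≡⇒≤ (cong length (eq j))) (m≤m+n _ _)
exec-length {σ = σ} (loop:: {t1 = t1} eq u p q) j = <=-two {n = length (σ j)} (<=-chain {n = length (σ j)} t1 (exec-length q j) (≤-trans (exec-length p j) (+-monoˡ-≤ t1 (pop-length j eq u))))

-- Functions computable in time polynomial in the size of the arguments and a
-- budget, an arbitrary function of the arguments that is never computed.

data Ty : Set where
 nat arr : Ty

El : Ty -> Set
El nat = ℕ
El arr = List ℕ

-- Numbers are in unary: the time bound is polynomial in the number of states itself, so this costs
-- nothing, and value and size become the same measure. In an array, `false` closes each entry.
enc : ∀ τ -> El τ -> List Bool
enc nat n = replicate n true
enc arr [] = []
enc arr (n ∷ ns) = replicate n true ++ false ∷ enc arr ns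

size : ∀ τ -> El τ -> ℕ
size τ v = length (enc τ v)

size-nat : ∀ n -> size nat n ≡ n
size-nat n = length-replicate n

Env : List Ty -> Set
Env [] = ⊤
Env (τ ∷ Γ) = El τ × Env Γ

sizes : ∀ Γ -> Env Γ -> ℕ
sizes [] _ = 0
sizes (τ ∷ Γ) (v , ρ) = size τ v + sizes Γ ρ

Layout : List Ty -> Set
Layout [] = ⊤
Layout (_ ∷ Γ) = ℕ × Layout Γ

Holds : ∀ Γ -> Layout Γ -> Store -> Env Γ -> Set
Holds [] _ σ _ = ⊤
Holds (τ ∷ Γ) (i , l) σ (v , ρ) = σ i ≡ enc τ v × Holds Γ l σ ρ

Avoids : ∀ Γ -> Layout Γ -> ℕ -> ℕ -> Set
Avoids [] _ o k = ⊤
Avoids (_ ∷ Γ) (i , l) o k = (i < k × i ≢ o) × Avoids Γ l o k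

avoids-map : ∀ Γ {l o k o' k'} -> (∀ {i} -> i < k -> i ≢ o -> i < k' × i ≢ o') -> Avoids Γ l o k -> Avoids Γ l o' k'
avoids-map [] f _ = tt
avoids-map (τ ∷ Γ) f ((i<k , i/=o) , a) = f i<k i/=o , avoids-map Γ f a

holds-cong : ∀ Γ {l o k σ σ' ρ} -> Avoids Γ l o k -> (∀ j -> j < k -> j ≢ o -> σ' j ≡ σ j) -> Holds Γ l σ ρ -> Holds Γ l σ' ρ
holds-cong [] a eq h = tt
holds-cong (τ ∷ Γ) ((i<k , i/=o) , a) eq (e , h) = tr (eq _ i<k i/=o) e , holds-cong Γ a eq h

<=>/=+ : ∀ {i k} n -> i < k -> i ≢ n + k
<=>/=+ n i<k refl = <⇒≱ i<k (m≤n+m _ n)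

-- The prospective output tape o is empty, and so are all tapes from k on,
-- which are available as scratch space.
record Ready Γ (l : Layout Γ) (o k : ℕ) (σ : Store) (ρ : Env Γ) : Set where
 field
  holds : Holds Γ l σ ρ
  avoids : Avoids Γ l o k
  o<k : o < k
  empty : σ o ≡ []
  clean : ∀ j -> k ≤ j -> σ j ≡ []

record Result (o k : ℕ) (v : List Bool) (σ σ' : Store) : Set where
 field
  output : σ' o ≡ v
  below : ∀ j -> j < k -> j ≢ o -> σ' j ≡ σ j
  clean' : ∀ j -> k ≤ j -> σ' j ≡ []

bud : ∀ {Γ} -> (Env Γ -> ℕ) -> Env Γ -> ℕ
bud {Γ} B ρ = 2 + (sizes Γ ρ + B ρ)

-- As a record it keeps base and exponent visible to unification, which would be lost in an unfolded
-- power.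
record Within (b k x : ℕ) : Set where
 constructor within
 field
  bound : x ≤ b ^ k

open Within public

module _ {b : ℕ} (2<=b : 2 ≤ b) where
 private
  instance
   b/=0 : NonZero b
   b/=0 = ℕ.>-nonZero (≤-trans (s≤s z≤n) 2<=b)
 weaken : ∀ {m n x} -> m ≤ n -> Within b m x -> Within b n x
 weaken m≤n (within p) = within (≤-trans p (^-monoʳ-≤ b m≤n))
 shrink : ∀ {m x y} -> x ≤ y -> Within b m y -> Within b m x
 shrink x≤y (within p) = within (≤-trans x≤y p)
 -- The extra degree pays for the factor 2 of a sum, since 2 ≤ `b`.
 plus : ∀ {m n x y} -> Within b m x -> Within b n y -> Within b (suc (m + n)) (x + y)
 plus {m} {n} {x} {y} p q = within (begin x + y ≤⟨ +-mono-≤ (bound (weaken (m≤m+n m n) p)) (bound (weaken (m≤n+m n m) q)) ⟩ b ^ (m + n) + b ^ (m + n) ≡⟨ cong (b ^ (m + n) +_) (+-identityʳ _) ⟨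
  2 * b ^ (m + n) ≤⟨ *-monoˡ-≤ (b ^ (m + n)) 2<=b ⟩ b * b ^ (m + n) ∎)
  where
   open ℕ.≤-Reasoning
 times : ∀ {m n x y} -> Within b m x -> Within b n y -> Within b (m + n) (x * y)
 times {m} {n} (within p) (within q) = within (≤-trans (*-mono-≤ p q) (≡⇒≤ (sym (^-distribˡ-+-* b m n))))
 const : ∀ c -> Within b c c
 const c = within (≤-trans (n<=2^n c) (^-monoˡ-≤ c 2<=b))
  where
  n<=2^n : ∀ n -> n ≤ 2 ^ n
  n<=2^n zero = z≤n
  n<=2^n (suc n) = ≤-trans (+-mono-≤ (m^n>0 2 n) (n<=2^n n)) (≡⇒≤ (cong (2 ^ n +_) (sym (+-identityʳ _))))
 self : ∀ {x} -> x ≤ b -> Within b 1 x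
 self x<=b = within (≤-trans x<=b (≡⇒≤ (sym (^-identityʳ b))))
 power : ∀ {m n x y} -> Within b m x -> Within x n y -> Within b (m * n) y
 power {m} {n} (within p) (within q) = within (≤-trans q (≤-trans (^-monoˡ-≤ n p) (≡⇒≤ (^-*-assoc b m n))))

record Poly {Γ} (B : Env Γ -> ℕ) τ (f : Env Γ -> El τ) : Set where
 field
  deg : ℕ
  prog : Layout Γ -> ℕ -> ℕ -> Cmd
  correct : ∀ {l o k σ ρ} -> Ready Γ l o k σ ρ -> ∃₂ \ σ' t -> Exec (prog l o k) σ σ' t × Result o k (enc τ (f ρ)) σ σ' × Within (bud B ρ) deg t

open Poly public

module _ {Γ} (B : Env Γ -> ℕ) (ρ : Env Γ) where
 2<=bud : 2 ≤ bud B ρ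
 2<=bud = s≤s (s≤s z≤n)
 sizes<=bud : sizes Γ ρ ≤ bud B ρ
 sizes<=bud = ≤-trans (m≤m+n _ (B ρ)) (m≤n+m _ 2)
 B<=bud : B ρ ≤ bud B ρ
 B<=bud = ≤-trans (m≤n+m _ (sizes Γ ρ)) (m≤n+m _ 2)

-- A canonical store shows that the size of f ρ is bounded as well.
module _ where
 private
  nth : List (List Bool) -> Store
  nth [] j = []
  nth (s ∷ ss) zero = s
  nth (s ∷ ss) (suc j) = nth ss j
  values : ∀ Γ -> Env Γ -> List (List Bool)
  values [] _ = []
  values (τ ∷ Γ) (v , ρ) = enc τ v ∷ values Γ ρ
  nth-≥ : ∀ ss j -> length ss ≤ j -> nth ss j ≡ []
  nth-≥ [] j _ = refl
  nth-≥ (s ∷ ss) (suc j) (s≤s p) = nth-≥ ss j p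
  length-values : ∀ Γ ρ -> length (values Γ ρ) ≡ length Γ
  length-values [] ρ = refl
  length-values (τ ∷ Γ) (v , ρ) = cong suc (length-values Γ ρ)
  line : ∀ Γ -> ℕ -> Layout Γ
  line [] i = tt
  line (τ ∷ Γ) i = i , line Γ (suc i)
  line-holds : ∀ Γ i ρ {σ} -> (∀ j -> σ (i + j) ≡ nth (values Γ ρ) j) -> Holds Γ (line Γ i) σ ρ
  line-holds [] i ρ eq = tt
  line-holds (τ ∷ Γ) i (v , ρ) {σ} eq = tr (cong σ (sym (+-identityʳ i))) (eq 0) , line-holds Γ (suc i) ρ (\ j -> tr (cong σ (sym (+-suc i j))) (eq (suc j)))
  line-avoids : ∀ Γ i o -> i + length Γ ≤ o -> Avoids Γ (line Γ i) o (suc o)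
  line-avoids [] i o p = tt
  line-avoids (τ ∷ Γ) i o p = (m≤n⇒m≤1+n (≤-trans i<o ≤-refl) , <⇒≢ i<o) , line-avoids Γ (suc i) o (subst (_≤ o) (+-suc i _) p)
   where
   i<o : i < o
   i<o = ≤-trans (≤-trans (≡⇒≤ (+-comm 1 i)) (+-monoʳ-≤ i (s≤s z≤n))) p
 size-bound : ∀ {Γ B τ f} (p : Poly {Γ} B τ f) ρ -> Within (bud B ρ) (deg p) (size τ (f ρ))
 size-bound {Γ} {B} {τ} {f} p ρ = let
   σ' , t , e , r , b = correct p ready
  in shrink (2<=bud B ρ) (subst (_≤ t) (cong length (Result.output r)) (subst (\ s -> length (σ' (length Γ)) ≤ length s + t) (nth-≥ (values Γ ρ) (length Γ) (≡⇒≤ (length-values Γ ρ)))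
     (exec-length e (length Γ)))) b
  where
  ready : Ready Γ (line Γ 0) (length Γ) (suc (length Γ)) (nth (values Γ ρ)) ρ
  ready = record { holds = line-holds Γ 0 ρ (\ _ -> refl) ; avoids = line-avoids Γ 0 (length Γ) ≤-refl ; o<k = ≤-refl ; empty = nth-≥ (values Γ ρ) _ (≡⇒≤ (length-values Γ ρ))
   ; clean = \ j p -> nth-≥ (values Γ ρ) j (subst (_≤ j) (sym (length-values Γ ρ)) (<⇒≤ p)) }

-- Variables, weakening and sequential composition

infix 4 _∋_

data _∋_ : List Ty -> Ty -> Set where
 here : ∀ {Γ τ} -> τ ∷ Γ ∋ τ
 there : ∀ {Γ τ τ'} -> Γ ∋ τ -> τ' ∷ Γ ∋ τ

value : ∀ {Γ τ} -> Γ ∋ τ -> Env Γ -> El τ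
value here (v , _) = v
value (there x) (_ , ρ) = value x ρ

tapeOf : ∀ {Γ τ} -> Γ ∋ τ -> Layout Γ -> ℕ
tapeOf here (i , _) = i
tapeOf (there x) (_ , l) = tapeOf x l

tapeOf-holds : ∀ {Γ τ l σ ρ} (x : Γ ∋ τ) -> Holds Γ l σ ρ -> σ (tapeOf x l) ≡ enc τ (value x ρ)
tapeOf-holds here (e , _) = e
tapeOf-holds (there x) (_ , h) = tapeOf-holds x h

tapeOf-avoids : ∀ {Γ τ l o k} (x : Γ ∋ τ) -> Avoids Γ l o k -> tapeOf x l < k × tapeOf x l ≢ o
tapeOf-avoids here (a , _) = a
tapeOf-avoids (there x) (_ , a) = tapeOf-avoids x a

size-value : ∀ {Γ τ} (x : Γ ∋ τ) ρ -> size τ (value x ρ) ≤ sizes Γ ρ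
size-value here (v , ρ) = m≤m+n _ _
size-value {τ ∷ Γ} (there x) (v , ρ) = ≤-trans (size-value x ρ) (m≤n+m _ (size τ v))

ext : ∀ {Γ B τ f g} -> (∀ ρ -> f ρ ≡ g ρ) -> Poly {Γ} B τ f -> Poly B τ g
ext {τ = τ} eq p = record { deg = deg p ; prog = prog p ; correct = \ {l} {o} {k} {σ} {ρ} r -> let
   σ' , t , e , res , b = correct p r
  in σ' , t , e , subst (\ v -> Result o k (enc τ v) σ σ') (eq ρ) res , b }

-- Polynomials are closed under composition: a budget may be exchanged for any other that bounds it
-- up to a power.
rebudget : ∀ {Γ B B' τ f} j -> (∀ ρ -> Within (bud B' ρ) j (B ρ)) -> Poly {Γ} B τ f -> Poly {Γ} B' τ f
rebudget {B' = B'} j B<= p = record { deg = _ ; prog = prog p ; correct = \ {_} {_} {_} {_} {ρ} r -> let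
   σ' , t , e , res , b = correct p r
   2<= = 2<=bud B' ρ
  in σ' , t , e , res , power 2<= (plus 2<= (const 2<= 2) (plus 2<= (self 2<= (sizes<=bud B' ρ)) (B<= ρ))) b }

data Thin : List Ty -> List Ty -> Set where
 ident : ∀ {Γ} -> Thin Γ Γ
 drop : ∀ {Γ Δ τ} -> Thin Γ Δ -> Thin (τ ∷ Γ) Δ
 keep : ∀ {Γ Δ τ} -> Thin Γ Δ -> Thin (τ ∷ Γ) (τ ∷ Δ)

prj : ∀ {Γ Δ} -> Thin Γ Δ -> Env Γ -> Env Δ
prj ident ρ = ρ
prj (drop θ) (_ , ρ) = prj θ ρ
prj (keep θ) (v , ρ) = v , prj θ ρ

prjLayout : ∀ {Γ Δ} -> Thin Γ Δ -> Layout Γ -> Layout Δ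
prjLayout ident l = l
prjLayout (drop θ) (_ , l) = prjLayout θ l
prjLayout (keep θ) (i , l) = i , prjLayout θ l

project-holds : ∀ {Γ Δ l σ ρ} (θ : Thin Γ Δ) -> Holds Γ l σ ρ -> Holds Δ (prjLayout θ l) σ (prj θ ρ)
project-holds ident h = h
project-holds (drop θ) (_ , h) = project-holds θ h
project-holds (keep θ) (e , h) = e , project-holds θ h

project-avoids : ∀ {Γ Δ l o k} (θ : Thin Γ Δ) -> Avoids Γ l o k -> Avoids Δ (prjLayout θ l) o k
project-avoids ident a = a
project-avoids (drop θ) (_ , a) = project-avoids θ a
project-avoids (keep θ) (e , a) = e , project-avoids θ a

size-project : ∀ {Γ Δ} (θ : Thin Γ Δ) ρ -> sizes Δ (prj θ ρ) ≤ sizes Γ ρ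
size-project ident ρ = ≤-refl
size-project (drop {τ = τ} θ) (v , ρ) = ≤-trans (size-project θ ρ) (m≤n+m _ (size τ v))
size-project (keep {τ = τ} θ) (v , ρ) = +-monoʳ-≤ (size τ v) (size-project θ ρ)

thin : ∀ {Γ Δ B τ f} (θ : Thin Γ Δ) -> Poly {Δ} B τ f -> Poly {Γ} (B ∘ prj θ) τ (f ∘ prj θ)
thin {B = B} θ p = record { deg = _ ; prog = \ l -> prog p (prjLayout θ l) ; correct = \ {_} {_} {_} {_} {ρ} r -> let
   σ' , t , e , res , b = correct p record { holds = project-holds θ (Ready.holds r) ; avoids = project-avoids θ (Ready.avoids r) ; o<k = Ready.o<k r ; empty = Ready.empty r ; clean = Ready.clean r }
   2<= = 2<=bud (B ∘ prj θ) ρ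
  in σ' , t , e , res , power 2<= (self 2<= (+-monoʳ-≤ 2 (+-monoˡ-≤ _ (size-project θ ρ)))) b }

forget : ∀ Γ -> Thin Γ []
forget [] = ident
forget (_ ∷ Γ) = drop (forget Γ)

wk : ∀ {Γ B τ τ' f} -> Poly {Γ} B τ f -> Poly {τ' ∷ Γ} (B ∘ snd) τ (f ∘ snd)
wk = thin (drop ident)

≥-spl : ∀ {k j} -> k ≤ j -> j ≡ k ⊎ suc k ≤ j
≥-spl k<=j with m≤n⇒m<n∨m≡n k<=j
... | in1 k<j = in2 k<j
... | in2 k≡j = in1 (sym k≡j)

-- Moving a stack reverses it. Moving it to the scratch stack and from there to two stacks restores
-- the order and also the original.
copy : ℕ -> ℕ -> ℕ -> Cmd
copy i o k = transfer i k ﹔ fork k i o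

copy-exec : ∀ {i o k} s {σ} -> i < k -> o < k -> i ≢ o -> σ i ≡ s -> σ o ≡ [] -> (∀ j -> k ≤ j -> σ j ≡ []) ->
 ∃[ σ' ] (Exec (copy i o k) σ σ' ((2 + 3 * length s) + (2 + 4 * length s)) × Result o k s σ σ')
copy-exec {i} {o} {k} s {σ} i<k o<k i/=o eq empty clean = σ2 , subst (\ n -> Exec (copy i o k) σ σ2 ((2 + 3 * length s) + (2 + 4 * n))) (length-reverse s) (fst (snd one) ﹔ fst (snd two)) , record
  { output = tr F.second (tr (cong (reverse s ʳ++_) (tr (T.others o (i/=o ∘ sym) (<⇒≢ o<k)) empty)) back) ; below = below ; clean' = clean' }
 where
 one = transfer-exec s {σ} (<⇒≢ i<k) eq
 σ1 = fst one
 module T = Transferred (snd (snd one))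
 two = fork-exec (reverse s) {σ1} (<⇒≢ i<k ∘ sym) (<⇒≢ o<k ∘ sym) i/=o (tr T.target (cong (s ʳ++_) (clean k ≤-refl)))
 σ2 = fst two
 module F = Forked (snd (snd two))
 back : reverse s ʳ++ [] ≡ s
 back = tr (reverse-ʳ++ s []) (++-identityʳ s)
 below : ∀ j -> j < k -> j ≢ o -> σ2 j ≡ σ j
 below j j<k j/=o with j ℕ.≟ i
 ... | yes refl = tr F.first (tr (cong (reverse s ʳ++_) T.source) (tr back (sym eq)))
 ... | no j/=i = tr (F.others j (<⇒≢ j<k) j/=i j/=o) (T.others j j/=i (<⇒≢ j<k))
 clean' : ∀ j -> k ≤ j -> σ2 j ≡ []
 clean' j k<=j with ≥-spl k<=j
 ... | in1 refl = F.source
 ... | in2 k<j = tr (F.others j (>⇒≢ k<j) (>⇒≢ (<-trans i<k k<j)) (>⇒≢ (<-trans o<k k<j))) (tr (T.others j (>⇒≢ (<-trans i<k k<j)) (>⇒≢ k<j)) (clean j k<=j))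

var : ∀ {Γ B τ} (x : Γ ∋ τ) -> Poly B τ (value x)
var {Γ} {B} {τ} x = record { deg = _ ; prog = \ l -> copy (tapeOf x l) ; correct = \ {l} {o} {k} {σ} {ρ} r -> let
   open Ready r
   σ' , e , res = copy-exec (enc τ (value x ρ)) {σ} (fst (tapeOf-avoids x avoids)) o<k (snd (tapeOf-avoids x avoids)) (tapeOf-holds x holds) empty clean
   2<= = 2<=bud B ρ
   sz = self 2<= (≤-trans (size-value x ρ) (sizes<=bud B ρ))
  in σ' , _ , e , res , plus 2<= (plus 2<= (const 2<= 2) (times 2<= (const 2<= 3) sz)) (plus 2<= (const 2<= 2) (times 2<= (const 2<= 4) sz)) }

module Scratch {Γ} {l : Layout Γ} {o k : ℕ} {σ : Store} {ρ : Env Γ} (r : Ready Γ l o k σ ρ) where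
 open Ready r
 scratch : ∀ n -> Ready Γ l k (suc (n + k)) σ ρ
 scratch n = record { holds = holds ; avoids = avoids-map Γ (\ i<k _ -> <-trans i<k (s≤s (m≤n+m k n)) , <⇒≢ i<k) avoids ; o<k = s≤s (m≤n+m k n) ; empty = clean k ≤-refl
  ; clean = \ j p -> clean j (≤-trans (≤-trans (m≤n+m k n) (n≤1+n _)) p) }
 holds' : ∀ {σ' o' k' v} -> k ≤ k' -> (∀ j -> j < k -> j ≢ o -> j ≢ o') -> Result o' k' v σ σ' -> Holds Γ l σ' ρ
 holds' k<=k' ne res = holds-cong Γ avoids (\ j j<k j/=o -> Result.below res j (≤-trans j<k k<=k') (ne j j<k j/=o)) holds

-- The intermediate value is kept on stack `k`, the scratch space starts one higher, and the value
-- is erased at the end. Its size is polynomial because it was written in polynomial time.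
bindWith : ∀ {Γ} {B : Env Γ -> ℕ} {τ τ' C f g} -> Poly B τ f -> Poly {τ ∷ Γ} C τ' g -> ∀ j -> (∀ ρ -> Within (bud B ρ) j (C (f ρ , ρ))) -> Poly B τ' (\ ρ -> g (f ρ , ρ))
bindWith {Γ} {B} {τ} {τ'} {C} {f} {g} p q j small = record { deg = _ ; prog = \ l o k -> prog p l k (suc k) ﹔ prog q (k , l) o (suc k) ﹔ clear k ; correct = \ {l} {o} {k} {σ} {ρ} r -> let
   open Ready r
   open Scratch r
   σ1 , t1 , e1 , r1 , b1 = correct p (scratch 0)
   module R1 = Result r1
   ready = record { holds = R1.output , holds' (n≤1+n k) (\ j j<k _ -> <⇒≢ j<k) r1 ; avoids = (≤-refl , >⇒≢ o<k) , avoids-map Γ (\ i<k i/=o -> m<n⇒m<1+n i<k , i/=o) avoids ; o<k = m<n⇒m<1+n o<k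
    ; empty = tr (R1.below o (m<n⇒m<1+n o<k) (<⇒≢ o<k)) empty ; clean = R1.clean' }
   σ2 , t2 , e2 , r2 , b2 = correct q ready
   module R2 = Result r2
   σ3 , e3 , u = clear-exec k (enc τ (f ρ)) {σ2} (tr (R2.below k ≤-refl (>⇒≢ o<k)) R1.output)
   2<= = 2<=bud B ρ
   sz = size-bound p ρ
  in σ3 , _ , (e1 ﹔ (e2 ﹔ e3)) , record { output = tr (frame u o (<⇒≢ o<k)) R2.output ; below = \ j j<k j/=o -> tr (frame u j (<⇒≢ j<k))
      (tr (R2.below j (m<n⇒m<1+n j<k) j/=o) (R1.below j (m<n⇒m<1+n j<k) (<⇒≢ j<k))) ; clean' = \ j k<=j -> case ≥-spl k<=j of \ where
      (in1 refl) -> at u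
      (in2 k<j) -> tr (frame u j (>⇒≢ k<j)) (R2.clean' j k<j)
    } , plus 2<= b1 (plus 2<= (power 2<= (plus 2<= (const 2<= 2) (plus 2<= (plus 2<= sz (self 2<= (sizes<=bud B ρ))) (small ρ))) b2) (plus 2<= (const 2<= 2) (times 2<= (const 2<= 3) sz))) }

bind : ∀ {Γ} {B : Env Γ -> ℕ} {τ τ' f g} -> Poly B τ f -> Poly {τ ∷ Γ} (B ∘ snd) τ' g -> Poly B τ' (\ ρ -> g (f ρ , ρ))
bind {B = B} p q = bindWith p q 1 (\ ρ -> self (2<=bud B ρ) (B<=bud B ρ))

zeroP : ∀ {Γ} {B : Env Γ -> ℕ} -> Poly B nat (\ _ -> 0)
zeroP {B = B} = record { deg = _ ; prog = \ _ _ _ -> skip ; correct = \ {_} {_} {_} {σ} {ρ} r -> σ , _ , skip (\ _ -> refl) , record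
  { output = Ready.empty r ; below = \ _ _ _ -> refl ; clean' = Ready.clean r } , const (2<=bud B ρ) 1 }

nilP : ∀ {Γ} {B : Env Γ -> ℕ} -> Poly B arr (\ _ -> [])
nilP {B = B} = record { deg = _ ; prog = \ _ _ _ -> skip ; correct = \ {_} {_} {_} {σ} {ρ} r -> σ , _ , skip (\ _ -> refl) , record
  { output = Ready.empty r ; below = \ _ _ _ -> refl ; clean' = Ready.clean r } , const (2<=bud B ρ) 1 }

push-result : ∀ {o k v σ σ1 b} -> o < k -> Result o k v σ σ1 -> ∃[ σ2 ] (Exec (push o b) σ1 σ2 1 × Result o k (b ∷ v) σ σ2)
push-result {o} {k} {v} {σ} {σ1} {b} o<k r = _ , push u , record { output = tr (at u) (cong (b ∷_) output) ; below = \ j j<k j/=o -> tr (frame u j j/=o) (below j j<k j/=o)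
 ; clean' = \ j k<=j -> tr (frame u j (>⇒≢ (<-≤-trans o<k k<=j))) (clean' j k<=j) }
 where
 open Result r
 u = upd-set o (b ∷ σ1 o) σ1

sucP : ∀ {Γ} {B : Env Γ -> ℕ} {f} -> Poly B nat f -> Poly B nat (suc ∘ f)
sucP {B = B} p = record { deg = _ ; prog = \ l o k -> prog p l o k ﹔ push o true ; correct = \ {_} {_} {_} {_} {ρ} r -> let
   σ1 , t1 , e1 , r1 , b1 = correct p r
   σ2 , e2 , r2 = push-result (Ready.o<k r) r1
  in σ2 , _ , (e1 ﹔ e2) , r2 , plus (2<=bud B ρ) b1 (const (2<=bud B ρ) 1) }

replicate-ʳ++ : ∀ n (s : List Bool) -> replicate n true ʳ++ s ≡ replicate n true ++ s
replicate-ʳ++ zero s = refl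
replicate-ʳ++ (suc n) s = tr (replicate-ʳ++ n (true ∷ s)) (shift n)
 where
 shift : ∀ n -> replicate n true ++ true ∷ s ≡ true ∷ replicate n true ++ s
 shift zero = refl
 shift (suc n) = cong (true ∷_) (shift n)

-- The tail is computed on the output stack and the head is moved on top of it. The reversal by
-- `transfer` does not affect a unary number.
consP : ∀ {Γ} {B : Env Γ -> ℕ} {f g} -> Poly B nat f -> Poly B arr g -> Poly B arr (\ ρ -> f ρ ∷ g ρ)
consP {Γ} {B} {f} {g} p q = record { deg = _ ; prog = \ l o k -> prog q l o k ﹔ push o false ﹔ prog p l k (suc k) ﹔ transfer k o ; correct = \ {l} {o} {k} {σ} {ρ} r -> let
   open Ready r
   σ1 , t1 , e1 , r1 , b1 = correct q r
   σ2 , e2 , r2 = push-result {b = false} o<k r1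
   module R2 = Result r2
   σ3 , t3 , e3 , r3 , b3 = correct p record { holds = holds-cong Γ avoids R2.below holds ; avoids = avoids-map Γ (\ i<k _ -> m<n⇒m<1+n i<k , <⇒≢ i<k) avoids ; o<k = ≤-refl
    ; empty = R2.clean' k ≤-refl ; clean = \ j p -> R2.clean' j (<⇒≤ p) }
   module R3 = Result r3
   σ4 , e4 , r4 = transfer-exec (enc nat (f ρ)) {σ3} (>⇒≢ o<k) R3.output
   module T = Transferred r4
   2<= = 2<=bud B ρ
  in σ4 , _ , (e1 ﹔ (e2 ﹔ (e3 ﹔ e4))) , record { output = tr T.target (tr (replicate-ʳ++ (f ρ) (σ3 o)) (cong (replicate (f ρ) true ++_) (tr (R3.below o (m<n⇒m<1+n o<k) (<⇒≢ o<k)) R2.output)))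
    ; below = \ j j<k j/=o -> tr (T.others j (<⇒≢ j<k) j/=o) (tr (R3.below j (m<n⇒m<1+n j<k) (<⇒≢ j<k)) (R2.below j j<k j/=o)) ; clean' = \ j k<=j -> case ≥-spl k<=j of \ where
     (in1 refl) -> T.source
     (in2 k<j) -> tr (T.others j (>⇒≢ k<j) (>⇒≢ (<-trans o<k k<j))) (R3.clean' j k<j)
    } , plus 2<= b1 (plus 2<= (const 2<= 1) (plus 2<= b3 (plus 2<= (const 2<= 2) (times 2<= (const 2<= 3) (size-bound p ρ))))) }

infixl 9 _‼_

-- The default value 0 marks the end of an array.
_‼_ : List ℕ -> ℕ -> ℕ
[] ‼ i = 0
(x ∷ xs) ‼ zero = x
(x ∷ xs) ‼ suc i = xs ‼ i

tailb : List Bool -> List Bool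
tailb [] = []
tailb (false ∷ s) = s
tailb (true ∷ s) = tailb s

headb : List Bool -> ℕ
headb [] = 0
headb (false ∷ s) = 0
headb (true ∷ s) = suc (headb s)

tailb-enc : ∀ xs -> tailb (enc arr xs) ≡ enc arr (List.drop 1 xs)
tailb-enc [] = refl
tailb-enc (zero ∷ xs) = refl
tailb-enc (suc x ∷ xs) = tailb-enc (x ∷ xs)

headb-enc : ∀ xs -> headb (enc arr xs) ≡ xs ‼ 0
headb-enc [] = refl
headb-enc (zero ∷ xs) = refl
headb-enc (suc x ∷ xs) = cong suc (headb-enc (x ∷ xs))

drop-‼ : ∀ i xs -> List.drop i xs ‼ 0 ≡ xs ‼ i
drop-‼ zero xs = refl
drop-‼ (suc i) [] = refl
drop-‼ (suc i) (x ∷ xs) = drop-‼ i xs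

drop1-size : ∀ xs -> size arr (List.drop 1 xs) ≤ size arr xs
drop1-size [] = z≤n
drop1-size (x ∷ xs) = ≤-trans (n≤1+n _) (≤-trans (m≤n+m _ (length (replicate x true))) (≡⇒≤ (sym (length-++ (replicate x true)))))

-- A loop can only test a stack for emptiness, so the stack `f` serves as the loop condition: it is
-- refilled after each `true` of the first entry and stays empty after the closing `false` or at the
-- end of the array.
takeLoop : ℕ -> ℕ -> ℕ -> Cmd
takeLoop a f j = loop f (\ _ -> branch a skip (if_then (push f true ﹔ push j true) else skip))

take : ℕ -> ℕ -> ℕ -> Cmd
take a f j = push f true ﹔ takeLoop a f j

record Taken (a f j : ℕ) (s : List Bool) (σ σ' : Store) : Set where
 field
  source : σ' a ≡ tailb s
  flag : σ' f ≡ []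
  target : σ' j ≡ replicate (headb s) true ++ σ j
  others : ∀ i -> i ≢ a -> i ≢ f -> i ≢ j -> σ' i ≡ σ i

module _ {a f j : ℕ} (a/=f : a ≢ f) (a/=j : a ≢ j) (f/=j : f ≢ j) where
 takeLoop-exec : ∀ s {σ} -> σ a ≡ s -> σ f ≡ true ∷ [] -> ∃₂ \ σ' t -> Exec (takeLoop a f j) σ σ' t × Taken a f j s σ σ' × t ≤ 7 + 6 * length s
 takeLoop-exec [] {σ} eqa eqf = σ1 , _ , loop:: eqf u (branch∅ (tr (frame u a a/=f) eqa) (skip (\ _ -> refl))) (loop∅ (at u) (\ _ -> refl)) ,
  record { source = tr (frame u a a/=f) eqa ; flag = at u ; target = frame u j (f/=j ∘ sym) ; others = \ i _ i/=f _ -> frame u i i/=f } , ≤-refl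
  where
  σ1 = set f [] σ
  u = upd-set f [] σ
 takeLoop-exec (false ∷ s) {σ} eqa eqf = σ2 , _ , loop:: eqf u (branch:: (tr (frame u a a/=f) eqa) v (skip (\ _ -> refl))) (loop∅ (tr (frame v f (a/=f ∘ sym)) (at u)) (\ _ -> refl)) ,
  record { source = at v ; flag = tr (frame v f (a/=f ∘ sym)) (at u) ; target = tr (frame v j (a/=j ∘ sym)) (frame u j (f/=j ∘ sym))
   ; others = \ i i/=a i/=f _ -> tr (frame v i i/=a) (frame u i i/=f) } , m≤m+n 7 _
  where
  σ1 = set f [] σ
  u = upd-set f [] σ
  σ2 = set a s σ1
  v = upd-set a s σ1
 takeLoop-exec (true ∷ s) {σ} eqa eqf = σ' , _ , loop:: eqf u (branch:: (tr (frame u a a/=f) eqa) v (push w ﹔ push x)) (fst (snd (snd rest))) , record { source = source ; flag = flag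
   ; target = tr target (tr (cong (replicate (headb s) true ++_) (tr (at x) (cong (true ∷_) (tr (frame w j (f/=j ∘ sym)) (tr (frame v j (a/=j ∘ sym)) (frame u j (f/=j ∘ sym))))))) (shift (headb s)))
   ; others = \ i i/=a i/=f i≢j -> tr (others i i/=a i/=f i≢j) (tr (frame x i i≢j) (tr (frame w i i/=f) (tr (frame v i i/=a) (frame u i i/=f)))) } , ≤-trans (+-monoʳ-≤ 6 (snd (snd (snd (snd rest)))))
   (≡⇒≤ (tr (+-comm 6 (7 + 6 * length s)) (tr (+-assoc 7 (6 * length s) 6) (cong (7 +_) (tr (+-comm (6 * length s) 6) (sym (*-suc 6 (length s))))))))
  where
  σ1 = set f [] σ
  u = upd-set f [] σ
  σ2 = set a s σ1
  v = upd-set a s σ1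
  σ3 = set f (true ∷ σ2 f) σ2
  w = upd-set f (true ∷ σ2 f) σ2
  σ4 = set j (true ∷ σ3 j) σ3
  x = upd-set j (true ∷ σ3 j) σ3
  rest = takeLoop-exec s {σ4} (tr (frame x a a/=j) (tr (frame w a a/=f) (at v))) (tr (frame x f f/=j) (tr (at w) (cong (true ∷_) (tr (frame v f (a/=f ∘ sym)) (at u)))))
  σ' = fst rest
  open Taken (fst (snd (snd (snd rest))))
  shift : ∀ n -> replicate n true ++ true ∷ σ j ≡ true ∷ replicate n true ++ σ j
  shift zero = refl
  shift (suc n) = cong (true ∷_) (shift n)
 take-exec : ∀ s {σ} -> σ a ≡ s -> σ f ≡ [] -> ∃₂ \ σ' t -> Exec (take a f j) σ σ' t × Taken a f j s σ σ' × t ≤ 8 + 6 * length s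
 take-exec s {σ} eqa eqf = let
   σ' , t , e , tk , b = takeLoop-exec s {σ1} (tr (frame u a a/=f) eqa) (tr (at u) (cong (true ∷_) eqf))
   open Taken tk
  in σ' , _ , (push u ﹔ e) , record { source = source ; flag = flag ; target = tr target (cong (replicate (headb s) true ++_) (frame u j (f/=j ∘ sym)))
   ; others = \ i i/=a i/=f i≢j -> tr (others i i/=a i/=f i≢j) (frame u i i/=f) } , s≤s b
  where
  σ1 = set f (true ∷ σ f) σ
  u = upd-set f (true ∷ σ f) σ

≥-spl4 : ∀ {k j} -> k ≤ j -> j ≡ k ⊎ j ≡ 1 + k ⊎ j ≡ 2 + k ⊎ j ≡ 3 + k ⊎ 4 + k ≤ j
≥-spl4 p0 with ≥-spl p0
... | in1 e0 = in1 e0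
... | in2 p1 with ≥-spl p1
... | in1 e1 = in2 (in1 e1)
... | in2 p2 with ≥-spl p2
... | in1 e2 = in2 (in2 (in1 e2))
... | in2 p3 with ≥-spl p3
... | in1 e3 = in2 (in2 (in2 (in1 e3)))
... | in2 p4 = in2 (in2 (in2 (in2 p4)))

headP : ∀ {Γ} {B : Env Γ -> ℕ} {f} -> Poly B arr f -> Poly B nat (\ ρ -> f ρ ‼ 0)
headP {Γ} {B} {f} p = record { deg = _ ; prog = \ l o k -> prog p l k (1 + k) ﹔ take k (1 + k) o ﹔ clear k ; correct = \ {l} {o} {k} {σ} {ρ} r -> let
   open Ready r
   open Scratch r
   σ1 , t1 , e1 , r1 , b1 = correct p (scratch 0)
   module R = Result r1
   σ2 , t2 , e2 , r2 , b2 = take-exec {k} {1 + k} {o} (\ ()) (>⇒≢ o<k) (<=>/=+ 1 o<k ∘ sym) (enc arr (f ρ)) {σ1} R.output (R.clean' (1 + k) ≤-refl)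
   module T = Taken r2
   rest = tr T.source (tailb-enc (f ρ))
   σ3 , e3 , u = clear-exec k (enc arr (List.drop 1 (f ρ))) {σ2} rest
   2<= = 2<=bud B ρ
   w = size-bound p ρ
  in σ3 , _ , (e1 ﹔ (e2 ﹔ e3)) , record { output = tr (frame u o (<⇒≢ o<k)) (tr T.target (tr (cong2 (\ n s -> replicate n true ++ s)
       (headb-enc (f ρ)) (tr (R.below o (m<n⇒m<1+n o<k) (<⇒≢ o<k)) empty)) (++-identityʳ _))) ; below = \ j j<k j/=o -> tr (frame u j (<⇒≢ j<k)) (tr (T.others j (<⇒≢ j<k) (<=>/=+ 1 j<k) j/=o)
       (R.below j (m<n⇒m<1+n j<k) (<⇒≢ j<k))) ; clean' = \ j k<=j -> case ≥-spl k<=j of \ where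
     (in1 refl) -> at u
     (in2 k<j) -> tr (frame u j (>⇒≢ k<j)) (case ≥-spl k<j of \ where
      (in1 refl) -> T.flag
      (in2 p) -> tr (T.others j (>⇒≢ k<j) (>⇒≢ p) (>⇒≢ (<-≤-trans o<k k<=j))) (R.clean' j k<j))
    } , plus 2<= b1 (plus 2<= (shrink 2<= b2 (plus 2<= (const 2<= 8) (times 2<= (const 2<= 6) w))) (plus 2<= (const 2<= 2) (times 2<= (const 2<= 3) (shrink 2<= (drop1-size (f ρ)) w)))) }

tailP : ∀ {Γ} {B : Env Γ -> ℕ} {f} -> Poly B arr f -> Poly B arr (List.drop 1 ∘ f)
tailP {Γ} {B} {f} p = record { deg = _ ; prog = \ l o k -> prog p l o k ﹔ take o k (1 + k) ﹔ clear (1 + k) ; correct = \ {l} {o} {k} {σ} {ρ} r -> let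
   open Ready r
   σ1 , t1 , e1 , r1 , b1 = correct p r
   module R = Result r1
   σ2 , t2 , e2 , r2 , b2 = take-exec {o} {k} {1 + k} (<⇒≢ o<k) (<=>/=+ 1 o<k) (\ ()) (enc arr (f ρ)) {σ1} R.output (R.clean' k ≤-refl)
   module T = Taken r2
   σ3 , e3 , u = clear-exec (1 + k) (σ2 (1 + k)) {σ2} refl
   2<= = 2<=bud B ρ
   c2 = shrink 2<= b2 (plus 2<= (const 2<= 8) (times 2<= (const 2<= 6) (size-bound p ρ)))
   len = subst (\ s -> length (σ2 (1 + k)) ≤ length s + t2) (R.clean' (1 + k) (n≤1+n k)) (exec-length e2 (1 + k))
  in σ3 , _ , (e1 ﹔ (e2 ﹔ e3)) , record { output = tr (frame u o (<=>/=+ 1 o<k)) (tr T.source (tailb-enc (f ρ))) ; below = \ j j<k j/=o -> tr (frame u j (<=>/=+ 1 j<k))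
       (tr (T.others j j/=o (<⇒≢ j<k) (<=>/=+ 1 j<k)) (R.below j j<k j/=o)) ; clean' = \ j k<=j -> case ≥-spl k<=j of \ where
     (in1 refl) -> tr (frame u k (\ ())) T.flag
     (in2 k<j) -> case ≥-spl k<j of \ where
      (in1 refl) -> at u
      (in2 p) -> tr (frame u j (>⇒≢ p)) (tr (T.others j (>⇒≢ (<-≤-trans o<k k<=j)) (>⇒≢ k<j) (>⇒≢ p)) (R.clean' j k<=j))
    } , plus 2<= b1 (plus 2<= c2 (plus 2<= (const 2<= 2) (times 2<= (const 2<= 3) (shrink 2<= len c2)))) }

-- Bounded iteration

iter : {A : Set} -> (ℕ -> A -> A) -> A -> ℕ -> A
iter s z zero = z
iter s z (suc i) = s i (iter s z i)

overwrite : ℕ -> ℕ -> ℕ -> Cmd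
overwrite n t a = clear a ﹔ transfer n t ﹔ transfer t a

record Overwr (n t a : ℕ) (s : List Bool) (σ σ' : Store) : Set where
 field
  source : σ' n ≡ []
  temp : σ' t ≡ []
  target : σ' a ≡ s
  others : ∀ j -> j ≢ n -> j ≢ t -> j ≢ a -> σ' j ≡ σ j

overwriteCost : ℕ -> ℕ -> ℕ
overwriteCost w u = (2 + 3 * w) + ((2 + 3 * u) + (2 + 3 * u))

overwrite-exec : ∀ {n t a} s {σ} -> n ≢ t -> n ≢ a -> t ≢ a -> σ n ≡ s -> σ t ≡ [] -> ∃[ σ' ] (Exec (overwrite n t a) σ σ' (overwriteCost (length (σ a)) (length s)) × Overwr n t a s σ σ')
overwrite-exec {n} {t} {a} s {σ} n/=t n/=a t/=a eq empty = σ3 , subst (\ u -> Exec (overwrite n t a) σ σ3 ((2 + 3 * length (σ a)) + ((2 + 3 * length s) + (2 + 3 * u))))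
  (length-reverse s) (e1 ﹔ (e2 ﹔ e3)) , record { source = tr (T3.others n n/=t n/=a) T2.source ; temp = T3.source
  ; target = tr T3.target (tr (cong (reverse s ʳ++_) (tr (T2.others a (n/=a ∘ sym) (t/=a ∘ sym)) (at u1))) (tr (reverse-ʳ++ s []) (++-identityʳ s)))
  ; others = \ j j/=n j/=t j/=a -> tr (T3.others j j/=t j/=a) (tr (T2.others j j/=n j/=t) (frame u1 j j/=a)) }
 where
 one = clear-exec a (σ a) {σ} refl
 σ1 = fst one
 e1 = fst (snd one)
 u1 = snd (snd one)
 two = transfer-exec s {σ1} n/=t (tr (frame u1 n n/=a) eq)
 σ2 = fst two
 e2 = fst (snd two)
 module T2 = Transferred (snd (snd two))
 three = transfer-exec (reverse s) {σ2} t/=a (tr T2.target (cong (s ʳ++_) (tr (frame u1 t t/=a) empty)))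
 σ3 = fst three
 e3 = fst (snd three)
 module T3 = Transferred (snd (snd three))

module Iter {Γ} {τ} {Bₛ : Env (τ ∷ nat ∷ Γ) -> ℕ} {s : Env Γ -> ℕ -> El τ -> El τ} (q : Poly {τ ∷ nat ∷ Γ} Bₛ τ (\ (a , i , ρ) -> s ρ i a)) where
 body : Layout Γ -> ℕ -> Cmd
 body l k = prog q (1 + k , 2 + k , l) (3 + k) (4 + k) ﹔ overwrite (3 + k) (4 + k) (1 + k) ﹔ push (2 + k) true
 -- k counts the remaining iterations, 1 + k holds the accumulator, 2 + k the
 -- number of iterations done.
 record Inv (k m i : ℕ) (a : El τ) (σ0 σ : Store) : Set where
  field
   remaining : σ k ≡ enc nat m
   accumulator : σ (1 + k) ≡ enc τ a
   done : σ (2 + k) ≡ enc nat i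
   below : ∀ j -> j < k -> σ j ≡ σ0 j
   clean : ∀ j -> 3 + k ≤ j -> σ j ≡ []
 cost : ℕ -> ℕ -> ℕ
 cost t w = t + (overwriteCost w t + 1)
 module Body {l o k σ0 σ ρ m i a} (r : Ready Γ l o k σ0 ρ) (inv : Inv k m i a σ0 σ) where
  open Inv inv
  module R = Ready r
  ready : Ready (τ ∷ nat ∷ Γ) (1 + k , 2 + k , l) (3 + k) (4 + k) σ (a , i , ρ)
  ready = record { holds = accumulator , done , holds-cong Γ R.avoids (\ j j<k _ -> below j j<k) R.holds ; avoids = (s≤s (s≤s (m≤n+m k 2)) , \ ()) , (s≤s (s≤s (s≤s (m≤n+m k 1))) , \ ()) ,
          avoids-map Γ (\ i<k _ -> <-trans i<k (s≤s (m≤n+m k 3)) , <=>/=+ 3 i<k) R.avoids ; o<k = ≤-refl ; empty = clean (3 + k) ≤-refl ; clean = \ j p -> clean j (<⇒≤ p) }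
  one = correct q ready
  σ1 = fst one
  t1 = fst (snd one)
  e1 = fst (snd (snd one))
  b1 = snd (snd (snd (snd one)))
  module R1 = Result (fst (snd (snd (snd one))))
  a' : El τ
  a' = s ρ i a
  same1 : ∀ j -> j < 3 + k -> σ1 j ≡ σ j
  same1 j p = R1.below j (m<n⇒m<1+n p) (<⇒≢ p)
  two = overwrite-exec {3 + k} {4 + k} {1 + k} (enc τ a') {σ1} (\ ()) (\ ()) (\ ()) R1.output (R1.clean' (4 + k) ≤-refl)
  σ2 = fst two
  e2 = fst (snd two)
  module O = Overwr (snd (snd two))
  σ3 = set (2 + k) (true ∷ σ2 (2 + k)) σ2
  u3 = upd-set (2 + k) (true ∷ σ2 (2 + k)) σ2
  same : ∀ j -> j ≢ 1 + k -> j < 3 + k -> σ2 j ≡ σ j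
  same j n1 p = tr (O.others j (<⇒≢ p) (<⇒≢ (m<n⇒m<1+n p)) n1) (same1 j p)
  clean2 : ∀ j -> 3 + k ≤ j -> σ2 j ≡ []
  clean2 j p with ≥-spl p
  ... | in1 refl = O.source
  ... | in2 p' with ≥-spl p'
  ... | in1 refl = O.temp
  ... | in2 p'' = tr (O.others j (>⇒≢ p') (>⇒≢ p'') (>⇒≢ (<-trans (n<1+n (1 + k)) p))) (R1.clean' j p')
  inv' : Inv k m (suc i) a' σ0 σ3
  inv' = record { remaining = tr (frame u3 k (\ ())) (tr (same k (\ ()) (s≤s (m≤n+m k 2))) remaining) ; accumulator = tr (frame u3 (1 + k) (\ ())) O.target
   ; done = tr (at u3) (cong (true ∷_) (tr (same (2 + k) (\ ()) ≤-refl) done)) ; below = \ j j<k -> tr (frame u3 j (<=>/=+ 2 j<k))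
            (tr (same j (<=>/=+ 1 j<k) (<-≤-trans j<k (m≤n+m k 3))) (below j j<k)) ; clean = \ j p -> tr (frame u3 j (>⇒≢ p)) (clean2 j p) }
  len : length (enc τ a') ≤ t1
  len = subst (_≤ t1) (cong length R1.output) (subst (\ s -> length (σ1 (3 + k)) ≤ length s + t1) (clean (3 + k) ≤-refl) (exec-length e1 (3 + k)))
  time<= : t1 + (overwriteCost (length (σ1 (1 + k))) (length (enc τ a')) + 1) ≤ cost t1 (size τ a)
  time<= = +-monoʳ-≤ t1 (+-monoˡ-≤ 1 (+-mono-≤ (+-monoʳ-≤ 2 (*-monoʳ-≤ 3 (≡⇒≤ (cong length (tr (same1 (1 + k) (s≤s (s≤s (m≤n+m k 1)))) accumulator)))))
   (+-mono-≤ (+-monoʳ-≤ 2 (*-monoʳ-≤ 3 len)) (+-monoʳ-≤ 2 (*-monoʳ-≤ 3 len)))))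
 body-exec : ∀ {l o k σ0 σ ρ m i a} -> Ready Γ l o k σ0 ρ -> Inv k m i a σ0 σ -> ∃₂ \ σ' t -> Exec (body l k) σ σ' t × Inv k m (suc i) (s ρ i a) σ0 σ' ×
         ∃[ u ] (t ≤ cost u (size τ a) × Within (bud Bₛ (a , i , ρ)) (deg q) u)
 body-exec r inv = σ3 , _ , (e1 ﹔ (e2 ﹔ push u3)) , inv' , t1 , time<= , b1
  where
     open Body r inv
 Cap : ∀ (ρ : Env Γ) (z : El τ) (n T : ℕ) -> Set
 Cap ρ z n T = ∀ i -> i < n -> ∀ {u} -> Within (bud Bₛ (iter (s ρ) z i , i , ρ)) (deg q) u -> cost u (size τ (iter (s ρ) z i)) ≤ T
 loop-exec : ∀ {l o k σ0 ρ z T n} m i -> m + i ≡ n -> Cap ρ z n T -> Ready Γ l o k σ0 ρ -> ∀ {σ} -> Inv k m i (iter (s ρ) z i) σ0 σ ->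
        ∃₂ \ σ' t -> Exec (loop k (\ _ -> body l k)) σ σ' t × Inv k 0 n (iter (s ρ) z n) σ0 σ' × t ≤ 2 + m * (2 + T)
 loop-exec zero i refl cap r {σ} inv = σ , _ , loop∅ (Inv.remaining inv) (\ _ -> refl) , inv , ≤-refl
 loop-exec {l} {o} {k} {σ0} {ρ} {z} {T} {n} (suc m) i refl cap r {σ} inv = fst rest , _ , loop:: remaining u (fst (snd (snd one))) (fst (snd (snd rest))) , fst (snd (snd (snd rest))) ,
  ≤-trans (+-monoʳ-≤ 2 (+-mono-≤ (≤-trans c (cap i (s≤s (m≤n+m i m)) w)) (snd (snd (snd (snd rest)))))) (≡⇒≤ (cong (2 +_) (tr (sym (+-assoc T 2 (m * (2 + T)))) (cong (_+ m * (2 + T)) (+-comm T 2)))))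
  where
  open Inv inv
  u = upd-set k (enc nat m) σ
  inv₁ : Inv k m i (iter (s ρ) z i) σ0 (set k (enc nat m) σ)
  inv₁ = record { remaining = at u ; accumulator = tr (frame u (1 + k) (\ ())) accumulator ; done = tr (frame u (2 + k) (\ ())) done ; below = \ j j<k -> tr (frame u j (<⇒≢ j<k)) (below j j<k)
   ; clean = \ j p -> tr (frame u j (>⇒≢ (≤-trans (s≤s (m≤n+m k 2)) p))) (clean j p) }
  one = body-exec r inv₁
  c = fst (snd (snd (snd (snd (snd one)))))
  w = snd (snd (snd (snd (snd (snd one)))))
  rest = loop-exec {z = z} m (suc i) (+-suc m i) cap r (fst (snd (snd (snd one))))
 module Run {l o k σ ρ n} {B : Env Γ -> ℕ} {z} (pn : Poly B nat n) (pz : Poly B τ z) (r : Ready Γ l o k σ ρ) {T} (cap : Cap ρ (z ρ) (n ρ) T) where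
  open Ready r
  open Scratch r
  m = n ρ
  v = iter (s ρ) (z ρ) m
  one = correct pn (scratch 3)
  σ1 = fst one
  e1 = fst (snd (snd one))
  r1 = fst (snd (snd (snd one)))
  module R1 = Result r1
  ready2 : Ready Γ l (1 + k) (4 + k) σ1 ρ
  ready2 = record { holds = holds' (m≤n+m k 4) (\ j j<k _ -> <⇒≢ j<k) r1 ; avoids = avoids-map Γ (\ i<k _ -> <-trans i<k (s≤s (m≤n+m k 3)) , <=>/=+ 1 i<k) avoids ; o<k = s≤s (s≤s (m≤n+m k 2))
   ; empty = tr (R1.below (1 + k) (s≤s (s≤s (m≤n+m k 2))) (\ ())) (clean (1 + k) (n≤1+n k)) ; clean = R1.clean' }
  two = correct pz ready2
  σ2 = fst two
  e2 = fst (snd (snd two))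
  module R2 = Result (fst (snd (snd (snd two))))
  same2 : ∀ j -> j < 4 + k -> j ≢ k -> j ≢ 1 + k -> σ2 j ≡ σ j
  same2 j p n0 n1 = tr (R2.below j p n1) (R1.below j p n0)
  clean2 : ∀ j -> 3 + k ≤ j -> σ2 j ≡ []
  clean2 j p with ≥-spl p
  ... | in1 refl = tr (same2 (3 + k) ≤-refl (\ ()) (\ ())) (clean (3 + k) (m≤n+m k 3))
  ... | in2 p' = R2.clean' j p'
  inv : Inv k m 0 (z ρ) σ σ2
  inv = record { remaining = tr (R2.below k (s≤s (m≤n+m k 3)) (\ ())) R1.output ; accumulator = R2.output
   ; done = tr (same2 (2 + k) (s≤s (s≤s (s≤s (m≤n+m k 1)))) (\ ()) (\ ())) (clean (2 + k) (m≤n+m k 2)) ; below = \ j j<k -> same2 j (≤-trans j<k (m≤n+m k 4)) (<=>/=+ 0 j<k) (<=>/=+ 1 j<k)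
   ; clean = clean2 }
  three = loop-exec {z = z ρ} m 0 (+-identityʳ m) cap r inv
  σ3 = fst three
  e3 = fst (snd (snd three))
  module I = Inv (fst (snd (snd (snd three))))
  c3 = snd (snd (snd (snd three)))
  four = overwrite-exec {1 + k} {3 + k} {o} (enc τ v) {σ3} (\ ()) (<=>/=+ 1 o<k ∘ sym) (<=>/=+ 3 o<k ∘ sym) I.accumulator (I.clean (3 + k) ≤-refl)
  σ4 = fst four
  e4 = fst (snd four)
  module O = Overwr (snd (snd four))
  five = clear-exec (2 + k) (enc nat m) {σ4} (tr (O.others (2 + k) (\ ()) (\ ()) (<=>/=+ 2 o<k ∘ sym)) I.done)
  σ5 = fst five
  e5 = fst (snd five)
  u5 = snd (snd five)
  clean5 : ∀ j -> k ≤ j -> σ5 j ≡ []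
  clean5 j k<=j with ≥-spl4 k<=j
  ... | in1 refl = tr (frame u5 k (\ ())) (tr (O.others k (\ ()) (\ ()) (<=>/=+ 0 o<k ∘ sym)) I.remaining)
  ... | in2 (in1 refl) = tr (frame u5 (1 + k) (\ ())) O.source
  ... | in2 (in2 (in1 refl)) = at u5
  ... | in2 (in2 (in2 (in1 refl))) = tr (frame u5 (3 + k) (\ ())) O.temp
  ... | in2 (in2 (in2 (in2 p))) = tr (frame u5 j (>⇒≢ (<-trans (n<1+n (2 + k)) p))) (tr (O.others j (>⇒≢ (<-trans (n<1+n (1 + k)) (<-trans (n<1+n (2 + k)) p))) (>⇒≢ p) (>⇒≢ (<-≤-trans o<k k<=j)))
     (I.clean j (<⇒≤ p)))
  result : Result o k (enc τ v) σ σ5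
  result = record { output = tr (frame u5 o (<=>/=+ 2 o<k)) O.target ; below = \ j j<k j/=o -> tr (frame u5 j (<=>/=+ 2 j<k)) (tr (O.others j (<=>/=+ 1 j<k) (<=>/=+ 3 j<k) j/=o) (I.below j j<k))
   ; clean' = clean5 }
  time-o : length (σ3 o) ≡ 0
  time-o = cong length (tr (I.below o o<k) empty)

module IterBound {Γ} {B : Env Γ -> ℕ} {τ} {Bₛ} {n : Env Γ -> ℕ} {z : Env Γ -> El τ} {s : Env Γ -> ℕ -> El τ -> El τ} (pn : Poly B nat n) (q : Poly {τ ∷ nat ∷ Γ} Bₛ τ (\ (a , i , ρ) -> s ρ i a))
 (j : ℕ) (small : ∀ ρ i -> i ≤ n ρ -> Within (bud B ρ) j (size τ (iter (s ρ) (z ρ) i))) (j' : ℕ) (small' : ∀ ρ i -> i < n ρ -> Within (bud B ρ) j' (Bₛ (iter (s ρ) (z ρ) i , i , ρ)))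
 where
 open Iter {s = s} q
 abstract
  stepDeg capDeg : ℕ
  stepDeg = suc (2 + suc (suc (j + suc (deg pn + 1)) + j')) * deg q
  capDeg = suc (stepDeg + suc (suc (suc (2 + (3 + j)) + suc (suc (2 + (3 + stepDeg)) + suc (2 + (3 + stepDeg)))) + 1))
  cap' : ∀ ρ i -> i < n ρ -> ∀ {u} -> Within (bud Bₛ (iter (s ρ) (z ρ) i , i , ρ)) (deg q) u -> Within (bud B ρ) capDeg (cost u (size τ (iter (s ρ) (z ρ) i)))
  cap' ρ i i<n {u} w = plus 2<= wu (plus 2<= (plus 2<= (plus 2<= (const 2<= 2) (times 2<= (const 2<= 3) wa)) (plus 2<= wt wt)) (const 2<= 1))
   where
   2<= : 2 ≤ bud B ρ
   2<= = 2<=bud B ρ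
   wa : Within (bud B ρ) j (size τ (iter (s ρ) (z ρ) i))
   wa = small ρ i (<⇒≤ i<n)
   wi : Within (bud B ρ) (deg pn) (size nat i)
   wi = shrink 2<= (≤-trans (≡⇒≤ (size-nat i)) (≤-trans (<⇒≤ i<n) (≡⇒≤ (sym (size-nat (n ρ)))))) (size-bound pn ρ)
   wu : Within (bud B ρ) stepDeg u
   wu = power 2<= (plus 2<= (const 2<= 2) (plus 2<= (plus 2<= wa (plus 2<= wi (self 2<= (sizes<=bud B ρ)))) (small' ρ i i<n))) w
   wt : Within (bud B ρ) (suc (2 + (3 + stepDeg))) (2 + 3 * u)
   wt = plus 2<= (const 2<= 2) (times 2<= (const 2<= 3) wu)
  cap : ∀ ρ -> Cap ρ (z ρ) (n ρ) (bud B ρ ^ capDeg)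
  cap ρ i i<n w = bound (cap' ρ i i<n w)

-- A body that runs in polynomial time may still square its argument at each turn, so bounds for all
-- iterates and for the inner budgets have to be supplied. With them every turn is polynomial in the
-- outer budget, and so is the sum over the turns.
iterP : ∀ {Γ} {B : Env Γ -> ℕ} {τ} {Bₛ} {n : Env Γ -> ℕ} {z : Env Γ -> El τ} {s : Env Γ -> ℕ -> El τ -> El τ} -> Poly B nat n -> Poly B τ z -> Poly {τ ∷ nat ∷ Γ} Bₛ τ (\ (a , i , ρ) -> s ρ i a) ->
 ∀ j -> (∀ ρ i -> i ≤ n ρ -> Within (bud B ρ) j (size τ (iter (s ρ) (z ρ) i))) -> ∀ j' -> (∀ ρ i -> i < n ρ -> Within (bud B ρ) j' (Bₛ (iter (s ρ) (z ρ) i , i , ρ))) ->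
 Poly B τ (\ ρ -> iter (s ρ) (z ρ) (n ρ))
iterP {Γ} {B} {τ} {Bₛ} {n} {z} {s} pn pz q j small j' small' = record { deg = suc (deg pn + suc (deg pz + suc (suc (2 + (deg pn + suc (2 + capDeg))) +
  suc (suc (suc (2 + (3 + 0)) + suc (suc (2 + (3 + j)) + suc (2 + (3 + j)))) + suc (2 + (3 + deg pn))))))
 ; prog = \ l o k -> prog pn l k (4 + k) ﹔ prog pz l (1 + k) (4 + k) ﹔ loop k (\ _ -> body l k) ﹔ overwrite (1 + k) (3 + k) o ﹔ clear (2 + k) ; correct = \ r -> correct' r }
 where
 open Iter {s = s} q
 open IterBound {Γ} {B} {τ} {Bₛ} {n} {z} {s} pn q j small j' small'
 correct' : ∀ {l o k σ ρ} -> Ready Γ l o k σ ρ -> _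
 correct' {ρ = ρ} r = σ5 , _ , (e1 ﹔ (e2 ﹔ (e3 ﹔ (e4 ﹔ e5)))) , result , plus 2<= (snd (snd (snd (snd one)))) (plus 2<= (snd (snd (snd (snd two)))) (plus 2<=
   (shrink 2<= c3 (plus 2<= (const 2<= 2) (times 2<= wₘ (plus 2<= (const 2<= 2) (within ≤-refl)))))
   (plus 2<= (plus 2<= (plus 2<= (const 2<= 2) (times 2<= (const 2<= 3) (shrink 2<= (≡⇒≤ time-o) (const 2<= 0)))) (plus 2<= wᵥ wᵥ))
    (plus 2<= (const 2<= 2) (times 2<= (const 2<= 3) (size-bound pn ρ))))))
  where
  open Run {z = z} pn pz r (cap ρ)
  2<= = 2<=bud B ρ
  wₘ : Within (bud B ρ) (deg pn) m
  wₘ = shrink 2<= (≡⇒≤ (sym (size-nat m))) (size-bound pn ρ)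
  wᵥ = plus 2<= (const 2<= 2) (times 2<= (const 2<= 3) (small ρ m ≤-refl))

getP : ∀ {Γ} {B : Env Γ -> ℕ} {f g} -> Poly B arr f -> Poly B nat g -> Poly B nat (\ ρ -> f ρ ‼ g ρ)
getP {B = B} {f} {g} p q = ext (\ ρ -> tr (cong (_‼ 0) (iter-tail (g ρ) (f ρ))) (drop-‼ (g ρ) (f ρ))) (headP (iterP {Bₛ = \ (_ , _ , ρ) -> B ρ} {s = \ _ _ -> List.drop 1} q p (tailP (var here))
  (deg p) (\ ρ i _ -> shrink (2<=bud B ρ) (iter-size (f ρ) i) (size-bound p ρ)) 1 (\ ρ _ _ -> self (2<=bud B ρ) (B<=bud B ρ))))
 where
 drop-suc : ∀ i (xs : List ℕ) -> List.drop 1 (List.drop i xs) ≡ List.drop (suc i) xs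
 drop-suc zero xs = refl
 drop-suc (suc i) [] = refl
 drop-suc (suc i) (x ∷ xs) = drop-suc i xs
 iter-tail : ∀ i xs -> iter (\ _ -> List.drop 1) xs i ≡ List.drop i xs
 iter-tail zero xs = refl
 iter-tail (suc i) xs = tr (cong (List.drop 1) (iter-tail i xs)) (drop-suc i xs)
 iter-size : ∀ xs i -> size arr (iter (\ _ -> List.drop 1) xs i) ≤ size arr xs
 iter-size xs zero = ≤-refl
 iter-size xs (suc i) = ≤-trans (drop1-size (iter (\ _ -> List.drop 1) xs i)) (iter-size xs i)


-- Arithmetic, tests and tables

none : ∀ {Γ} -> Env Γ -> ℕ
none _ = 0

app1 : ∀ {Γ} {B : Env Γ -> ℕ} {τ1 τ f g} -> Poly {τ1 ∷ []} none τ g -> Poly B τ1 f -> Poly B τ (\ ρ -> g (f ρ , tt))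
app1 {Γ} g p = bind p (rebudget 0 (\ _ -> within z≤n) (thin (keep (forget Γ)) g))

app2 : ∀ {Γ} {B : Env Γ -> ℕ} {τ1 τ2 τ f1 f2 g} -> Poly {τ1 ∷ τ2 ∷ []} none τ g -> Poly B τ1 f1 -> Poly B τ2 f2 -> Poly B τ (\ ρ -> g (f1 ρ , f2 ρ , tt))
app2 {Γ} g p q = bind q (bind (wk p) (rebudget 0 (\ _ -> within z≤n) (thin (keep (keep (forget Γ))) g)))

nat-within : ∀ n {b k} -> Within b k n -> Within b k (size nat n)
nat-within n (within p) = within (≤-trans (≡⇒≤ (size-nat n)) p)

within-nat : ∀ n {b k} -> Within b k (size nat n) -> Within b k n
within-nat n (within p) = within (≤-trans (≡⇒≤ (sym (size-nat n))) p)

value-bound : ∀ {Γ B f} (p : Poly {Γ} B nat f) ρ -> Within (bud B ρ) (deg p) (f ρ)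
value-bound {f = f} p ρ = within-nat (f ρ) (size-bound p ρ)

size-within : ∀ {Γ} (B : Env Γ -> ℕ) {τ} (x : Γ ∋ τ) ρ -> Within (bud B ρ) 1 (size τ (value x ρ))
size-within B x ρ = self (2<=bud B ρ) (≤-trans (size-value x ρ) (sizes<=bud B ρ))

value-within : ∀ {Γ} (B : Env Γ -> ℕ) (x : Γ ∋ nat) ρ -> Within (bud B ρ) 1 (value x ρ)
value-within B x ρ = within-nat (value x ρ) (size-within B x ρ)

#0 : ∀ {Γ τ} {B : Env (τ ∷ Γ) -> ℕ} -> Poly B τ fst
#0 = var here

#1 : ∀ {Γ τ0 τ} {B : Env (τ0 ∷ τ ∷ Γ) -> ℕ} -> Poly B τ (fst ∘ snd)
#1 = var (there here)

#2 : ∀ {Γ τ0 τ1 τ} {B : Env (τ0 ∷ τ1 ∷ τ ∷ Γ) -> ℕ} -> Poly B τ (fst ∘ snd ∘ snd)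
#2 = var (there (there here))

#3 : ∀ {Γ τ0 τ1 τ2 τ} {B : Env (τ0 ∷ τ1 ∷ τ2 ∷ τ ∷ Γ) -> ℕ} -> Poly B τ (fst ∘ snd ∘ snd ∘ snd)
#3 = var (there (there (there here)))

litP : ∀ {Γ} {B : Env Γ -> ℕ} n -> Poly B nat (\ _ -> n)
litP zero = zeroP
litP (suc n) = sucP (litP n)

iter-cong : ∀ {A B : Set} (h : A -> B) {s : ℕ -> A -> A} {s' : ℕ -> B -> B} {z z'} -> h z ≡ z' -> (∀ i a -> h (s i a) ≡ s' i (h a)) -> ∀ n -> h (iter s z n) ≡ iter s' z' n
iter-cong h hz hs zero = hz
iter-cong h {s' = s'} hz hs (suc n) = tr (hs n _) (cong (s' n) (iter-cong h hz hs n))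

iter-+ : ∀ x y -> iter (\ _ a -> suc a) y x ≡ x + y
iter-+ zero y = refl
iter-+ (suc x) y = cong suc (iter-+ x y)

iter-* : ∀ x y -> iter (\ _ a -> y + a) 0 x ≡ x * y
iter-* zero y = refl
iter-* (suc x) y = cong (y +_) (iter-* x y)

-- The predecessor is the loop counter of the last turn.
iter-pred : ∀ x -> iter (\ i _ -> i) 0 x ≡ ℕ.pred x
iter-pred zero = refl
iter-pred (suc x) = refl

iter-∸ : ∀ x y -> iter (\ _ a -> ℕ.pred a) x y ≡ x ∸ y
iter-∸ x zero = refl
iter-∸ x (suc y) = tr (cong ℕ.pred (iter-∸ x y)) (pred[m∸n]≡m∸[1+n] x y)

-- Natural number recursion with the bound on the iterates given by a value.
iterN : ∀ {Γ} {B : Env Γ -> ℕ} {n z} {s : Env Γ -> ℕ -> ℕ -> ℕ} -> Poly B nat n -> Poly B nat z -> Poly {nat ∷ nat ∷ Γ} (\ (_ , _ , ρ) -> B ρ) nat (\ (a , i , ρ) -> s ρ i a) ->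
 ∀ j -> (∀ ρ i -> i ≤ n ρ -> Within (bud B ρ) j (iter (s ρ) (z ρ) i)) -> Poly B nat (\ ρ -> iter (s ρ) (z ρ) (n ρ))
iterN {B = B} {z = z} {s = s} pn pz q j small = iterP {s = s} pn pz q j (\ ρ i p -> nat-within (iter (s ρ) (z ρ) i) (small ρ i p)) 1 (\ ρ _ _ -> self (2<=bud B ρ) (B<=bud B ρ))

add-poly : Poly {nat ∷ nat ∷ []} none nat (\ (x , y , _) -> x + y)
add-poly = ext (\ (x , y , _) -> iter-+ x y) (iterN #0 #1 (sucP #0) 1 (\ (x , y , _) i i<=x -> self (s≤s (s≤s z≤n)) (subst (_≤ _) (sym (iter-+ i y))
   (≤-trans (+-mono-≤ (≤-trans i<=x (≡⇒≤ (sym (size-nat x)))) (≤-trans (≡⇒≤ (sym (size-nat y))) (m≤m+n _ 0))) (≤-trans (m≤m+n _ 0) (m≤n+m _ 2))))))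

infixl 6 _+P_ _∸P_
infixl 7 _*P_

_+P_ : ∀ {Γ} {B : Env Γ -> ℕ} {f g} -> Poly B nat f -> Poly B nat g -> Poly B nat (\ ρ -> f ρ + g ρ)
_+P_ = app2 add-poly

mul-poly : Poly {nat ∷ nat ∷ []} none nat (\ (x , y , _) -> x * y)
mul-poly = ext (\ (x , y , _) -> iter-* x y) (iterN #0 zeroP (#3 +P #0) 2 (\ (x , y , _) i i<=x -> shrink (s≤s (s≤s z≤n)) (subst (_≤ x * y) (sym (iter-* i y)) (*-monoˡ-≤ y i<=x))
   (times (s≤s (s≤s z≤n)) (value-within none here (x , y , tt)) (value-within none (there here) (x , y , tt)))))

_*P_ : ∀ {Γ} {B : Env Γ -> ℕ} {f g} -> Poly B nat f -> Poly B nat g -> Poly B nat (\ ρ -> f ρ * g ρ)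
_*P_ = app2 mul-poly

pred-poly : Poly {nat ∷ []} none nat (\ (x , _) -> ℕ.pred x)
pred-poly = ext (\ (x , _) -> iter-pred x) (iterN #0 zeroP #1 1 (\ (x , _) i i<=x -> shrink (s≤s (s≤s z≤n)) (≤-trans (≡⇒≤ (iter-pred i)) (≤-trans pred[n]≤n i<=x)) (value-within none here (x , tt))))

monus-poly : Poly {nat ∷ nat ∷ []} none nat (\ (x , y , _) -> x ∸ y)
monus-poly = ext (\ (x , y , _) -> iter-∸ x y) (iterN #1 #0 (app1 pred-poly #0) 1 (\ (x , y , _) i _ -> shrink (s≤s (s≤s z≤n)) (≤-trans (≡⇒≤ (iter-∸ x i)) (m∸n≤m x i))
  (value-within none here (x , y , tt))))

_∸P_ : ∀ {Γ} {B : Env Γ -> ℕ} {f g} -> Poly B nat f -> Poly B nat g -> Poly B nat (\ ρ -> f ρ ∸ g ρ)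
_∸P_ = app2 monus-poly

b2n : Bool -> ℕ
b2n false = 0
b2n true = 1

Test : ∀ {Γ} -> (Env Γ -> ℕ) -> (Env Γ -> Bool) -> Set
Test B c = Poly B nat (b2n ∘ c)

-- A conditional is a loop of at most one turn: it starts from the value of the second branch, and
-- the turn replaces this by the value of the first.
ifP : ∀ {Γ} {B : Env Γ -> ℕ} {τ c f g} -> Test B c -> Poly B τ f -> Poly B τ g -> Poly B τ (\ ρ -> if c ρ then f ρ else g ρ)
ifP {B = B} {c = c} {f} {g} pc p q = ext (\ ρ -> choose (c ρ)) (iterP {s = \ ρ _ _ -> f ρ} pc q (wk (wk p)) (deg p + deg q) (\ ρ i _ -> small ρ i) 1 (\ ρ _ _ -> self (2<=bud B ρ) (B<=bud B ρ)))
 where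
 choose : ∀ {A : Set} {x y : A} b -> iter (\ _ _ -> x) y (b2n b) ≡ (if b then x else y)
 choose false = refl
 choose true = refl
 small : ∀ ρ i -> Within (bud B ρ) (deg p + deg q) (size _ (iter (\ _ _ -> f ρ) (g ρ) i))
 small ρ zero = weaken (2<=bud B ρ) (m≤n+m (deg q) (deg p)) (size-bound q ρ)
 small ρ (suc i) = weaken (2<=bud B ρ) (m≤m+n (deg p) (deg q)) (size-bound p ρ)

trueP : ∀ {Γ} {B : Env Γ -> ℕ} -> Test B (\ _ -> true)
trueP = litP 1

falseP : ∀ {Γ} {B : Env Γ -> ℕ} -> Test B (\ _ -> false)
falseP = zeroP

notP : ∀ {Γ} {B : Env Γ -> ℕ} {c} -> Test B c -> Test B (\ ρ -> Bool.not (c ρ))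
notP {c = c} p = ext (\ ρ -> lemma (c ρ)) (litP 1 ∸P p)
 where
 lemma : ∀ b -> 1 ∸ b2n b ≡ b2n (Bool.not b)
 lemma false = refl
 lemma true = refl

infixr 6 _∧P_
infixr 5 _∨P_

_∧P_ : ∀ {Γ} {B : Env Γ -> ℕ} {c d} -> Test B c -> Test B d -> Test B (\ ρ -> c ρ ∧ d ρ)
_∧P_ {c = c} {d} p q = ext (\ ρ -> lemma (c ρ) (d ρ)) (p *P q)
 where
 lemma : ∀ b b' -> b2n b * b2n b' ≡ b2n (b ∧ b')
 lemma false b' = refl
 lemma true b' = +-identityʳ _

_∨P_ : ∀ {Γ} {B : Env Γ -> ℕ} {c d} -> Test B c -> Test B d -> Test B (\ ρ -> c ρ ∨ d ρ)
_∨P_ {c = c} {d} p q = ext (\ ρ -> lemma (c ρ) (d ρ)) (notP (notP p ∧P notP q))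
 where
 lemma : ∀ b b' -> b2n (Bool.not (Bool.not b ∧ Bool.not b')) ≡ b2n (b ∨ b')
 lemma false false = refl
 lemma false true = refl
 lemma true b' = refl

zero-poly : Poly {nat ∷ []} none nat (\ (x , _) -> b2n (x ≤ᵇ 0))
zero-poly = ext (\ (x , _) -> lemma x) (litP 1 ∸P #0)
 where
 lemma : ∀ x -> 1 ∸ x ≡ b2n (x ≤ᵇ 0)
 lemma zero = refl
 lemma (suc x) = 0∸n≡0 x

infix 4 _<=bP_ _=bP_

_<=bP_ : ∀ {Γ} {B : Env Γ -> ℕ} {f g} -> Poly B nat f -> Poly B nat g -> Test B (\ ρ -> f ρ ≤ᵇ g ρ)
_<=bP_ {f = f} {g} p q = ext (\ ρ -> cong b2n (lemma (f ρ) (g ρ))) (app1 zero-poly (p ∸P q))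
 where
 suc<=b : ∀ x y -> (suc x ≤ᵇ suc y) ≡ (x ≤ᵇ y)
 suc<=b zero y = refl
 suc<=b (suc x) y = refl
 lemma : ∀ x y -> (x ∸ y ≤ᵇ 0) ≡ (x ≤ᵇ y)
 lemma x zero = refl
 lemma zero (suc y) = refl
 lemma (suc x) (suc y) = tr (lemma x y) (sym (suc<=b x y))

_=bP_ : ∀ {Γ} {B : Env Γ -> ℕ} {f g} -> Poly B nat f -> Poly B nat g -> Test B (\ ρ -> f ρ ≡ᵇ g ρ)
_=bP_ {f = f} {g} p q = ext (\ ρ -> cong b2n (lemma (f ρ) (g ρ))) (app1 zero-poly ((p ∸P q) +P (q ∸P p)))
 where
 lemma : ∀ x y -> ((x ∸ y) + (y ∸ x) ≤ᵇ 0) ≡ (x ≡ᵇ y)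
 lemma zero zero = refl
 lemma zero (suc y) = refl
 lemma (suc x) zero = refl
 lemma (suc x) (suc y) = lemma x y

-- An index below a computed bound enlarges the budget only polynomially, so a bound found for each
-- index holds uniformly in the outer budget.
index-within : ∀ {Γ} {B : Env Γ -> ℕ} {n} (pn : Poly B nat n) {d x} ρ i -> i ≤ n ρ -> Within (bud {nat ∷ Γ} (B ∘ snd) (i , ρ)) d x -> Within (bud B ρ) (suc (2 + suc (suc (deg pn + 1) + 1)) * d) x
index-within {Γ} {B} pn ρ i i≤n w = power 2<= (plus 2<= (const 2<= 2) (plus 2<= (plus 2<= (nat-within i (shrink 2<= i≤n (value-bound pn ρ))) (self 2<= (sizes<=bud B ρ))) (self 2<= (B<=bud B ρ)))) w
 where
  2<= = 2<=bud B ρ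

sum : ℕ -> (ℕ -> ℕ) -> ℕ
sum n f = iter (\ i a -> f i + a) 0 n

any every : ℕ -> (ℕ -> Bool) -> Bool
any n f = iter (\ i a -> f i ∨ a) false n
every n f = iter (\ i a -> f i ∧ a) true n

any-cong : ∀ n {f g} -> (∀ i -> i < n -> f i ≡ g i) -> any n f ≡ any n g
any-cong zero h = refl
any-cong (suc n) h = cong2 _∨_ (h n ≤-refl) (any-cong n (\ i p -> h i (m<n⇒m<1+n p)))

sum-<= : ∀ n f {m} -> (∀ i -> i < n -> f i ≤ m) -> sum n f ≤ n * m
sum-<= zero f le' = z≤n
sum-<= (suc n) f le' = +-mono-≤ (le' n ≤-refl) (sum-<= n f (\ i p -> le' i (m<n⇒m<1+n p)))

module _ {Γ} {B : Env Γ -> ℕ} {n : Env Γ -> ℕ} (pn : Poly B nat n) where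
 private
  b2n-<=1 : ∀ b -> b2n b ≤ 1
  b2n-<=1 false = z≤n
  b2n-<=1 true = ≤-refl
 boolIterP : ∀ {s : Env Γ -> ℕ -> Bool -> Bool} {z : Bool} -> Poly {nat ∷ nat ∷ Γ} (\ (_ , _ , ρ) -> B ρ) nat (\ (a , i , ρ) -> b2n (s ρ i (1 ≤ᵇ a))) -> Test B (\ ρ -> iter (s ρ) z (n ρ))
 boolIterP {s} {z} p = ext (\ ρ -> sym (iterates ρ (n ρ))) (iterN {s = \ ρ i a -> b2n (s ρ i (1 ≤ᵇ a))} pn (litP (b2n z)) p 1
   (\ ρ i _ -> shrink (2<=bud B ρ) (subst (_≤ 1) (iterates ρ i) (b2n-<=1 _)) (const (2<=bud B ρ) 1)))
  where
  unb2n-b2n : ∀ b -> (1 ≤ᵇ b2n b) ≡ b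
  unb2n-b2n false = refl
  unb2n-b2n true = refl
  iterates : ∀ ρ i -> b2n (iter (s ρ) z i) ≡ iter (\ i a -> b2n (s ρ i (1 ≤ᵇ a))) (b2n z) i
  iterates ρ = iter-cong b2n refl (\ i a -> cong (\ c -> b2n (s ρ i c)) (sym (unb2n-b2n a)))
 anyP : ∀ {f} -> Test {nat ∷ Γ} (B ∘ snd) f -> Test B (\ ρ -> any (n ρ) (\ i -> f (i , ρ)))
 anyP {f} p = boolIterP {s = \ ρ i a -> f (i , ρ) ∨ a} (wk p ∨P (litP 1 <=bP #0))
 allP : ∀ {f} -> Test {nat ∷ Γ} (B ∘ snd) f -> Test B (\ ρ -> every (n ρ) (\ i -> f (i , ρ)))
 allP {f} p = boolIterP {s = \ ρ i a -> f (i , ρ) ∧ a} (wk p ∧P (litP 1 <=bP #0))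


-- Total division: a divisor 0 is treated as 1.
infixl 7 _÷_ _rem_

_÷_ _rem_ : ℕ -> ℕ -> ℕ
m ÷ n = m ℕ./ suc (ℕ.pred n)
m rem n = m ℕ.% suc (ℕ.pred n)

/-unique : ∀ q x d .{{_ : NonZero d}} -> q * d ≤ x -> x < suc q * d -> x ℕ./ d ≡ q
/-unique q x d lo hi = ≤-antisym (≤-pred (DM.m<n*o⇒m/o<n hi)) (≤-trans (≡⇒≤ (sym (DM.m*n/n≡m q d))) (DM./-monoˡ-≤ d lo))

divStep : ℕ -> ℕ -> ℕ -> ℕ
divStep d i a = if suc a * d ≤ᵇ suc i then suc a else a

-- Division by counting up the dividend: when it grows by one, the quotient grows by at most one,
-- and it does so exactly when the next multiple of `d` is reached.
iter-÷ : ∀ d .{{_ : NonZero d}} x -> iter (divStep d) 0 x ≡ x ℕ./ d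
iter-÷ d zero = sym (DM.0/n≡0 d)
iter-÷ d (suc x) rewrite iter-÷ d x with suc (x ℕ./ d) * d ≤ᵇ suc x in eq
... | true = sym (/-unique (suc (x ℕ./ d)) (suc x) d (≤ᵇ⇒≤ _ _ (subst T (sym eq) tt)) (begin-strict suc x ≤⟨ s≤s (≡⇒≤ (DM.m≡m%n+[m/n]*n x d)) ⟩
  suc (x ℕ.% d) + (x ℕ./ d) * d <⟨ +-monoˡ-< ((x ℕ./ d) * d) (s≤s (DM.m%n<n x d)) ⟩ suc d + (x ℕ./ d) * d ≤⟨ +-monoˡ-≤ ((x ℕ./ d) * d) (+-monoˡ-≤ d (ℕ.>-nonZero⁻¹ d)) ⟩
  d + d + (x ℕ./ d) * d ≡⟨ +-assoc d d _ ⟩ suc (suc (x ℕ./ d)) * d ∎))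
 where
   open ℕ.≤-Reasoning
... | false = sym (/-unique (x ℕ./ d) (suc x) d (m≤n⇒m≤1+n (DM.m/n*n≤m x d)) (≰⇒> (\ le' -> subst T eq (≤⇒≤ᵇ le'))))

div-poly : Poly {nat ∷ nat ∷ []} none nat (\ (x , d , _) -> x ÷ d)
div-poly = ext (\ (x , d , _) -> iter-÷ (suc (ℕ.pred d)) x) (iterN #0 zeroP (ifP (sucP #0 *P sucP (app1 pred-poly #3) <=bP sucP #1) (sucP #0) #0) 1 (\ (x , d , _) i i<=x -> shrink (s≤s (s≤s z≤n))
   (≤-trans (≡⇒≤ (iter-÷ (suc (ℕ.pred d)) i)) (≤-trans (DM.m/n≤m i _) i<=x)) (value-within none here (x , d , tt))))

infixl 7 _÷P_ _remP_

_÷P_ : ∀ {Γ} {B : Env Γ -> ℕ} {f g} -> Poly B nat f -> Poly B nat g -> Poly B nat (\ ρ -> f ρ ÷ g ρ)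
_÷P_ = app2 div-poly

rem-poly : Poly {nat ∷ nat ∷ []} none nat (\ (x , d , _) -> x rem d)
rem-poly = ext (\ (x , d , _) -> sym (DM.m%n≡m∸m/n*n x (suc (ℕ.pred d)))) (#0 ∸P (#0 ÷P #1) *P sucP (app1 pred-poly #1))

_remP_ : ∀ {Γ} {B : Env Γ -> ℕ} {f g} -> Poly B nat f -> Poly B nat g -> Poly B nat (\ ρ -> f ρ rem g ρ)
_remP_ = app2 rem-poly

-- A power is not polynomial in its exponent, so its value is put into the budget; whoever takes a
-- power must show that it is small.
powBudget : ℕ -> Env (nat ∷ []) -> ℕ
powBudget c (x , _) = suc c ^ x

pow-poly : ∀ c -> Poly {nat ∷ []} (powBudget c) nat (\ (x , _) -> suc c ^ x)
pow-poly c = ext (\ (x , _) -> iter-pow x) (iterN #0 (litP 1) (litP (suc c) *P #0) 1 (\ (x , _) i i<=x -> shrink (s≤s (s≤s z≤n)) (≤-trans (≡⇒≤ (iter-pow i)) (^-monoʳ-≤ (suc c) i<=x))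
   (self (s≤s (s≤s z≤n)) (B<=bud (powBudget c) (x , tt)))))
 where
 iter-pow : ∀ x -> iter (\ _ a -> suc c * a) 1 x ≡ suc c ^ x
 iter-pow zero = refl
 iter-pow (suc x) = cong (suc c *_) (iter-pow x)

powP : ∀ c {Γ} {B : Env Γ -> ℕ} {f} j -> (∀ ρ -> Within (bud B ρ) j (suc c ^ f ρ)) -> Poly B nat f -> Poly B nat (\ ρ -> suc c ^ f ρ)
powP c {Γ} j small p = bindWith p (thin (keep (forget Γ)) (pow-poly c)) j small

-- Arrays grow at the front, so the entries are produced from the last index down to 0.
tab : ℕ -> (ℕ -> ℕ) -> List ℕ
tab n f = iter (\ k xs -> f (n ∸ suc k) ∷ xs) [] n

tab-‼ : ∀ n f {i} -> i < n -> tab n f ‼ i ≡ f i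
tab-‼ n f {i} i<n = tr (go n ≤-refl i i<n) (cong (\ k -> f (k + i)) (n∸n≡0 n))
 where
 go : ∀ k -> k ≤ n -> ∀ i -> i < k -> iter (\ k xs -> f (n ∸ suc k) ∷ xs) [] k ‼ i ≡ f ((n ∸ k) + i)
 go (suc k) k<n zero _ = cong f (sym (+-identityʳ _))
 go (suc k) k<n (suc i) (s≤s i<k) = tr (go k (<⇒≤ k<n) i i<k) (cong f (tr (cong (_+ i) (+-∸-assoc 1 k<n)) (sym (+-suc _ i))))

tab-size : ∀ n (f : ℕ -> ℕ) {m} k -> (∀ k -> f (n ∸ suc k) ≤ m) -> size arr (iter (\ k xs -> f (n ∸ suc k) ∷ xs) [] k) ≤ k * suc m
tab-size n f zero le' = z≤n
tab-size n f {m} (suc k) le' = begin length (replicate (f i) true ++ false ∷ enc arr xs) ≡⟨ length-++ (replicate (f i) true) ⟩ length (replicate (f i) true) + suc (size arr xs)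
  ≡⟨ cong (_+ suc (size arr xs)) (length-replicate (f i)) ⟩ f i + suc (size arr xs) ≤⟨ +-mono-≤ (le' k) (s≤s (tab-size n f k le')) ⟩ m + suc (k * suc m) ≡⟨ +-suc m _ ⟩ suc m + k * suc m ∎
 where
 open ℕ.≤-Reasoning
 i = n ∸ suc k
 xs = iter (\ k xs -> f (n ∸ suc k) ∷ xs) [] k

tabP : ∀ {Γ} {B : Env Γ -> ℕ} {n f} -> Poly B nat n -> Poly {nat ∷ Γ} (B ∘ snd) nat f -> Poly B arr (\ ρ -> tab (n ρ) (\ i -> f (i , ρ)))
tabP {Γ} {B} {n} {f} pn p = iterP {Bₛ = \ (_ , _ , ρ) -> B ρ} {s = \ ρ k xs -> f (n ρ ∸ suc k , ρ) ∷ xs} pn nilP (consP (bind (wk (wk pn) ∸P sucP #1) (thin (keep (drop (drop ident))) p)) #0)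
  (deg pn + suc (1 + K)) small 1 (\ ρ _ _ -> self (2<=bud B ρ) (B<=bud B ρ))
 where
 K = suc (2 + suc (suc (deg pn + 1) + 1)) * deg p
 small : ∀ ρ k -> k ≤ n ρ -> Within (bud B ρ) (deg pn + suc (1 + K)) (size arr (iter (\ k xs -> f (n ρ ∸ suc k , ρ) ∷ xs) [] k))
 small ρ k k≤n = shrink 2<= (tab-size (n ρ) (\ i -> f (i , ρ)) k (\ k -> bound (index-within pn ρ (n ρ ∸ suc k) (m∸n≤m (n ρ) (suc k)) (value-bound p (n ρ ∸ suc k , ρ)))))
   (times 2<= (shrink 2<= k≤n (value-bound pn ρ)) (plus 2<= (const 2<= 1) (within ≤-refl)))
  where
    2<= = 2<=bud B ρ

-- Integer-valued functions, as differences of natural number valued ones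

record PolyZ {Γ} (B : Env Γ -> ℕ) (f : Env Γ -> ℤ) : Set where
 field
  {pos neg} : Env Γ -> ℕ
  posP : Poly B nat pos
  negP : Poly B nat neg
  differ : ∀ ρ -> f ρ ≡ Z.+ pos ρ Z.- Z.+ neg ρ

open PolyZ public

module _ where
 open Z-Solver
 +-differ : ∀ a b c d -> (Z.+ a Z.- Z.+ b) Z.+ (Z.+ c Z.- Z.+ d) ≡ Z.+ (a + c) Z.- Z.+ (b + d)
 +-differ a b c d = tr (solve 4 (\ a b c d -> (a :- b) :+ (c :- d) := (a :+ c) :- (b :+ d)) refl (Z.+ a) (Z.+ b) (Z.+ c) (Z.+ d)) (sym (cong2 Z._-_ (Z.pos-+ a c) (Z.pos-+ b d)))
 *-differ : ∀ a b c d -> (Z.+ a Z.- Z.+ b) Z.* (Z.+ c Z.- Z.+ d) ≡ Z.+ (a * c + b * d) Z.- Z.+ (a * d + b * c)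
 *-differ a b c d = tr (solve 4 (\ a b c d -> (a :- b) :* (c :- d) := (a :* c :+ b :* d) :- (a :* d :+ b :* c)) refl (Z.+ a) (Z.+ b) (Z.+ c) (Z.+ d))
  (sym (cong2 Z._-_ (pos-+-* a c b d) (pos-+-* a d b c)))
  where
  pos-+-* : ∀ a b c d -> Z.+ (a * b + c * d) ≡ Z.+ a Z.* Z.+ b Z.+ Z.+ c Z.* Z.+ d
  pos-+-* a b c d = tr (Z.pos-+ (a * b) (c * d)) (cong2 Z._+_ (Z.pos-* a b) (Z.pos-* c d))
 neg-differ : ∀ a b -> Z.- (Z.+ a Z.- Z.+ b) ≡ Z.+ b Z.- Z.+ a
 neg-differ a b = solve 2 (\ a b -> :- (a :- b) := b :- a) refl (Z.+ a) (Z.+ b)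

infixl 6 _+Z_ _-Z_
infixl 7 _*Z_

natZ : ∀ {Γ} {B : Env Γ -> ℕ} {f} -> Poly B nat f -> PolyZ B (\ ρ -> Z.+ f ρ)
natZ p = record { posP = p ; negP = litP 0 ; differ = \ ρ -> sym (Z.+-identityʳ _) }

negZ : ∀ {Γ} {B : Env Γ -> ℕ} {f} -> PolyZ B f -> PolyZ B (\ ρ -> Z.- f ρ)
negZ p = record { posP = negP p ; negP = posP p ; differ = \ ρ -> tr (cong Z.-_ (differ p ρ)) (neg-differ (pos p ρ) (neg p ρ)) }

litZ : ∀ {Γ} {B : Env Γ -> ℕ} z -> PolyZ B (\ _ -> z)
litZ (Z.+ n) = natZ (litP n)
litZ -[1+ n ] = negZ (natZ (litP (suc n)))

_+Z_ : ∀ {Γ} {B : Env Γ -> ℕ} {f g} -> PolyZ B f -> PolyZ B g -> PolyZ B (\ ρ -> f ρ Z.+ g ρ)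
p +Z q = record { posP = posP p +P posP q ; negP = negP p +P negP q ; differ = \ ρ -> tr (cong2 Z._+_ (differ p ρ) (differ q ρ)) (+-differ (pos p ρ) (neg p ρ) (pos q ρ) (neg q ρ)) }

_-Z_ : ∀ {Γ} {B : Env Γ -> ℕ} {f g} -> PolyZ B f -> PolyZ B g -> PolyZ B (\ ρ -> f ρ Z.- g ρ)
p -Z q = p +Z negZ q

_*Z_ : ∀ {Γ} {B : Env Γ -> ℕ} {f g} -> PolyZ B f -> PolyZ B g -> PolyZ B (\ ρ -> f ρ Z.* g ρ)
p *Z q = record { posP = posP p *P posP q +P negP p *P negP q ; negP = posP p *P negP q +P negP p *P posP q
 ; differ = \ ρ -> tr (cong2 Z._*_ (differ p ρ) (differ q ρ)) (*-differ (pos p ρ) (neg p ρ) (pos q ρ) (neg q ρ)) }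

ifZ : ∀ {Γ} {B : Env Γ -> ℕ} {c f g} -> Test B c -> PolyZ B f -> PolyZ B g -> PolyZ B (\ ρ -> if c ρ then f ρ else g ρ)
ifZ {c = c} {f} {g} pc p q = record { posP = ifP pc (posP p) (posP q) ; negP = ifP pc (negP p) (negP q) ; differ = \ ρ -> choose (c ρ) (differ p ρ) (differ q ρ) }
 where
 choose : ∀ b {x y a a' m m'} -> x ≡ Z.+ a Z.- Z.+ m -> y ≡ Z.+ a' Z.- Z.+ m' -> (if b then x else y) ≡ Z.+ (if b then a else a') Z.- Z.+ (if b then m else m')
 choose false p q = q
 choose true p q = p

bindZ : ∀ {Γ} {B : Env Γ -> ℕ} {τ f g} -> Poly B τ f -> PolyZ {τ ∷ Γ} (B ∘ snd) g -> PolyZ B (\ ρ -> g (f ρ , ρ))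
bindZ p q = record { posP = bind p (posP q) ; negP = bind p (negP q) ; differ = \ ρ -> differ q _ }

thinZ : ∀ {Γ Δ B f} (θ : Thin Γ Δ) -> PolyZ {Δ} B f -> PolyZ {Γ} (B ∘ prj θ) (f ∘ prj θ)
thinZ θ p = record { posP = thin θ (posP p) ; negP = thin θ (negP p) ; differ = \ ρ -> differ p _ }

extZ : ∀ {Γ} {B : Env Γ -> ℕ} {f g} -> (∀ ρ -> f ρ ≡ g ρ) -> PolyZ B f -> PolyZ B g
extZ eq p = record { posP = posP p ; negP = negP p ; differ = \ ρ -> tr (sym (eq ρ)) (differ p ρ) }

nonneg : ℤ -> Bool
nonneg (Z.+ _) = true
nonneg -[1+ _ ] = false

nonneg-⊖ : ∀ m n -> nonneg (m ⊖ n) ≡ (n ≤ᵇ m)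
nonneg-⊖ m zero = refl
nonneg-⊖ zero (suc n) = refl
nonneg-⊖ (suc m) (suc n) = tr (cong nonneg (Z.[1+m]⊖[1+n]≡m⊖n m n)) (tr (nonneg-⊖ m n) (suc<=b n m))
 where
 suc<=b : ∀ x y -> (x ≤ᵇ y) ≡ (suc x ≤ᵇ suc y)
 suc<=b zero y = refl
 suc<=b (suc x) y = refl

nonnegP : ∀ {Γ} {B : Env Γ -> ℕ} {f} -> PolyZ B f -> Test B (\ ρ -> nonneg (f ρ))
nonnegP p = ext (\ ρ -> cong b2n (sym (tr (cong nonneg (tr (differ p ρ) (Z.m-n≡m⊖n (pos p ρ) (neg p ρ)))) (nonneg-⊖ (pos p ρ) (neg p ρ))))) (negP p <=bP posP p)

absP : ∀ {Γ} {B : Env Γ -> ℕ} {f} -> PolyZ B f -> Poly B nat (\ ρ -> Z.∣ f ρ ∣)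
absP p = ext (\ ρ -> tr (abs-⊖ (pos p ρ) (neg p ρ)) (cong Z.∣_∣ (sym (tr (differ p ρ) (Z.m-n≡m⊖n (pos p ρ) (neg p ρ)))))) ((posP p ∸P negP p) +P (negP p ∸P posP p))
 where
 abs-⊖ : ∀ m n -> (m ∸ n) + (n ∸ m) ≡ Z.∣ m ⊖ n ∣
 abs-⊖ m zero = tr (cong (m +_) (0∸n≡0 m)) (+-identityʳ m)
 abs-⊖ zero (suc n) = refl
 abs-⊖ (suc m) (suc n) = tr (abs-⊖ m n) (cong Z.∣_∣ (sym (Z.[1+m]⊖[1+n]≡m⊖n m n)))

-- Quadratic irrationals

abstract
 -- Opaque, because the fraction unfolds to a computation of greatest common divisors.
 ι : ℤ -> ℚ
 ι i = i Q./ 1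
 ι-def : ∀ i -> ι i ≡ i Q./ 1
 ι-def i = refl
 ι-0 : ι 0ℤ ≡ 0ℚ
 ι-0 = refl
 ι-1 : ι 1ℤ ≡ 1ℚ
 ι-1 = refl
 ι-mkℚ : ∀ i -> ι i ≡ mkℚ i 0 (Coprime.sym (Coprime.1-coprimeTo Z.∣ i ∣))
 ι-mkℚ i = Q.↥p/↧p≡p (mkℚ i 0 (Coprime.sym (Coprime.1-coprimeTo Z.∣ i ∣)))
 ι-+ : ∀ i j -> ι (i Z.+ j) ≡ ι i Q.+ ι j
 ι-+ i j = tr (cong ι (sym (cong2 Z._+_ (Z.*-identityʳ i) (Z.*-identityʳ j)))) (sym (cong2 Q._+_ (ι-mkℚ i) (ι-mkℚ j)))
 ι-* : ∀ i j -> ι (i Z.* j) ≡ ι i Q.* ι j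
 ι-* i j = sym (cong2 Q._*_ (ι-mkℚ i) (ι-mkℚ j))
 ι-neg : ∀ i -> ι (Z.- i) ≡ Q.- ι i
 ι-neg i = tr (ι-mkℚ (Z.- i)) (tr (lemma i) (cong Q.-_ (sym (ι-mkℚ i))))
  where
  lemma : ∀ i -> mkℚ (Z.- i) 0 (Coprime.sym (Coprime.1-coprimeTo Z.∣ Z.- i ∣)) ≡ Q.- mkℚ i 0 (Coprime.sym (Coprime.1-coprimeTo Z.∣ i ∣))
  lemma (Z.+ zero) = refl
  lemma (Z.+ (suc n)) = refl
  lemma -[1+ n ] = refl
 ι-mono : ∀ {i j} -> i Z.≤ j -> ι i Q.≤ ι j
 ι-mono {i} {j} i≤j = subst2 Q._≤_ (sym (ι-mkℚ i)) (sym (ι-mkℚ j)) (Q.*≤* (Z.*-monoʳ-≤-nonNeg 1ℤ i≤j))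

ι-nonneg : ∀ n -> 0ℚ Q.≤ ι (Z.+ n)
ι-nonneg n = subst (Q._≤ ι (Z.+ n)) ι-0 (ι-mono (Z.+≤+ (z≤n {n})))

ι-≥1 : ∀ {i} -> 1ℤ Z.≤ i -> 1ℚ Q.≤ ι i
ι-≥1 {i} 1<=i = subst (Q._≤ ι i) ι-1 (ι-mono 1<=i)

Null : (ℕ -> ℚ) -> Set
Null u = ∀ ε -> 0ℚ Q.< ε -> ∃[ N ] (∀ n -> N ≤ n -> Q.∣ u n ∣ Q.≤ ε)

divide : ∀ K ε -> 0ℚ Q.< K -> 0ℚ Q.< ε -> ∃[ δ ] (0ℚ Q.< δ × K Q.* δ ≡ ε)
divide K ε 0<K 0<ε = (Q.1/ K) Q.* ε , Q.positive⁻¹ _ , eq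
 where
 instance
  posK = Q.positive 0<K
  nzK = Q.pos⇒nonZero K
  posε = Q.positive 0<ε
  pos1/K = Q.1/pos⇒pos K
  posδ = Q.pos*pos⇒pos (Q.1/ K) ε
 eq : K Q.* ((Q.1/ K) Q.* ε) ≡ ε
 eq = tr (sym (Q.*-assoc K (Q.1/ K) ε)) (tr (cong (Q._* ε) (Q.*-inverseʳ K)) (Q.*-identityˡ ε))

null-dominated : ∀ {u v K} -> 0ℚ Q.< K -> Null u -> ∃[ N ] (∀ n -> N ≤ n -> Q.∣ v n ∣ Q.≤ K Q.* Q.∣ u n ∣) -> Null v
null-dominated {u} {v} {K} 0<K null (N , dom) ε 0<ε with divide K ε 0<K 0<ε
... | δ , 0<δ , Kδ=ε with null δ 0<δ
... | M , small = M + N , \ n p -> begin Q.∣ v n ∣ ≤⟨ dom n (m+n≤o⇒n≤o M p) ⟩ K Q.* Q.∣ u n ∣ ≤⟨ Q.*-monoˡ-≤-nonNeg K {{Q.nonNegative (Q.<⇒≤ 0<K)}} (small n (m+n≤o⇒m≤o M p)) ⟩ K Q.* δ ≡⟨ Kδ=ε ⟩ ε ∎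
 where
  open Q.≤-Reasoning

0<1 : 0ℚ Q.< 1ℚ
0<1 = Q.positive⁻¹ 1ℚ

0<½ : 0ℚ Q.< ½
0<½ = Q.positive⁻¹ ½

q<=1+q : ∀ q -> q Q.≤ 1ℚ Q.+ q
q<=1+q q = Q.≤-trans (Q.≤-reflexive (sym (Q.+-identityˡ q))) (Q.+-monoˡ-≤ q (Q.<⇒≤ 0<1))

0<1+∣q∣ : ∀ q -> 0ℚ Q.< 1ℚ Q.+ Q.∣ q ∣
0<1+∣q∣ q = Q.<-≤-trans 0<1 (Q.≤-trans (Q.≤-reflexive (sym (Q.+-identityʳ 1ℚ))) (Q.+-monoʳ-≤ 1ℚ (Q.0≤∣p∣ q)))

null-scale : ∀ {u v} k -> Null u -> (∀ n -> v n ≡ k Q.* u n) -> Null v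
null-scale {u} {v} k null eq = null-dominated {u} {v} (0<1+∣q∣ k) null (0 , \ n _ -> begin Q.∣ v n ∣ ≡⟨ cong Q.∣_∣ (eq n) ⟩ Q.∣ k Q.* u n ∣ ≡⟨ Q.∣p*q∣≡∣p∣*∣q∣ k (u n) ⟩
 Q.∣ k ∣ Q.* Q.∣ u n ∣ ≤⟨ Q.*-monoʳ-≤-nonNeg Q.∣ u n ∣ {{Q.∣-∣-nonNeg (u n)}} (q<=1+q Q.∣ k ∣) ⟩ (1ℚ Q.+ Q.∣ k ∣) Q.* Q.∣ u n ∣ ∎)
 where
  open Q.≤-Reasoning

∣q∣<=r=>q<=r : ∀ {q r} -> Q.∣ q ∣ Q.≤ r -> q Q.≤ r
∣q∣<=r=>q<=r {q} le' with Q.≤-total 0ℚ q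
... | in1 0≤q = subst (Q._≤ _) (Q.0≤p⇒∣p∣≡p 0≤q) le'
... | in2 q<=0 = Q.≤-trans q<=0 (Q.≤-trans (Q.0≤∣p∣ q) le')

∣q∣<=r=>-r<=q : ∀ {q r} -> Q.∣ q ∣ Q.≤ r -> Q.- r Q.≤ q
∣q∣<=r=>-r<=q {q} {r} le' = subst (Q.- r Q.≤_) (neg-neg q) (Q.neg-antimono-≤ (∣q∣<=r=>q<=r {Q.- q} (subst (Q._≤ r) (sym (Q.∣-p∣≡∣p∣ q)) le')))
 where
 neg-neg : ∀ q -> Q.- (Q.- q) ≡ q
 neg-neg = solve 1 (\ q -> :- (:- q) := q) refl where
  open ℚ-Solver

1<=∣ι∣ : ∀ i -> i ≢ 0ℤ -> 1ℚ Q.≤ Q.∣ ι i ∣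
1<=∣ι∣ (Z.+ zero) i≢0 = contradiction refl i≢0
1<=∣ι∣ (Z.+ (suc n)) _ = Q.≤-trans (ι-≥1 (Z.+≤+ (s≤s (z≤n {n})))) (Q.≤-reflexive (sym (Q.0≤p⇒∣p∣≡p (ι-nonneg (suc n)))))
1<=∣ι∣ -[1+ n ] _ = Q.≤-trans (ι-≥1 (Z.+≤+ (s≤s (z≤n {n})))) (Q.≤-reflexive (tr (sym (Q.0≤p⇒∣p∣≡p (ι-nonneg (suc n)))) (tr (sym (Q.∣-p∣≡∣p∣ (ι (Z.+ suc n)))) (cong Q.∣_∣ (sym (ι-neg (Z.+ suc n)))))))

-- The square root, up to sign, of a discriminant, as the limit of y.
module Root (y : ℕ -> ℚ) (D : ℤ) (cauchy-y : ∀ ε -> 0ℚ Q.< ε -> EventuallyClose y ε) (y²→D : Null (\ n -> y n Q.* y n Q.- ι D)) (y-irrational : ∀ p q -> q ≢ 0ℤ -> ¬ Null (\ n -> ι q Q.* y n Q.- ι p))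
 where
 open Q.≤-Reasoning
 -- From p² = D q² the product (q y - p)(q y + p) tends to 0, while the factors differ by 2 p. If p
 -- ≠ 0, one of them is at least 1 in absolute value at an index `N0` from which q y varies by at
 -- most ½; it stays above ½, so the other tends to 0 and y has a rational limit. Which factor is
 -- large is a decidable comparison of rationals. If p = 0 the two factors coincide.
 module NonSquare (p q : ℤ) (q/=0 : q ≢ 0ℤ) (p²=Dq² : p Z.* p ≡ D Z.* (q Z.* q)) where
  u v : ℕ -> ℚ
  u n = ι q Q.* y n Q.- ι p
  v n = ι q Q.* y n Q.- ι (Z.- p)
  square : ι p Q.* ι p ≡ ι D Q.* (ι q Q.* ι q)
  square = tr (sym (ι-* p p)) (tr (cong ι p²=Dq²) (tr (ι-* D (q Z.* q)) (cong (ι D Q.*_) (ι-* q q))))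
  uv-null : Null (\ n -> u n Q.* v n)
  uv-null = null-scale (ι q Q.* ι q) y²→D \ n -> begin-equality (ι q Q.* y n Q.- ι p) Q.* (ι q Q.* y n Q.- ι (Z.- p)) ≡⟨ cong (\ z -> u n Q.* (ι q Q.* y n Q.- z)) (ι-neg p) ⟩
   (ι q Q.* y n Q.- ι p) Q.* (ι q Q.* y n Q.- (Q.- ι p)) ≡⟨ expand (ι q) (y n) (ι p) ⟩ (ι q Q.* ι q) Q.* (y n Q.* y n) Q.- ι p Q.* ι p ≡⟨ cong (\ z -> (ι q Q.* ι q) Q.* (y n Q.* y n) Q.- z) square ⟩
   (ι q Q.* ι q) Q.* (y n Q.* y n) Q.- ι D Q.* (ι q Q.* ι q) ≡⟨ factor (ι q Q.* ι q) (y n Q.* y n) (ι D) ⟩ (ι q Q.* ι q) Q.* (y n Q.* y n Q.- ι D) ∎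
   where
   open ℚ-Solver
   expand : ∀ q y p -> (q Q.* y Q.- p) Q.* (q Q.* y Q.- (Q.- p)) ≡ (q Q.* q) Q.* (y Q.* y) Q.- p Q.* p
   expand = solve 3 (\ q y p -> (q :* y :- p) :* (q :* y :- (:- p)) := (q :* q) :* (y :* y) :- p :* p) refl
   factor : ∀ q y d -> q Q.* y Q.- d Q.* q ≡ q Q.* (y Q.- d)
   factor = solve 3 (\ q y d -> q :* y :- d :* q := q :* (y :- d)) refl
  away : ∀ (g h : ℕ -> ℚ) -> Null (\ n -> g n Q.* h n) -> ∃[ N ] (∀ n -> N ≤ n -> ½ Q.≤ Q.∣ g n ∣) -> Null h
  away g h null (N , big) = null-dominated {K = 1ℚ Q.+ 1ℚ} (Q.positive⁻¹ (1ℚ Q.+ 1ℚ)) null (N , \ n N≤n -> begin Q.∣ h n ∣ ≡⟨ double Q.∣ h n ∣ ⟩ (1ℚ Q.+ 1ℚ) Q.* (½ Q.* Q.∣ h n ∣)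
    ≤⟨ Q.*-monoˡ-≤-nonNeg (1ℚ Q.+ 1ℚ) (Q.*-monoʳ-≤-nonNeg Q.∣ h n ∣ {{Q.∣-∣-nonNeg (h n)}} (big n N≤n)) ⟩
   (1ℚ Q.+ 1ℚ) Q.* (Q.∣ g n ∣ Q.* Q.∣ h n ∣) ≡⟨ cong ((1ℚ Q.+ 1ℚ) Q.*_) (Q.∣p*q∣≡∣p∣*∣q∣ (g n) (h n)) ⟨ (1ℚ Q.+ 1ℚ) Q.* Q.∣ g n Q.* h n ∣ ∎)
   where
   double : ∀ x -> x ≡ (1ℚ Q.+ 1ℚ) Q.* (½ Q.* x)
   double x = tr (sym (Q.*-identityˡ x)) (Q.*-assoc (1ℚ Q.+ 1ℚ) ½ x)
  δ0 : ∃[ δ ] (0ℚ Q.< δ × (1ℚ Q.+ Q.∣ ι q ∣) Q.* δ ≡ ½)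
  δ0 = divide (1ℚ Q.+ Q.∣ ι q ∣) ½ (0<1+∣q∣ (ι q)) 0<½
  abstract
   close : ∃[ N ] (∀ m n -> N ≤ m -> N ≤ n -> ∀ r -> Q.∣ (ι q Q.* y m Q.- r) Q.- (ι q Q.* y n Q.- r) ∣ Q.≤ ½)
   close = fst near , \ m n N<=m N≤n r -> begin Q.∣ (ι q Q.* y m Q.- r) Q.- (ι q Q.* y n Q.- r) ∣ ≡⟨ cong Q.∣_∣ (cancel (ι q) (y m) (y n) r) ⟩ Q.∣ ι q Q.* (y m Q.- y n) ∣ ≡⟨ Q.∣p*q∣≡∣p∣*∣q∣ (ι q) _ ⟩
    Q.∣ ι q ∣ Q.* Q.∣ y m Q.- y n ∣ ≤⟨ Q.*-monoˡ-≤-nonNeg Q.∣ ι q ∣ {{Q.∣-∣-nonNeg (ι q)}} (snd near m n N<=m N≤n) ⟩ Q.∣ ι q ∣ Q.* δ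
     ≤⟨ Q.*-monoʳ-≤-nonNeg δ {{Q.nonNegative (Q.<⇒≤ (fst (snd δ0)))}} (q<=1+q Q.∣ ι q ∣) ⟩ (1ℚ Q.+ Q.∣ ι q ∣) Q.* δ ≡⟨ snd (snd δ0) ⟩ ½ ∎
    where
    open ℚ-Solver
    δ : ℚ
    δ = fst δ0
    near : EventuallyClose y δ
    near = cauchy-y δ (fst (snd δ0))
    cancel : ∀ q y z r -> (q Q.* y Q.- r) Q.- (q Q.* z Q.- r) ≡ q Q.* (y Q.- z)
    cancel = solve 4 (\ q y z r -> (q :* y :- r) :- (q :* z :- r) := q :* (y :- z)) refl
  N0 : ℕ
  N0 = fst close
  stays : ∀ r -> 1ℚ Q.≤ Q.∣ ι q Q.* y N0 Q.- r ∣ -> ∃[ N ] (∀ n -> N ≤ n -> ½ Q.≤ Q.∣ ι q Q.* y n Q.- r ∣)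
  stays r big = N0 , \ n N≤n -> cancel-½ (begin ½ Q.+ ½ ≤⟨ big ⟩ Q.∣ f N0 ∣ ≡⟨ cong Q.∣_∣ (split (f N0) (f n)) ⟩ Q.∣ (f N0 Q.- f n) Q.+ f n ∣ ≤⟨ Q.∣p+q∣≤∣p∣+∣q∣ (f N0 Q.- f n) (f n) ⟩
   Q.∣ f N0 Q.- f n ∣ Q.+ Q.∣ f n ∣ ≤⟨ Q.+-monoˡ-≤ Q.∣ f n ∣ (snd close N0 n ≤-refl N≤n r) ⟩ ½ Q.+ Q.∣ f n ∣ ∎)
   where
   f : ℕ -> ℚ
   f n = ι q Q.* y n Q.- r
   open ℚ-Solver
   split : ∀ x y -> x ≡ (x Q.- y) Q.+ y
   split = solve 2 (\ x y -> x := (x :- y) :+ y) refl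
   shift : ∀ x -> (Q.- ½) Q.+ (½ Q.+ x) ≡ x
   shift x = tr (sym (Q.+-assoc (Q.- ½) ½ x)) (Q.+-identityˡ x)
   cancel-½ : ∀ {x} -> ½ Q.+ ½ Q.≤ ½ Q.+ x -> ½ Q.≤ x
   cancel-½ {x} le' = subst (½ Q.≤_) (shift x) (Q.+-monoʳ-≤ (Q.- ½) le')
  null-square : ∀ (g : ℕ -> ℚ) -> Null (\ n -> g n Q.* g n) -> Null g
  null-square g null ε 0<ε = fst small , \ n N≤n -> Q.≮⇒≥ \ ε<g -> Q.<-irrefl refl (begin-strict ε Q.* ε <⟨ Q.*-monoʳ-<-pos ε {{Q.positive 0<ε}} ε<g ⟩
   ε Q.* Q.∣ g n ∣ ≤⟨ Q.*-monoʳ-≤-nonNeg Q.∣ g n ∣ {{Q.∣-∣-nonNeg (g n)}} (Q.<⇒≤ ε<g) ⟩ Q.∣ g n ∣ Q.* Q.∣ g n ∣ ≡⟨ Q.∣p*q∣≡∣p∣*∣q∣ (g n) (g n) ⟨ Q.∣ g n Q.* g n ∣ ≤⟨ snd small n N≤n ⟩ ε Q.* ε ∎)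
   where
   small = null (ε Q.* ε) (Q.positive⁻¹ (ε Q.* ε) {{Q.pos*pos⇒pos ε {{Q.positive 0<ε}} ε {{Q.positive 0<ε}}}})
  one-big : p ≢ 0ℤ -> 1ℚ Q.≤ Q.∣ u N0 ∣ ⊎ 1ℚ Q.≤ Q.∣ v N0 ∣
  one-big p≢0 = decide (1ℚ Q.≤? Q.∣ u N0 ∣) (1ℚ Q.≤? Q.∣ v N0 ∣)
   where
   spread : ∀ x z -> Q.- z ≡ ι (Z.- p) -> ι p ≡ z -> ι p Q.+ ι p ≡ (x Q.- ι (Z.- p)) Q.- (x Q.- ι p)
   spread x z eq refl = tr (solve 2 (\ x p -> p :+ p := (x :- (:- p)) :- (x :- p)) refl x (ι p)) (cong (\ w -> (x Q.- w) Q.- (x Q.- ι p)) eq)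
    where
     open ℚ-Solver
   double : ∀ {x} -> 1ℚ Q.≤ Q.∣ x ∣ -> 1ℚ Q.+ 1ℚ Q.≤ Q.∣ x Q.+ x ∣
   double {x} big with Q.≤-total 0ℚ x
   ... | in1 0≤x = begin 1ℚ Q.+ 1ℚ ≤⟨ Q.+-mono-≤ big big ⟩ Q.∣ x ∣ Q.+ Q.∣ x ∣ ≡⟨ cong2 Q._+_ (Q.0≤p⇒∣p∣≡p 0≤x) (Q.0≤p⇒∣p∣≡p 0≤x) ⟩ x Q.+ x ≡⟨ Q.0≤p⇒∣p∣≡p (Q.+-mono-≤ 0≤x 0≤x) ⟨ Q.∣ x Q.+ x ∣ ∎
   ... | in2 x<=0 = begin 1ℚ Q.+ 1ℚ ≤⟨ Q.+-mono-≤ big big ⟩ Q.∣ x ∣ Q.+ Q.∣ x ∣ ≡⟨ cong2 Q._+_ flip flip ⟩ Q.- x Q.+ Q.- x ≡⟨ Q.0≤p⇒∣p∣≡p (Q.+-mono-≤ (Q.neg-antimono-≤ x<=0) (Q.neg-antimono-≤ x<=0)) ⟨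
    Q.∣ Q.- x Q.+ Q.- x ∣ ≡⟨ cong Q.∣_∣ (Q.neg-distrib-+ x x) ⟨ Q.∣ Q.- (x Q.+ x) ∣ ≡⟨ Q.∣-p∣≡∣p∣ (x Q.+ x) ⟩ Q.∣ x Q.+ x ∣ ∎
    where
    flip : Q.∣ x ∣ ≡ Q.- x
    flip = tr (sym (Q.∣-p∣≡∣p∣ x)) (Q.0≤p⇒∣p∣≡p (Q.neg-antimono-≤ x<=0))
   decide : Dec (1ℚ Q.≤ Q.∣ u N0 ∣) -> Dec (1ℚ Q.≤ Q.∣ v N0 ∣) -> 1ℚ Q.≤ Q.∣ u N0 ∣ ⊎ 1ℚ Q.≤ Q.∣ v N0 ∣
   decide (yes big) _ = in1 big
   decide (no _) (yes big) = in2 big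
   decide (no ¬u) (no ¬v) = contradiction (begin-strict 1ℚ Q.+ 1ℚ ≤⟨ double (1<=∣ι∣ p p≢0) ⟩ Q.∣ ι p Q.+ ι p ∣ ≡⟨ cong Q.∣_∣ (spread (ι q Q.* y N0) (ι p) (sym (ι-neg p)) refl) ⟩
    Q.∣ v N0 Q.- u N0 ∣ ≤⟨ Q.∣p-q∣≤∣p∣+∣q∣ (v N0) (u N0) ⟩ Q.∣ v N0 ∣ Q.+ Q.∣ u N0 ∣ <⟨ Q.+-mono-< (Q.≰⇒> ¬v) (Q.≰⇒> ¬u) ⟩ 1ℚ Q.+ 1ℚ ∎) (Q.<-irrefl refl)
  absurd : ⊥
  absurd = go (p Z.≟ 0ℤ)
   where
   uu-null : p ≡ 0ℤ -> Null (\ n -> u n Q.* u n)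
   uu-null p≡0 = subst (\ r -> Null (\ n -> u n Q.* (ι q Q.* y n Q.- ι r))) (tr (cong Z.-_ p≡0) (sym p≡0)) uv-null
   vu-null : Null (\ n -> v n Q.* u n)
   vu-null ε 0<ε = fst (uv-null ε 0<ε) , \ n N≤n -> subst (\ z -> Q.∣ z ∣ Q.≤ ε) (Q.*-comm (u n) (v n)) (snd (uv-null ε 0<ε) n N≤n)
   go : Dec (p ≡ 0ℤ) -> ⊥
   go (yes p≡0) = y-irrational p q q/=0 (null-square u (uu-null p≡0))
   go (no p≢0) = Sum.[ (\ big -> y-irrational (Z.- p) q q/=0 (away u v uv-null (stays (ι p) big))) , (\ big -> y-irrational p q q/=0 (away v u vu-null (stays (ι (Z.- p)) big))) ] (one-big p≢0)
 nonsquare : ∀ p q -> p Z.* p ≡ D Z.* (q Z.* q) -> q ≡ 0ℤ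
 nonsquare p q eq with q Z.≟ 0ℤ
 ... | yes q=0 = q=0
 ... | no q/=0 = ⊥-elim (NonSquare.absurd p q q/=0 eq)

-- The sign of P + Q √D, decided by squaring.
module Sign (D : ℕ) where
 nnR : ℤ -> ℤ -> Bool
 nnR P Q = if nonneg P then (if nonneg Q then true else nonneg (P Z.* P Z.- Z.+ D Z.* (Q Z.* Q))) else (if nonneg Q then nonneg (Z.+ D Z.* (Q Z.* Q) Z.- P Z.* P) else false)

Evtly : (ℕ -> Set) -> Set
Evtly P = ∃[ N ] (∀ n -> N ≤ n -> P n)

both : ∀ {P Q : ℕ -> Set} -> Evtly P -> Evtly Q -> Evtly (\ n -> P n × Q n)
both (M , p) (N , q) = M + N , \ n le' -> p n (m+n≤o⇒m≤o M le') , q n (m+n≤o⇒n≤o M le')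

mapE : ∀ {P Q : ℕ -> Set} -> (∀ n -> P n -> Q n) -> Evtly P -> Evtly Q
mapE f (N , p) = N , \ n le' -> f n (p n le')

-- Positivity of the limit in the sense of `_<ᴿ_`, with an explicit margin.
PosE : (ℕ -> ℚ) -> Set
PosE g = ∃[ ε ] (0ℚ Q.< ε × Evtly (\ n -> ε Q.≤ g n))

module Sqrt (D : ℕ) (θ : ℕ -> ℚ) (1<=θ : Evtly (\ n -> 1ℚ Q.≤ θ n)) (θ²→D : Null (\ n -> θ n Q.* θ n Q.- ι (Z.+ D))) (nonsquare : ∀ p q -> p Z.* p ≡ Z.+ D Z.* (q Z.* q) -> q ≡ 0ℤ)
 where
 open Q.≤-Reasoning
 open Sign D public
 combine : ℤ -> ℤ -> ℕ -> ℚ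
 combine P Q n = ι P Q.+ ι Q Q.* θ n
 K : ℚ
 K = 1ℚ Q.+ ι (Z.+ D)
 θ<=K : Evtly (\ n -> θ n Q.≤ K)
 θ<=K = mapE (\ n (1<= , small) -> begin θ n ≡⟨ Q.*-identityʳ (θ n) ⟨ θ n Q.* 1ℚ ≤⟨ Q.*-monoˡ-≤-nonNeg (θ n) {{Q.nonNegative (Q.≤-trans (Q.<⇒≤ 0<1) 1<=)}} 1<= ⟩
   θ n Q.* θ n ≡⟨ split (θ n Q.* θ n) (ι (Z.+ D)) ⟩ (θ n Q.* θ n Q.- ι (Z.+ D)) Q.+ ι (Z.+ D) ≤⟨ Q.+-monoˡ-≤ (ι (Z.+ D)) (∣q∣<=r=>q<=r small) ⟩ K ∎) (both 1<=θ (θ²→D 1ℚ 0<1))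
  where
  split : ∀ x d -> x ≡ (x Q.- d) Q.+ d
  split = solve 2 (\ x d -> x := (x :- d) :+ d) refl where
    open ℚ-Solver
 product-positive : ∀ (g h : ℕ -> ℚ) k -> Evtly (\ n -> ½ Q.≤ g n Q.* h n) -> Evtly (\ n -> 0ℚ Q.< h n × h n Q.≤ k) -> 0ℚ Q.< k -> PosE g
 product-positive g h k ½<= bounds 0<k = ε , fst (snd quotient) , mapE (\ n (½<=gh , 0<h , h<=k) -> Q.*-cancelʳ-≤-pos (h n) {{Q.positive 0<h}} (begin
   ε Q.* h n ≤⟨ Q.*-monoˡ-≤-nonNeg ε {{Q.nonNegative (Q.<⇒≤ (fst (snd quotient)))}} h<=k ⟩ ε Q.* k ≡⟨ Q.*-comm ε k ⟩ k Q.* ε ≡⟨ snd (snd quotient) ⟩ ½ ≤⟨ ½<=gh ⟩ g n Q.* h n ∎)) (both ½<= bounds)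
  where
  quotient = divide k ½ 0<k 0<½
  ε = fst quotient
 -- P² - Q² θ² tends to the nonzero integer P² - D Q², of sign σ.
 difference-big : ∀ σ P Q -> 1ℤ Z.≤ σ Z.* (P Z.* P Z.- Z.+ D Z.* (Q Z.* Q)) -> Evtly (\ n -> ½ Q.≤ ι σ Q.* (ι P Q.* ι P Q.- (ι Q Q.* ι Q) Q.* (θ n Q.* θ n)))
 difference-big σ P Q big = mapE (\ n small -> begin 1ℚ Q.- ½ ≤⟨ Q.+-mono-≤ (ι-≥1 big) (Q.neg-antimono-≤ (∣q∣<=r=>q<=r small)) ⟩
   ι (σ Z.* (P Z.* P Z.- Z.+ D Z.* (Q Z.* Q))) Q.- (ι σ Q.* (ι Q Q.* ι Q)) Q.* (θ n Q.* θ n Q.- ι (Z.+ D)) ≡⟨ cong (Q._- (ι σ Q.* (ι Q Q.* ι Q)) Q.* (θ n Q.* θ n Q.- ι (Z.+ D))) ι-expand ⟩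
   ι σ Q.* (ι P Q.* ι P Q.- ι (Z.+ D) Q.* (ι Q Q.* ι Q)) Q.- (ι σ Q.* (ι Q Q.* ι Q)) Q.* (θ n Q.* θ n Q.- ι (Z.+ D)) ≡⟨ collect (ι σ) (ι P Q.* ι P) (ι Q Q.* ι Q) (θ n Q.* θ n) (ι (Z.+ D)) ⟩
   ι σ Q.* (ι P Q.* ι P Q.- (ι Q Q.* ι Q) Q.* (θ n Q.* θ n)) ∎) (null-scale (ι σ Q.* (ι Q Q.* ι Q)) θ²→D (\ _ -> refl) ½ 0<½)
  where
  ι-expand : ι (σ Z.* (P Z.* P Z.- Z.+ D Z.* (Q Z.* Q))) ≡ ι σ Q.* (ι P Q.* ι P Q.- ι (Z.+ D) Q.* (ι Q Q.* ι Q))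
  ι-expand = tr (ι-* σ _) (cong (ι σ Q.*_) (tr (ι-+ (P Z.* P) (Z.- (Z.+ D Z.* (Q Z.* Q)))) (cong2 Q._+_ (ι-* P P)
   (tr (ι-neg (Z.+ D Z.* (Q Z.* Q))) (cong Q.-_ (tr (ι-* (Z.+ D) (Q Z.* Q)) (cong (ι (Z.+ D) Q.*_) (ι-* Q Q))))))))
  collect : ∀ s p q t d -> s Q.* (p Q.- d Q.* q) Q.- (s Q.* q) Q.* (t Q.- d) ≡ s Q.* (p Q.- q Q.* t)
  collect = solve 5 (\ s p q t d -> s :* (p :- d :* q) :- (s :* q) :* (t :- d) := s :* (p :- q :* t)) refl
   where
     open ℚ-Solver
 combine-nonneg : ∀ m n -> m + n ≢ 0 -> PosE (combine (Z.+ m) (Z.+ n))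
 combine-nonneg m n m+n/=0 = 1ℚ , 0<1 , mapE (\ k 1<= -> begin 1ℚ ≤⟨ ι-≥1 (Z.+≤+ (n≢0⇒n>0 m+n/=0)) ⟩ ι (Z.+ (m + n)) ≡⟨ tr (cong ι (Z.pos-+ m n)) (ι-+ (Z.+ m) (Z.+ n)) ⟩
  ι (Z.+ m) Q.+ ι (Z.+ n) ≡⟨ cong (ι (Z.+ m) Q.+_) (Q.*-identityʳ (ι (Z.+ n))) ⟨ ι (Z.+ m) Q.+ ι (Z.+ n) Q.* 1ℚ
   ≤⟨ Q.+-monoʳ-≤ (ι (Z.+ m)) (Q.*-monoˡ-≤-nonNeg (ι (Z.+ n)) {{Q.nonNegative (ι-nonneg n)}} 1<=) ⟩ combine (Z.+ m) (Z.+ n) k ∎) 1<=θ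
 combine-bounds : ∀ m n -> m + n ≢ 0 -> Evtly (\ k -> 0ℚ Q.< combine (Z.+ m) (Z.+ n) k × combine (Z.+ m) (Z.+ n) k Q.≤ ι (Z.+ m) Q.+ ι (Z.+ n) Q.* K)
 combine-bounds m n m+n/=0 = mapE {P = \ k -> 1ℚ Q.≤ combine (Z.+ m) (Z.+ n) k × θ k Q.≤ K} (\ k (1<= , <=K) -> Q.<-≤-trans 0<1 1<= ,
   Q.+-monoʳ-≤ (ι (Z.+ m)) (Q.*-monoˡ-≤-nonNeg (ι (Z.+ n)) {{Q.nonNegative (ι-nonneg n)}} <=K)) (both (snd (snd (combine-nonneg m n m+n/=0))) θ<=K)
 0<bound : ∀ m n -> m + n ≢ 0 -> 0ℚ Q.< ι (Z.+ m) Q.+ ι (Z.+ n) Q.* K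
 0<bound m n m+n/=0 = Q.<-≤-trans (fst bounds) (snd bounds)
  where
   bounds = snd (combine-bounds m n m+n/=0) (fst (combine-bounds m n m+n/=0)) ≤-refl
 nonneg=><= : ∀ {i} -> nonneg i ≡ true -> 0ℤ Z.≤ i
 nonneg=><= {Z.+ n} _ = Z.+≤+ z≤n
 1<=-nonsquare : ∀ σ P Q -> σ ≢ 0ℤ -> P ≢ 0ℤ ⊎ Q ≢ 0ℤ -> nonneg (σ Z.* (P Z.* P Z.- Z.+ D Z.* (Q Z.* Q))) ≡ true -> 1ℤ Z.≤ σ Z.* (P Z.* P Z.- Z.+ D Z.* (Q Z.* Q))
 1<=-nonsquare σ P Q σ/=0 PQ/=0 eq = Z.i<j⇒suc[i]≤j (Z.≤∧≢⇒< (nonneg=><= eq) (nonzero PQ/=0 ∘ sym))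
  where
  P²=DQ² : σ Z.* (P Z.* P Z.- Z.+ D Z.* (Q Z.* Q)) ≡ 0ℤ -> P Z.* P ≡ Z.+ D Z.* (Q Z.* Q)
  P²=DQ² e = Z.i-j≡0⇒i≡j (P Z.* P) _ (Sum.[ (\ z -> contradiction z σ/=0) , id ] (Z.i*j≡0⇒i≡0∨j≡0 σ e))
  nonzero : P ≢ 0ℤ ⊎ Q ≢ 0ℤ -> σ Z.* (P Z.* P Z.- Z.+ D Z.* (Q Z.* Q)) ≢ 0ℤ
  nonzero (in2 Q/=0) e = Q/=0 (nonsquare P Q (P²=DQ² e))
  nonzero (in1 P/=0) e = P/=0 (Sum.[ id , id ] (Z.i*j≡0⇒i≡0∨j≡0 P (tr (P²=DQ² e) (tr (cong (\ q -> Z.+ D Z.* (q Z.* q)) (nonsquare P Q (P²=DQ² e))) (Z.*-zeroʳ (Z.+ D))))))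
 module _ where
  private
   open ℚ-Solver
   conjugate1 : ∀ m n z t -> z ≡ Q.- n -> (m Q.+ z Q.* t) Q.* (m Q.+ n Q.* t) ≡ ι 1ℤ Q.* (m Q.* m Q.- (n Q.* n) Q.* (t Q.* t))
   conjugate1 m n _ t refl = tr (solve 3 (\ m n t -> (m :+ (:- n) :* t) :* (m :+ n :* t) :=
    con 1ℚ :* (m :* m :- (n :* n) :* (t :* t))) refl m n t) (cong (Q._* (m Q.* m Q.- (n Q.* n) Q.* (t Q.* t))) (sym ι-1))
   conjugate2 : ∀ m n z t -> z ≡ Q.- m -> (z Q.+ n Q.* t) Q.* (m Q.+ n Q.* t) ≡ ι Z.-1ℤ Q.* (m Q.* m Q.- (n Q.* n) Q.* (t Q.* t))
   conjugate2 m n _ t refl = tr (solve 3 (\ m n t -> ((:- m) :+ n :* t) :* (m :+ n :* t) := (:- con 1ℚ) :* (m :* m :- (n :* n) :* (t :* t))) refl m n t)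
    (cong (Q._* (m Q.* m Q.- (n Q.* n) Q.* (t Q.* t))) (sym (tr (ι-neg 1ℤ) (cong Q.-_ ι-1))))
   one* : ∀ x -> 1ℤ Z.* x ≡ x
   one* = Z.*-identityˡ
   minus-one* : ∀ x y -> Z.-1ℤ Z.* (x Z.- y) ≡ y Z.- x
   minus-one* = ZS.solve 2 (\ x y -> (ZS.con Z.-1ℤ) ZS.:* (x ZS.:- y) ZS.:= y ZS.:- x) refl
    where
     module ZS = Z-Solver
  -- If the signs differ, multiply by the conjugate with both coordinates nonnegative. The product
  -- tends to plus or minus P² - D Q², a nonzero integer because `D` is no square, and so is
  -- eventually at least ½; the conjugate is positive and bounded, which leaves a margin for the
  -- other factor.
  positive : ∀ P Q -> nnR P Q ≡ true -> P ≢ 0ℤ ⊎ Q ≢ 0ℤ -> PosE (combine P Q)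
  positive (Z.+ m) (Z.+ n) eq /=0 = combine-nonneg m n (\ m+n≡0 -> Sum.[ (\ P/=0 -> P/=0 (cong Z.+_ (m+n≡0⇒m≡0 m m+n≡0))) , (\ Q/=0 -> Q/=0 (cong Z.+_ (m+n≡0⇒n≡0 m m+n≡0))) ] /=0)
  positive (Z.+ m) -[1+ n ] eq /=0 = product-positive (combine (Z.+ m) -[1+ n ]) (combine (Z.+ m) (Z.+ suc n)) (ι (Z.+ m) Q.+ ι (Z.+ suc n) Q.* K)
    (mapE (\ k -> subst (½ Q.≤_) (sym (conjugate1 (ι (Z.+ m)) (ι (Z.+ suc n)) (ι -[1+ n ]) (θ k) (ι-neg (Z.+ suc n))))) (difference-big 1ℤ (Z.+ m) (Z.+ suc n)
      (1<=-nonsquare 1ℤ (Z.+ m) (Z.+ suc n) (\ ()) (in2 (\ ())) (tr (cong nonneg (one* (Z.+ m Z.* Z.+ m Z.- Z.+ D Z.* (Z.+ suc n Z.* Z.+ suc n)))) eq))))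
    (combine-bounds m (suc n) m+n/=0) (0<bound m (suc n) m+n/=0)
   where
   m+n/=0 : m + suc n ≢ 0
   m+n/=0 e = contradiction (m+n≡0⇒n≡0 m e) (\ ())
  positive -[1+ m ] (Z.+ n) eq /=0 = product-positive (combine -[1+ m ] (Z.+ n)) (combine (Z.+ suc m) (Z.+ n)) (ι (Z.+ suc m) Q.+ ι (Z.+ n) Q.* K)
    (mapE (\ k -> subst (½ Q.≤_) (sym (conjugate2 (ι (Z.+ suc m)) (ι (Z.+ n)) (ι -[1+ m ]) (θ k) (ι-neg (Z.+ suc m))))) (difference-big Z.-1ℤ (Z.+ suc m) (Z.+ n)
      (1<=-nonsquare Z.-1ℤ (Z.+ suc m) (Z.+ n) (\ ()) (in1 (\ ())) (tr (cong nonneg (minus-one* (Z.+ suc m Z.* Z.+ suc m) (Z.+ D Z.* (Z.+ n Z.* Z.+ n)))) eq))))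
    (combine-bounds (suc m) n (\ ())) (0<bound (suc m) n (\ ()))
 zero? : ∀ P Q -> (P ≡ 0ℤ × Q ≡ 0ℤ) ⊎ (P ≢ 0ℤ ⊎ Q ≢ 0ℤ)
 zero? P Q with P Z.≟ 0ℤ | Q Z.≟ 0ℤ
 ... | yes p | yes q = in1 (p , q)
 ... | no p | _ = in2 (in1 p)
 ... | yes _ | no q = in2 (in2 q)
 combine-+ : ∀ P Q P' Q' n -> combine (P Z.+ P') (Q Z.+ Q') n ≡ combine P Q n Q.+ combine P' Q' n
 combine-+ P Q P' Q' n = tr (cong2 (\ x y -> x Q.+ y Q.* θ n) (ι-+ P P') (ι-+ Q Q')) (solve 5 (\ p p' q q' t -> (p :+ p') :+ (q :+ q') :* t := (p :+ q :* t) :+ (p' :+ q' :* t)) refl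
   (ι P) (ι P') (ι Q) (ι Q') (θ n))
  where
   open ℚ-Solver
 combine-0 : ∀ {P Q} n -> P ≡ 0ℤ -> Q ≡ 0ℤ -> combine P Q n ≡ 0ℚ
 combine-0 n refl refl = tr (cong2 (\ x y -> x Q.+ y Q.* θ n) ι-0 ι-0) (tr (Q.+-identityˡ _) (Q.*-zeroˡ (θ n)))
 eventually-nonneg : ∀ P Q -> nnR P Q ≡ true -> Evtly (\ n -> 0ℚ Q.≤ combine P Q n)
 eventually-nonneg P Q eq with zero? P Q
 ... | in1 (p , q) = 0 , \ n _ -> Q.≤-reflexive (sym (combine-0 n p q))
 ... | in2 /=0 = mapE (\ n ε<= -> Q.≤-trans (Q.<⇒≤ (fst (snd pos'))) ε<=) (snd (snd pos'))
  where
   pos' = positive P Q eq /=0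
 nonneg-neg : ∀ i -> nonneg i ≡ false -> nonneg (Z.- i) ≡ true
 nonneg-neg -[1+ n ] _ = refl
 nnR-total : ∀ P Q -> nnR P Q ≡ false -> nnR (Z.- P) (Z.- Q) ≡ true × (P ≢ 0ℤ ⊎ Q ≢ 0ℤ)
 nnR-total (Z.+ zero) -[1+ n ] eq = refl , in2 (\ ())
 nnR-total (Z.+ (suc m)) -[1+ n ] eq = tr (cong nonneg (flip-sub (Z.+ suc m Z.* Z.+ suc m) (Z.+ D Z.* (Z.+ suc n Z.* Z.+ suc n)))) (nonneg-neg _ eq) , in1 (\ ())
  where
  flip-sub : ∀ x y -> y Z.- x ≡ Z.- (x Z.- y)
  flip-sub = solve 2 (\ x y -> y :- x := :- (x :- y)) refl where
   open Z-Solver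
 nnR-total -[1+ m ] (Z.+ zero) eq = refl , in1 (\ ())
 nnR-total -[1+ m ] (Z.+ (suc n)) eq = tr (cong nonneg (flip-sub (Z.+ D Z.* (Z.+ suc n Z.* Z.+ suc n)) (Z.+ suc m Z.* Z.+ suc m))) (nonneg-neg _ eq) , in1 (\ ())
  where
  flip-sub : ∀ x y -> y Z.- x ≡ Z.- (x Z.- y)
  flip-sub = solve 2 (\ x y -> y :- x := :- (x :- y)) refl where
   open Z-Solver
 nnR-total -[1+ m ] -[1+ n ] eq = refl , in1 (\ ())
 ¬positive-negative : ∀ {g h : ℕ -> ℚ} -> Evtly (\ n -> 0ℚ Q.≤ g n) -> PosE h -> ¬ (∀ n -> g n Q.+ h n ≡ 0ℚ)
 ¬positive-negative {g} {h} (M , 0<=g) (ε , 0<ε , N , ε<=h) eq = Q.<-irrefl refl (begin-strict 0ℚ <⟨ 0<ε ⟩ ε ≡⟨ Q.+-identityˡ ε ⟨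
  0ℚ Q.+ ε ≤⟨ Q.+-mono-≤ (0<=g (M + N) (m≤m+n M N)) (ε<=h (M + N) (m≤n+m N M)) ⟩ g (M + N) Q.+ h (M + N) ≡⟨ eq (M + N) ⟩ 0ℚ ∎)
 nnR-antisym : ∀ P Q -> nnR P Q ≡ true -> nnR (Z.- P) (Z.- Q) ≡ true -> P ≡ 0ℤ × Q ≡ 0ℤ
 nnR-antisym P Q eq eq' with zero? P Q
 ... | in1 z = z
 ... | in2 /=0 = contradiction (\ n -> tr (sym (combine-+ (Z.- P) (Z.- Q) P Q n)) (combine-0 n (Z.+-inverseˡ P) (Z.+-inverseˡ Q)))
  (¬positive-negative (eventually-nonneg (Z.- P) (Z.- Q) eq') (positive P Q eq /=0))
 -- Proved in the limit: if the test failed on the sum, the negated sum would be positive with a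
 -- margin, although both summands are eventually nonnegative.
 nonnegR-+ : ∀ P Q P' Q' -> nnR P Q ≡ true -> nnR P' Q' ≡ true -> nnR (P Z.+ P') (Q Z.+ Q') ≡ true
 nonnegR-+ P Q P' Q' eq eq' with nnR (P Z.+ P') (Q Z.+ Q') in eq''
 ... | true = refl
 ... | false = contradiction (\ n -> tr (cong (Q._+ combine (Z.- (P Z.+ P')) (Z.- (Q Z.+ Q')) n) (sym (combine-+ P Q P' Q' n)))
   (tr (sym (combine-+ (P Z.+ P') (Q Z.+ Q') (Z.- (P Z.+ P')) (Z.- (Q Z.+ Q')) n)) (combine-0 n (Z.+-inverseʳ (P Z.+ P')) (Z.+-inverseʳ (Q Z.+ Q'))))) (¬positive-negative
   (mapE (\ n (p , q) -> Q.+-mono-≤ p q) (both (eventually-nonneg P Q eq) (eventually-nonneg P' Q' eq')))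
   (positive _ _ (fst total) (Sum.map (\ ne e -> ne (neg-zero e)) (\ ne e -> ne (neg-zero e)) (snd total))))
  where
  total = nnR-total (P Z.+ P') (Q Z.+ Q') eq''
  neg-zero : ∀ {i} -> Z.- i ≡ 0ℤ -> i ≡ 0ℤ
  neg-zero {i} e = tr (sym (Z.neg-involutive i)) (cong Z.-_ e)

<=>≱ℚ : ∀ {p q} -> p Q.< q -> ¬ (q Q.≤ p)
<=>≱ℚ p<q q≤p = Q.<-irrefl refl (Q.<-≤-trans p<q q≤p)

-- For a root of a x² + b x + c with a > 0 and discriminant `D`, the number 2 a α + b is √D up to
-- the sign `s`, and `θ` tends to √D. By `scaled`, 2 a (p + q α) lies in ℤ[√D]; as 2 a is positive,
-- signs can be read off there.
record Quadratic (α : ℝ) : Set where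
 field
  D : ℕ
  2<=D : 2 ≤ D
  θ : ℕ -> ℚ
  1<=θ : Evtly (\ n -> 1ℚ Q.≤ θ n)
  θ²→D : Null (\ n -> θ n Q.* θ n Q.- ι (Z.+ D))
  nonsquare : ∀ p q -> p Z.* p ≡ Z.+ D Z.* (q Z.* q) -> q ≡ 0ℤ
  k : ℕ
  b s : ℤ
  s²=1 : s Z.* s ≡ 1ℤ
 scale : ℤ
 scale = Z.+ suc k
 field
  scaled : ∀ p q n -> ι scale Q.* (ι p Q.+ ι q Q.* seq α n) ≡ ι (scale Z.* p Z.- b Z.* q) Q.+ ι (s Z.* q) Q.* θ n

module FromEquation (α : ℝ) (k : ℕ) (b c : ℤ) (root : Null (\ n -> ι (Z.+ suc k) Q.* (seq α n Q.* seq α n) Q.+ ι b Q.* seq α n Q.+ ι c)) (irrational : ∀ q -> ¬ Null (\ n -> seq α n Q.- q))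
 where
 open Q.≤-Reasoning
 x : ℕ -> ℚ
 x = seq α
 a A D : ℤ
 a = Z.+ suc k
 A = a Z.+ a
 D = b Z.* b Z.- (a Z.* c Z.+ a Z.* c Z.+ (a Z.* c Z.+ a Z.* c))
 y : ℕ -> ℚ
 y n = ι A Q.* x n Q.+ ι b
 ι-D : ι D ≡ ι b Q.* ι b Q.- (ι a Q.* ι c Q.+ ι a Q.* ι c Q.+ (ι a Q.* ι c Q.+ ι a Q.* ι c))
 ι-D = tr (ι-+ (b Z.* b) (Z.- 4ac)) (cong2 Q._+_ (ι-* b b) (tr (ι-neg 4ac) (cong Q.-_ (tr (ι-+ 2ac 2ac) (cong2 Q._+_ ι-2ac ι-2ac)))))
  where
  2ac 4ac : ℤ
  2ac = a Z.* c Z.+ a Z.* c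
  4ac = 2ac Z.+ 2ac
  ι-2ac : ι 2ac ≡ ι a Q.* ι c Q.+ ι a Q.* ι c
  ι-2ac = tr (ι-+ (a Z.* c) (a Z.* c)) (cong2 Q._+_ (ι-* a c) (ι-* a c))
 y²→D : Null (\ n -> y n Q.* y n Q.- ι D)
 y²→D = null-scale (ι a Q.+ ι a Q.+ (ι a Q.+ ι a)) root \ n -> tr (cong2 (\ A D -> (A Q.* x n Q.+ ι b) Q.* (A Q.* x n Q.+ ι b) Q.- D) (ι-+ a a) ι-D) (complete (ι a) (ι b) (ι c) (x n))
  where
  complete : ∀ a b c x -> ((a Q.+ a) Q.* x Q.+ b) Q.* ((a Q.+ a) Q.* x Q.+ b) Q.- (b Q.* b Q.- (a Q.* c Q.+ a Q.* c Q.+ (a Q.* c Q.+ a Q.* c))) ≡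
   (a Q.+ a Q.+ (a Q.+ a)) Q.* (a Q.* (x Q.* x) Q.+ b Q.* x Q.+ c)
  complete = solve 4 (\ a b c x -> ((a :+ a) :* x :+ b) :* ((a :+ a) :* x :+ b) :- (b :* b :- (a :* c :+ a :* c :+ (a :* c :+ a :* c))) := (a :+ a :+ (a :+ a)) :* (a :* (x :* x) :+ b :* x :+ c)) refl
   where
    open ℚ-Solver
 cauchy-y : ∀ ε -> 0ℚ Q.< ε -> EventuallyClose y ε
 cauchy-y ε 0<ε = fst near , \ m n p q -> begin Q.∣ y m Q.- y n ∣ ≡⟨ cong Q.∣_∣ (cancel (ι A) (x m) (x n) (ι b)) ⟩ Q.∣ ι A Q.* (x m Q.- x n) ∣ ≡⟨ Q.∣p*q∣≡∣p∣*∣q∣ (ι A) _ ⟩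
   Q.∣ ι A ∣ Q.* Q.∣ x m Q.- x n ∣ ≤⟨ Q.*-monoˡ-≤-nonNeg Q.∣ ι A ∣ {{Q.∣-∣-nonNeg (ι A)}} (snd near m n p q) ⟩ Q.∣ ι A ∣ Q.* δ
    ≤⟨ Q.*-monoʳ-≤-nonNeg δ {{Q.nonNegative (Q.<⇒≤ (fst (snd quotient)))}} (q<=1+q Q.∣ ι A ∣) ⟩ (1ℚ Q.+ Q.∣ ι A ∣) Q.* δ ≡⟨ snd (snd quotient) ⟩ ε ∎
  where
  quotient = divide (1ℚ Q.+ Q.∣ ι A ∣) ε (0<1+∣q∣ (ι A)) 0<ε
  δ = fst quotient
  near : EventuallyClose x δ
  near = cauchy α δ (fst (snd quotient))
  cancel : ∀ a x z r -> (a Q.* x Q.+ r) Q.- (a Q.* z Q.+ r) ≡ a Q.* (x Q.- z)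
  cancel = solve 4 (\ a x z r -> (a :* x :+ r) :- (a :* z :+ r) := a :* (x :- z)) refl
   where
     open ℚ-Solver
 y-irrational : ∀ p q -> q ≢ 0ℤ -> ¬ Null (\ n -> ι q Q.* y n Q.- ι p)
 y-irrational p q q/=0 null = irrational r (null-scale κ null identity)
  where
  qA/=0 : q Z.* A ≢ 0ℤ
  qA/=0 e = Sum.[ q/=0 , (\ ()) ] (Z.i*j≡0⇒i≡0∨j≡0 q e)
  instance
   nz : Q.NonZero (ι (q Z.* A))
   nz = Q.≢-nonZero (\ e -> <=>≱ℚ 0<1 (subst (\ z -> 1ℚ Q.≤ Q.∣ z ∣) e (1<=∣ι∣ (q Z.* A) qA/=0)))
  κ r : ℚ
  κ = Q.1/ ι (q Z.* A)
  r = κ Q.* (ι p Q.- ι q Q.* ι b)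
  identity : ∀ n -> x n Q.- r ≡ κ Q.* (ι q Q.* y n Q.- ι p)
  identity n = begin-equality x n Q.- r ≡⟨ cong (Q._- r) (sym (tr (sym (Q.*-assoc κ (ι (q Z.* A)) (x n))) (tr (cong (Q._* x n) (Q.*-inverseˡ (ι (q Z.* A)))) (Q.*-identityˡ (x n))))) ⟩
   κ Q.* (ι (q Z.* A) Q.* x n) Q.- r ≡⟨ cong (\ z -> κ Q.* (z Q.* x n) Q.- r) (ι-* q A) ⟩ κ Q.* (ι q Q.* ι A Q.* x n) Q.- r ≡⟨ rearrange κ (ι q) (ι A) (x n) (ι p) (ι b) ⟩ κ Q.* (ι q Q.* y n Q.- ι p) ∎
   where
   rearrange : ∀ κ q A x p b -> κ Q.* (q Q.* A Q.* x) Q.- κ Q.* (p Q.- q Q.* b) ≡ κ Q.* (q Q.* (A Q.* x Q.+ b) Q.- p)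
   rearrange = solve 6 (\ κ q A x p b -> κ :* (q :* A :* x) :- κ :* (p :- q :* b) := κ :* (q :* (A :* x :+ b) :- p)) refl
    where
     open ℚ-Solver
 open Root y D cauchy-y y²→D y-irrational
 -- The values 0 and 1 are squares, and a negative value contradicts y² → `D`.
 D≥2 : ∃[ d ] (D ≡ Z.+ d × 2 ≤ d)
 D≥2 = go D refl
  where
  one-square : D ≡ 1ℤ -> ⊥
  one-square e = contradiction (nonsquare 1ℤ 1ℤ (sym (cong (Z._* 1ℤ) e))) (\ ())
  negative : ∀ m -> D ≢ -[1+ m ]
  negative m e = <=>≱ℚ (Q.*<* (Z.+<+ (s≤s (s≤s z≤n)))) (begin 1ℚ ≤⟨ ι-≥1 (Z.+≤+ (s≤s (z≤n {m}))) ⟩ ι (Z.+ suc m) ≡⟨ tr (cong (\ d -> ι (Z.- d)) (sym e)) (ι-neg D) ⟩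
   Q.- ι D ≡⟨ Q.+-identityˡ (Q.- ι D) ⟨ 0ℚ Q.- ι D ≤⟨ Q.+-monoˡ-≤ (Q.- ι D) (square-nonneg (y N)) ⟩ y N Q.* y N Q.- ι D ≤⟨ ∣q∣<=r=>q<=r (snd (y²→D ½ 0<½) N ≤-refl) ⟩ ½ ∎)
   where
   N = fst (y²→D ½ 0<½)
   square-nonneg : ∀ t -> 0ℚ Q.≤ t Q.* t
   square-nonneg t with Q.≤-total 0ℚ t
   ... | in1 0<=t = Q.≤-trans (Q.≤-reflexive (sym (Q.*-zeroʳ t))) (Q.*-monoˡ-≤-nonNeg t {{Q.nonNegative 0<=t}} 0<=t)
   ... | in2 t<=0 = Q.≤-trans (Q.≤-reflexive (sym (Q.*-zeroʳ t))) (Q.*-monoˡ-≤-nonPos t {{Q.nonPositive t<=0}} t<=0)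
  go : ∀ z -> D ≡ z -> ∃[ d ] (z ≡ Z.+ d × 2 ≤ d)
  go (Z.+ 0) e = contradiction (nonsquare 0ℤ 1ℤ (sym (cong (Z._* 1ℤ) e))) (\ ())
  go (Z.+ 1) e = ⊥-elim (one-square e)
  go (Z.+ (suc (suc d))) e = _ , refl , s≤s (s≤s z≤n)
  go -[1+ m ] e = contradiction e (negative m)
 d : ℕ
 d = fst D≥2
 D=d : D ≡ Z.+ d
 D=d = fst (snd D≥2)
 1<=y² : Evtly (\ n -> 1ℚ Q.≤ y n Q.* y n)
 1<=y² = mapE (\ n small -> begin 1ℚ ≡⟨ Q.+-assoc (Q.- 1ℚ) 1ℚ 1ℚ ⟩ (Q.- 1ℚ) Q.+ (1ℚ Q.+ 1ℚ) ≤⟨ Q.+-mono-≤ (∣q∣<=r=>-r<=q small) 2<=ιD ⟩ (y n Q.* y n Q.- ι D) Q.+ ι D ≡⟨ split (y n Q.* y n) (ι D) ⟩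
   y n Q.* y n ∎) (y²→D 1ℚ 0<1)
  where
  2<=ιD : 1ℚ Q.+ 1ℚ Q.≤ ι D
  2<=ιD = Q.≤-trans (Q.≤-reflexive (tr (cong2 Q._+_ (sym ι-1) (sym ι-1)) (sym (ι-+ 1ℤ 1ℤ)))) (ι-mono (subst (Z.+ 2 Z.≤_) (sym D=d) (Z.+≤+ (snd (snd D≥2)))))
  split : ∀ x d -> (x Q.- d) Q.+ d ≡ x
  split = solve 2 (\ x d -> (x :- d) :+ d := x) refl where
    open ℚ-Solver
 ≥-½=>≥1 : ∀ t -> 1ℚ Q.≤ t Q.* t -> Q.- ½ Q.≤ t -> 1ℚ Q.≤ t
 ≥-½=>≥1 t 1<=t² -½<=t = Q.≮⇒≥ \ t<1 -> Sum.[ case₁ t<1 , case₂ ] (Q.≤-total 0ℚ t)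
  where
  case₁ : t Q.< 1ℚ -> 0ℚ Q.≤ t -> ⊥
  case₁ t<1 0<=t = <=>≱ℚ t<1 (begin 1ℚ ≤⟨ 1<=t² ⟩ t Q.* t ≤⟨ Q.*-monoˡ-≤-nonNeg t {{Q.nonNegative 0<=t}} (Q.<⇒≤ t<1) ⟩ t Q.* 1ℚ ≡⟨ Q.*-identityʳ t ⟩ t ∎)
  case₂ : t Q.≤ 0ℚ -> ⊥
  case₂ t<=0 = <=>≱ℚ (Q.*<* (Z.+<+ (s≤s (s≤s z≤n)))) (begin 1ℚ ≤⟨ 1<=t² ⟩ t Q.* t ≤⟨ Q.*-monoˡ-≤-nonPos t {{Q.nonPositive t<=0}} -½<=t ⟩
   t Q.* (Q.- ½) ≤⟨ Q.*-monoʳ-≤-nonPos (Q.- ½) {{Q.nonPositive (Q.<⇒≤ (Q.negative⁻¹ (Q.- ½)))}} -½<=t ⟩ (Q.- ½) Q.* (Q.- ½) ≤⟨ Q.≤ᵇ⇒≤ tt ⟩ ½ ∎)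
 -- With squares at least 1 and variation at most ½ the sequence cannot change its sign after `N`.
 signed : ∀ (g : ℕ -> ℚ) N -> (∀ n -> N ≤ n -> 1ℚ Q.≤ g n Q.* g n) -> (∀ n -> N ≤ n -> Q.∣ g N Q.- g n ∣ Q.≤ ½) -> 0ℚ Q.≤ g N -> Evtly (\ n -> 1ℚ Q.≤ g n)
 signed g N big near 0<=gN = N , \ n N≤n -> ≥-½=>≥1 (g n) (big n N≤n) (begin Q.- ½ ≡⟨ Q.+-identityˡ (Q.- ½) ⟨ 0ℚ Q.+ (Q.- ½) ≤⟨ Q.+-mono-≤ 0<=gN (Q.neg-antimono-≤ (∣q∣<=r=>q<=r (near n N≤n))) ⟩
   g N Q.- (g N Q.- g n) ≡⟨ cancel (g N) (g n) ⟩ g n ∎)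
  where
  cancel : ∀ x y -> x Q.- (x Q.- y) ≡ y
  cancel = solve 2 (\ x y -> x :- (x :- y) := y) refl where
    open ℚ-Solver
 N1 N2 N : ℕ
 N1 = fst 1<=y²
 N2 = fst (cauchy-y ½ 0<½)
 N = N1 + N2
 big : ∀ n -> N ≤ n -> 1ℚ Q.≤ y n Q.* y n
 big n N≤n = snd 1<=y² n (m+n≤o⇒m≤o N1 N≤n)
 near : ∀ n -> N ≤ n -> Q.∣ y N Q.- y n ∣ Q.≤ ½
 near n N≤n = snd (cauchy-y ½ 0<½) N n (m≤n+m N2 N1) (m+n≤o⇒n≤o N1 N≤n)
 neg-square : ∀ t -> (Q.- t) Q.* (Q.- t) ≡ t Q.* t
 neg-square = solve 1 (\ t -> (:- t) :* (:- t) := t :* t) refl where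
  open ℚ-Solver
 build : (s : ℤ) -> s Z.* s ≡ 1ℤ -> (θ : ℕ -> ℚ) -> Evtly (\ n -> 1ℚ Q.≤ θ n) -> (∀ n -> θ n Q.* θ n ≡ y n Q.* y n) -> (∀ n -> ι s Q.* θ n ≡ y n) -> Quadratic α
 build s s²=1 θ 1<=θ θ² sθ = record { D = d ; 2<=D = snd (snd D≥2) ; θ = θ ; 1<=θ = 1<=θ ; θ²→D = \ ε 0<ε -> let M , small = y²→D ε 0<ε in M , \ n p ->
   subst2 (\ t d -> Q.∣ t Q.- ι d ∣ Q.≤ ε) (sym (θ² n)) D=d (small n p) ; nonsquare = \ p q e -> nonsquare p q (tr e (cong (Z._* (q Z.* q)) (sym D=d))) ; k = k + suc k ; b = b ; s = s ; s²=1 = s²=1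
  ; scaled = \ p q n -> begin-equality ι A Q.* (ι p Q.+ ι q Q.* x n) ≡⟨ rearrange (ι A) (ι p) (ι q) (x n) (ι b) ⟩ (ι A Q.* ι p Q.- ι b Q.* ι q) Q.+ ι q Q.* y n
    ≡⟨ cong2 (\ u v -> u Q.+ ι q Q.* v) (sym (tr (ι-+ (A Z.* p) _) (cong2 Q._+_ (ι-* A p) (tr (ι-neg (b Z.* q)) (cong Q.-_ (ι-* b q)))))) (sym (sθ n)) ⟩
   ι (A Z.* p Z.- b Z.* q) Q.+ ι q Q.* (ι s Q.* θ n) ≡⟨ cong (ι (A Z.* p Z.- b Z.* q) Q.+_) (tr (sym (Q.*-assoc (ι q) (ι s) (θ n))) (cong (Q._* θ n) (tr (Q.*-comm (ι q) (ι s)) (sym (ι-* s q))))) ⟩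
   ι (A Z.* p Z.- b Z.* q) Q.+ ι (s Z.* q) Q.* θ n ∎ }
  where
  rearrange : ∀ A p q x b -> A Q.* (p Q.+ q Q.* x) ≡ (A Q.* p Q.- b Q.* q) Q.+ q Q.* (A Q.* x Q.+ b)
  rearrange = solve 5 (\ A p q x b -> A :* (p :+ q :* x) := (A :* p :- b :* q) :+ q :* (A :* x :+ b)) refl
   where
    open ℚ-Solver
 neg-sub : ∀ x y -> Q.- (x Q.- y) ≡ (Q.- x) Q.- (Q.- y)
 neg-sub = solve 2 (\ x y -> :- (x :- y) := (:- x) :- (:- y)) refl where
  open ℚ-Solver
 neg-one : ∀ x -> (Q.- 1ℚ) Q.* (Q.- x) ≡ x
 neg-one = solve 1 (\ x -> (:- con 1ℚ) :* (:- x) := x) refl where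
  open ℚ-Solver
 nonneg-case : 0ℚ Q.≤ y N -> Quadratic α
 nonneg-case 0<= = build 1ℤ refl y (signed y N big near 0<=) (\ _ -> refl) (\ n -> tr (cong (Q._* y n) ι-1) (Q.*-identityˡ (y n)))
 nonpos-case : y N Q.≤ 0ℚ -> Quadratic α
 nonpos-case <=0 = build Z.-1ℤ refl (\ n -> Q.- y n) (signed (\ n -> Q.- y n) N (\ n p -> subst (1ℚ Q.≤_) (sym (neg-square (y n))) (big n p))
   (\ n p -> subst (Q._≤ ½) (tr (sym (Q.∣-p∣≡∣p∣ (y N Q.- y n))) (cong Q.∣_∣ (neg-sub (y N) (y n)))) (near n p)) (Q.neg-antimono-≤ <=0)) (\ n -> neg-square (y n))
  (\ n -> tr (cong (Q._* (Q.- y n)) (tr (ι-neg 1ℤ) (cong Q.-_ ι-1))) (neg-one (y n)))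
 result : Quadratic α
 result = Sum.[ nonneg-case , nonpos-case ] (Q.≤-total 0ℚ (y N))

quadratic : ∀ {α} -> QuadraticIrrational α -> Quadratic α
quadratic {α} record { a = a ; b = b ; c = c ; a≢0 = a≢0 ; root = root ; irrational = irr } = go a a≢0 (\ ε 0<ε -> fst (root ε 0<ε) , \ n p ->
  subst (\ z -> Q.∣ z ∣ Q.≤ ε) (value-at n) (snd (root ε 0<ε) n p))
 where
 x = seq α
 minus-zero : ∀ u -> u Q.- (0ℤ Q./ 1) ≡ u
 minus-zero u = Q.+-identityʳ u
 poly : (a b c t : ℚ) -> ℚ
 poly a b c t = a Q.* (t Q.* t) Q.+ b Q.* t Q.+ c
 value-at : ∀ n -> poly (a Q./ 1) (b Q./ 1) (c Q./ 1) (x n) Q.- (0ℤ Q./ 1) ≡ poly (ι a) (ι b) (ι c) (x n)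
 value-at n = tr (minus-zero (poly (a Q./ 1) (b Q./ 1) (c Q./ 1) (x n))) (tr (cong (\ z -> poly z (b Q./ 1) (c Q./ 1) (x n)) (sym (ι-def a)))
   (tr (cong (\ z -> poly (ι a) z (c Q./ 1) (x n)) (sym (ι-def b))) (cong (\ z -> poly (ι a) (ι b) z (x n)) (sym (ι-def c)))))
 go : ∀ a -> a ≢ 0ℤ -> Null (\ n -> ι a Q.* (x n Q.* x n) Q.+ ι b Q.* x n Q.+ ι c) -> Quadratic α
 go (Z.+ zero) a≢0 root = contradiction refl a≢0
 go (Z.+ (suc k)) a≢0 root = FromEquation.result α k b c root irr
 go -[1+ k ] a≢0 root = FromEquation.result α k (Z.- b) (Z.- c) (null-scale (Q.- 1ℚ) root \ n -> tr (cong2 (\ u v -> ι (Z.+ suc k) Q.* (x n Q.* x n) Q.+ u Q.* x n Q.+ v) (ι-neg b) (ι-neg c))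
    (tr (negate (ι (Z.+ suc k)) (ι b) (ι c) (x n)) (cong (\ a -> (Q.- 1ℚ) Q.* (a Q.* (x n Q.* x n) Q.+ ι b Q.* x n Q.+ ι c)) (sym (ι-neg (Z.+ suc k)))))) irr
  where
  negate : ∀ a b c x -> a Q.* (x Q.* x) Q.+ (Q.- b) Q.* x Q.+ (Q.- c) ≡ (Q.- 1ℚ) Q.* ((Q.- a) Q.* (x Q.* x) Q.+ b Q.* x Q.+ c)
  negate = solve 4 (\ a b c x -> a :* (x :* x) :+ (:- b) :* x :+ (:- c) := (:- con 1ℚ) :* ((:- a) :* (x :* x) :+ b :* x :+ c)) refl
   where
    open ℚ-Solver

-- The Pell equation.  The forms A x² + 2 h x y - C y² of determinant
-- h² + A C = D with A, C > 0 are finitely many, and the norm form x² - D y² is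
-- reduced within this set by additive steps of the continued fraction
-- algorithm.  A form that occurs twice yields a solution.
module Pell (D : ℕ) (nonsquare : ∀ p q -> p Z.* p ≡ Z.+ D Z.* (q Z.* q) -> q ≡ 0ℤ) where
 open Z-Solver
 -- The elements u1 + u2 √D and v1 + v2 √D are a basis of ℤ[√D] of determinant 1, and A, 2 h, - C
 -- are the coefficients of the norm form in this basis. Keeping the basis makes it possible to read
 -- a unit off two equal forms.
 record Form : Set where
  field
   A C : ℕ
   h : ℤ
   u1 u2 v1 v2 : ℕ
   A/=0 : NonZero A
   C/=0 : NonZero C
   determinant : h Z.* h Z.+ Z.+ A Z.* Z.+ C ≡ Z.+ D
   norm-u : Z.+ u1 Z.* Z.+ u1 Z.- Z.+ D Z.* (Z.+ u2 Z.* Z.+ u2) ≡ Z.+ A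
   norm-v : Z.+ v1 Z.* Z.+ v1 Z.- Z.+ D Z.* (Z.+ v2 Z.* Z.+ v2) ≡ Z.- Z.+ C
   product : Z.+ u1 Z.* Z.+ v1 Z.- Z.+ D Z.* (Z.+ u2 Z.* Z.+ v2) ≡ h
   unimodular : Z.+ u1 Z.* Z.+ v2 Z.- Z.+ u2 Z.* Z.+ v1 ≡ 1ℤ
 mass : Form -> ℕ
 mass F = (u1 + u2) + (v1 + v2) where
  open Form F
 interchange : ∀ a b c d -> (a + b) + (c + d) ≡ (a + c) + (b + d)
 interchange a b c d = tr (+-assoc a b (c + d)) (tr (cong (a +_) (tr (sym (+-assoc b c d)) (tr (cong (_+ d) (+-comm b c)) (+-assoc c b d)))) (sym (+-assoc a c (b + d))))
 -- The sum of the basis vectors has norm A + 2 h - C. It replaces the first vector if this is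
 -- positive and the second if it is negative. It is not zero, since otherwise (h + A)² = h² + A C =
 -- D. The coordinates are nonnegative, so the mass grows strictly.
 next-form : ∀ F -> ∃[ G ] (mass F < mass G)
 next-form F = go (Z.+ A Z.+ (h Z.+ h) Z.- Z.+ C) refl
  where
  open Form F
  1<=u : 1 ≤ u1 + u2
  1<=u = n≢0⇒n>0 \ e -> case tr (sym unimodular) (cong2 (\ x y -> Z.+ x Z.* Z.+ v2 Z.- Z.+ y Z.* Z.+ v1) (m+n≡0⇒m≡0 u1 e) (m+n≡0⇒n≡0 u1 e)) of \ ()
  1<=v : 1 ≤ v1 + v2
  1<=v = n≢0⇒n>0 \ e -> case tr (sym unimodular) (tr (cong2 (\ x y -> Z.+ u1 Z.* Z.+ x Z.- Z.+ u2 Z.* Z.+ y)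
   (m+n≡0⇒n≡0 v1 e) (m+n≡0⇒m≡0 v1 e)) (cong2 Z._-_ (Z.*-zeroʳ (Z.+ u1)) (Z.*-zeroʳ (Z.+ u2)))) of \ ()
  norm-sum : Z.+ (u1 + v1) Z.* Z.+ (u1 + v1) Z.- Z.+ D Z.* (Z.+ (u2 + v2) Z.* Z.+ (u2 + v2)) ≡ Z.+ A Z.+ (h Z.+ h) Z.- Z.+ C
  norm-sum = tr (cong2 (\ x y -> x Z.* x Z.- Z.+ D Z.* (y Z.* y)) (Z.pos-+ u1 v1) (Z.pos-+ u2 v2)) (tr (solve 5 (\ d a b x y -> (a :+ x) :* (a :+ x) :- d :* ((b :+ y) :* (b :+ y)) :=
     (a :* a :- d :* (b :* b)) :+ ((a :* x :- d :* (b :* y)) :+ (a :* x :- d :* (b :* y))) :+ (x :* x :- d :* (y :* y))) refl (Z.+ D) (Z.+ u1) (Z.+ u2) (Z.+ v1) (Z.+ v2))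
    (cong2 Z._+_ (cong2 Z._+_ norm-u (cong2 Z._+_ product product)) norm-v))
  go : ∀ z -> Z.+ A Z.+ (h Z.+ h) Z.- Z.+ C ≡ z -> ∃[ G ] (mass F < mass G)
  go (Z.+ zero) e = ⊥-elim (ℕ.≢-nonZero⁻¹ A {{A/=0}} (Z.+-injective (nonsquare-root _ refl)))
   where
   square : (h Z.+ Z.+ A) Z.* (h Z.+ Z.+ A) ≡ Z.+ D Z.* (1ℤ Z.* 1ℤ)
   square = tr (solve 3 (\ h a c -> (h :+ a) :* (h :+ a) := (h :* h :+ a :* c) :+ a :* (a :+ (h :+ h) :- c)) refl h (Z.+ A) (Z.+ C))
    (tr (cong2 Z._+_ determinant (tr (cong (Z.+ A Z.*_) e) (Z.*-zeroʳ (Z.+ A)))) (tr (Z.+-identityʳ (Z.+ D)) (sym (Z.*-identityʳ (Z.+ D)))))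
   nonsquare-root : ∀ z -> z ≡ 1ℤ -> Z.+ A ≡ 0ℤ
   nonsquare-root z _ = contradiction (nonsquare (h Z.+ Z.+ A) 1ℤ square) (\ ())
  go (Z.+ (suc t)) e = record { A = suc t ; C = C ; h = h Z.- Z.+ C ; u1 = u1 + v1 ; u2 = u2 + v2 ; v1 = v1 ; v2 = v2 ; A/=0 = _ ; C/=0 = C/=0
   ; determinant = tr (cong (\ a -> (h Z.- Z.+ C) Z.* (h Z.- Z.+ C) Z.+ a Z.* Z.+ C) (sym e))
    (tr (solve 3 (\ h a c -> (h :- c) :* (h :- c) :+ (a :+ (h :+ h) :- c) :* c := h :* h :+ a :* c) refl h (Z.+ A) (Z.+ C)) determinant) ; norm-u = tr norm-sum e ; norm-v = norm-v
   ; product = tr (cong2 (\ x y -> x Z.* Z.+ v1 Z.- Z.+ D Z.* (y Z.* Z.+ v2)) (Z.pos-+ u1 v1) (Z.pos-+ u2 v2)) (tr (solve 5 (\ d a b x y -> (a :+ x) :* x :- d :* ((b :+ y) :* y) :=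
      (a :* x :- d :* (b :* y)) :+ (x :* x :- d :* (y :* y))) refl (Z.+ D) (Z.+ u1) (Z.+ u2) (Z.+ v1) (Z.+ v2)) (cong2 Z._+_ product norm-v))
   ; unimodular = tr (cong2 (\ x y -> x Z.* Z.+ v2 Z.- y Z.* Z.+ v1) (Z.pos-+ u1 v1) (Z.pos-+ u2 v2))
    (tr (solve 4 (\ a b x y -> (a :+ x) :* y :- (b :+ y) :* x := a :* y :- b :* x) refl (Z.+ u1) (Z.+ u2) (Z.+ v1) (Z.+ v2)) unimodular)
   } , +-monoˡ-< (v1 + v2) (≤-trans (≡⇒≤ (sym (+-comm (u1 + u2) 1))) (≤-trans (+-monoʳ-≤ (u1 + u2) 1<=v) (≡⇒≤ (interchange u1 u2 v1 v2))))
  go -[1+ t ] e = record { A = A ; C = suc t ; h = h Z.+ Z.+ A ; u1 = u1 ; u2 = u2 ; v1 = u1 + v1 ; v2 = u2 + v2 ; A/=0 = A/=0 ; C/=0 = _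
   ; determinant = tr (cong (\ c -> (h Z.+ Z.+ A) Z.* (h Z.+ Z.+ A) Z.+ Z.+ A Z.* c) (cong Z.-_ (sym e)))
    (tr (solve 3 (\ h a c -> (h :+ a) :* (h :+ a) :+ a :* (:- (a :+ (h :+ h) :- c)) := h :* h :+ a :* c) refl h (Z.+ A) (Z.+ C)) determinant) ; norm-u = norm-u ; norm-v = tr norm-sum e
   ; product = tr (cong2 (\ x y -> Z.+ u1 Z.* x Z.- Z.+ D Z.* (Z.+ u2 Z.* y)) (Z.pos-+ u1 v1) (Z.pos-+ u2 v2)) (tr (solve 5 (\ d a b x y -> a :* (a :+ x) :- d :* (b :* (b :+ y)) :=
      (a :* x :- d :* (b :* y)) :+ (a :* a :- d :* (b :* b))) refl (Z.+ D) (Z.+ u1) (Z.+ u2) (Z.+ v1) (Z.+ v2)) (cong2 Z._+_ product norm-u))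
   ; unimodular = tr (cong2 (\ x y -> Z.+ u1 Z.* y Z.- Z.+ u2 Z.* x) (Z.pos-+ u1 v1) (Z.pos-+ u2 v2))
    (tr (solve 4 (\ a b x y -> a :* (b :+ y) :- b :* (a :+ x) := a :* y :- b :* x) refl (Z.+ u1) (Z.+ u2) (Z.+ v1) (Z.+ v2)) unimodular)
   } , +-monoʳ-< (u1 + u2) (≤-trans (+-monoˡ-≤ (v1 + v2) 1<=u) (≡⇒≤ (interchange u1 u2 v1 v2)))
 forms : ℕ -> Form
 forms zero = record { A = 1 ; C = D ; h = 0ℤ ; u1 = 1 ; u2 = 0 ; v1 = 0 ; v2 = 1 ; A/=0 = _
  ; C/=0 = ℕ.≢-nonZero (\ D=0 -> contradiction (nonsquare 0ℤ 1ℤ (sym (cong (\ d -> Z.+ d Z.* 1ℤ) D=0))) (\ ())) ; determinant = tr (Z.+-identityˡ _) (Z.*-identityˡ (Z.+ D))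
  ; norm-u = tr (cong (\ z -> 1ℤ Z.- z) (Z.*-zeroʳ (Z.+ D))) refl ; norm-v = tr (Z.+-identityˡ _) (cong Z.-_ (Z.*-identityʳ (Z.+ D))) ; product = tr (Z.+-identityˡ _) (cong Z.-_ (Z.*-zeroʳ (Z.+ D)))
  ; unimodular = refl }
 forms (suc n) = fst (next-form (forms n))
 mass-mono : ∀ {m n} -> m < n -> mass (forms m) < mass (forms n)
 mass-mono {m} {suc n} (s≤s m≤n) with m≤n⇒m<n∨m≡n m≤n
 ... | in1 m<n = <-trans (mass-mono m<n) (snd (next-form (forms n)))
 ... | in2 refl = snd (next-form (forms m))
 module Bounds (F : Form) where
  open Form F
  square-<= : Z.∣ h ∣ * Z.∣ h ∣ + A * C ≡ D
  square-<= = Z.+-injective (tr (Z.pos-+ (Z.∣ h ∣ * Z.∣ h ∣) (A * C)) (tr (cong2 Z._+_ (tr (Z.pos-* Z.∣ h ∣ Z.∣ h ∣) (abs-square h)) (Z.pos-* A C)) determinant))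
   where
   abs-square : ∀ i -> Z.+ Z.∣ i ∣ Z.* Z.+ Z.∣ i ∣ ≡ i Z.* i
   abs-square (Z.+ n) = refl
   abs-square -[1+ n ] = refl
  A<=D : A ≤ D
  A<=D = ≤-trans (m≤m*n A C {{C/=0}}) (subst (A * C ≤_) square-<= (m≤n+m _ _))
  C<=D : C ≤ D
  C<=D = ≤-trans (m≤n*m C A {{A/=0}}) (subst (A * C ≤_) square-<= (m≤n+m _ _))
  h<=D : Z.∣ h ∣ ≤ D
  h<=D = ≤-trans (n<=n*n Z.∣ h ∣) (subst (Z.∣ h ∣ * Z.∣ h ∣ ≤_) square-<= (m≤m+n _ _))
   where
   n<=n*n : ∀ n -> n ≤ n * n
   n<=n*n zero = z≤n
   n<=n*n (suc n) = m≤m*n (suc n) (suc n)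
 signBit : ℤ -> Fin 2
 signBit (Z.+ _) = zero
 signBit -[1+ _ ] = suc zero
 signBit-injective : ∀ {i j} -> signBit i ≡ signBit j -> Z.∣ i ∣ ≡ Z.∣ j ∣ -> i ≡ j
 signBit-injective {Z.+ m} {Z.+ n} _ e = cong Z.+_ e
 signBit-injective { -[1+ m ]} { -[1+ n ]} _ e = cong -[1+_] (suc-injective e)
 shape : Form -> Fin (suc D * (suc D * (2 * suc D)))
 shape F = Fin.combine (Fin.fromℕ< (s≤s A<=D)) (Fin.combine (Fin.fromℕ< (s≤s C<=D)) (Fin.combine (signBit h) (Fin.fromℕ< (s≤s h<=D))))
  where
  open Form F
  open Bounds F
 shape-injective : ∀ F G -> shape F ≡ shape G -> Form.A F ≡ Form.A G × Form.C F ≡ Form.C G × Form.h F ≡ Form.h G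
 shape-injective F G e = A= , C= , signBit-injective sign= abs=
  where
  module F = Bounds F
  module G = Bounds G
  parts = Fin.combine-injective (Fin.fromℕ< (s≤s F.A<=D)) _ (Fin.fromℕ< (s≤s G.A<=D)) _ e
  parts2 = Fin.combine-injective (Fin.fromℕ< (s≤s F.C<=D)) _ (Fin.fromℕ< (s≤s G.C<=D)) _ (snd parts)
  parts3 = Fin.combine-injective (signBit (Form.h F)) _ (signBit (Form.h G)) _ (snd parts2)
  unfin : ∀ {m n} (p : m < suc D) (q : n < suc D) -> Fin.fromℕ< p ≡ Fin.fromℕ< q -> m ≡ n
  unfin p q e = tr (sym (Fin.toℕ-fromℕ< p)) (tr (cong toℕ e) (Fin.toℕ-fromℕ< q))
  A= = unfin (s≤s F.A<=D) (s≤s G.A<=D) (fst parts)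
  C= = unfin (s≤s F.C<=D) (s≤s G.C<=D) (fst parts2)
  sign= = fst parts3
  abs= = unfin (s≤s F.h<=D) (s≤s G.h<=D) (snd parts3)
 square-injective : ∀ {m n} -> m * m ≡ n * n -> m ≡ n
 square-injective {m} {n} e with <-cmp m n
 ... | tri< m<n _ _ = contradiction e (<⇒≢ (*-mono-< m<n m<n))
 ... | tri≈ _ m≡n _ = m≡n
 ... | tri> _ _ n<m = contradiction (sym e) (<⇒≢ (*-mono-< n<m n<m))
 square-injectiveZ : ∀ {m n} -> Z.+ m Z.* Z.+ m ≡ Z.+ n Z.* Z.+ n -> m ≡ n
 square-injectiveZ {m} {n} e = square-injective (Z.+-injective (tr (Z.pos-* m m) (tr e (sym (Z.pos-* n n)))))
 module Unit (F G : Form) (A= : Form.A F ≡ Form.A G) (C= : Form.C F ≡ Form.C G) (h= : Form.h F ≡ Form.h G) (grows : mass F < mass G) where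
  open Form F
  module G = Form G
  d x y u v p1 p2 q1 q2 : ℤ
  d = Z.+ D
  x = Z.+ u1
  y = Z.+ u2
  u = Z.+ v1
  v = Z.+ v2
  p1 = Z.+ G.u1
  p2 = Z.+ G.u2
  q1 = Z.+ G.v1
  q2 = Z.+ G.v2
  X Y : ℤ
  -- By unimodularity 1 = v (x + y √D) - y (u + v √D). Hence X + Y √D is the image of 1 under the
  -- isometry that carries the basis of `F` to that of `G`.
  X = v Z.* p1 Z.- y Z.* q1
  Y = v Z.* p2 Z.- y Z.* q2
  norm : X Z.* X Z.- d Z.* (Y Z.* Y) ≡ 1ℤ
  norm = begin X Z.* X Z.- d Z.* (Y Z.* Y) ≡⟨ solve 7 (\ d v y p1 p2 q1 q2 -> (v :* p1 :- y :* q1) :* (v :* p1 :- y :* q1) :- d :* ((v :* p2 :- y :* q2) :* (v :* p2 :- y :* q2)) :=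
      (v :* v) :* (p1 :* p1 :- d :* (p2 :* p2)) :- (v :* y :+ v :* y) :* (p1 :* q1 :- d :* (p2 :* q2)) :+ (y :* y) :* (q1 :* q1 :- d :* (q2 :* q2))) refl d v y p1 p2 q1 q2 ⟩
   (v Z.* v) Z.* (p1 Z.* p1 Z.- d Z.* (p2 Z.* p2)) Z.- (v Z.* y Z.+ v Z.* y) Z.* (p1 Z.* q1 Z.- d Z.* (p2 Z.* q2)) Z.+ (y Z.* y) Z.* (q1 Z.* q1 Z.- d Z.* (q2 Z.* q2))
    ≡⟨ cong2 Z._+_ (cong2 (\ a b -> (v Z.* v) Z.* a Z.- (v Z.* y Z.+ v Z.* y) Z.* b) same-u same-h) (cong ((y Z.* y) Z.*_) same-v) ⟩
   (v Z.* v) Z.* (x Z.* x Z.- d Z.* (y Z.* y)) Z.- (v Z.* y Z.+ v Z.* y) Z.* (x Z.* u Z.- d Z.* (y Z.* v)) Z.+ (y Z.* y) Z.* (u Z.* u Z.- d Z.* (v Z.* v)) ≡⟨ solve 5 (\ d x y u v ->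
      (v :* v) :* (x :* x :- d :* (y :* y)) :- (v :* y :+ v :* y) :* (x :* u :- d :* (y :* v)) :+ (y :* y) :* (u :* u :- d :* (v :* v)) := (x :* v :- y :* u) :* (x :* v :- y :* u)) refl d x y u v ⟩
   (x Z.* v Z.- y Z.* u) Z.* (x Z.* v Z.- y Z.* u) ≡⟨ cong (\ z -> z Z.* z) unimodular ⟩ 1ℤ ∎
   where
   open ≡-Reasoning
   same-u = tr G.norm-u (tr (cong Z.+_ (sym A=)) (sym norm-u))
   same-v = tr G.norm-v (tr (cong (\ c -> Z.- Z.+ c) (sym C=)) (sym norm-v))
   same-h = tr G.product (tr (sym h=) (sym product))
  -- If Y = 0 then X² = 1, and the second coordinates of the two bases agree up to sign, thus agree
  -- as natural numbers. Equal norms then force the first coordinates to agree, against the growth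
  -- of the mass.
  Y/=0 : Y ≢ 0ℤ
  Y/=0 Y=0 = <-irrefl (cong2 _+_ (cong2 _+_ u1= u2=) (cong2 _+_ v1= v2=)) grows
   where
   X²=1 : X Z.* X ≡ 1ℤ
   X²=1 = tr (sym (tr (cong (\ z -> X Z.* X Z.- d Z.* (z Z.* z)) Y=0) (tr (cong (\ z -> X Z.* X Z.- z) (Z.*-zeroʳ d)) (Z.+-identityʳ _)))) norm
   u2-identity : y ≡ p2 Z.* X
   u2-identity = begin y ≡⟨ Z.*-identityʳ y ⟨ y Z.* 1ℤ ≡⟨ cong (y Z.*_) G.unimodular ⟨ y Z.* (p1 Z.* q2 Z.- p2 Z.* q1) ≡⟨ solve 6 (\ v y p1 p2 q1 q2 -> y :* (p1 :* q2 :- p2 :* q1) :=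
        p2 :* (v :* p1 :- y :* q1) :- p1 :* (v :* p2 :- y :* q2)) refl v y p1 p2 q1 q2 ⟩ p2 Z.* X Z.- p1 Z.* Y ≡⟨ cong (\ z -> p2 Z.* X Z.- p1 Z.* z) Y=0 ⟩
    p2 Z.* X Z.- p1 Z.* 0ℤ ≡⟨ tr (cong (\ z -> p2 Z.* X Z.- z) (Z.*-zeroʳ p1)) (Z.+-identityʳ _) ⟩ p2 Z.* X ∎
    where
       open ≡-Reasoning
   v2-identity : v ≡ q2 Z.* X
   v2-identity = begin v ≡⟨ Z.*-identityʳ v ⟨ v Z.* 1ℤ ≡⟨ cong (v Z.*_) G.unimodular ⟨ v Z.* (p1 Z.* q2 Z.- p2 Z.* q1) ≡⟨ solve 6 (\ v y p1 p2 q1 q2 -> v :* (p1 :* q2 :- p2 :* q1) :=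
        q2 :* (v :* p1 :- y :* q1) :- q1 :* (v :* p2 :- y :* q2)) refl v y p1 p2 q1 q2 ⟩ q2 Z.* X Z.- q1 Z.* Y ≡⟨ cong (\ z -> q2 Z.* X Z.- q1 Z.* z) Y=0 ⟩
    q2 Z.* X Z.- q1 Z.* 0ℤ ≡⟨ tr (cong (\ z -> q2 Z.* X Z.- z) (Z.*-zeroʳ q1)) (Z.+-identityʳ _) ⟩ q2 Z.* X ∎
    where
       open ≡-Reasoning
   drop-X : ∀ {m n} -> Z.+ m ≡ Z.+ n Z.* X -> m ≡ n
   drop-X {m} {n} e = square-injectiveZ (tr (cong (\ z -> z Z.* z) e) (tr (solve 2 (\ n x -> (n :* x) :* (n :* x) := (n :* n) :* (x :* x)) refl (Z.+ n) X)
     (tr (cong ((Z.+ n Z.* Z.+ n) Z.*_) X²=1) (Z.*-identityʳ _))))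
   u2= : u2 ≡ G.u2
   u2= = drop-X u2-identity
   v2= : v2 ≡ G.v2
   v2= = drop-X v2-identity
   from-norm : ∀ {m m' n n'} {z} -> Z.+ m Z.* Z.+ m Z.- d Z.* (Z.+ n Z.* Z.+ n) ≡ z -> Z.+ m' Z.* Z.+ m' Z.- d Z.* (Z.+ n' Z.* Z.+ n') ≡ z -> n ≡ n' -> m ≡ m'
   from-norm {m} {m'} {n} e e' refl = square-injectiveZ (tr (split (Z.+ m Z.* Z.+ m)) (tr (cong (Z._+ d Z.* (Z.+ n Z.* Z.+ n)) (tr e (sym e'))) (sym (split (Z.+ m' Z.* Z.+ m')))))
    where
    split : ∀ a -> a ≡ (a Z.- d Z.* (Z.+ n Z.* Z.+ n)) Z.+ d Z.* (Z.+ n Z.* Z.+ n)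
    split a = solve 2 (\ a b -> a := (a :- b) :+ b) refl a (d Z.* (Z.+ n Z.* Z.+ n))
   u1= : u1 ≡ G.u1
   u1= = from-norm norm-u (tr G.norm-u (cong Z.+_ (sym A=))) u2=
   v1= : v1 ≡ G.v1
   v1= = from-norm norm-v (tr G.norm-v (cong (\ c -> Z.- Z.+ c) (sym C=))) v2=
 from-repetition : ∀ F G -> shape F ≡ shape G -> mass F < mass G -> ∃₂ \ X Y -> X * X ≡ 1 + D * (Y * Y) × 1 ≤ Y
 from-repetition F G e grows = Z.∣ X ∣ , Z.∣ Y ∣ , equation , n≢0⇒n>0 (Y/=0 ∘ Z.∣i∣≡0⇒i≡0)
  where
  same = shape-injective F G e
  open Unit F G (fst same) (fst (snd same)) (snd (snd same)) grows
  abs-square : ∀ i -> Z.+ (Z.∣ i ∣ * Z.∣ i ∣) ≡ i Z.* i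
  abs-square (Z.+ n) = Z.pos-* n n
  abs-square -[1+ n ] = refl
  equation : Z.∣ X ∣ * Z.∣ X ∣ ≡ 1 + D * (Z.∣ Y ∣ * Z.∣ Y ∣)
  equation = Z.+-injective (begin Z.+ (Z.∣ X ∣ * Z.∣ X ∣) ≡⟨ abs-square X ⟩ X Z.* X ≡⟨ solve 2 (\ a b -> a := (a :- b) :+ b) refl (X Z.* X) (d Z.* (Y Z.* Y)) ⟩
   (X Z.* X Z.- d Z.* (Y Z.* Y)) Z.+ d Z.* (Y Z.* Y) ≡⟨ cong2 Z._+_ norm (cong (d Z.*_) (sym (abs-square Y))) ⟩ 1ℤ Z.+ d Z.* Z.+ (Z.∣ Y ∣ * Z.∣ Y ∣) ≡⟨ cong (\ z -> 1ℤ Z.+ z) (Z.pos-* D _) ⟨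
   1ℤ Z.+ Z.+ (D * (Z.∣ Y ∣ * Z.∣ Y ∣)) ≡⟨ Z.pos-+ 1 _ ⟨ Z.+ (1 + D * (Z.∣ Y ∣ * Z.∣ Y ∣)) ∎)
   where
    open ≡-Reasoning
 solution : ∃₂ \ X Y -> X * X ≡ 1 + D * (Y * Y) × 1 ≤ Y
 solution = from-pair (Fin.pigeonhole ≤-refl (\ i -> shape (forms (toℕ i))))
  where
  from-pair : ∃₂ (\ i j -> i Fin.< j × shape (forms (toℕ i)) ≡ shape (forms (toℕ j))) -> ∃₂ \ X Y -> X * X ≡ 1 + D * (Y * Y) × 1 ≤ Y
  from-pair (i , j , i<j , e) = from-repetition (forms (toℕ i)) (forms (toℕ j)) e (mass-mono i<j)

-- Order and multiplication by units in ℤ[√D]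

infixl 6 _⊕_ _⊝_
infix 8 ⊝_

ZR : Set
ZR = ℤ × ℤ

_⊕_ _⊝_ : ZR -> ZR -> ZR
(p , q) ⊕ (p' , q') = p Z.+ p' , q Z.+ q'
(p , q) ⊝ (p' , q') = p Z.- p' , q Z.- q'

⊝_ : ZR -> ZR
⊝ (p , q) = Z.- p , Z.- q

0R : ZR
0R = 0ℤ , 0ℤ

conj : ZR -> ZR
conj (p , q) = p , Z.- q

scaleR : ℤ -> ZR -> ZR
scaleR n (p , q) = n Z.* p , n Z.* q

constR : ℕ -> ZR
constR n = Z.+ n , 0ℤ

-- Multiplication by c + g √D.
actR : ℕ -> ℤ -> ℤ -> ZR -> ZR
actR D c g (p , q) = c Z.* p Z.+ Z.+ D Z.* g Z.* q , g Z.* p Z.+ c Z.* q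

module OrderTest (D : ℕ) where
 open Sign D public
 nnR' : ZR -> Bool
 nnR' (p , q) = nnR p q
 leq : ZR -> ZR -> Bool
 leq z w = nnR' (w ⊝ z)

module Order (D : ℕ) (total : ∀ P Q -> Sign.nnR D P Q ≡ false -> Sign.nnR D (Z.- P) (Z.- Q) ≡ true × (P ≢ 0ℤ ⊎ Q ≢ 0ℤ))
 (antisym : ∀ P Q -> Sign.nnR D P Q ≡ true -> Sign.nnR D (Z.- P) (Z.- Q) ≡ true -> P ≡ 0ℤ × Q ≡ 0ℤ) (add : ∀ P Q P' Q' -> Sign.nnR D P Q ≡ true -> Sign.nnR D P' Q' ≡ true ->
  Sign.nnR D (P Z.+ P') (Q Z.+ Q') ≡ true)
 where
 open OrderTest D public
 open Z-Solver
 record Nonneg (z : ZR) : Set where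
  constructor test
  field
   passes : nnR' z ≡ true
 open Nonneg public
 infix 4 _≼_
 record _≼_ (z w : ZR) : Set where
  constructor above
  field
   gap : Nonneg (w ⊝ z)
 open _≼_ public
 leq=>≼ : ∀ z w -> leq z w ≡ true -> z ≼ w
 leq=>≼ z w e = above (test e)
 ≼=>leq : ∀ {z w} -> z ≼ w -> leq z w ≡ true
 ≼=>leq (above (test e)) = e
 nn-cong : ∀ {z w} -> z ≡ w -> Nonneg z -> Nonneg w
 nn-cong refl p = p
 nonneg-⊕ : ∀ {z w} -> Nonneg z -> Nonneg w -> Nonneg (z ⊕ w)
 nonneg-⊕ {p , q} {p' , q'} (test e) (test e') = test (add p q p' q' e e')
 nonneg? : ∀ z -> Nonneg z ⊎ nnR' z ≡ false
 nonneg? z with nnR' z in e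
 ... | true = in1 (test e)
 ... | false = in2 refl
 nonneg-antisym : ∀ {z} -> Nonneg z -> Nonneg (⊝ z) -> z ≡ 0R
 nonneg-antisym {p , q} (test e) (test e') with antisym p q e e'
 ... | refl , refl = refl
 ⊕-⊝ : ∀ x y z -> (z ⊝ y) ⊕ (y ⊝ x) ≡ z ⊝ x
 ⊕-⊝ (a , a') (b , b') (c , c') = cong2 _,_ (lemma a b c) (lemma a' b' c')
  where
  lemma : ∀ a b c -> (c Z.- b) Z.+ (b Z.- a) ≡ c Z.- a
  lemma = solve 3 (\ a b c -> (c :- b) :+ (b :- a) := c :- a) refl
 ⊝-self : ∀ z -> 0R ≡ z ⊝ z
 ⊝-self (p , q) = cong2 _,_ (sym (Z.+-inverseʳ p)) (sym (Z.+-inverseʳ q))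
 ⊝-swap : ∀ z w -> ⊝ (w ⊝ z) ≡ z ⊝ w
 ⊝-swap (p , q) (p' , q') = cong2 _,_ (lemma p p') (lemma q q')
  where
  lemma : ∀ a b -> Z.- (b Z.- a) ≡ a Z.- b
  lemma = solve 2 (\ a b -> :- (b :- a) := a :- b) refl
 ≼-refl : ∀ {z} -> z ≼ z
 ≼-refl {z} = above (nn-cong (⊝-self z) (test refl))
 ≼-reflexive : ∀ {z w} -> z ≡ w -> z ≼ w
 ≼-reflexive refl = ≼-refl
 ≼-trans : ∀ {x y z} -> x ≼ y -> y ≼ z -> x ≼ z
 ≼-trans {x} {y} {z} (above p) (above q) = above (nn-cong (⊕-⊝ x y z) (nonneg-⊕ q p))
 ≼-total : ∀ z w -> leq z w ≡ false -> w ≼ z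
 ≼-total z w e = above (nn-cong (⊝-swap z w) (test (fst (total (fst (w ⊝ z)) (snd (w ⊝ z)) e))))
 ≼-⊕ : ∀ {x y z w} -> x ≼ y -> z ≼ w -> x ⊕ z ≼ y ⊕ w
 ≼-⊕ {a , a'} {b , b'} {c , c'} {d , d'} (above p) (above q) = above (nn-cong (cong2 _,_ (lemma a b c d) (lemma a' b' c' d')) (nonneg-⊕ p q))
  where
  lemma : ∀ a b c d -> (b Z.- a) Z.+ (d Z.- c) ≡ (b Z.+ d) Z.- (a Z.+ c)
  lemma = solve 4 (\ a b c d -> (b :- a) :+ (d :- c) := (b :+ d) :- (a :+ c)) refl
 ≼-⊝ : ∀ {x y} -> x ≼ y -> ⊝ y ≼ ⊝ x
 ≼-⊝ {a , a'} {b , b'} (above p) = above (nn-cong (cong2 _,_ (lemma a b) (lemma a' b')) p)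
  where
  lemma : ∀ a b -> b Z.- a ≡ (Z.- a) Z.- (Z.- b)
  lemma = solve 2 (\ a b -> b :- a := (:- a) :- (:- b)) refl
 ⊝-0 : ∀ z -> z ⊝ 0R ≡ z
 ⊝-0 (p , q) = cong2 _,_ (Z.+-identityʳ p) (Z.+-identityʳ q)
 nn=>0≼ : ∀ {z} -> Nonneg z -> 0R ≼ z
 nn=>0≼ {z} p = above (nn-cong (sym (⊝-0 z)) p)
 0≼=>nonneg : ∀ {z} -> 0R ≼ z -> Nonneg z
 0≼=>nonneg {z} (above p) = nn-cong (⊝-0 z) p
 nn-const : ∀ n -> Nonneg (constR n)
 nn-const n = test refl
 private
  nonneg-* : ∀ n i -> nonneg i ≡ true -> nonneg (Z.+ n Z.* i) ≡ true
  nonneg-* n (Z.+ m) _ = subst (\ z -> nonneg z ≡ true) (Z.pos-* n m) refl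
 nonneg-scale : ∀ n {z} -> Nonneg z -> Nonneg (scaleR (Z.+ n) z)
 nonneg-scale zero {p , q} e = test refl
 nonneg-scale (suc n) {p , q} e = nn-cong (cong2 _,_ (sym (Z.suc-* (Z.+ n) p)) (sym (Z.suc-* (Z.+ n) q))) (nonneg-⊕ e (nonneg-scale n e))
 mulRD : ZR -> ZR
 mulRD (p , q) = Z.+ D Z.* q , p
 -- Multiplication by √D exchanges the coordinates, and the test then compares the same two squares
 -- with a common factor `D`.
 nonneg-RD : ∀ {z} -> 1 ≤ D -> Nonneg z -> Nonneg (mulRD z)
 nonneg-RD {z} (s≤s {n = d} z≤n) (test e) = test (go (fst z) (snd z) e)
  where
  d' = Z.+ suc d
  sgn : ∀ i -> nonneg (d' Z.* i) ≡ nonneg i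
  sgn (Z.+ n) = nonneg-* (suc d) (Z.+ n) refl
  sgn -[1+ n ] = refl
  factor1 : ∀ p q -> d' Z.* (p Z.* p Z.- d' Z.* (q Z.* q)) ≡ d' Z.* (p Z.* p) Z.- d' Z.* q Z.* (d' Z.* q)
  factor1 p q = solve 3 (\ d p q -> d :* (p :* p :- d :* (q :* q)) := d :* (p :* p) :- d :* q :* (d :* q)) refl d' p q
  factor2 : ∀ p q -> d' Z.* (d' Z.* (q Z.* q) Z.- p Z.* p) ≡ d' Z.* q Z.* (d' Z.* q) Z.- d' Z.* (p Z.* p)
  factor2 p q = solve 3 (\ d p q -> d :* (d :* (q :* q) :- p :* p) := d :* q :* (d :* q) :- d :* (p :* p)) refl d' p q
  go : ∀ p q -> nnR p q ≡ true -> nnR (d' Z.* q) p ≡ true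
  go p q e rewrite sgn q with nonneg p | nonneg q | e
  ... | true | true | _ = refl
  ... | true | false | e' = subst (\ z -> nonneg z ≡ true) (factor1 p q) (nonneg-* (suc d) _ e')
  ... | false | true | e' = subst (\ z -> nonneg z ≡ true) (factor2 p q) (nonneg-* (suc d) _ e')
 module _ (1<=D : 1 ≤ D) where
  nonneg-act : ∀ c g {z} -> Nonneg z -> Nonneg (actR D (Z.+ c) (Z.+ g) z)
  nonneg-act c g {p , q} n = nn-cong (cong2 _,_ (solve 5 (\ d c g p q -> c :* p :+ g :* (d :* q) := c :* p :+ d :* g :* q) refl (Z.+ D) (Z.+ c) (Z.+ g) p q)
    (solve 4 (\ c g p q -> c :* q :+ g :* p := g :* p :+ c :* q) refl (Z.+ c) (Z.+ g) p q)) (nonneg-⊕ (nonneg-scale c n) (nonneg-scale g (nonneg-RD 1<=D n)))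
  ≼-act : ∀ c g {z w} -> z ≼ w -> actR D (Z.+ c) (Z.+ g) z ≼ actR D (Z.+ c) (Z.+ g) w
  ≼-act c g {a , a'} {b , b'} (above n) = above (nn-cong (cong2 _,_ (solve 7 (\ d c g a a' b b' -> c :* (b :- a) :+ d :* g :* (b' :- a') :=
     (c :* b :+ d :* g :* b') :- (c :* a :+ d :* g :* a')) refl (Z.+ D) (Z.+ c) (Z.+ g) a a' b b') (solve 6 (\ c g a a' b b' -> g :* (b :- a) :+ c :* (b' :- a') :=
     (g :* b :+ c :* b') :- (g :* a :+ c :* a')) refl (Z.+ c) (Z.+ g) a a' b b')) (nonneg-act c g n))
  -- Rests on √D ≤ D.
  bounded-above : ∀ m {p q} -> Z.∣ p ∣ ≤ m -> Z.∣ q ∣ ≤ m -> (p , q) ≼ constR (suc D * m)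
  bounded-above m {p} {q} p<= q<= = above (nn-cong (cong2 _,_ sum₁ refl)
   (nonneg-⊕ {Z.+ m Z.- p , 0ℤ} {Z.+ (D * m) , Z.- q} (test first) (test (second (Z.- q) (subst (_≤ m) (sym (Z.∣-i∣≡∣i∣ q)) q<=)))))
   where
   sum₁ : (Z.+ m Z.- p) Z.+ Z.+ (D * m) ≡ Z.+ (m + D * m) Z.- p
   sum₁ = tr (solve 3 (\ m p k -> (m :- p) :+ k := (m :+ k) :- p) refl (Z.+ m) p (Z.+ (D * m))) (cong (Z._- p) (sym (Z.pos-+ m (D * m))))
   m-p : ∀ p -> Z.∣ p ∣ ≤ m -> nonneg (Z.+ m Z.- p) ≡ true
   m-p (Z.+ n) n≤m = tr (cong nonneg (tr (Z.m-n≡m⊖n m n) (Z.⊖-≥ n≤m))) refl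
   m-p -[1+ n ] _ = refl
   first : nnR (Z.+ m Z.- p) 0ℤ ≡ true
   first rewrite m-p p p<= = refl
   second : ∀ q -> Z.∣ q ∣ ≤ m -> nnR (Z.+ (D * m)) q ≡ true
   second (Z.+ n) _ = refl
   second -[1+ n ] n≤m = tr (cong nonneg (tr (cong2 Z._-_ (sym (Z.pos-* (D * m) (D * m))) (sym (Z.pos-* D (suc n * suc n)))) (tr (Z.m-n≡m⊖n (D * m * (D * m)) (D * (suc n * suc n))) (Z.⊖-≥ (begin
     D * (suc n * suc n) ≤⟨ *-monoʳ-≤ D (*-mono-≤ n≤m n≤m) ⟩ D * (m * m) ≤⟨ m≤n*m (D * (m * m)) D {{ℕ.>-nonZero 1<=D}} ⟩
     D * (D * (m * m)) ≡⟨ cong (D *_) (tr (sym (*-assoc D m m)) (*-comm (D * m) m)) ⟩ D * (m * (D * m)) ≡⟨ *-assoc D m (D * m) ⟨ D * m * (D * m) ∎))))) refl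
    where
     open ℕ.≤-Reasoning
 -- Conversely, bounds on an element and its conjugate bound the coordinates.
 first-bounded : ∀ B p q -> (p , q) ≼ constR B -> conj (p , q) ≼ constR B -> p Z.≤ Z.+ B
 first-bounded B p q (above n) (above n') = Z.0≤i-j⇒j≤i (halve (Z.+ B Z.- p) (rational (passes total-gap)))
  where
  total-gap : Nonneg ((Z.+ B Z.- p) Z.+ (Z.+ B Z.- p) , 0ℤ)
  total-gap = nn-cong (cong2 _,_ refl (tr (cong2 Z._+_ (Z.+-identityˡ (Z.- q)) (Z.+-identityˡ (Z.- (Z.- q)))) (Z.+-inverseʳ (Z.- q)))) (nonneg-⊕ n n')
  rational : ∀ {i} -> nnR i 0ℤ ≡ true -> nonneg i ≡ true
  rational {Z.+ n} _ = refl
  rational { -[1+ n ]} e = tr (cong (\ z -> nonneg (z Z.- -[1+ n ] Z.* -[1+ n ])) (sym (Z.*-zeroʳ (Z.+ D)))) e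
  halve : ∀ i -> nonneg (i Z.+ i) ≡ true -> 0ℤ Z.≤ i
  halve (Z.+ n) _ = Z.+≤+ z≤n
 second-bounded : ∀ B p q -> 1 ≤ D -> (p , q) ≼ constR B -> ⊝ constR B ≼ conj (p , q) -> q Z.≤ Z.+ B
 second-bounded B p q 1<=D (above n) (above n') = go q (passes total-gap)
  where
  total-gap : Nonneg (Z.+ (B + B) , Z.- q Z.- q)
  total-gap = nn-cong (cong2 _,_ (tr (solve 2 (\ b p -> (b :- p) :+ (p :- (:- b)) := b :+ b) refl (Z.+ B) p) (sym (Z.pos-+ B B)))
   (cong2 Z._+_ (Z.+-identityˡ (Z.- q)) (Z.+-identityʳ (Z.- q)))) (nonneg-⊕ n n')
  go : ∀ q -> nnR (Z.+ (B + B)) (Z.- q Z.- q) ≡ true -> q Z.≤ Z.+ B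
  go -[1+ m ] _ = Z.-≤+
  go (Z.+ zero) _ = Z.+≤+ z≤n
  go (Z.+ (suc m)) e = Z.+≤+ (≮⇒≥ \ B<q -> <⇒≱ (small B<q) big)
   where
   r = suc (suc (m + m))
   big : D * (r * r) ≤ (B + B) * (B + B)
   big = Z.drop‿+≤+ (Z.0≤i-j⇒j≤i (positive-part (tr (cong nonneg (cong2 Z._-_ (Z.pos-* (B + B) (B + B)) (Z.pos-* D (r * r)))) e)))
    where
    positive-part : ∀ {i} -> nonneg i ≡ true -> 0ℤ Z.≤ i
    positive-part {Z.+ n} _ = Z.+≤+ z≤n
   small : B < suc m -> (B + B) * (B + B) < D * (r * r)
   small B<q = <-≤-trans (*-mono-< 2B<r 2B<r) (m≤n*m (r * r) D {{ℕ.>-nonZero 1<=D}})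
    where
    2B<r : B + B < r
    2B<r = subst (B + B <_) (cong suc (+-suc m m)) (+-mono-< B<q B<q)
 ∣∣<= : ∀ {i n} -> i Z.≤ Z.+ n -> Z.- i Z.≤ Z.+ n -> Z.∣ i ∣ ≤ n
 ∣∣<= {Z.+ _} (Z.+≤+ p) _ = p
 ∣∣<= { -[1+ _ ]} _ (Z.+≤+ p) = p
 -- An interval of values alone contains infinitely many elements; bounding the conjugate too bounds
 -- both coordinates, and thus the number of states.
 record Boxed (B : ℕ) (z : ZR) : Set where
  field
   upper : z ≼ constR B
   lower : ⊝ constR B ≼ z
   upper' : conj z ≼ constR B
   lower' : ⊝ constR B ≼ conj z
 boxed-bounds : ∀ {B p q} -> 1 ≤ D -> Boxed B (p , q) -> Z.∣ p ∣ ≤ B × Z.∣ q ∣ ≤ B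
 boxed-bounds {B} {p} {q} 1<=D box = ∣∣<= (first-bounded B p q upper upper') (first-bounded B (Z.- p) (Z.- q) (flip lower) (flip lower')) , ∣∣<= (second-bounded B p q 1<=D upper lower')
   (second-bounded B p (Z.- q) 1<=D upper' (subst (\ r -> ⊝ constR B ≼ (p , r)) (sym (Z.neg-involutive q)) lower))
  where
  open Boxed box
  flip : ∀ {z} -> ⊝ constR B ≼ z -> ⊝ z ≼ constR B
  flip {z} l = subst (⊝ z ≼_) (cong (_, 0ℤ) (Z.neg-involutive (Z.+ B))) (≼-⊝ l)

-- The numeration system with weights U₀ = 1, U₁ = 2 X, … attached to the unit
-- β = X + Y √D:  βᵏ⁺¹ = c k + Y (U k) √D.
module Weights (D X Y : ℕ) (pell : X * X ≡ 1 + D * (Y * Y)) (2<=X : 2 ≤ X) where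
 c U : ℕ -> ℕ
 c zero = X
 c (suc k) = X * c k + D * (Y * Y) * U k
 U zero = 1
 U (suc k) = c k + X * U k
 c<=XU : ∀ k -> c k ≤ X * U k
 c<=XU zero = ≡⇒≤ (sym (*-identityʳ X))
 c<=XU (suc k) = begin X * c k + D * (Y * Y) * U k ≤⟨ +-monoʳ-≤ (X * c k) (*-monoˡ-≤ (U k) (≤-trans (n≤1+n _) (≡⇒≤ (sym pell)))) ⟩ X * c k + X * X * U k ≡⟨ cong (X * c k +_) (*-assoc X X (U k)) ⟩
  X * c k + X * (X * U k) ≡⟨ *-distribˡ-+ X (c k) (X * U k) ⟨ X * (c k + X * U k) ∎
  where
   open ℕ.≤-Reasoning
 -- This ratio of consecutive weights is why digits up to 2 X suffice for the greedy expansion.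
 U-upper : ∀ k -> U (suc k) ≤ (X + X) * U k
 U-upper k = ≤-trans (+-monoˡ-≤ (X * U k) (c<=XU k)) (≡⇒≤ (sym (*-distribʳ-+ (U k) X X)))
 k<U : ∀ k -> k < U k
 k<U zero = s≤s z≤n
 k<U (suc k) = begin-strict suc k <⟨ s≤s (k<U k) ⟩ suc (U k) ≤⟨ +-monoˡ-≤ (U k) (≤-trans (s≤s z≤n) (k<U k)) ⟩ U k + U k ≡⟨ cong (U k +_) (+-identityʳ (U k)) ⟨ 2 * U k ≤⟨ *-monoˡ-≤ (U k) 2<=X ⟩
  X * U k ≤⟨ m≤n+m (X * U k) (c k) ⟩ c k + X * U k ∎
  where
   open ℕ.≤-Reasoning
 open Z-Solver
 private
  d x y : ℤ
  d = Z.+ D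
  x = Z.+ X
  y = Z.+ Y
  pellZ : x Z.* x Z.- d Z.* (y Z.* y) ≡ 1ℤ
  pellZ = tr (cong (Z._- d Z.* (y Z.* y)) (tr (sym (Z.pos-* X X)) (tr (cong Z.+_ pell) (tr (Z.pos-+ 1 (D * (Y * Y))) (cong (\ z -> 1ℤ Z.+ z) (tr (Z.pos-* D (Y * Y)) (cong (d Z.*_) (Z.pos-* Y Y))))))))
   (solve 1 (\ z -> (con 1ℤ :+ z) :- z := con 1ℤ) refl (d Z.* (y Z.* y)))
 g : ℕ -> ℕ
 g k = Y * U k
 c-step : ∀ k -> Z.+ c (suc k) ≡ x Z.* Z.+ c k Z.+ d Z.* (y Z.* Z.+ g k)
 c-step k = tr (Z.pos-+ (X * c k) (D * (Y * Y) * U k)) (cong2 Z._+_ (Z.pos-* X (c k)) (tr (cong Z.+_ (tr (*-assoc D (Y * Y) (U k)) (cong (D *_) (*-assoc Y Y (U k)))))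
   (tr (Z.pos-* D (Y * g k)) (cong (d Z.*_) (Z.pos-* Y (g k))))))
 g-step : ∀ k -> Z.+ g (suc k) ≡ y Z.* Z.+ c k Z.+ x Z.* Z.+ g k
 g-step k = tr (cong Z.+_ (tr (*-distribˡ-+ Y (c k) (X * U k)) (cong (Y * c k +_) (tr (sym (*-assoc Y X (U k))) (tr (cong (_* U k) (*-comm Y X)) (*-assoc X Y (U k)))))))
  (tr (Z.pos-+ (Y * c k) (X * g k)) (cong2 Z._+_ (Z.pos-* Y (c k)) (Z.pos-* X (g k))))
 norm : ∀ k -> Z.+ c k Z.* Z.+ c k Z.- d Z.* (Z.+ g k Z.* Z.+ g k) ≡ 1ℤ
 norm zero = tr (cong (\ z -> x Z.* x Z.- d Z.* (Z.+ z Z.* Z.+ z)) (*-identityʳ Y)) pellZ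
 norm (suc k) = tr (cong2 (\ c g -> c Z.* c Z.- d Z.* (g Z.* g)) (c-step k) (g-step k))
  (tr (solve 5 (\ d x y c g -> (x :* c :+ d :* (y :* g)) :* (x :* c :+ d :* (y :* g)) :- d :* ((y :* c :+ x :* g) :* (y :* c :+ x :* g)) :=
    (x :* x :- d :* (y :* y)) :* (c :* c :- d :* (g :* g))) refl d x y (Z.+ c k) (Z.+ g k)) (cong2 Z._*_ pellZ (norm k)))
 β β̄ : ZR -> ZR
 β = actR D x y
 β̄ = actR D x (Z.- y)
 powerR : ℕ -> ZR -> ZR
 powerR k = actR D (Z.+ c k) (Z.+ g k)
 power-zero : ∀ z -> powerR 0 z ≡ β z
 power-zero (p , q) = cong (\ g -> actR D x (Z.+ g) (p , q)) (*-identityʳ Y)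
 power-suc : ∀ k z -> powerR (suc k) z ≡ β (powerR k z)
 power-suc k (p , q) = tr (cong2 (\ c g -> actR D c g (p , q)) (c-step k) (g-step k)) (cong2 _,_ (solve 7 (\ d x y c g p q -> (x :* c :+ d :* (y :* g)) :* p :+ d :* (y :* c :+ x :* g) :* q :=
   x :* (c :* p :+ d :* g :* q) :+ d :* y :* (g :* p :+ c :* q)) refl d x y (Z.+ c k) (Z.+ g k) p q) (solve 7 (\ d x y c g p q -> (y :* c :+ x :* g) :* p :+ (x :* c :+ d :* (y :* g)) :* q :=
   y :* (c :* p :+ d :* g :* q) :+ x :* (g :* p :+ c :* q)) refl d x y (Z.+ c k) (Z.+ g k) p q))
 β-power : ∀ k z -> β (powerR k z) ≡ powerR k (β z)
 β-power k (p , q) = cong2 _,_ (solve 7 (\ d x y c g p q -> x :* (c :* p :+ d :* g :* q) :+ d :* y :* (g :* p :+ c :* q) :=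
   c :* (x :* p :+ d :* y :* q) :+ d :* g :* (y :* p :+ x :* q)) refl d x y (Z.+ c k) (Z.+ g k) p q) (solve 7 (\ d x y c g p q -> y :* (c :* p :+ d :* g :* q) :+ x :* (g :* p :+ c :* q) :=
   g :* (x :* p :+ d :* y :* q) :+ c :* (y :* p :+ x :* q)) refl d x y (Z.+ c k) (Z.+ g k) p q)
 -- Multiplication by β - β⁻¹ = 2 Y √D.
 Z : ZR -> ZR
 Z = actR D 0ℤ (y Z.+ y)
 -- (β - β⁻¹) U k = βᵏ⁺¹ - β⁻ᵏ⁻¹.
 Z-power : ∀ k z -> powerR k (Z (scaleR (Z.+ U k) z)) ≡ powerR k (powerR k z) ⊝ z
 Z-power k (p , q) = subst (\ h -> actR D c' h (Z (scaleR u (p , q))) ≡ actR D c' h (actR D c' h (p , q)) ⊝ (p , q)) (sym (Z.pos-* Y (U k))) (cong2 _,_ (tr (solve 6 (\ d y u c p q ->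
   c :* (con 0ℤ :* (u :* p) :+ d :* (y :+ y) :* (u :* q)) :+ d :* (y :* u) :* ((y :+ y) :* (u :* p) :+ con 0ℤ :* (u :* q)) :=
   (c :* (c :* p :+ d :* (y :* u) :* q) :+ d :* (y :* u) :* ((y :* u) :* p :+ c :* q)) :- (c :* c :- d :* ((y :* u) :* (y :* u))) :* p)
   refl d y u c' p q) (cong (\ n -> (c' Z.* (c' Z.* p Z.+ d Z.* g' Z.* q) Z.+ d Z.* g' Z.* (g' Z.* p Z.+ c' Z.* q)) Z.- n) (unit p))) (tr (solve 6 (\ d y u c p q ->
   (y :* u) :* (con 0ℤ :* (u :* p) :+ d :* (y :+ y) :* (u :* q)) :+ c :* ((y :+ y) :* (u :* p) :+ con 0ℤ :* (u :* q)) :=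
   ((y :* u) :* (c :* p :+ d :* (y :* u) :* q) :+ c :* ((y :* u) :* p :+ c :* q)) :- (c :* c :- d :* ((y :* u) :* (y :* u))) :* q)
   refl d y u c' p q) (cong (\ n -> (g' Z.* (c' Z.* p Z.+ d Z.* g' Z.* q) Z.+ c' Z.* (g' Z.* p Z.+ c' Z.* q)) Z.- n) (unit q))))
  where
  u c' g' : ℤ
  u = Z.+ U k
  c' = Z.+ c k
  g' = y Z.* u
  unit : ∀ r -> (c' Z.* c' Z.- d Z.* (g' Z.* g')) Z.* r ≡ r
  unit r = tr (cong (Z._* r) (tr (cong (\ h -> c' Z.* c' Z.- d Z.* (h Z.* h)) (sym (Z.pos-* Y (U k)))) (norm k))) (Z.*-identityˡ r)
 -- Digits run over -2X, …, 2X; a digit v stands for v % (2X + 1) - v / (2X + 1).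
 a R1 A : ℕ
 R1 = suc (X + X)
 a = (X + X) + (X + X) * R1
 A = suc a
 digitVal : ℕ -> ℤ
 digitVal v = Z.+ (v rem R1) Z.- Z.+ (v ÷ R1)
 -- The most significant digit comes first.
 weigh : List ℤ -> ℤ
 weigh [] = 0ℤ
 weigh (d ∷ ds) = d Z.* Z.+ U (length ds) Z.+ weigh ds
 greedy : ∀ k n -> n < U k -> ∃[ ds ] (length ds ≡ k × All (_< R1) ds × weigh (map Z.+_ ds) ≡ Z.+ n)
 greedy zero zero _ = [] , refl , [] , refl
 greedy zero (suc n) (s≤s ())
 greedy (suc k) n n<U with greedy k (n ℕ.% U k) (DM.m%n<n n (U k))
  where instance
   nz = ℕ.>-nonZero (≤-trans (s≤s z≤n) (k<U k))
 ... | ds , len , small , eq = n ℕ./ U k ∷ ds , cong suc len , DM.m<n*o⇒m/o<n bound' ∷ small , (begin Z.+ (n ℕ./ U k) Z.* Z.+ U (length (map Z.+_ ds)) Z.+ weigh (map Z.+_ ds)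
    ≡⟨ cong2 (\ l w -> Z.+ (n ℕ./ U k) Z.* Z.+ U l Z.+ w) (tr (length-map Z.+_ ds) len) eq ⟩ Z.+ (n ℕ./ U k) Z.* Z.+ U k Z.+ Z.+ (n ℕ.% U k)
    ≡⟨ cong (Z._+ Z.+ (n ℕ.% U k)) (Z.pos-* (n ℕ./ U k) (U k)) ⟨ Z.+ ((n ℕ./ U k) * U k + n ℕ.% U k) ≡⟨ cong Z.+_ (tr (+-comm _ (n ℕ.% U k)) (sym (DM.m≡m%n+[m/n]*n n (U k)))) ⟩ Z.+ n ∎)
  where
  instance
     nz = ℕ.>-nonZero (≤-trans (s≤s z≤n) (k<U k))
  open ≡-Reasoning
  bound' : n < R1 * U k
  bound' = <-≤-trans n<U (≤-trans (U-upper k) (m≤n+m _ (U k)))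
 weigh-neg : ∀ ds -> weigh (map (Z.-_) ds) ≡ Z.- weigh ds
 weigh-neg [] = refl
 weigh-neg (d ∷ ds) = tr (cong2 (\ l w -> Z.- d Z.* Z.+ U l Z.+ w) (length-map (Z.-_) ds) (weigh-neg ds))
  (solve 3 (\ d u w -> :- d :* u :+ (:- w) := :- (d :* u :+ w)) refl d (Z.+ U (length ds)) (weigh ds))
 digit-pos : ∀ {v} -> v < R1 -> digitVal v ≡ Z.+ v
 digit-pos {v} v<R = tr (cong2 (\ r q -> Z.+ r Z.- Z.+ q) (DM.m<n⇒m%n≡m v<R) (DM.m<n⇒m/n≡0 v<R)) (Z.+-identityʳ (Z.+ v))
 digit-neg : ∀ v -> digitVal (v * R1) ≡ Z.- Z.+ v
 digit-neg v = tr (cong2 (\ r q -> Z.+ r Z.- Z.+ q) (DM.m*n%n≡0 v R1) (DM.m*n/n≡m v R1)) (Z.+-identityˡ _)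
 value-of : List ℕ -> ℤ
 value-of ds = weigh (map digitVal ds)
 -- Any length from the absolute value on is enough because of `k<U`. For a negative integer the
 -- digits of its opposite are negated.
 represent : ∀ x L -> Z.∣ x ∣ ≤ L -> ∃[ ds ] (length ds ≡ L × All (_< A) ds × value-of ds ≡ x)
 represent (Z.+ n) L n<=L with greedy L n (≤-<-trans n<=L (k<U L))
 ... | ds , len , small , eq = ds , len , All.map (\ v<R -> <-≤-trans v<R (m≤m+n R1 _)) small , tr (cong weigh (map-digits small)) eq
  where
  map-digits : ∀ {ds} -> All (_< R1) ds -> map digitVal ds ≡ map Z.+_ ds
  map-digits [] = refl
  map-digits (p ∷ s) = cong2 _∷_ (digit-pos p) (map-digits s)
 represent -[1+ n ] L n<=L with greedy L (suc n) (≤-<-trans n<=L (k<U L))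
 ... | ds , len , small , eq = map (_* R1) ds , tr (length-map _ ds) len , scaled-small small , tr (cong weigh (map-digits ds)) (tr (weigh-neg (map Z.+_ ds)) (cong Z.-_ eq))
  where
  scaled-small : ∀ {ds} -> All (_< R1) ds -> All (_< A) (map (_* R1) ds)
  scaled-small [] = []
  scaled-small {v ∷ _} (s≤s p ∷ s) = s≤s (≤-trans (*-monoˡ-≤ R1 p) (m≤n+m _ (X + X))) ∷ scaled-small s
  map-digits : ∀ ds -> map digitVal (map (_* R1) ds) ≡ map (Z.-_) (map Z.+_ ds)
  map-digits [] = refl
  map-digits (v ∷ ds) = cong2 _∷_ (digit-neg v) (map-digits ds)
 -- A letter carries one digit for each variable.
 digit : ℕ -> ℕ -> ℕ
 digit i u = iter (\ _ v -> v ÷ A) u i rem A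
 values : ∀ n -> List ℕ -> Vec ℤ n
 values zero w = []
 values (suc n) w = value-of (map (_rem A) w) ∷ values n (map (_÷ A) w)
 iter-shift : ∀ {S : Set} (f : S -> S) z n -> iter (\ _ v -> f v) z (suc n) ≡ iter (\ _ v -> f v) (f z) n
 iter-shift f z zero = refl
 iter-shift f z (suc n) = cong f (iter-shift f z n)
 lookup-values : ∀ {n} (i : Fin n) w -> lookup (values n w) i ≡ value-of (map (digit (toℕ i)) w)
 lookup-values zero w = refl
 lookup-values (suc i) w = tr (lookup-values i (map (_÷ A) w)) (cong value-of (tr (sym (map-∘ w)) (map-cong (\ u -> cong (_rem A) (sym (iter-shift (_÷ A) u (toℕ i)))) w)))
 -- The letter of outer variables u and m inner variables d.
 join : ℕ -> ℕ -> ℕ -> ℕ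
 join m d u = d + u * A ^ m
 join-rem : ∀ m d u -> join (suc m) d u rem A ≡ d rem A
 join-rem m d u = tr (cong (_rem A) (cong (d +_) (tr (cong (u *_) (*-comm A (A ^ m))) (sym (*-assoc u (A ^ m) A))))) (DM.[m+kn]%n≡m%n d (u * A ^ m) A)
 join-÷ : ∀ m d u -> join (suc m) d u ÷ A ≡ join m (d ÷ A) u
 join-÷ m d u = tr (cong (_÷ A) (cong (d +_) (tr (cong (u *_) (*-comm A (A ^ m))) (sym (*-assoc u (A ^ m) A)))))
  (tr (DM.+-distrib-/-∣ʳ d (DV.divides (u * A ^ m) refl)) (cong (d ÷ A +_) (DM.m*n/n≡m (u * A ^ m) A)))
 joins : ∀ m -> List ℕ -> List ℕ -> List ℕ
 joins m = List.zipWith (join m)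
 values-joins : ∀ m n ds w -> length ds ≡ length w -> All (_< A ^ m) ds -> values (m + n) (joins m ds w) ≡ values m ds Vec.++ values n w
 values-joins zero n ds w len small = cong (values n) (drop-zero ds w len small)
  where
  drop-zero : ∀ ds w -> length ds ≡ length w -> All (_< 1) ds -> joins 0 ds w ≡ w
  drop-zero [] [] _ _ = refl
  drop-zero (.0 ∷ ds) (u ∷ w) len (s≤s z≤n ∷ s) = cong2 _∷_ (*-identityʳ u) (drop-zero ds w (suc-injective len) s)
 values-joins (suc m) n ds w len small = cong2 _∷_ (cong value-of (map-rem ds w len)) (tr (cong (values (m + n)) (map-÷ ds w len))
   (values-joins m n (map (_÷ A) ds) w (tr (length-map _ ds) len) (shrunk small)))
  where
  map-rem : ∀ ds w -> length ds ≡ length w -> map (_rem A) (joins (suc m) ds w) ≡ map (_rem A) ds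
  map-rem [] [] _ = refl
  map-rem (d ∷ ds) (u ∷ w) len = cong2 _∷_ (join-rem m d u) (map-rem ds w (suc-injective len))
  map-÷ : ∀ ds w -> length ds ≡ length w -> map (_÷ A) (joins (suc m) ds w) ≡ joins m (map (_÷ A) ds) w
  map-÷ [] [] _ = refl
  map-÷ (d ∷ ds) (u ∷ w) len = cong2 _∷_ (join-÷ m d u) (map-÷ ds w (suc-injective len))
  shrunk : ∀ {ds} -> All (_< A * A ^ m) ds -> All (_< A ^ m) (map (_÷ A) ds)
  shrunk [] = []
  shrunk (p ∷ s) = DM.m<n*o⇒m/o<n (<-≤-trans p (≡⇒≤ (*-comm A (A ^ m)))) ∷ shrunk s
 join-small : ∀ m n {d u} -> d < A ^ m -> u < A ^ n -> join m d u < A ^ (m + n)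
 join-small m n {d} {u} d< u< = begin-strict d + u * A ^ m <⟨ +-monoˡ-< (u * A ^ m) d< ⟩ suc u * A ^ m ≤⟨ *-monoˡ-≤ (A ^ m) u< ⟩
  A ^ n * A ^ m ≡⟨ tr (*-comm (A ^ n) (A ^ m)) (sym (^-distribˡ-+-* A m n)) ⟩ A ^ (m + n) ∎
  where
   open ℕ.≤-Reasoning
 -- Every vector of integers has representations of all sufficiently large lengths.
 represents : ∀ m (xs : Vec ℤ m) -> ∃[ L0 ] (∀ L -> L0 ≤ L -> ∃[ ds ] (length ds ≡ L × All (_< A ^ m) ds × values m ds ≡ xs))
 represents zero [] = 0 , \ L _ -> replicate L 0 , length-replicate L , zeros L , refl
  where
  zeros : ∀ L -> All (_< 1) (replicate L 0)
  zeros zero = []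
  zeros (suc L) = s≤s z≤n ∷ zeros L
 represents (suc m) (x ∷ xs) with represents m xs
 ... | L0 , rep = Z.∣ x ∣ + L0 , \ L p -> combine' (represent x L (m+n≤o⇒m≤o Z.∣ x ∣ p)) (rep L (m+n≤o⇒n≤o Z.∣ x ∣ p))
  where
  combine' : ∀ {L} -> ∃[ ds ] (length ds ≡ L × All (_< A) ds × value-of ds ≡ x) -> ∃[ es ] (length es ≡ L × All (_< A ^ m) es × values m es ≡ xs) ->
   ∃[ fs ] (length fs ≡ L × All (_< A ^ suc m) fs × values (suc m) fs ≡ x ∷ xs)
  combine' {L} (ds , len , small , eq) (es , len' , small' , eq') = fs ds es , length-fs ds es len len' , small-fs small small' , cong2 _∷_
    (tr (cong value-of (rem-fs small es (tr len (sym len')))) eq) (tr (cong (values m) (÷-fs small es (tr len (sym len')))) eq')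
   where
   fs : List ℕ -> List ℕ -> List ℕ
   fs = List.zipWith (\ d e -> d + e * A)
   length-fs : ∀ ds es {L} -> length ds ≡ L -> length es ≡ L -> length (fs ds es) ≡ L
   length-fs [] [] refl _ = refl
   length-fs (d ∷ ds) (e ∷ es) refl le' = cong suc (length-fs ds es refl (suc-injective le'))
   small-fs : ∀ {ds es} -> All (_< A) ds -> All (_< A ^ m) es -> All (_< A ^ suc m) (fs ds es)
   small-fs [] _ = []
   small-fs (_ ∷ _) [] = []
   small-fs {d ∷ _} {e ∷ _} (p ∷ s) (p' ∷ s') = <-≤-trans (+-monoˡ-< (e * A) p) (≤-trans (*-monoˡ-≤ A p') (≡⇒≤ (*-comm (A ^ m) A))) ∷ small-fs s s'
   rem-fs : ∀ {ds} -> All (_< A) ds -> ∀ es -> length ds ≡ length es -> map (_rem A) (fs ds es) ≡ ds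
   rem-fs [] [] _ = refl
   rem-fs {d ∷ _} (p ∷ s) (e ∷ es) l = cong2 _∷_ (tr (DM.[m+kn]%n≡m%n d e A) (DM.m<n⇒m%n≡m p)) (rem-fs s es (suc-injective l))
   ÷-fs : ∀ {ds} -> All (_< A) ds -> ∀ es -> length ds ≡ length es -> map (_÷ A) (fs ds es) ≡ es
   ÷-fs [] [] _ = refl
   ÷-fs {d ∷ _} (p ∷ s) (e ∷ es) l = cong2 _∷_ (tr (DM.+-distrib-/-∣ʳ d (DV.divides e refl)) (cong2 _+_ (DM.m<n⇒m/n≡0 p) (DM.m*n/n≡m e A))) (÷-fs s es (suc-injective l))
 -- Leading zeros do not matter.
 zeros-joins : ∀ n k w -> values n (replicate k 0 ++ w) ≡ values n w
 zeros-joins zero k w = refl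
 zeros-joins (suc n) k w = cong2 _∷_ (tr (cong value-of (tr (map-++ (_rem A) (replicate k 0) w) (cong (_++ map (_rem A) w) (map-replicate (_rem A) k 0)))) (padded k (map (_rem A) w)))
  (tr (cong (values n) (tr (map-++ (_÷ A) (replicate k 0) w) (cong (_++ map (_÷ A) w) (map-replicate (_÷ A) k 0)))) (zeros-joins n k (map (_÷ A) w)))
  where
  padded : ∀ k ds -> value-of (replicate k 0 ++ ds) ≡ value-of ds
  padded zero ds = refl
  padded (suc k) ds = tr (Z.+-identityˡ _) (padded k ds)

-- Multiplication by β with rounding to a bounded range

record Setting : Set where
 field
  D X Y : ℕ
  pell : X * X ≡ 1 + D * (Y * Y)
  2<=X : 2 ≤ X
  1<=Y : 1 ≤ Y
  1<=D : 1 ≤ D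
  total : ∀ P Q -> Sign.nnR D P Q ≡ false -> Sign.nnR D (Z.- P) (Z.- Q) ≡ true × (P ≢ 0ℤ ⊎ Q ≢ 0ℤ)
  antisym : ∀ P Q -> Sign.nnR D P Q ≡ true -> Sign.nnR D (Z.- P) (Z.- Q) ≡ true -> P ≡ 0ℤ × Q ≡ 0ℤ
  add : ∀ P Q P' Q' -> Sign.nnR D P Q ≡ true -> Sign.nnR D P' Q' ≡ true -> Sign.nnR D (P Z.+ P') (Q Z.+ Q') ≡ true

-- Identities in the additive group ℤ√.
module Additive where
 open Z-Solver
 ⊕-comm : ∀ z w -> z ⊕ w ≡ w ⊕ z
 ⊕-comm (a , b) (c , d) = cong2 _,_ (Z.+-comm a c) (Z.+-comm b d)
 ⊕-0 : ∀ z -> z ⊕ 0R ≡ z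
 ⊕-0 (a , b) = cong2 _,_ (Z.+-identityʳ a) (Z.+-identityʳ b)
 0-⊝ : ∀ z -> 0R ⊝ z ≡ ⊝ z
 0-⊝ (a , b) = cong2 _,_ (Z.+-identityˡ _) (Z.+-identityˡ _)
 ⊝-involutive : ∀ z -> ⊝ (⊝ z) ≡ z
 ⊝-involutive (a , b) = cong2 _,_ (Z.neg-involutive a) (Z.neg-involutive b)
 ⊝-⊕ : ∀ z w -> ⊝ (z ⊕ w) ≡ ⊝ z ⊕ ⊝ w
 ⊝-⊕ (a , b) (c , d) = cong2 _,_ (Z.neg-distrib-+ a c) (Z.neg-distrib-+ b d)
 ⊕-cancel : ∀ z -> (z ⊕ z) ⊕ ⊝ z ≡ z
 ⊕-cancel (a , b) = cong2 _,_ (lemma a) (lemma b)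
  where
  lemma : ∀ a -> (a Z.+ a) Z.- a ≡ a
  lemma = solve 1 (\ a -> (a :+ a) :- a := a) refl
 ⊝-⊕-⊝ : ∀ z w -> (z ⊕ z) ⊝ (w ⊕ w) ≡ (z ⊝ w) ⊕ (z ⊝ w)
 ⊝-⊕-⊝ (a , b) (c , d) = cong2 _,_ (lemma a c) (lemma b d)
  where
  lemma : ∀ a c -> (a Z.+ a) Z.- (c Z.+ c) ≡ (a Z.- c) Z.+ (a Z.- c)
  lemma = solve 2 (\ a c -> (a :+ a) :- (c :+ c) := (a :- c) :+ (a :- c)) refl
 double-zero : ∀ z -> z ⊕ z ≡ 0R -> z ≡ 0R
 double-zero (a , b) e = cong2 _,_ (halve a (cong fst e)) (halve b (cong snd e))
  where
  halve : ∀ a -> a Z.+ a ≡ 0ℤ -> a ≡ 0ℤ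
  halve (Z.+ zero) _ = refl
 act-⊕ : ∀ D c g z w -> actR D c g (z ⊕ w) ≡ actR D c g z ⊕ actR D c g w
 act-⊕ D c g (a , b) (p , q) = cong2 _,_ (solve 7 (\ d c g a b p q -> c :* (a :+ p) :+ d :* g :* (b :+ q) := (c :* a :+ d :* g :* b) :+ (c :* p :+ d :* g :* q)) refl (Z.+ D) c g a b p q)
  (solve 6 (\ c g a b p q -> g :* (a :+ p) :+ c :* (b :+ q) := (g :* a :+ c :* b) :+ (g :* p :+ c :* q)) refl c g a b p q)
 act-⊝ : ∀ D c g z -> actR D c g (⊝ z) ≡ ⊝ actR D c g z
 act-⊝ D c g (a , b) = cong2 _,_ (solve 5 (\ d c g a b -> c :* (:- a) :+ d :* g :* (:- b) := :- (c :* a :+ d :* g :* b)) refl (Z.+ D) c g a b)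
  (solve 4 (\ c g a b -> g :* (:- a) :+ c :* (:- b) := :- (g :* a :+ c :* b)) refl c g a b)
 act-0 : ∀ D c g -> actR D c g 0R ≡ 0R
 act-0 D c g = cong2 _,_ (cong2 Z._+_ (Z.*-zeroʳ c) (Z.*-zeroʳ (Z.+ D Z.* g))) (cong2 Z._+_ (Z.*-zeroʳ g) (Z.*-zeroʳ c))
 conj-act : ∀ D c g z -> conj (actR D c g z) ≡ actR D c (Z.- g) (conj z)
 conj-act D c g (a , b) = cong2 _,_ (solve 5 (\ d c g a b -> c :* a :+ d :* g :* b := c :* a :+ d :* (:- g) :* (:- b)) refl (Z.+ D) c g a b)
  (solve 4 (\ c g a b -> :- (g :* a :+ c :* b) := (:- g) :* a :+ c :* (:- b)) refl c g a b)
 conj-⊕ : ∀ z w -> conj (z ⊕ w) ≡ conj z ⊕ conj w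
 conj-⊕ (a , b) (c , d) = cong (a Z.+ c ,_) (Z.neg-distrib-+ b d)
 inverse-act : ∀ D c g z -> c Z.* c Z.- Z.+ D Z.* (g Z.* g) ≡ 1ℤ -> actR D c (Z.- g) (actR D c g z) ≡ z
 inverse-act D c g (a , b) e = cong2 _,_ (tr (solve 5 (\ d c g a b -> c :* (c :* a :+ d :* g :* b) :+ d :* (:- g) :* (g :* a :+ c :* b) :=
   (c :* c :- d :* (g :* g)) :* a) refl (Z.+ D) c g a b) (unit a)) (tr (solve 5 (\ d c g a b -> (:- g) :* (c :* a :+ d :* g :* b) :+ c :* (g :* a :+ c :* b) :=
   (c :* c :- d :* (g :* g)) :* b) refl (Z.+ D) c g a b) (unit b))
  where
  unit : ∀ r -> (c Z.* c Z.- Z.+ D Z.* (g Z.* g)) Z.* r ≡ r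
  unit r = tr (cong (Z._* r) e) (Z.*-identityˡ r)

module Clipped (setting : Setting) where
 open Setting setting public
 open Order D total antisym add public
 open Weights D X Y pell 2<=X public
 open Additive public
 x y : ℤ
 x = Z.+ X
 y = Z.+ Y
 β-≼ : ∀ {z w} -> z ≼ w -> β z ≼ β w
 β-≼ = ≼-act 1<=D X Y
 β̄-β : ∀ z -> β̄ (β z) ≡ z
 β̄-β z = inverse-act D x y z unit
  where
  unit : x Z.* x Z.- Z.+ D Z.* (y Z.* y) ≡ 1ℤ
  unit = tr (cong (\ h -> x Z.* x Z.- Z.+ D Z.* (Z.+ h Z.* Z.+ h)) (sym (*-identityʳ Y))) (norm 0)
 β-β̄ : ∀ z -> β (β̄ z) ≡ z
 β-β̄ z = tr (cong (\ h -> actR D x h (β̄ z)) (sym (Z.neg-involutive y))) (inverse-act D x (Z.- y) z (tr (cong (\ h -> x Z.* x Z.- Z.+ D Z.* h) (square y)) unit))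
  where
  open Z-Solver
  square : ∀ y -> Z.- y Z.* Z.- y ≡ y Z.* y
  square = solve 1 (\ y -> :- y :* :- y := y :* y) refl
  unit : x Z.* x Z.- Z.+ D Z.* (y Z.* y) ≡ 1ℤ
  unit = tr (cong (\ h -> x Z.* x Z.- Z.+ D Z.* (Z.+ h Z.* Z.+ h)) (sym (*-identityʳ Y))) (norm 0)
 nonneg-absurd : ∀ {z} -> nnR' z ≡ false -> z ≢ 0R
 nonneg-absurd e refl = case e of \ ()
 nonneg-¬ : ∀ z -> nnR' z ≡ false -> Nonneg (⊝ z)
 nonneg-¬ z e = test (fst (total (fst z) (snd z) e))
 -- A linear map that preserves nonnegativity and is injective reflects it.
 reflects : ∀ (f : ZR -> ZR) -> (∀ {z} -> Nonneg z -> Nonneg (f z)) -> (∀ z -> f (⊝ z) ≡ ⊝ f z) -> (∀ {z} -> f z ≡ 0R -> z ≡ 0R) -> ∀ {z} -> Nonneg (f z) -> Nonneg z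
 reflects f mono odd inj {z} n with nonneg? z
 ... | in1 p = p
 ... | in2 e = contradiction (inj (nonneg-antisym n (nn-cong (odd z) (mono (nonneg-¬ z e))))) (nonneg-absurd e)
 nonneg-β̄ : ∀ {z} -> Nonneg z -> Nonneg (β̄ z)
 nonneg-β̄ {z} n = reflects β (nonneg-act 1<=D X Y) (act-⊝ D x y) (\ {w} e -> tr (sym (β̄-β w)) (tr (cong β̄ e) (act-0 D x (Z.- y)))) (nn-cong (sym (β-β̄ z)) n)
 β̄-⊝ : ∀ z w -> β̄ (z ⊝ w) ≡ β̄ z ⊝ β̄ w
 β̄-⊝ z w = tr (act-⊕ D x (Z.- y) z (⊝ w)) (cong (β̄ z ⊕_) (act-⊝ D x (Z.- y) w))
 β̄-≼ : ∀ {z w} -> z ≼ w -> β̄ z ≼ β̄ w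
 β̄-≼ {z} {w} (above n) = above (nn-cong (β̄-⊝ w z) (nonneg-β̄ n))
 -- Bounds such as β⁻¹ ≤ ½ are stated for doubles, since ℤ[√D] has no halves.
 halve-≼ : ∀ {z w} -> z ⊕ z ≼ w ⊕ w -> z ≼ w
 halve-≼ {z} {w} (above n) = above (reflects (\ u -> u ⊕ u) (\ p -> nonneg-⊕ p p) (\ u -> sym (⊝-⊕ u u)) (\ {u} -> double-zero u) (nn-cong (⊝-⊕-⊝ w z) n))
 -- `E` bounds what one letter adds. With `B` = 2 E and β ≥ 2, values from `B` up stay there, since
 -- 2 B - E ≥ B, and so do values from - B down. Conjugates stay within `B`, since they are
 -- multiplied by β⁻¹ ≤ ½ and B / 2 + E = B.
 module Bound (E : ℕ) where
  B : ℕ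
  B = E + E
  cE cB : ZR
  cE = constR E
  cB = constR B
  cE⊕cE : cE ⊕ cE ≡ cB
  cE⊕cE = cong (_, 0ℤ) (sym (Z.pos-+ E E))
  2cB≼βcB : cB ⊕ cB ≼ β cB
  2cB≼βcB = above (nn-cong (cong2 _,_ gap1 gap2) (test {Z.+ ((X ∸ 2) * B) , Z.+ (Y * B)} refl))
   where
   open Z-Solver
   gap1 : Z.+ ((X ∸ 2) * B) ≡ (x Z.* Z.+ B Z.+ Z.+ D Z.* y Z.* 0ℤ) Z.- (Z.+ B Z.+ Z.+ B)
   gap1 = tr (Z.pos-* (X ∸ 2) B) (tr (cong (Z._* Z.+ B) (tr (sym (Z.⊖-≥ 2<=X)) (sym (Z.m-n≡m⊖n X 2))))
    (solve 4 (\ x b d y -> (x :- con (Z.+ 2)) :* b := (x :* b :+ d :* y :* con 0ℤ) :- (b :+ b)) refl x (Z.+ B) (Z.+ D) y))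
   gap2 : Z.+ (Y * B) ≡ (y Z.* Z.+ B Z.+ x Z.* 0ℤ) Z.- 0ℤ
   gap2 = tr (Z.pos-* Y B) (solve 3 (\ y b x -> y :* b := (y :* b :+ x :* con 0ℤ) :- con 0ℤ) refl y (Z.+ B) x)
  2β̄cB≼cB : β̄ cB ⊕ β̄ cB ≼ cB
  2β̄cB≼cB = subst2 _≼_ (act-⊕ D x (Z.- y) cB cB) (β̄-β cB) (β̄-≼ 2cB≼βcB)
  cE≼cB : cE ≼ cB
  cE≼cB = subst2 _≼_ (⊕-0 cE) cE⊕cE (≼-⊕ (≼-refl {cE}) (nn=>0≼ (nn-const E)))
  -cB≼-cE : ⊝ cB ≼ ⊝ cE
  -cB≼-cE = ≼-⊝ cE≼cB
  -cB≼cB : ⊝ cB ≼ cB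
  -cB≼cB = ≼-trans (subst (⊝ cB ≼_) refl (≼-⊝ (nn=>0≼ (nn-const B)))) (nn=>0≼ (nn-const B))
  -- The conditions on a run are only inequalities from above, so lowering a value to `B` is always
  -- permitted.
  clip : ZR -> ZR
  clip z = if leq cB z then cB else z
  clip-below : ∀ z -> clip z ≼ z
  clip-below z with leq cB z in e
  ... | true = leq=>≼ cB z e
  ... | false = ≼-refl
  stepR : ZR -> ZR -> ZR
  stepR z f = clip (β z ⊕ f)
  step-below : ∀ z f -> stepR z f ≼ β z ⊕ f
  step-below z f = clip-below (β z ⊕ f)
  step-up : ∀ {f} -> Boxed E f -> stepR cB f ≡ cB
  step-up {f} small = cong (if_then cB else (β cB ⊕ f)) (≼=>leq (subst (_≼ β cB ⊕ f) (⊕-cancel cB) (≼-⊕ 2cB≼βcB (≼-trans -cB≼-cE (Boxed.lower small)))))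
  step-down : ∀ {z f} -> Boxed E f -> z ≼ ⊝ cB -> stepR z f ≼ ⊝ cB
  step-down {z} {f} small z≼ = ≼-trans (step-below z f) (subst (β z ⊕ f ≼_) cancelled (≼-⊕ (≼-trans (subst (β z ≼_) (act-⊝ D x y cB) (β-≼ z≼)) (≼-⊝ 2cB≼βcB)) (≼-trans (Boxed.upper small) cE≼cB)))
   where
   cancelled : ⊝ (cB ⊕ cB) ⊕ cB ≡ ⊝ cB
   cancelled = tr (cong (_⊕ cB) (⊝-⊕ cB cB)) (tr (cong ((⊝ cB ⊕ ⊝ cB) ⊕_) (sym (⊝-involutive cB))) (⊕-cancel (⊝ cB)))
  -- Rounding never yields a third kind of value: once at `B`, the rounded sequence remains there by
  -- `step-up`.
  step-track : ∀ {ẑ z f} -> Boxed E f -> ẑ ≡ z ⊎ ẑ ≡ cB -> stepR ẑ f ≡ β z ⊕ f ⊎ stepR ẑ f ≡ cB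
  step-track {z = z} {f} small (in1 refl) with leq cB (β z ⊕ f)
  ... | true = in2 refl
  ... | false = in1 refl
  step-track small (in2 refl) = in2 (step-up small)
  -- The bounds that hold along every clipped sequence. The missing lower bound on the value itself
  -- depends on the truth of the inequality.
  record Good (z : ZR) : Set where
   field
    upper : z ≼ cB
    upper' : conj z ≼ cB
    lower' : ⊝ cB ≼ conj z
  good-0 : Good 0R
  good-0 = record { upper = nn=>0≼ (nn-const B) ; upper' = nn=>0≼ (nn-const B) ; lower' = ≼-⊝ (nn=>0≼ (nn-const B)) }
  good-cB : Good cB
  good-cB = record { upper = ≼-refl ; upper' = ≼-refl ; lower' = -cB≼cB }
  step-good : ∀ {z f} -> Boxed E f -> Good z -> Good (stepR z f)
  step-good {z} {f} small good with leq cB (β z ⊕ f) in e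
  ... | true = good-cB
  ... | false = record { upper = ≼-total cB (β z ⊕ f) e ; upper' = subst (_≼ cB) (sym conjugate) (halve-≼ (subst (_≼ cB ⊕ cB) (swap (β̄ z̄) f̄)
    (≼-⊕ (≼-trans (≼-⊕ (β̄-≼ (Good.upper' good)) (β̄-≼ (Good.upper' good))) 2β̄cB≼cB) (subst (f̄ ⊕ f̄ ≼_) cE⊕cE (≼-⊕ (Boxed.upper' small) (Boxed.upper' small))))))
   ; lower' = subst (⊝ cB ≼_) (sym conjugate) (halve-≼ (subst (⊝ cB ⊕ ⊝ cB ≼_) (swap (β̄ z̄) f̄)
    (≼-⊕ (≼-trans (≼-⊝ 2β̄cB≼cB) (subst (_≼ β̄ z̄ ⊕ β̄ z̄) negated (≼-⊕ (β̄-≼ (Good.lower' good)) (β̄-≼ (Good.lower' good)))))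
     (subst (_≼ f̄ ⊕ f̄) (tr (sym (⊝-⊕ cE cE)) (cong ⊝_ cE⊕cE)) (≼-⊕ (Boxed.lower' small) (Boxed.lower' small)))))) }
   where
   z̄ f̄ : ZR
   z̄ = conj z
   f̄ = conj f
   conjugate : conj (β z ⊕ f) ≡ β̄ z̄ ⊕ f̄
   conjugate = tr (conj-⊕ (β z) f) (cong (_⊕ f̄) (conj-act D x y z))
   swap : ∀ u v -> (u ⊕ u) ⊕ (v ⊕ v) ≡ (u ⊕ v) ⊕ (u ⊕ v)
   swap (a , b) (c , d) = cong2 _,_ (lemma a c) (lemma b d)
    where
    open Z-Solver
    lemma : ∀ a c -> (a Z.+ a) Z.+ (c Z.+ c) ≡ (a Z.+ c) Z.+ (a Z.+ c)
    lemma = solve 2 (\ a c -> (a :+ a) :+ (c :+ c) := (a :+ c) :+ (a :+ c)) refl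
   negated : β̄ (⊝ cB) ⊕ β̄ (⊝ cB) ≡ ⊝ (β̄ cB ⊕ β̄ cB)
   negated = tr (cong2 _⊕_ (act-⊝ D x (Z.- y) cB) (act-⊝ D x (Z.- y) cB)) (sym (⊝-⊕ (β̄ cB) (β̄ cB)))

-- One linear inequality.  A word is read from its least significant letter on,
-- while t guesses the value of the letters still to come, in powers of β, and r
-- subtracts the letters read, in powers of β⁻¹, everything only up to ≼.
module Inequalities (setting : Setting) where
 open Clipped setting public
 cond : Bool -> ZR -> Bool
 cond strict z = if strict then Bool.not (leq z 0R) else leq 0R z
 -- Opaque, because unfolding these tests on concrete arguments is costly.
 abstract
  initial? : ZR -> ZR -> ZR -> Bool
  initial? b t r = leq r (β (β t ⊝ Z b))
  next? : ZR -> ZR -> ZR -> ZR -> ZR -> Bool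
  next? e t r t' r' = leq t (β t' ⊕ e) ∧ leq r' (β (r ⊝ e))
  final? : Bool -> ZR -> ZR -> Bool
  final? strict t r = leq t 0R ∧ cond strict r
  initial?-def : ∀ b t r -> initial? b t r ≡ leq r (β (β t ⊝ Z b))
  initial?-def b t r = refl
  next?-def : ∀ e t r t' r' -> next? e t r t' r' ≡ leq t (β t' ⊕ e) ∧ leq r' (β (r ⊝ e))
  next?-def e t r t' r' = refl
  final?-def : ∀ strict t r -> final? strict t r ≡ leq t 0R ∧ cond strict r
  final?-def strict t r = refl
 ∧-split : ∀ {a b} -> a ∧ b ≡ true -> a ≡ true × b ≡ true
 ∧-split {true} {true} _ = refl , refl
 ∧-join : ∀ {a b} -> a ≡ true -> b ≡ true -> a ∧ b ≡ true
 ∧-join refl refl = refl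
 bool-= : ∀ {a b} -> (a ≡ true -> b ≡ true) -> (b ≡ true -> a ≡ true) -> a ≡ b
 bool-= {false} {false} f g = refl
 bool-= {true} {b} f g = sym (f refl)
 bool-= {false} {true} f g = g refl
 module Atom (e : ℕ -> ZR) (b : ZR) where
  total-val : List ℕ -> ZR
  total-val [] = ⊝ b
  total-val (u ∷ w) = total-val w ⊕ scaleR (Z.+ U (length w)) (e u)
  data Run : List ℕ -> ZR -> ZR -> Set where
   start : ∀ {t r} -> initial? b t r ≡ true -> Run [] t r
   next : ∀ {u w t r t' r'} -> Run w t r -> next? (e u) t r t' r' ≡ true -> Run (u ∷ w) t' r'
  P : ℕ -> ZR -> ZR
  P = powerR
  P-⊕ : ∀ k z w -> P k (z ⊕ w) ≡ P k z ⊕ P k w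
  P-⊕ k z w = act-⊕ D (Z.+ c k) (Z.+ g k) z w
  P-0 : ∀ k -> P k 0R ≡ 0R
  P-0 k = act-0 D (Z.+ c k) (Z.+ g k)
  -- The quantity that r approximates.
  target : List ℕ -> ZR -> ZR
  target w t = P (length w) (Z (total-val w)) ⊕ P (length w) (P (length w) t)
  target-[] : ∀ t -> β (β t ⊝ Z b) ≡ target [] t
  target-[] t = begin β (β t ⊝ Z b) ≡⟨ act-⊕ D x y (β t) (⊝ Z b) ⟩ β (β t) ⊕ β (⊝ Z b) ≡⟨ ⊕-comm (β (β t)) (β (⊝ Z b)) ⟩ β (⊝ Z b) ⊕ β (β t) ≡⟨ cong2 (\ v w -> β v ⊕ w) (sym (act-⊝ D 0ℤ (y Z.+ y) b))
    (tr (cong β (sym (power-zero t))) (sym (power-zero (P 0 t)))) ⟩ β (Z (⊝ b)) ⊕ P 0 (P 0 t) ≡⟨ cong (_⊕ P 0 (P 0 t)) (sym (power-zero (Z (⊝ b)))) ⟩ P 0 (Z (⊝ b)) ⊕ P 0 (P 0 t) ∎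
   where
    open ≡-Reasoning
  -- Let k be the length of `w`. The condition t = β t' + e moves β²ᵏ⁺² e out of t. By `Z-power`
  -- this is the weighted letter, multiplied by (β - β⁻¹) βᵏ⁺¹, plus a remainder e, and the
  -- remainder is what the automaton subtracts from r.
  target-:: : ∀ u w t' -> β (target w (β t' ⊕ e u) ⊝ e u) ≡ target (u ∷ w) t'
  target-:: u w t' = begin β ((Pk (Z S) ⊕ Pk (Pk (β t' ⊕ e u))) ⊝ e u) ≡⟨ cong (\ v -> β ((Pk (Z S) ⊕ v) ⊝ e u)) (tr (cong Pk (P-⊕ k (β t') (e u))) (P-⊕ k (Pk (β t')) (Pk (e u)))) ⟩
   β ((Pk (Z S) ⊕ (Pk (Pk (β t')) ⊕ Pk (Pk (e u)))) ⊝ e u) ≡⟨ cong β (rearrange (Pk (Z S)) (Pk (Pk (β t'))) (Pk (Pk (e u))) (e u)) ⟩ β ((Pk (Z S) ⊕ (Pk (Pk (e u)) ⊝ e u)) ⊕ Pk (Pk (β t')))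
    ≡⟨ cong (\ v -> β ((Pk (Z S) ⊕ v) ⊕ Pk (Pk (β t')))) (sym (Z-power k (e u))) ⟩ β ((Pk (Z S) ⊕ Pk (Z (scaleR (Z.+ U k) (e u)))) ⊕ Pk (Pk (β t')))
    ≡⟨ cong (\ v -> β (v ⊕ Pk (Pk (β t')))) (sym (tr (cong Pk (act-⊕ D 0ℤ (y Z.+ y) S Ue)) (P-⊕ k (Z S) (Z Ue)))) ⟩ β (Pk (Z S') ⊕ Pk (Pk (β t'))) ≡⟨ act-⊕ D x y (Pk (Z S')) (Pk (Pk (β t'))) ⟩
   β (Pk (Z S')) ⊕ β (Pk (Pk (β t'))) ≡⟨ cong2 _⊕_ (sym (power-suc k (Z S'))) (tr (cong (β ∘ Pk) (tr (sym (β-power k t')) (sym (power-suc k t')))) (sym (power-suc k (P (suc k) t')))) ⟩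
   P (suc k) (Z S') ⊕ P (suc k) (P (suc k) t') ∎
   where
   open ≡-Reasoning
   k = length w
   Pk = P k
   S = total-val w
   Ue = scaleR (Z.+ U k) (e u)
   S' = total-val (u ∷ w)
   rearrange : ∀ a b c d -> (a ⊕ (b ⊕ c)) ⊝ d ≡ (a ⊕ (c ⊝ d)) ⊕ b
   rearrange (a , a') (b , b') (c , c') (d , d') = cong2 _,_ (lemma a b c d) (lemma a' b' c' d')
    where
    open Z-Solver
    lemma : ∀ a b c d -> (a Z.+ (b Z.+ c)) Z.- d ≡ (a Z.+ (c Z.- d)) Z.+ b
    lemma = solve 4 (\ a b c d -> (a :+ (b :+ c)) :- d := (a :+ (c :- d)) :+ b) refl
  P-≼ : ∀ k {z w} -> z ≼ w -> P k z ≼ P k w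
  P-≼ k = ≼-act 1<=D (c k) (g k)
  target-≼ : ∀ w {t t'} -> t ≼ t' -> target w t ≼ target w t'
  target-≼ w {t} {t'} t≼ = ≼-⊕ {PZw} {PZw} {P k (P k t)} {P k (P k t')} ≼-refl (P-≼ k (P-≼ k t≼))
   where
   k = length w
   PZw = P k (Z (total-val w))
  invariant : ∀ {w t r} -> Run w t r -> r ≼ target w t
  invariant (start {t} {r} i) = ≼-trans (leq=>≼ r (β (β t ⊝ Z b)) (tr (sym (initial?-def b t r)) i)) (≼-reflexive (target-[] t))
  invariant (next {u} {w} {t} {r} {t'} {r'} run n) = ≼-trans (leq=>≼ r' (β (r ⊝ e u)) (snd (∧-split n'))) (≼-trans (β-≼ inner) (≼-reflexive (target-:: u w t')))
   where
   n' = tr (sym (next?-def (e u) t r t' r')) n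
   inner : r ⊝ e u ≼ target w (β t' ⊕ e u) ⊝ e u
   inner = ≼-⊕ {r} {target w (β t' ⊕ e u)} {⊝ e u} {⊝ e u} (≼-trans (invariant run) (target-≼ w (leq=>≼ t (β t' ⊕ e u) (fst (∧-split n'))))) ≼-refl
  Z-nonneg : ∀ {z} -> Nonneg z -> Nonneg (Z z)
  Z-nonneg {p , q} n = nn-cong (cong (\ h -> actR D 0ℤ h (p , q)) (Z.pos-+ Y Y)) (nonneg-act 1<=D 0 (Y + Y) n)
  PZ : ℕ -> ZR -> ZR
  PZ k z = P k (Z z)
  PZ-nonneg : ∀ k {z} -> Nonneg z -> Nonneg (PZ k z)
  PZ-nonneg k n = nonneg-act 1<=D (c k) (g k) (Z-nonneg n)
  PZ-⊝ : ∀ k z -> PZ k (⊝ z) ≡ ⊝ PZ k z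
  PZ-⊝ k z = tr (cong (P k) (act-⊝ D 0ℤ (y Z.+ y) z)) (act-⊝ D (Z.+ c k) (Z.+ g k) (Z z))
  Z-injective : ∀ {z} -> Z z ≡ 0R -> z ≡ 0R
  Z-injective {p , q} e = cong2 _,_ p≡0 q=0
   where
   2y/=0 : y Z.+ y ≢ 0ℤ
   2y/=0 z = <⇒≢ (<-≤-trans 1<=Y (m≤m+n Y Y)) (sym (Z.+-injective (tr (Z.pos-+ Y Y) z)))
   D2y/=0 : Z.+ D Z.* (y Z.+ y) ≢ 0ℤ
   D2y/=0 z = Sum.[ (\ d -> <⇒≢ 1<=D (sym (Z.+-injective d))) , 2y/=0 ] (Z.i*j≡0⇒i≡0∨j≡0 (Z.+ D) z)
   p≡0 : p ≡ 0ℤ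
   p≡0 = Sum.[ (\ z -> contradiction z 2y/=0) , id ] (Z.i*j≡0⇒i≡0∨j≡0 (y Z.+ y) (tr (sym (tr (cong (\ z -> (y Z.+ y) Z.* p Z.+ z) (Z.*-zeroˡ q)) (Z.+-identityʳ _))) (cong snd e)))
   q=0 : q ≡ 0ℤ
   q=0 = Sum.[ (\ z -> contradiction z D2y/=0) , id ]
    (Z.i*j≡0⇒i≡0∨j≡0 (Z.+ D Z.* (y Z.+ y)) (tr (sym (tr (cong (\ z -> z Z.+ Z.+ D Z.* (y Z.+ y) Z.* q) (Z.*-zeroˡ p)) (Z.+-identityˡ _))) (cong fst e)))
  PZ-injective : ∀ k {z} -> PZ k z ≡ 0R -> z ≡ 0R
  PZ-injective k {z} e = Z-injective (tr (sym (inverse-act D (Z.+ c k) (Z.+ g k) (Z z) (norm k))) (tr (cong (actR D (Z.+ c k) (Z.- Z.+ g k)) e) (act-0 D (Z.+ c k) (Z.- Z.+ g k))))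
  PZ-reflects : ∀ k {z} -> Nonneg (PZ k z) -> Nonneg z
  PZ-reflects k = reflects (PZ k) (PZ-nonneg k) (PZ-⊝ k) (PZ-injective k)
  ≼0=>nonneg : ∀ {z} -> z ≼ 0R -> Nonneg (⊝ z)
  ≼0=>nonneg {z} (above n) = nn-cong (0-⊝ z) n
  nonneg=>≼0 : ∀ {z} -> Nonneg (⊝ z) -> z ≼ 0R
  nonneg=>≼0 {z} n = above (nn-cong (sym (0-⊝ z)) n)
  -- Replacing a value by its image under PZ, or by a larger one.
  cond-PZ : ∀ k s z -> cond s (PZ k z) ≡ cond s z
  cond-PZ k false z = bool-= (\ p -> ≼=>leq (nn=>0≼ (PZ-reflects k (0≼=>nonneg (leq=>≼ 0R (PZ k z) p))))) (\ p -> ≼=>leq (nn=>0≼ (PZ-nonneg k (0≼=>nonneg (leq=>≼ 0R z p)))))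
  cond-PZ k true z = cong Bool.not (bool-= (\ p -> ≼=>leq (nonneg=>≼0 (PZ-reflects k (nn-cong (sym (PZ-⊝ k z)) (≼0=>nonneg (leq=>≼ (PZ k z) 0R p))))))
   (\ p -> ≼=>leq (nonneg=>≼0 (nn-cong (PZ-⊝ k z) (PZ-nonneg k (≼0=>nonneg (leq=>≼ z 0R p)))))))
  cond-≼ : ∀ s {z w} -> z ≼ w -> cond s z ≡ true -> cond s w ≡ true
  cond-≼ false {z} {w} z≼w p = ≼=>leq (≼-trans (leq=>≼ 0R z p) z≼w)
  cond-≼ true {z} {w} z≼w p with leq w 0R in e
  ... | false = refl
  ... | true = tr (cong Bool.not (sym (≼=>leq (≼-trans z≼w (leq=>≼ w 0R e))))) p
  -- At the end t ≼ 0, so r is at most the total value times a power of β and β - β⁻¹. This factor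
  -- is positive, hence preserves and reflects the condition, and the condition passes upwards.
  sound : ∀ s {w t r} -> Run w t r -> final? s t r ≡ true -> cond s (total-val w) ≡ true
  sound s {w} {t} {r} run fin = tr (sym (cond-PZ k s (total-val w))) (cond-≼ s (≼-trans (invariant run) below-target) (snd (∧-split fin')))
   where
   k = length w
   fin' = tr (sym (final?-def s t r)) fin
   below-target : target w t ≼ PZ k (total-val w)
   below-target = subst (target w t ≼_) (tr (cong (PZ k (total-val w) ⊕_) (tr (cong (P k) (P-0 k)) (P-0 k))) (⊕-0 (PZ k (total-val w)))) (target-≼ w (leq=>≼ t 0R (fst (∧-split fin'))))
  module Complete (E : ℕ) (1<=E : 1 ≤ E) (small : ∀ u -> Boxed E (e u)) (small-β : ∀ u -> Boxed E (⊝ β (e u))) (small-b : Boxed E (⊝ β (Z b))) where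
   open Bound E
   boxed-0 : Boxed E 0R
   boxed-0 = record { upper = nn=>0≼ (nn-const E) ; lower = ≼-⊝ (nn=>0≼ (nn-const E)) ; upper' = nn=>0≼ (nn-const E) ; lower' = ≼-⊝ (nn=>0≼ (nn-const E)) }
   -- hi lists the letters still to come, the next one first.
   upperOf : List ℕ -> ZR
   upperOf [] = 0R
   upperOf (u ∷ hi) = stepR (upperOf hi) (e u)
   lowerOf : ZR -> List ℕ -> ZR
   -- Two rounded steps, the first with no letter, because `initial?` multiplies t by β twice.
   lowerOf t [] = stepR (stepR t 0R) (⊝ β (Z b))
   lowerOf t (u ∷ lo) = stepR (lowerOf t lo) (⊝ β (e u))
   β-⊝ : ∀ z w -> β z ⊕ ⊝ β w ≡ β (z ⊝ w)
   β-⊝ z w = sym (tr (act-⊕ D x y z (⊝ w)) (cong (β z ⊕_) (act-⊝ D x y w)))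
   initial-step : ∀ t -> stepR (stepR t 0R) (⊝ β (Z b)) ≼ β (β t ⊝ Z b)
   initial-step t = ≼-trans {y = β (stepR t 0R) ⊕ ⊝ β (Z b)} (step-below (stepR t 0R) (⊝ β (Z b))) (subst (_≼ β (β t ⊝ Z b)) (sym (β-⊝ (stepR t 0R) (Z b))) (β-≼ inner))
    where
    inner : stepR t 0R ⊝ Z b ≼ β t ⊝ Z b
    inner = ≼-⊕ (subst (stepR t 0R ≼_) (⊕-0 (β t)) (step-below t 0R)) (≼-refl {⊝ Z b})
   next-step : ∀ u r -> stepR r (⊝ β (e u)) ≼ β (r ⊝ e u)
   next-step u r = subst (stepR r (⊝ β (e u)) ≼_) (β-⊝ r (e u)) (step-below r (⊝ β (e u)))
   exact-upper : List ℕ -> ZR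
   exact-upper [] = 0R
   exact-upper (u ∷ hi) = β (exact-upper hi) ⊕ e u
   exact-lower : ZR -> List ℕ -> ZR
   exact-lower t [] = β (β t ⊕ 0R) ⊕ ⊝ β (Z b)
   exact-lower t (u ∷ lo) = β (exact-lower t lo) ⊕ ⊝ β (e u)
   track-upper : ∀ hi -> upperOf hi ≡ exact-upper hi ⊎ upperOf hi ≡ cB
   track-upper [] = in1 refl
   track-upper (u ∷ hi) = step-track (small u) (track-upper hi)
   track-lower : ∀ lo {t z} -> t ≡ z ⊎ t ≡ cB -> lowerOf t lo ≡ exact-lower z lo ⊎ lowerOf t lo ≡ cB
   track-lower [] tr = step-track small-b (step-track boxed-0 tr)
   track-lower (u ∷ lo) tr = step-track (small-β u) (track-lower lo tr)
   exact : ∀ lo hi {t0} -> exact-upper (lo ʳ++ hi) ≡ t0 -> exact-lower t0 lo ≡ target lo (exact-upper hi)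
   exact [] hi refl = tr (β-⊝ (β t ⊕ 0R) (Z b)) (tr (cong (\ v -> β (v ⊝ Z b)) (⊕-0 (β t))) (target-[] t))
    where
       t = exact-upper hi
   exact (u ∷ lo) hi {t0} eq = tr (β-⊝ (exact-lower t0 lo) (e u)) (tr (cong (\ v -> β (v ⊝ e u)) (exact lo (u ∷ hi) eq)) (target-:: u lo (exact-upper hi)))
   good-upper : ∀ hi -> Good (upperOf hi)
   good-upper [] = good-0
   good-upper (u ∷ hi) = step-good (small u) (good-upper hi)
   good-lower : ∀ lo {t} -> Good t -> Good (lowerOf t lo)
   good-lower [] good = step-good small-b (step-good boxed-0 good)
   good-lower (u ∷ lo) good = step-good (small-β u) (good-lower lo good)
   down-upper : ∀ lo hi -> upperOf hi ≼ ⊝ cB -> upperOf (lo ʳ++ hi) ≼ ⊝ cB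
   down-upper [] hi d = d
   down-upper (u ∷ lo) hi d = down-upper lo (u ∷ hi) (step-down (small u) d)
   down-start : ∀ lo {t} -> t ≼ ⊝ cB -> lowerOf t lo ≼ ⊝ cB
   down-start [] d = step-down small-b (step-down boxed-0 d)
   down-start (u ∷ lo) d = step-down (small-β u) (down-start lo d)
   down-lower : ∀ hi lo {t} -> lowerOf t lo ≼ ⊝ cB -> lowerOf t (hi ʳ++ lo) ≼ ⊝ cB
   down-lower [] lo d = d
   down-lower (u ∷ hi) lo d = down-lower hi (u ∷ lo) (step-down (small-β u) d)
   module _ (s : Bool) (w : List ℕ) (claim : cond s (total-val w) ≡ true) where
    t0 : ZR
    t0 = upperOf (reverse w)
    0⋠-cB : ¬ (0R ≼ ⊝ cB)
    0⋠-cB l = case 0≼=>nonneg l of \ n -> impossible E 1<=E (passes n)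
     where
     impossible : ∀ E -> 1 ≤ E -> nnR' (⊝ constR (E + E)) ≡ true -> ⊥
     impossible (suc E) _ e = case tr (sym e) (negative-rational (E + suc E)) of \ ()
      where
      negative-rational : ∀ n -> nnR -[1+ n ] 0ℤ ≡ false
      negative-rational n = cong (\ z -> nonneg (z Z.- -[1+ n ] Z.* -[1+ n ])) (Z.*-zeroʳ (Z.+ D))
    cond=>0≼ : ∀ s {z} -> cond s z ≡ true -> 0R ≼ z
    cond=>0≼ false {z} p = leq=>≼ 0R z p
    cond=>0≼ true {z} p = ≼-total z 0R (not-true p)
     where
     not-true : ∀ {b} -> Bool.not b ≡ true -> b ≡ false
     not-true {false} _ = refl
    cond-cB : cond s cB ≡ true
    cond-cB = go s
     where
     go : ∀ s -> cond s cB ≡ true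
     go false = ≼=>leq (nn=>0≼ (nn-const B))
     go true with leq cB 0R in l
     ... | false = refl
     ... | true = contradiction (≼-⊝ (leq=>≼ cB 0R l)) 0⋠-cB
    -- The last value is either exact, and then a positive multiple of the total value, or it is
    -- `B`, which is positive.
    accepts : cond s (lowerOf t0 w) ≡ true
    accepts = go (track-lower w {z = exact-upper (reverse w)} (track-upper (reverse w)))
     where
     exact-value : exact-lower (exact-upper (reverse w)) w ≡ PZ (length w) (total-val w)
     exact-value = tr (exact w [] refl) (tr (cong (PZ (length w) (total-val w) ⊕_) (tr (cong (P (length w)) (P-0 (length w))) (P-0 (length w)))) (⊕-0 (PZ (length w) (total-val w))))
     go : lowerOf t0 w ≡ exact-lower (exact-upper (reverse w)) w ⊎ lowerOf t0 w ≡ cB -> cond s (lowerOf t0 w) ≡ true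
     go (in1 eq) = tr (cong (cond s) (tr eq exact-value)) (tr (cond-PZ (length w) s (total-val w)) claim)
     go (in2 eq) = tr (cong (cond s) eq) cond-cB
    never-down : ¬ (lowerOf t0 w ≼ ⊝ cB)
    never-down d = 0⋠-cB (≼-trans (cond=>0≼ s accepts) d)
    not-low : ∀ z -> ¬ (z ≼ ⊝ cB) -> ⊝ cB ≼ z
    not-low z h with leq (⊝ cB) z in l
    ... | true = leq=>≼ (⊝ cB) z l
    ... | false = contradiction (≼-total (⊝ cB) z l) h
    -- A value of at most - B would persist through the remaining letters, then through the whole
    -- sequence that starts from `t0`, up to the last one, where the true inequality requires a
    -- nonnegative value. This supplies the lower bound missing in `Good`.
    boxed-upper : ∀ lo hi -> lo ʳ++ hi ≡ reverse w -> Boxed B (upperOf hi)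
    boxed-upper lo hi eq = record { upper = Good.upper good ; upper' = Good.upper' good ; lower' = Good.lower' good
     ; lower = not-low _ (\ d -> never-down (down-start w (subst (\ l -> upperOf l ≼ ⊝ cB) eq (down-upper lo hi d)))) }
     where
         good = good-upper hi
    boxed-lower : ∀ hi lo -> hi ʳ++ lo ≡ w -> Boxed B (lowerOf t0 lo)
    boxed-lower hi lo eq = record { upper = Good.upper good ; upper' = Good.upper' good ; lower' = Good.lower' good
     ; lower = not-low _ (\ d -> never-down (subst (\ l -> lowerOf t0 l ≼ ⊝ cB) eq (down-lower hi lo d))) }
     where
         good = good-lower lo (good-upper (reverse w))

-- Automata whose states are the numbers below N

true/=false : ∀ {b} -> b ≡ true -> b ≡ false -> ⊥
true/=false refl ()

/=true=>false : ∀ {b} -> b ≢ true -> b ≡ false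
/=true=>false {false} _ = refl
/=true=>false {true} h = contradiction refl h

any-intro : ∀ n f {i} -> i < n -> f i ≡ true -> any n f ≡ true
any-intro (suc n) f {i} i<n e with f n in e'
... | true = refl
... | false with m≤n⇒m<n∨m≡n (≤-pred i<n)
... | in1 i<n' = any-intro n f i<n' e
... | in2 refl = ⊥-elim (true/=false e e')

any-elim : ∀ n f -> any n f ≡ true -> ∃[ i ] (i < n × f i ≡ true)
any-elim (suc n) f e with f n in e'
... | true = n , ≤-refl , e'
... | false = let i , i<n , e'' = any-elim n f e in i , m<n⇒m<1+n i<n , e''

every-intro : ∀ n f -> (∀ i -> i < n -> f i ≡ true) -> every n f ≡ true
every-intro zero f h = refl
every-intro (suc n) f h = tr (cong (_∧ every n f) (h n ≤-refl)) (every-intro n f (\ i p -> h i (m<n⇒m<1+n p)))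

every-elim : ∀ n f -> every n f ≡ true -> ∀ i -> i < n -> f i ≡ true
every-elim (suc n) f e i i<n with f n in e'
... | true with m≤n⇒m<n∨m≡n (≤-pred i<n)
... | in1 i<n' = every-elim n f e i i<n'
... | in2 refl = e'

∨-left : ∀ {a b} -> a ≡ true -> a ∨ b ≡ true
∨-left refl = refl

∨-right : ∀ a {b} -> b ≡ true -> a ∨ b ≡ true
∨-right true _ = refl
∨-right false e = e

∨-case : ∀ {a b} -> a ∨ b ≡ true -> a ≡ true ⊎ b ≡ true
∨-case {true} _ = in1 refl
∨-case {false} e = in2 e

∧-both : ∀ {a b} -> a ≡ true -> b ≡ true -> a ∧ b ≡ true
∧-both refl refl = refl

∧-fst : ∀ {a b} -> a ∧ b ≡ true -> a ≡ true
∧-fst {true} _ = refl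

∧-snd : ∀ {a b} -> a ∧ b ≡ true -> b ≡ true
∧-snd {true} e = e

infix 4 _==_

_==_ : Bool -> Bool -> Bool
true == b = b
false == b = Bool.not b

==-elim : ∀ {a b} -> (a == b) ≡ true -> a ≡ b
==-elim {true} {true} _ = refl
==-elim {false} {false} _ = refl

==-intro : ∀ {a b} -> a ≡ b -> (a == b) ≡ true
==-intro {true} refl = refl
==-intro {false} refl = refl

bit? : ℕ -> ℕ -> Bool
bit? X q = iter (\ _ v -> v ÷ 2) X q rem 2 ≡ᵇ 1

encodeSet : ∀ N (f : ℕ -> Bool) -> ∃[ X ] (X < 2 ^ N × (∀ q -> q < N -> bit? X q ≡ f q))
encodeSet zero f = 0 , s≤s z≤n , \ _ ()
encodeSet (suc N) f with encodeSet N (f ∘ suc)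
... | X , X< , bits' = b2n (f 0) + X * 2 , small (f 0) , bits-of
 where
 small : ∀ b -> b2n b + X * 2 < 2 * 2 ^ N
 small b = <-≤-trans (+-monoˡ-< (X * 2) (b2n<2 b)) (≤-trans (*-monoˡ-≤ 2 X<) (≡⇒≤ (*-comm (2 ^ N) 2)))
  where
  b2n<2 : ∀ b -> b2n b < 2
  b2n<2 false = s≤s z≤n
  b2n<2 true = s≤s (s≤s z≤n)
 half : ∀ b -> (b2n b + X * 2) ÷ 2 ≡ X
 half false = DM.m*n/n≡m X 2
 half true = tr (DM.+-distrib-/-∣ʳ 1 {X * 2} {2} (DV.divides X refl)) (DM.m*n/n≡m X 2)
 parity : ∀ b -> ((b2n b + X * 2) rem 2 ≡ᵇ 1) ≡ b
 parity false = cong (_≡ᵇ 1) (DM.m*n%n≡0 X 2)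
 parity true = cong (_≡ᵇ 1) (DM.[m+kn]%n≡m%n 1 X 2)
 shift : ∀ {S : Set} (f : S -> S) z n -> iter (\ _ v -> f v) z (suc n) ≡ iter (\ _ v -> f v) (f z) n
 shift f z zero = refl
 shift f z (suc n) = cong f (shift f z n)
 bits-of : ∀ q -> q < suc N -> bit? (b2n (f 0) + X * 2) q ≡ f q
 bits-of zero _ = parity (f 0)
 bits-of (suc q) (s≤s q<N) = tr (cong (\ v -> v rem 2 ≡ᵇ 1) (tr (shift (_÷ 2) (b2n (f 0) + X * 2) q) (cong (\ X -> iter (\ _ v -> v ÷ 2) X q) (half (f 0))))) (bits' q q<N)

-- Iterating a monotone inflationary operator on subsets of {0, …, N - 1} N
-- times reaches a fixed point, since every step before adds an element.
module Saturate (N : ℕ) (F : (ℕ -> Bool) -> ℕ -> Bool) (inflate : ∀ f q -> f q ≡ true -> F f q ≡ true) (congruent : ∀ f f' -> (∀ q -> q < N -> f q ≡ f' q) -> ∀ q -> q < N -> F f q ≡ F f' q)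
 (f0 : ℕ -> Bool)
 where
 stage : ℕ -> ℕ -> Bool
 stage k = iter (\ _ f -> F f) f0 k
 Stable : ℕ -> Set
 Stable k = ∀ q -> q < N -> F (stage k) q ≡ stage k q
 size-of : ℕ -> ℕ
 size-of k = sum N (b2n ∘ stage k)
 stable-suc : ∀ {k} -> Stable k -> Stable (suc k)
 stable-suc {k} st = congruent (stage (suc k)) (stage k) st
 sum-mono : ∀ n (f g : ℕ -> ℕ) -> (∀ i -> i < n -> f i ≤ g i) -> sum n f ≤ sum n g
 sum-mono zero f g h = z≤n
 sum-mono (suc n) f g h = +-mono-≤ (h n ≤-refl) (sum-mono n f g (\ i p -> h i (m<n⇒m<1+n p)))
 sum-strict : ∀ n (f g : ℕ -> ℕ) -> (∀ i -> i < n -> f i ≤ g i) -> ∀ {i} -> i < n -> f i < g i -> sum n f < sum n g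
 sum-strict (suc n) f g h i<n f<g with m≤n⇒m<n∨m≡n (≤-pred i<n)
 ... | in2 refl = +-mono-<-≤ f<g (sum-mono n f g (\ i p -> h i (m<n⇒m<1+n p)))
 ... | in1 i<n' = +-mono-≤-< (h n ≤-refl) (sum-strict n f g (\ i p -> h i (m<n⇒m<1+n p)) i<n' f<g)
 b2n-mono : ∀ {a b} -> (a ≡ true -> b ≡ true) -> b2n a ≤ b2n b
 b2n-mono {false} h = z≤n
 b2n-mono {true} h rewrite h refl = ≤-refl
 b2n<=1 : ∀ b -> b2n b ≤ 1
 b2n<=1 false = z≤n
 b2n<=1 true = ≤-refl
 grow : ∀ k -> Stable k ⊎ size-of k < size-of (suc k)
 grow k with every N (\ q -> F (stage k) q == stage k q) in e
 ... | true = in1 (\ q q<N -> ==-elim (every-elim N _ e q q<N))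
 ... | false with any N (\ q -> Bool.not (F (stage k) q == stage k q)) in e'
 ... | false = ⊥-elim (true/=false (every-intro N _ (\ q q<N -> not-not (/=true=>false \ p -> true/=false (any-intro N _ q<N p) e'))) e)
  where
  not-not : ∀ {b} -> Bool.not b ≡ false -> b ≡ true
  not-not {true} _ = refl
 ... | true with any-elim N _ e'
 ... | q , q<N , p = in2 (sum-strict N (b2n ∘ stage k) (b2n ∘ stage (suc k)) (\ i _ -> b2n-mono (inflate (stage k) i)) q<N (differs _ _ p (inflate (stage k) q)))
  where
  differs : ∀ a b -> Bool.not (a == b) ≡ true -> (b ≡ true -> a ≡ true) -> b2n b < b2n a
  differs true false _ _ = s≤s z≤n
  differs false true _ h = case h refl of \ ()
 progress : ∀ k -> Stable k ⊎ k ≤ size-of k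
 progress zero = in2 z≤n
 progress (suc k) with progress k
 ... | in1 st = in1 (stable-suc {k} st)
 ... | in2 k≤ with grow k
 ... | in1 st = in1 (stable-suc {k} st)
 ... | in2 up = in2 (≤-<-trans k≤ up)
 full : ∀ n f -> n ≤ sum n (b2n ∘ f) -> ∀ q -> q < n -> f q ≡ true
 full (suc n) f n<= q q<n with f n in e
 full (suc n) f n<= q q<n | false = ⊥-elim (<⇒≱ n<= (subst (sum n (b2n ∘ f) ≤_) (*-identityʳ n) (sum-<= n (b2n ∘ f) (\ i _ -> b2n<=1 (f i)))))
 full (suc n) f n<= q q<n | true with m≤n⇒m<n∨m≡n (≤-pred q<n)
 ... | in1 q<n' = full n f (≤-pred n<=) q q<n'
 ... | in2 refl = e
 saturated : Stable N
 saturated with progress N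
 ... | in1 st = st
 ... | in2 N<= = \ q q<N -> tr (inflate (stage N) q (full N (stage N) N<= q q<N)) (sym (full N (stage N) N<= q q<N))

record Auto : Set where
 field
  N : ℕ
  rel : ℕ -> ℕ -> ℕ -> Bool
  ini : ℕ -> Bool
  acc : ℕ -> Bool

module Automata (setting : Setting) where
 open Inequalities setting public
 -- The head of a word is the letter read last.
 data Reach (M : Auto) : List ℕ -> ℕ -> Set where
  start : ∀ {q} -> q < Auto.N M -> Auto.ini M q ≡ true -> Reach M [] q
  next : ∀ {w q u q'} -> Reach M w q -> q' < Auto.N M -> Auto.rel M q u q' ≡ true -> Reach M (u ∷ w) q'
 reach-< : ∀ {M w q} -> Reach M w q -> q < Auto.N M
 reach-< (start p _) = p
 reach-< (next _ p _) = p
 Accept : Auto -> List ℕ -> Set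
 Accept M w = ∃[ q ] (Reach M w q × Auto.acc M q ≡ true)
 -- Rejection has a statement of its own instead of the negation of `P`: a rejected word of a
 -- determinized automaton has to yield a witness, which the negation of a universal statement does
 -- not give constructively.
 Spec : Auto -> ∀ n -> (Vec ℤ n -> Set) -> (Vec ℤ n -> Set) -> Set
 Spec M n P P̄ = ∀ w -> All (_< A ^ n) w -> (Accept M w -> P (values n w)) × (¬ Accept M w -> P̄ (values n w))
 -- Witnesses for the m inner variables may need more digits than the outer word has. A letter below
 -- `A ^ m` has only zeros for the outer variables, so the closure consists of the states from which
 -- further letters of this kind lead to acceptance.
 closStep : Auto -> ℕ -> (ℕ -> Bool) -> ℕ -> Bool
 closStep M m f q = f q ∨ any (A ^ m) (\ d -> any N (\ q' -> rel q d q' ∧ f q'))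
  where
   open Auto M
 closure : Auto -> ℕ -> ℕ -> Bool
 closure M m = iter (\ _ f -> closStep M m f) (Auto.acc M) (Auto.N M)
 alive : Auto -> ℕ -> (ℕ -> Bool) -> Bool
 alive M m S = any (Auto.N M) (\ q -> S q ∧ closure M m q)
 -- The subset construction for the projection along m variables, complemented: a word is accepted
 -- if no witness exists. One complement per block is what alternating quantifiers require. States
 -- are bit sets, and a transition prescribes every bit of its target.
 det : Auto -> ℕ -> Auto
 det M m = record { N = 2 ^ N ; rel = \ X u Y -> every N (\ q' -> bit? Y q' == any N (\ q -> bit? X q ∧ any (A ^ m) (\ d -> rel q (join m d u) q'))) ; ini = \ X -> every N (\ q -> bit? X q == ini q)
  ; acc = \ X -> Bool.not (alive M m (bit? X)) }
  where
   open Auto M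
 module Projection (M : Auto) (m : ℕ) where
  open Auto M
  open Saturate N (closStep M m) (\ f q -> ∨-left) (\ f f' h q q<N -> cong2 _∨_ (h q q<N) (any-cong (A ^ m) (\ d _ -> any-cong N (\ q' q'<N -> cong (rel q d q' ∧_) (h q' q'<N))))) acc
  closure-sound : ∀ k q {v} -> stage k q ≡ true -> Reach M v q -> ∃₂ \ es q' -> All (_< A ^ m) es × Reach M (es ++ v) q' × acc q' ≡ true
  closure-sound zero q e r = [] , q , [] , r , e
  closure-sound (suc k) q {v} e r with ∨-case e
  ... | in1 e' = closure-sound k q e' r
  ... | in2 e' with any-elim (A ^ m) _ e'
  ... | d , d< , e'' with any-elim N _ e''
  ... | q' , q'< , e''' with closure-sound k q' (∧-snd {rel q d q'} e''') (next r q'< (∧-fst e'''))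
  ... | es , q'' , small , r'' , a = es ++ d ∷ [] , q'' , AllP.++⁺ small (d< ∷ []) , subst (\ w -> Reach M w q'') (sym (++-assoc es (d ∷ []) v)) r'' , a
  closure-complete : ∀ es {v q'} -> All (_< A ^ m) es -> Reach M (es ++ v) q' -> closure M m q' ≡ true -> ∃[ q ] (Reach M v q × closure M m q ≡ true)
  closure-complete [] _ r e = _ , r , e
  closure-complete (d ∷ es) (d< ∷ small) (next {q = q} r q'< t) e = closure-complete es small r (tr (sym (saturated q (reach-< r)))
    (∨-right (stage N q) (any-intro (A ^ m) _ d< (any-intro N _ q'< (∧-both t e)))))
  accept-closure : ∀ {q} -> q < N -> acc q ≡ true -> closure M m q ≡ true
  accept-closure {q} _ e = go N
   where
   go : ∀ k -> stage k q ≡ true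
   go zero = e
   go (suc k) = ∨-left (go k)
  -- Completeness has to cover all ways to fill in the inner digits, since a set from which no
  -- witness is found must exclude every one of them.
  Lifts : List ℕ -> (ℕ -> Bool) -> Set
  Lifts w S = (∀ q -> q < N -> S q ≡ true -> ∃[ ds ] (length ds ≡ length w × All (_< A ^ m) ds × Reach M (joins m ds w) q)) ×
   (∀ q ds -> length ds ≡ length w -> All (_< A ^ m) ds -> Reach M (joins m ds w) q -> S q ≡ true)
  zeros : ℕ -> List ℕ
  zeros k = replicate k 0
  joins-++ : ∀ es ds w -> joins m (es ++ ds) (zeros (length es) ++ w) ≡ es ++ joins m ds w
  joins-++ [] ds w = refl
  joins-++ (d ∷ es) ds w = cong2 _∷_ (+-identityʳ d) (joins-++ es ds w)
  joins-small : ∀ n {ds w} -> All (_< A ^ m) ds -> All (_< A ^ n) w -> All (_< A ^ (m + n)) (joins m ds w)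
  joins-small n [] _ = []
  joins-small n (_ ∷ _) [] = []
  joins-small n (p ∷ s) (p' ∷ s') = join-small m n p p' ∷ joins-small n s s'
  zeros-small : ∀ n k {w} -> All (_< A ^ n) w -> All (_< A ^ n) (zeros k ++ w)
  zeros-small n zero s = s
  zeros-small n (suc k) s = m^n>0 A n ∷ zeros-small n k s
  length-zeros : ∀ k (w : List ℕ) -> length (zeros k ++ w) ≡ k + length w
  length-zeros k w = tr (length-++ (zeros k)) (cong (_+ length w) (length-replicate k))
  module _ {n P P̄} (spec : Spec M (m + n) P P̄) {w} (small : All (_< A ^ n) w) {S} (lifts : Lifts w S) where
   alive-true : alive M m S ≡ true -> ∃[ x ] P (x Vec.++ values n w)
   alive-true e = values m ds , subst P (tr (values-joins m n ds (zeros (length es) ++ w) len all-small) (cong (values m ds Vec.++_) (zeros-joins n (length es) w)))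
     (fst (spec (joins m ds (zeros (length es) ++ w)) (joins-small n all-small (zeros-small n (length es) small))) (q' , subst (\ v -> Reach M v q') (sym (joins-++ es ds0 w)) reached , accepting))
    where
    found = any-elim N _ e
    q = fst found
    q<N = fst (snd found)
    lifted = fst lifts q q<N (∧-fst (snd (snd found)))
    ds0 = fst lifted
    sounded = closure-sound N q (∧-snd {S q} (snd (snd found))) (snd (snd (snd lifted)))
    es = fst sounded
    q' = fst (snd sounded)
    reached = fst (snd (snd (snd sounded)))
    accepting = snd (snd (snd (snd sounded)))
    ds = es ++ ds0
    all-small : All (_< A ^ m) ds
    all-small = AllP.++⁺ (fst (snd (snd sounded))) (fst (snd (snd lifted)))
    len : length ds ≡ length (zeros (length es) ++ w)
    len = tr (length-++ es) (tr (cong (length es +_) (fst (snd lifted))) (sym (length-zeros (length es) w)))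
   alive-false : alive M m S ≡ false -> ∀ x -> P̄ (x Vec.++ values n w)
   alive-false e x = subst P̄ (tr (values-joins m n ds (zeros L0 ++ w) len ds-small) (cong2 Vec._++_ ds-value (zeros-joins n L0 w)))
     (snd (spec (joins m ds (zeros L0 ++ w)) (joins-small n ds-small (zeros-small n L0 small))) rejected)
    where
    L0 = fst (represents m x)
    -- `L0` letters more than `w` has guarantee a representation of `x`. The first `L0` of them lie
    -- beyond `w` and are handled by the closure.
    rep = snd (represents m x) (L0 + length w) (m≤m+n L0 (length w))
    ds = fst rep
    ds-len = fst (snd rep)
    ds-small = fst (snd (snd rep))
    ds-value = snd (snd (snd rep))
    len : length ds ≡ length (zeros L0 ++ w)
    len = tr ds-len (sym (length-zeros L0 w))
    es ds0 : List ℕ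
    es = List.take L0 ds
    ds0 = List.drop L0 ds
    split : es ++ ds0 ≡ ds
    split = take++drop≡id L0 ds
    es-len : length es ≡ L0
    es-len = tr (length-take L0 ds) (tr (cong (L0 ℕ.⊓_) ds-len) (m≤n⇒m⊓n≡m (m≤m+n L0 (length w))))
    ds0-len : length ds0 ≡ length w
    ds0-len = tr (length-drop L0 ds) (tr (cong (_∸ L0) ds-len) (m+n∸m≡n L0 (length w)))
    both-small : All (_< A ^ m) (es ++ ds0)
    both-small = subst (All (_< A ^ m)) (sym split) ds-small
    shape-eq : joins m ds (zeros L0 ++ w) ≡ es ++ joins m ds0 w
    shape-eq = tr (cong2 (\ v k -> joins m v (zeros k ++ w)) (sym split) (sym es-len)) (joins-++ es ds0 w)
    rejected : ¬ Accept M (joins m ds (zeros L0 ++ w))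
    rejected (q' , r , a) with closure-complete es (AllP.++⁻ˡ es both-small) (subst (\ v -> Reach M v q') shape-eq r) (accept-closure (reach-< r) a)
    ... | q , r0 , cl = true/=false (any-intro N _ (reach-< r0) (∧-both (snd lifts q ds0 ds0-len (AllP.++⁻ʳ es both-small) r0) cl)) e
  lifts-[] : Lifts [] ini
  lifts-[] = (\ q q<N e -> [] , refl , [] , start q<N e) , \ { q [] _ _ (start _ e) -> e }
  lifts-det : ∀ {w X} -> Reach (det M m) w X -> Lifts w (bit? X)
  lifts-det {X = X} (start _ e) = (\ q q<N b -> [] , refl , [] , start q<N (tr (sym (==-elim (every-elim N _ e q q<N))) b)) , \ { q [] _ _ (start q<N i) -> tr (==-elim (every-elim N _ e q q<N)) i }
  lifts-det {u ∷ w} {Y} (next {q = X} r _ e) = forth , back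
   where
   IH = lifts-det r
   forth : ∀ q -> q < N -> bit? Y q ≡ true -> ∃[ ds ] (length ds ≡ suc (length w) × All (_< A ^ m) ds × Reach M (joins m ds (u ∷ w)) q)
   forth q' q'<N b with any-elim N _ (tr (sym (==-elim (every-elim N _ e q' q'<N))) b)
   ... | q , q<N , p with any-elim (A ^ m) _ (∧-snd {bit? X q} p) | fst IH q q<N (∧-fst p)
   ... | d , d< , t | ds , len , sm , r' = d ∷ ds , cong suc len , d< ∷ sm , next r' q'<N t
   back : ∀ q ds -> length ds ≡ suc (length w) -> All (_< A ^ m) ds -> Reach M (joins m ds (u ∷ w)) q -> bit? Y q ≡ true
   back q' (d ∷ ds) len (d< ∷ sm) (next {q = q} r' q'<N t) = tr (==-elim (every-elim N _ e q' q'<N))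
    (any-intro N _ (reach-< r') (∧-both (snd IH q ds (suc-injective len) sm r') (any-intro (A ^ m) _ d< t)))
  reach-det : ∀ w -> ∃[ X ] Reach (det M m) w X
  reach-det [] with encodeSet N ini
  ... | X , X< , eq = X , start X< (every-intro N _ (\ q q<N -> ==-intro (eq q q<N)))
  reach-det (u ∷ w) with reach-det w
  ... | X , r with encodeSet N (\ q' -> any N (\ q -> bit? X q ∧ any (A ^ m) (\ d -> rel q (join m d u) q')))
  ... | Y , Y< , eq = Y , next r Y< (every-intro N _ (\ q q<N -> ==-intro (eq q q<N)))
  det-spec : ∀ {n P P̄} -> Spec M (m + n) P P̄ -> Spec (det M m) n (\ ρ -> ∀ x -> P̄ (x Vec.++ ρ)) (\ ρ -> ∃[ x ] P (x Vec.++ ρ))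
  det-spec {n} {P} {P̄} spec w small = accepted , rejected
   where
   accepted : Accept (det M m) w -> ∀ x -> P̄ (x Vec.++ values n w)
   accepted (X , r , a) = alive-false {n} {P} {P̄} spec small (lifts-det r) (not-true a)
    where
    not-true : ∀ {b} -> Bool.not b ≡ true -> b ≡ false
    not-true {false} _ = refl
   rejected : ¬ Accept (det M m) w -> ∃[ x ] P (x Vec.++ values n w)
   rejected h with reach-det w
   ... | X , r = alive-true {n} {P} {P̄} spec small (lifts-det r) (not-false (/=true=>false (\ a -> h (X , r , a))))
    where
    not-false : ∀ {b} -> Bool.not b ≡ false -> b ≡ true
    not-false {true} _ = refl

-- Reading the text of a sentence

-- Arrays store bits as 1 and 2, and weighted by 8, 4, 2, 1 these give 15 plus the binary value of
-- the symbol. So 0 remains as the code of a position after the end.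
code : Symbol -> ℕ
code ‵∀ = 15
code ‵∃ = 16
code ‵x = 17
code ‵0 = 18
code ‵1 = 19
code ‵- = 20
code ‵+ = 21
code ‵α = 22
code ‵⟨ = 23
code ‵⟩ = 24
code ‵≤ = 25
code ‵< = 26
code ‵∧ = 27
code ‵∨ = 28
code ‵¬ = 29

bitCode : Bool -> ℕ
bitCode b = if b then 2 else 1

bitCodes : List Bool -> List ℕ
bitCodes = map bitCode

symAt : List ℕ -> ℕ -> ℕ
symAt w p = 8 * (w ‼ (p * 4)) + 4 * (w ‼ (1 + p * 4)) + 2 * (w ‼ (2 + p * 4)) + w ‼ (3 + p * 4)

symbol-codes : ∀ ss p -> symAt (bitCodes (List.concatMap bits ss)) p ≡ map code ss ‼ p
symbol-codes [] p = refl
symbol-codes (‵∀ ∷ ss) zero = refl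
symbol-codes (‵∃ ∷ ss) zero = refl
symbol-codes (‵x ∷ ss) zero = refl
symbol-codes (‵0 ∷ ss) zero = refl
symbol-codes (‵1 ∷ ss) zero = refl
symbol-codes (‵- ∷ ss) zero = refl
symbol-codes (‵+ ∷ ss) zero = refl
symbol-codes (‵α ∷ ss) zero = refl
symbol-codes (‵⟨ ∷ ss) zero = refl
symbol-codes (‵⟩ ∷ ss) zero = refl
symbol-codes (‵≤ ∷ ss) zero = refl
symbol-codes (‵< ∷ ss) zero = refl
symbol-codes (‵∧ ∷ ss) zero = refl
symbol-codes (‵∨ ∷ ss) zero = refl
symbol-codes (‵¬ ∷ ss) zero = refl
symbol-codes (s ∷ ss) (suc p) = tr (rest s) (symbol-codes ss p)
 where
 rest : ∀ s -> symAt (bitCodes (bits s ++ List.concatMap bits ss)) (suc p) ≡ symAt (bitCodes (List.concatMap bits ss)) p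
 rest ‵∀ = refl
 rest ‵∃ = refl
 rest ‵x = refl
 rest ‵0 = refl
 rest ‵1 = refl
 rest ‵- = refl
 rest ‵+ = refl
 rest ‵α = refl
 rest ‵⟨ = refl
 rest ‵⟩ = refl
 rest ‵≤ = refl
 rest ‵< = refl
 rest ‵∧ = refl
 rest ‵∨ = refl
 rest ‵¬ = refl

isDigit isRel isTerm : ℕ -> Bool
isDigit s = (s ≡ᵇ 18) ∨ (s ≡ᵇ 19)
isRel s = (s ≡ᵇ 25) ∨ (s ≡ᵇ 26)
isTerm s = s ≡ᵇ 23

isConn : ℕ -> Bool
isConn s = 27 ≤ᵇ s

codes : List Symbol -> List ℕ
codes = map code

abstract
 numrl : ℕ -> List ℕ
 numrl n = codes (Write.nat n)
 integer : ℤ -> List ℕ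
 integer z = codes (Write.int z)
 numeral-def : ∀ n -> numrl n ≡ codes (Write.nat n)
 numeral-def n = refl
 integer-def : ∀ z -> integer z ≡ codes (Write.int z)
 integer-def z = refl
 integer-nonneg : ∀ n -> integer (Z.+ n) ≡ numrl n
 integer-nonneg n = refl
 integer-neg : ∀ n -> integer -[1+ n ] ≡ 20 ∷ numrl (suc n)
 integer-neg n = refl

digCodes : List Bit -> List ℕ
digCodes = map (\ d -> code (Write.bit d))

numeral-digits : ∀ n -> ∃[ ds ] (numrl n ≡ digCodes ds × fromDigits {2} ds ≡ n)
numeral-digits n = fst (toDigits 2 n) , tr (numeral-def n) (sym (map-∘ (fst (toDigits 2 n)))) , snd (toDigits 2 n)

-- The numeral 0 is not empty, so every atom that follows a number is preceded
-- by a closing bracket.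
numeral-last : ∀ n -> ∃₂ \ ds d -> numrl n ≡ digCodes ds ++ code (Write.bit d) ∷ []
numeral-last zero = [] , zero , numeral-def 0
numeral-last (suc n) = split (numeral-digits (suc n))
 where
 split : ∃[ ds ] (numrl (suc n) ≡ digCodes ds × fromDigits {2} ds ≡ suc n) -> ∃₂ \ ds d -> numrl (suc n) ≡ digCodes ds ++ code (Write.bit d) ∷ []
 split (ds , eq , val) with List.initLast ds
 ... | [] = case val of \ ()
 ... | ds' List.∷ʳ′ d = ds' , d , tr eq (map-++ _ ds' (d ∷ []))

Numeric : ℕ -> Set
Numeric s = s ≡ 18 ⊎ s ≡ 19 ⊎ s ≡ 20

numeral-numeric : ∀ n -> All Numeric (numrl n)
numeral-numeric n with numeral-digits n
... | ds , eq , _ = subst (All Numeric) (sym eq) (go ds)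
 where
 go : ∀ ds -> All Numeric (digCodes ds)
 go [] = []
 go (zero ∷ ds) = in1 refl ∷ go ds
 go (suc zero ∷ ds) = in2 (in1 refl) ∷ go ds

int-numeric : ∀ z -> All Numeric (integer z)
int-numeric (Z.+ n) = subst (All Numeric) (sym (integer-nonneg n)) (numeral-numeric n)
int-numeric -[1+ n ] = subst (All Numeric) (sym (integer-neg n)) (in2 (in2 refl) ∷ numeral-numeric (suc n))

numeric : ∀ {P : ℕ -> Set} -> P 18 -> P 19 -> P 20 -> ∀ {s} -> Numeric s -> P s
numeric a b d (in1 refl) = a
numeric a b d (in2 (in1 refl)) = b
numeric a b d (in2 (in2 refl)) = d

-- The text of a coefficient after its opening bracket.
inside : ℤ[α] -> List ℕ
inside (c + d ·α) = integer c ++ 21 ∷ integer d ++ 22 ∷ 24 ∷ []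

coeff-text : ∀ a -> codes (Write.coeff a) ≡ 23 ∷ inside a
coeff-text (c + d ·α) = cong (23 ∷_) (tr (map-++ code (Write.int c) _)
 (cong2 (\ u v -> u ++ 21 ∷ v) (sym (integer-def c)) (tr (map-++ code (Write.int d) _) (cong (_++ 22 ∷ 24 ∷ []) (sym (integer-def d))))))

inside-All : ∀ {P : ℕ -> Set} -> P 18 -> P 19 -> P 20 -> P 21 -> P 22 -> P 24 -> ∀ a -> All P (inside a)
inside-All {P} h18 h19 h20 h21 h22 h24 (c + d ·α) = AllP.++⁺ (All.map (numeric {P} h18 h19 h20) (int-numeric c)) (h21 ∷ AllP.++⁺ (All.map (numeric {P} h18 h19 h20) (int-numeric d)) (h22 ∷ h24 ∷ []))

module Text (symb : ℕ -> ℕ) (ℓ : ℕ) where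
 -- The text is processed from its end down to position p.
 backwards : {S : Set} -> (ℕ -> S -> S) -> S -> ℕ -> S
 backwards step z p = iter (\ k a -> step (p + (ℓ ∸ suc k)) a) z ℓ
 -- The least significant digit comes first, so a pass from the end is Horner's rule; any other
 -- symbol starts it anew.
 numStep : ℕ -> ℕ -> ℕ
 numStep s a = if isDigit s then (s ∸ 18) + 2 * a else 0
 num : ℕ -> ℕ
 num = backwards (\ i -> numStep (symb i)) 0
 int : ℕ -> ℤ
 int p = if symb p ≡ᵇ 20 then Z.- Z.+ num (suc p) else Z.+ num p
 distStep : (ℕ -> Bool) -> ℕ -> ℕ -> ℕ
 distStep c s a = if c s ∨ (s ≡ᵇ 0) then 0 else suc a
 dist : (ℕ -> Bool) -> ℕ -> ℕ
 dist c = backwards (\ i -> distStep c (symb i)) 0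
 c₀ c₁ : ℕ -> ℤ
 c₀ p = int (suc p)
 c₁ p = int (p + suc (dist (_≡ᵇ 21) p))
 variable# : ℕ -> ℕ
 variable# p = num (p + suc (dist (_≡ᵇ 17) p))
 termStep : {S : Set} -> S -> (ℕ -> S -> S) -> ℕ -> S -> S
 termStep z F i a = if isRel (symb i) then z else if isTerm (symb i) then F i a else a
 -- Folds F over the terms of the atom that starts at p.
 overTms : {S : Set} -> S -> (ℕ -> S -> S) -> ℕ -> S
 overTms z F = backwards (termStep z F) z
 relation : ℕ -> ℕ
 relation p = p + dist isRel p
 busy : ℕ -> Bool
 busy s = isDigit s ∨ isRel s
 -- Inside an atom each later term and the relation follow a digit of a variable index, and the
 -- right-hand side follows the relation. The first symbol of an atom follows a bracket, a
 -- connective or a quantified variable. An atom without terms begins with its relation.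
 start? : ℕ -> Bool
 start? p = (isTerm (symb p) ∨ isRel (symb p)) ∧ Bool.not (busy (symb (p ∸ 1)))
 module Reading (beyond : ∀ i -> ℓ ≤ i -> symb i ≡ 0) where
  -- From position p on, the text reads w and then ends.
  record At (p : ℕ) (w : List ℕ) : Set where
   constructor text
   field
    reads : ∀ k -> symb (p + k) ≡ w ‼ k
  open At public
  at-tail : ∀ {p s w} -> At p (s ∷ w) -> At (suc p) w
  at-tail {p} (text h) = text (\ k -> tr (cong symb (sym (+-suc p k))) (h (suc k)))
  at-drop : ∀ {p} xs {w} -> At p (xs ++ w) -> At (p + length xs) w
  at-drop {p} [] {w} tx = subst (\ p -> At p w) (sym (+-identityʳ p)) tx
  at-drop {p} (x ∷ xs) {w} tx = subst (\ p -> At p w) (sym (+-suc p (length xs))) (at-drop xs (at-tail tx))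
  at-head : ∀ {p s w} -> At p (s ∷ w) -> symb p ≡ s
  at-head {p} (text h) = tr (cong symb (sym (+-identityʳ p))) (h 0)
  shift : ∀ {p n w} -> At (suc (p + n)) w -> At (p + suc n) w
  shift {p} {n} {w} = subst (\ q -> At q w) (sym (+-suc p n))
  at-end : ∀ {p} -> At p [] -> symb p ≡ 0
  at-end {p} (text h) = tr (cong symb (sym (+-identityʳ p))) (h 0)
  module Unroll {S : Set} (step : ℕ -> S -> S) (z : S) (end : ∀ i -> symb i ≡ 0 -> step i z ≡ z) where
   upTo : ℕ -> ℕ -> S
   upTo n p = iter (\ k a -> step (p + (n ∸ suc k)) a) z n
   iter-ext : ∀ {s s' : ℕ -> S -> S} {z} n -> (∀ k -> k < n -> ∀ a -> s k a ≡ s' k a) -> iter s z n ≡ iter s' z n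
   iter-ext zero h = refl
   iter-ext {s} {s'} (suc n) h = tr (h n ≤-refl _) (cong (s' n) (iter-ext n (\ k k<n -> h k (m<n⇒m<1+n k<n))))
   iter-first : ∀ (s : ℕ -> S -> S) z n -> iter s z (suc n) ≡ iter (\ k -> s (suc k)) (s 0 z) n
   iter-first s z zero = refl
   iter-first s z (suc n) = cong (s (suc n)) (iter-first s z n)
   grow : ∀ n p -> upTo (suc n) p ≡ step p (upTo n (suc p))
   grow n p = cong2 step (tr (cong (p +_) (n∸n≡0 n)) (+-identityʳ p)) (iter-ext n (\ k k<n a -> cong (\ i -> step i a) (tr (cong (p +_) (+-∸-assoc 1 k<n)) (+-suc p _))))
   extend : ∀ n p -> ℓ ≤ p + n -> upTo (suc n) p ≡ upTo n p
   extend n p ℓ<= = tr (iter-first (\ k a -> step (p + (suc n ∸ suc k)) a) z n) (cong (\ z -> iter (\ k a -> step (p + (n ∸ suc k)) a) z n) (end (p + n) (beyond (p + n) ℓ<=)))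
   -- The pass always takes ℓ steps, whatever p is. Positions past the end leave the start value
   -- unchanged, so one more step at the far end makes no difference.
   unroll : ∀ p -> backwards step z p ≡ step p (backwards step z (suc p))
   unroll p = tr (sym (extend ℓ p (m≤n+m ℓ p))) (grow ℓ p)
   past : ∀ p -> At p [] -> backwards step z p ≡ z
   past p (text h) = go ℓ p h
    where
    go : ∀ n p -> (∀ i -> symb (p + i) ≡ 0) -> upTo n p ≡ z
    go zero p h = refl
    go (suc n) p h = tr (grow n p) (tr (cong (step p) (go n (suc p) (\ i -> tr (cong symb (sym (+-suc p i))) (h (suc i))))) (end p (tr (cong symb (sym (+-identityʳ p))) (h 0))))
  num-step : ∀ p -> num p ≡ numStep (symb p) (num (suc p))
  num-step = Unroll.unroll (\ i -> numStep (symb i)) 0 (\ i e -> cong (\ s -> numStep s 0) e)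
  dist-step : ∀ c p -> dist c p ≡ distStep c (symb p) (dist c (suc p))
  dist-step c = Unroll.unroll (\ i -> distStep c (symb i)) 0 (\ i e -> tr (cong (\ s -> distStep c s 0) e) (last (c 0)))
   where
   last : ∀ b -> (if b ∨ true then 0 else 1) ≡ 0
   last false = refl
   last true = refl
  overTerms-step : ∀ {S : Set} (z : S) F p -> overTms z F p ≡ termStep z F p (overTms z F (suc p))
  overTerms-step z F = Unroll.unroll (termStep z F) z (\ i e -> cong (\ s -> if isRel s then z else if isTerm s then F i z else z) e)
  Other : (ℕ -> Bool) -> ℕ -> Set
  Other c s = c s ∨ (s ≡ᵇ 0) ≡ false
  dist-at : ∀ c {p s w} xs -> At p (xs ++ s ∷ w) -> All (Other c) xs -> c s ≡ true -> dist c p ≡ length xs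
  dist-at c {p} {s} [] tx [] hit = tr (dist-step c p) (tr (cong (\ s -> distStep c s (dist c (suc p))) (at-head tx)) (cong (\ b -> if b ∨ (s ≡ᵇ 0) then 0 else suc (dist c (suc p))) hit))
  dist-at c {p} (x ∷ xs) tx (o ∷ os) hit = tr (dist-step c p) (tr (cong (\ s -> distStep c s (dist c (suc p))) (at-head tx)) (tr (cong (\ b -> if b then 0 else suc (dist c (suc p))) o)
   (cong suc (dist-at c xs (at-tail tx) os hit))))
  digits-at : ∀ ds {p s w} -> At p (digCodes ds ++ s ∷ w) -> isDigit s ≡ false -> num p ≡ fromDigits {2} ds
  digits-at [] {p} {s} tx e = tr (num-step p) (tr (cong (\ s -> numStep s (num (suc p))) (at-head tx)) (cong (\ b -> if b then (s ∸ 18) + 2 * num (suc p) else 0) e))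
  digits-at (zero ∷ ds) {p} tx e = tr (num-step p) (tr (cong (\ s -> numStep s (num (suc p))) (at-head tx)) (tr (cong (2 *_) (digits-at ds (at-tail tx) e)) (*-comm 2 (fromDigits ds))))
  digits-at (suc zero ∷ ds) {p} tx e = tr (num-step p) (tr (cong (\ s -> numStep s (num (suc p))) (at-head tx)) (cong suc (tr (cong (2 *_) (digits-at ds (at-tail tx) e)) (*-comm 2 (fromDigits ds)))))
  nat-at : ∀ n {p s w} -> At p (numrl n ++ s ∷ w) -> isDigit s ≡ false -> num p ≡ n
  nat-at n {p} {s} {w} tx e with numeral-digits n
  ... | ds , eq , val = tr (digits-at ds (subst (\ v -> At p (v ++ s ∷ w)) eq tx) e) val
  int-at : ∀ z {p s w} -> At p (integer z ++ s ∷ w) -> isDigit s ≡ false -> (s ≡ᵇ 20) ≡ false -> int p ≡ z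
  int-at (Z.+ n) {p} {s} {w} tx e e' = tr (cong (\ b -> if b then Z.- Z.+ num (suc p) else Z.+ num p) (unsigned (numeral-digits n))) (cong Z.+_ (nat-at n tx' e))
   where
   tx' : At p (numrl n ++ s ∷ w)
   tx' = subst (\ v -> At p (v ++ s ∷ w)) (integer-nonneg n) tx
   first : ∀ ds -> At p (digCodes ds ++ s ∷ w) -> (symb p ≡ᵇ 20) ≡ false
   first [] tx = tr (cong (_≡ᵇ 20) (at-head tx)) e'
   first (zero ∷ ds) tx = cong (_≡ᵇ 20) (at-head tx)
   first (suc zero ∷ ds) tx = cong (_≡ᵇ 20) (at-head tx)
   unsigned : ∃[ ds ] (numrl n ≡ digCodes ds × fromDigits {2} ds ≡ n) -> (symb p ≡ᵇ 20) ≡ false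
   unsigned (ds , eq , _) = first ds (subst (\ v -> At p (v ++ s ∷ w)) eq tx')
  int-at -[1+ n ] {p} {s} {w} tx e e' = tr (cong (\ b -> if b then Z.- Z.+ num (suc p) else Z.+ num p) (cong (_≡ᵇ 20) (at-head tx'))) (cong (\ m -> Z.- Z.+ m) (nat-at (suc n) (at-tail tx') e))
   where
   tx' : At p (20 ∷ numrl (suc n) ++ s ∷ w)
   tx' = subst (\ v -> At p (v ++ s ∷ w)) (integer-neg n) tx
  c0-at : ∀ a {p rest} -> At p (23 ∷ inside a ++ rest) -> c₀ p ≡ ℤ[α].c₀ a
  c0-at (c + d ·α) {p} {rest} tx = int-at c (subst (At (suc p)) (++-assoc (integer c) _ rest) (at-tail tx)) refl refl
  c1-at : ∀ a {p rest} -> At p (23 ∷ inside a ++ rest) -> c₁ p ≡ ℤ[α].c₁ a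
  c1-at (c + d ·α) {p} {rest} tx = tr (cong (\ n -> int (p + suc n)) (dist-at (_≡ᵇ 21) (23 ∷ integer c) tx' (refl ∷ All.map (numeric {Other (_≡ᵇ 21)} refl refl refl) (int-numeric c)) refl))
   (int-at d {s = 22} {24 ∷ rest} (shift {p} (at-tail (at-drop (23 ∷ integer c) tx'))) refl refl)
   where
   tx' : At p (23 ∷ integer c ++ 21 ∷ integer d ++ 22 ∷ 24 ∷ rest)
   tx' = subst (At p) (cong (23 ∷_) (tr (++-assoc (integer c) _ rest) (cong (\ v -> integer c ++ 21 ∷ v) (++-assoc (integer d) _ rest)))) tx
  variable-at : ∀ a i {p s rest} -> At p (23 ∷ inside a ++ 17 ∷ numrl i ++ s ∷ rest) -> isDigit s ≡ false -> variable# p ≡ i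
  variable-at a i {p} {s} {rest} tx e = tr (cong (\ n -> num (p + suc n)) (dist-at (_≡ᵇ 17) (23 ∷ inside a) tx (refl ∷ inside-All {Other (_≡ᵇ 17)} refl refl refl refl refl refl a) refl))
   (nat-at i {s = s} {rest} (shift {p} (at-tail (at-drop (23 ∷ inside a) tx))) e)

-- Evaluating a formula, given the truth values of its atoms

-- A number serves as a stack of truth values with its lowest bit on top; formulas in prefix
-- notation are evaluated on it from the end.
_◂_ : Bool -> ℕ -> ℕ
b ◂ a = b2n b + a * 2

latest : ℕ -> Bool
latest a = a rem 2 ≡ᵇ 1

earlier : ℕ -> ℕ
earlier a = a ÷ 2

latest-◂ : ∀ b a -> latest (b ◂ a) ≡ b
latest-◂ false a = cong (_≡ᵇ 1) (DM.m*n%n≡0 a 2)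
latest-◂ true a = cong (_≡ᵇ 1) (DM.[m+kn]%n≡m%n 1 a 2)

earlier-◂ : ∀ b a -> earlier (b ◂ a) ≡ a
earlier-◂ false a = DM.m*n/n≡m a 2
earlier-◂ true a = tr (DM.+-distrib-/-∣ʳ 1 {a * 2} {2} (DV.divides a refl)) (DM.m*n/n≡m a 2)

connect : ℕ -> ℕ -> ℕ
connect s a = if s ≡ᵇ 27 then (latest a ∧ latest (earlier a)) ◂ earlier (earlier a) else if s ≡ᵇ 28 then (latest a ∨ latest (earlier a)) ◂ earlier (earlier a) else
 if s ≡ᵇ 29 then Bool.not (latest a) ◂ earlier a else a

connect-idle : ∀ s a -> isConn s ≡ false -> connect s a ≡ a
connect-idle s a e = tr (choose s 27 e ≤-refl) (tr (choose s 28 e (s<=n 1)) (choose s 29 e (s<=n 2)))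
 where
 s<=n : ∀ n -> 27 ≤ n + 27
 s<=n n = m≤n+m 27 n
 choose : ∀ s n {x y : ℕ} -> (27 ≤ᵇ s) ≡ false -> 27 ≤ n -> (if s ≡ᵇ n then x else y) ≡ y
 choose s n e n≥ with s ≡ᵇ n in e'
 ... | false = refl
 ... | true = ⊥-elim (true/=false (tr (cong (27 ≤ᵇ_) (≡ᵇ⇒≡ s n (subst T (sym e') tt))) (T=>= (≤⇒≤ᵇ n≥))) e)
  where
  T=>= : ∀ {b} -> T b -> b ≡ true
  T=>= {true} _ = refl

connect-∧ : ∀ v v' a -> connect 27 (v ◂ (v' ◂ a)) ≡ (v ∧ v') ◂ a
connect-∧ v v' a = cong2 _◂_ (cong2 _∧_ (latest-◂ v (v' ◂ a)) (tr (cong latest (earlier-◂ v (v' ◂ a))) (latest-◂ v' a))) (tr (cong earlier (earlier-◂ v (v' ◂ a))) (earlier-◂ v' a))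

connect-∨ : ∀ v v' a -> connect 28 (v ◂ (v' ◂ a)) ≡ (v ∨ v') ◂ a
connect-∨ v v' a = cong2 _◂_ (cong2 _∨_ (latest-◂ v (v' ◂ a)) (tr (cong latest (earlier-◂ v (v' ◂ a))) (latest-◂ v' a))) (tr (cong earlier (earlier-◂ v (v' ◂ a))) (earlier-◂ v' a))

connect-¬ : ∀ v a -> connect 29 (v ◂ a) ≡ Bool.not v ◂ a
connect-¬ v a = cong2 (\ c r -> Bool.not c ◂ r) (latest-◂ v a) (earlier-◂ v a)

termsText : ∀ {n} -> List (ℤ[α] × Fin n) -> List ℕ -> List ℕ
termsText [] rest = rest
termsText ((a , i) ∷ t) rest = 23 ∷ inside a ++ 17 ∷ numrl (toℕ i) ++ termsText t rest

relCode : Inequality -> ℕ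
relCode le = 25
relCode lt = 26

atomText : ∀ {n} -> List (ℤ[α] × Fin n) -> Inequality -> ℤ[α] -> List ℕ -> List ℕ
atomText t R b rest = termsText t (relCode R ∷ 23 ∷ inside b ++ rest)

formText : ∀ {n} -> Formula n -> List ℕ -> List ℕ
formText (atom t R b) rest = atomText t R b rest
formText (and φ ψ) rest = 27 ∷ formText φ (formText ψ rest)
formText (or φ ψ) rest = 28 ∷ formText φ (formText ψ rest)
formText (not φ) rest = 29 ∷ formText φ rest

codes-++ : ∀ ss ss' -> codes (ss ++ ss') ≡ codes ss ++ codes ss'
codes-++ = map-++ code

formText-= : ∀ {n} (φ : Formula n) rest -> codes (Write.formula φ) ++ rest ≡ formText φ rest
formText-= {n} (atom t R b) rest = go t
 where
 relation-= : ∀ R -> code (Write.inequality R) ≡ relCode R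
 relation-= le = refl
 relation-= lt = refl
 term : ℤ[α] × Fin n -> List Symbol
 term (a , i) = Write.coeff a ++ ‵x ∷ Write.nat (toℕ i)
 go : ∀ t -> codes (List.concatMap (\ (a , i) -> Write.coeff a ++ ‵x ∷ Write.nat (toℕ {n} i)) t ++ Write.inequality R ∷ Write.coeff b) ++ rest ≡ atomText t R b rest
 go [] = cong2 (\ r w -> r ∷ w ++ rest) (relation-= R) (coeff-text b)
 go ((a , i) ∷ t) = begin codes ((term (a , i) ++ ts) ++ end) ++ rest ≡⟨ cong (\ v -> codes v ++ rest) (++-assoc (term (a , i)) ts end) ⟩
  codes (term (a , i) ++ ts ++ end) ++ rest ≡⟨ cong (_++ rest) (codes-++ (term (a , i)) (ts ++ end)) ⟩ (codes (term (a , i)) ++ codes (ts ++ end)) ++ rest ≡⟨ ++-assoc (codes (term (a , i))) _ rest ⟩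
  codes (term (a , i)) ++ codes (ts ++ end) ++ rest ≡⟨ cong (codes (term (a , i)) ++_) (go t) ⟩
  codes (term (a , i)) ++ atomText t R b rest ≡⟨ cong (_++ atomText t R b rest) (codes-++ (Write.coeff a) (‵x ∷ Write.nat (toℕ i))) ⟩
  (codes (Write.coeff a) ++ 17 ∷ codes (Write.nat (toℕ i))) ++ atomText t R b rest ≡⟨ cong (\ v -> (codes (Write.coeff a) ++ 17 ∷ v) ++ atomText t R b rest) (sym (numeral-def (toℕ i))) ⟩
  (codes (Write.coeff a) ++ 17 ∷ numrl (toℕ i)) ++ atomText t R b rest ≡⟨ ++-assoc (codes (Write.coeff a)) _ _ ⟩ codes (Write.coeff a) ++ 17 ∷ numrl (toℕ i) ++ atomText t R b rest
   ≡⟨ cong (_++ 17 ∷ numrl (toℕ i) ++ atomText t R b rest) (coeff-text a) ⟩ atomText ((a , i) ∷ t) R b rest ∎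
  where
  open ≡-Reasoning
  ts end : List Symbol
  ts = List.concatMap term t
  end = Write.inequality R ∷ Write.coeff b
formText-= (and φ ψ) rest = cong (27 ∷_) (two φ ψ)
 where
 two : ∀ {n} (φ ψ : Formula n) -> codes (Write.formula φ ++ Write.formula ψ) ++ rest ≡ formText φ (formText ψ rest)
 two φ ψ = tr (cong (_++ rest) (codes-++ (Write.formula φ) (Write.formula ψ))) (tr (++-assoc (codes (Write.formula φ)) _ rest)
  (tr (cong (codes (Write.formula φ) ++_) (formText-= ψ rest)) (formText-= φ _)))
formText-= (or φ ψ) rest = cong (28 ∷_) (tr (cong (_++ rest) (codes-++ (Write.formula φ) (Write.formula ψ))) (tr (++-assoc (codes (Write.formula φ)) _ rest)
  (tr (cong (codes (Write.formula φ) ++_) (formText-= ψ rest)) (formText-= φ _))))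
formText-= (not φ) rest = cong (29 ∷_) (formText-= φ rest)

quantCode : Quantifier -> ℕ
quantCode all = 15
quantCode ex = 16

preText : ∀ {Q n r} -> Prenex Q n r -> List ℕ
preText (matrix φ) = formText φ []
preText {Q} (block m S) = quantCode Q ∷ replicate m 17 ++ preText S

prenexText-= : ∀ {Q n r} (S : Prenex Q n r) -> codes (Write.prenex S) ≡ preText S
prenexText-= (matrix φ) = tr (sym (++-identityʳ _)) (formText-= φ [])
prenexText-= {Q} (block m S) = cong2 _∷_ (quantifier-= Q) (tr (codes-++ (replicate m ‵x) (Write.prenex S)) (cong2 _++_ (map-replicate code m ‵x) (prenexText-= S)))
 where
 quantifier-= : ∀ Q -> code (Write.quantifier Q) ≡ quantCode Q
 quantifier-= all = refl
 quantifier-= ex = refl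

module Evaluation (symb : ℕ -> ℕ) (ℓ : ℕ) where
 open Text symb ℓ public
 evalStep : (ℕ -> Bool) -> ℕ -> ℕ -> ℕ
 evalStep claims i a = if start? i then claims i ◂ a else connect (symb i) a
 verdict : (ℕ -> Bool) -> Bool
 verdict claims = latest (backwards (evalStep claims) 0 0)
 isQuant : ℕ -> Bool
 isQuant s = (s ≡ᵇ 15) ∨ (s ≡ᵇ 16)
 quantStep lastStep : ℕ -> ℕ -> ℕ
 quantStep i a = if isQuant (symb i) then suc a else a
 lastStep i a = if isQuant (symb i) ∧ (a ≡ᵇ 0) then symb i else a
 quants lastQ : ℕ -> ℕ
 quants = backwards quantStep 0
 lastQ = backwards lastStep 0
 -- Bound variables are told apart from those in terms, which follow a coefficient.
 blockStep : ℕ -> ℕ -> ℕ -> ℕ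
 blockStep j i a = if ((symb i ≡ᵇ 17) ∧ Bool.not (symb (i ∸ 1) ≡ᵇ 24)) ∧ (quants (suc i) ≡ᵇ j) then suc a else a
 -- The size of the block with j quantifiers to its right.
 bsize : ℕ -> ℕ -> ℕ
 bsize j = backwards (blockStep j) 0
 -- Whether the innermost block is existential. The first elimination looks for a witness, so for an
 -- innermost universal block the product automaton has to accept the negated matrix.
 polarity : Bool
 polarity = lastQ 0 ≡ᵇ 16
 module Parsing (beyond : ∀ i -> ℓ ≤ i -> symb i ≡ 0) where
  open Reading beyond public
  -- The symbol before position p allows an atom to start at p.
  Free : ℕ -> Set
  Free p = busy (symb (p ∸ 1)) ≡ false
  Parsed : (ℕ -> Set) -> List ℕ -> Set
  Parsed P rest = ∃[ q ] (P q × At q rest × Free q)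
  start-busy : ∀ p -> busy (symb (p ∸ 1)) ≡ true -> start? p ≡ false
  start-busy p e with isTerm (symb p) ∨ isRel (symb p)
  ... | false = refl
  ... | true = cong Bool.not e
  start-free : ∀ p -> isTerm (symb p) ∨ isRel (symb p) ≡ true -> Free p -> start? p ≡ true
  start-free p e e' = cong2 (\ a b -> a ∧ Bool.not b) e e'
  start-plain : ∀ p -> isTerm (symb p) ∨ isRel (symb p) ≡ false -> start? p ≡ false
  start-plain p e = cong (_∧ Bool.not (busy (symb (p ∸ 1)))) e
  pass : ∀ {S : Set} (V : ℕ -> S) {Q : ℕ -> Set} -> (∀ {p} -> Q (symb p) -> V p ≡ V (suc p)) -> ∀ xs {p w} -> All Q xs -> At p (xs ++ w) -> V p ≡ V (p + length xs)
  pass V h [] {p} [] tx = cong V (sym (+-identityʳ p))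
  pass V {Q} h (x ∷ xs) {p} (q ∷ qs) tx = tr (h (subst Q (sym (at-head tx)) q)) (tr (pass V h xs qs (at-tail tx)) (cong V (sym (+-suc p (length xs)))))
  before : ℤ[α] -> List ℕ
  before (c + d ·α) = integer c ++ 21 ∷ integer d ++ 22 ∷ []
  inside-= : ∀ a rest -> inside a ++ rest ≡ before a ++ 24 ∷ rest
  inside-= (c + d ·α) rest = begin (ci ++ 21 ∷ di ++ 22 ∷ 24 ∷ []) ++ rest ≡⟨ ++-assoc ci _ rest ⟩ ci ++ 21 ∷ (di ++ 22 ∷ 24 ∷ []) ++ rest ≡⟨ cong (\ v -> ci ++ 21 ∷ v) (++-assoc di _ rest) ⟩
   ci ++ 21 ∷ di ++ 22 ∷ 24 ∷ rest ≡⟨ cong (\ v -> ci ++ 21 ∷ v) (++-assoc di (22 ∷ []) (24 ∷ rest)) ⟨ ci ++ 21 ∷ (di ++ 22 ∷ []) ++ 24 ∷ rest ≡⟨ ++-assoc ci _ (24 ∷ rest) ⟨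
   (ci ++ 21 ∷ di ++ 22 ∷ []) ++ 24 ∷ rest ∎
   where
   open ≡-Reasoning
   ci di : List ℕ
   ci = integer c
   di = integer d
  before-All : ∀ {P : ℕ -> Set} -> P 18 -> P 19 -> P 20 -> P 21 -> P 22 -> ∀ a -> All P (before a)
  before-All {P} h18 h19 h20 h21 h22 (c + d ·α) = AllP.++⁺ (All.map (numeric {P} h18 h19 h20) (int-numeric c)) (h21 ∷ AllP.++⁺ (All.map (numeric {P} h18 h19 h20) (int-numeric d)) (h22 ∷ []))
  terms-head : ∀ {n} (t : List (ℤ[α] × Fin n)) R w -> ∃₂ \ s v -> termsText t (relCode R ∷ w) ≡ s ∷ v × isDigit s ≡ false
  terms-head [] le w = 25 , w , refl , refl
  terms-head [] lt w = 26 , w , refl , refl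
  terms-head ((a , i) ∷ t) R w = 23 , _ , refl , refl
  -- A pass that ignores the symbols of coefficients and indices has the same value on both sides of
  -- a term. The variable mark 17 has a hypothesis of its own, because the size of a block counts
  -- some of these marks, but none after the bracket 24.
  module Walk {S : Set} (V : ℕ -> S) (Q : ℕ -> Set) (h : ∀ {p} -> Q (symb p) -> V p ≡ V (suc p))
   (h17 : ∀ {p} -> symb p ≡ 17 -> symb (p ∸ 1) ≡ 24 -> V p ≡ V (suc p)) (q18 : Q 18) (q19 : Q 19) (q20 : Q 20) (q21 : Q 21) (q22 : Q 22) (q24 : Q 24) where
   walk-inside : ∀ a {p rest} -> At p (inside a ++ rest) -> ∃[ q ] (V p ≡ V (suc q) × At (suc q) rest × symb q ≡ 24)
   walk-inside a {p} {rest} tx = q , tr (pass V h (before a) (before-All {Q} q18 q19 q20 q21 q22 a) tx') (h (subst Q (sym (at-head tx'')) q24)) , at-tail tx'' , at-head tx''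
    where
    tx' : At p (before a ++ 24 ∷ rest)
    tx' = subst (At p) (inside-= a rest) tx
    q = p + length (before a)
    tx'' : At q (24 ∷ rest)
    tx'' = at-drop (before a) tx'
   walk-nat : ∀ n {p rest} -> At p (numrl n ++ rest) -> ∃[ q ] (V p ≡ V (suc q) × At (suc q) rest × isDigit (symb q) ≡ true)
   walk-nat n {p} {rest} tx with numeral-last n
   ... | ds , d , eq = q , tr (pass V h (digCodes ds) (digits ds) tx') (h (subst Q (sym (at-head tx'')) (digit-Q d))) , at-tail tx'' , tr (cong isDigit (at-head tx'')) (is-digit d)
    where
    digit-Q : ∀ d -> Q (code (Write.bit d))
    digit-Q zero = q18
    digit-Q (suc zero) = q19
    is-digit : ∀ d -> isDigit (code (Write.bit d)) ≡ true
    is-digit zero = refl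
    is-digit (suc zero) = refl
    digits : ∀ ds -> All Q (digCodes ds)
    digits [] = []
    digits (d ∷ ds) = digit-Q d ∷ digits ds
    tx' : At p (digCodes ds ++ code (Write.bit d) ∷ rest)
    tx' = subst (At p) (tr (cong (_++ rest) eq) (++-assoc (digCodes ds) _ rest)) tx
    q = p + length (digCodes ds)
    tx'' : At q (code (Write.bit d) ∷ rest)
    tx'' = at-drop (digCodes ds) tx'
   walk-term : ∀ a i {p rest} -> At p (inside a ++ 17 ∷ numrl i ++ rest) -> ∃[ q ] (V p ≡ V (suc q) × At (suc q) rest × isDigit (symb q) ≡ true)
   walk-term a i tx with walk-inside a tx
   ... | q1 , e1 , tx1 , s24 with walk-nat i (at-tail tx1)
   ... | q2 , e2 , tx2 , d = q2 , tr e1 (tr (h17 (at-head tx1) s24) e2) , tx2 , d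
  rel-at : ∀ {n} (t : List (ℤ[α] × Fin n)) R b {p rest} -> At p (atomText t R b rest) -> At (relation p) (relCode R ∷ 23 ∷ inside b ++ rest)
  rel-at t R b {p} {rest} tx = go t tx
   where
   relation-step : ∀ p -> relation p ≡ p + distStep isRel (symb p) (dist isRel (suc p))
   relation-step p = cong (p +_) (dist-step isRel p)
   here! : ∀ {p} R {w} -> At p (relCode R ∷ w) -> relation p ≡ p
   here! {p} le tx = tr (relation-step p) (tr (cong (\ s -> p + distStep isRel s (dist isRel (suc p))) (at-head tx)) (+-identityʳ p))
   here! {p} lt tx = tr (relation-step p) (tr (cong (\ s -> p + distStep isRel s (dist isRel (suc p))) (at-head tx)) (+-identityʳ p))
   walks : ∀ {p} -> Other isRel (symb p) -> relation p ≡ relation (suc p)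
   walks {p} o = tr (relation-step p) (tr (cong (\ b -> p + (if b then 0 else suc (dist isRel (suc p)))) o) (+-suc p _))
   open Walk relation (Other isRel) walks (\ e _ -> walks (subst (Other isRel) (sym e) refl)) refl refl refl refl refl refl
   go : ∀ t {p} -> At p (atomText t R b rest) -> At (relation p) (relCode R ∷ 23 ∷ inside b ++ rest)
   go [] {p} tx = subst (\ q -> At q _) (sym (here! R tx)) tx
   go ((a , i) ∷ t) {p} tx with walk-term a (toℕ i) (at-tail tx)
   ... | q , e , tx' , _ = subst (\ q -> At q (relCode R ∷ 23 ∷ inside b ++ rest)) (sym (tr (walks (subst (Other isRel) (sym (at-head tx)) refl)) e)) (go t tx')
  overTerms-at : ∀ {S : Set} {n} z (F : ℕ -> S -> S) (G : ℤ[α] × Fin n -> S -> S) ->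
   (∀ {p a i s rest} -> At p (23 ∷ inside a ++ 17 ∷ numrl (toℕ i) ++ s ∷ rest) -> isDigit s ≡ false -> ∀ x -> F p x ≡ G (a , i) x) ->
   ∀ t R b {p rest} -> At p (atomText t R b rest) -> overTms z F p ≡ List.foldr G z t
  overTerms-at z F G h t R b {rest = rest} = go t
   where
   V = overTms z F
   Calm : ℕ -> Set
   Calm s = isRel s ≡ false × isTerm s ≡ false
   walks : ∀ {p} -> Calm (symb p) -> V p ≡ V (suc p)
   walks {p} (e , e') = tr (overTerms-step z F p) (tr (cong (\ b -> if b then z else if isTerm (symb p) then F p (V (suc p)) else V (suc p)) e)
    (cong (\ b -> if b then F p (V (suc p)) else V (suc p)) e'))
   open Walk V Calm walks (\ e _ -> walks (subst Calm (sym e) (refl , refl))) (refl , refl) (refl , refl) (refl , refl) (refl , refl) (refl , refl) (refl , refl)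
   cases : ∀ {p s} -> symb p ≡ s -> V p ≡ (if isRel s then z else if isTerm s then F p (V (suc p)) else V (suc p))
   cases {p} e = tr (overTerms-step z F p) (cong (\ s -> if isRel s then z else if isTerm s then F p (V (suc p)) else V (suc p)) e)
   go : ∀ t {p} -> At p (atomText t R b rest) -> V p ≡ List.foldr G z t
   go [] tx = ends R tx
    where
    ends : ∀ R {p} -> At p (atomText {0} [] R b rest) -> V p ≡ z
    ends le tx = cases (at-head tx)
    ends lt tx = cases (at-head tx)
   go ((a , i) ∷ t) {p} tx with walk-term a (toℕ i) (at-tail tx) | terms-head t R (23 ∷ inside b ++ rest)
   ... | q , e , tx' , _ | s , v , eq , nd = tr (cases (at-head tx))
    (tr (h {a = a} {i} (subst (\ w -> At p (23 ∷ inside a ++ 17 ∷ numrl (toℕ i) ++ w)) eq tx) nd (V (suc p))) (cong (G (a , i)) (tr e (go t tx'))))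
  Plain : ℕ -> Set
  Plain s = (isTerm s ∨ isRel s) ≡ false × isConn s ≡ false
  module Scan {S : Set} (step : ℕ -> S -> S) (z : S) (idle : ∀ i a -> start? i ≡ false -> isConn (symb i) ≡ false -> step i a ≡ a) where
   V : ℕ -> S
   V = backwards step z
   open Unroll step z (\ i e -> idle i z (start-plain i (cong (\ s -> isTerm s ∨ isRel s) e)) (cong isConn e)) public
   walks : ∀ {p} -> Plain (symb p) -> V p ≡ V (suc p)
   walks {p} (e , e') = tr (unroll p) (idle p (V (suc p)) (start-plain p e) e')
   open Walk V Plain walks (\ e _ -> walks (subst Plain (sym e) (refl , refl))) (refl , refl) (refl , refl) (refl , refl) (refl , refl) (refl , refl) (refl , refl)
   walk-busy : ∀ {p} -> busy (symb (p ∸ 1)) ≡ true -> isConn (symb p) ≡ false -> V p ≡ V (suc p)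
   walk-busy {p} e e' = tr (unroll p) (idle p (V (suc p)) (start-busy p e) e')
   coefficient : ∀ b {p s rest} -> symb p ≡ s -> busy s ≡ true -> At (suc p) (23 ∷ inside b ++ rest) -> Parsed (\ q -> V (suc p) ≡ V q) rest
   coefficient b {p} eq e tx with walk-inside b (at-tail tx)
   ... | q , e' , tx' , s24 = suc q , tr (walk-busy (tr (cong busy eq) e) (cong isConn (at-head tx))) e' , tx' , cong busy s24
   busy-relation : ∀ R -> busy (relCode R) ≡ true
   busy-relation le = refl
   busy-relation lt = refl
   calm-relation : ∀ R -> isConn (relCode R) ≡ false
   calm-relation le = refl
   calm-relation lt = refl
   busy-digit : ∀ s -> isDigit s ≡ true -> busy s ≡ true
   busy-digit s e = cong (_∨ isRel s) e
   -- After its first symbol no position of an atom counts as the start of another one, as the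
   -- preceding symbol is busy.
   remainder : ∀ {n} (t : List (ℤ[α] × Fin n)) R b {p rest} -> busy (symb (p ∸ 1)) ≡ true -> At p (atomText t R b rest) -> Parsed (\ q -> V p ≡ V q) rest
   remainder [] R b {p} e tx with coefficient b (at-head tx) (busy-relation R) (at-tail tx)
   ... | q , e' , tx' , fr = q , tr (walk-busy e (tr (cong isConn (at-head tx)) (calm-relation R))) e' , tx' , fr
   remainder ((a , i) ∷ t) R b {p} e tx with walk-term a (toℕ i) (at-tail tx)
   ... | q , e' , tx' , d with remainder t R b (busy-digit (symb q) d) tx'
   ... | q' , e'' , tx'' , fr = q' , tr (walk-busy e (cong isConn (at-head tx))) (tr e' e'') , tx'' , fr
   atom-scan : ∀ {n} (t : List (ℤ[α] × Fin n)) R b {p rest} -> Free p -> At p (atomText t R b rest) -> start? p ≡ true × Parsed (\ q -> V p ≡ step p (V q)) rest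
   atom-scan [] R b {p} fr tx with coefficient b (at-head tx) (busy-relation R) (at-tail tx)
   ... | q , e' , tx' , fr' = start-free p (relation-starts R (at-head tx)) fr , q , tr (unroll p) (cong (step p) e') , tx' , fr'
    where
    relation-starts : ∀ R {s} -> s ≡ relCode R -> isTerm s ∨ isRel s ≡ true
    relation-starts le refl = refl
    relation-starts lt refl = refl
   atom-scan ((a , i) ∷ t) R b {p} fr tx with walk-term a (toℕ i) (at-tail tx)
   ... | q , e' , tx' , d with remainder t R b (busy-digit (symb q) d) tx'
   ... | q' , e'' , tx'' , fr' = start-free p (cong (\ s -> isTerm s ∨ isRel s) (at-head tx)) fr , q' , tr (unroll p) (cong (step p) (tr e' e'')) , tx'' , fr'

-- Mixed radix notation

prod : ℕ -> (ℕ -> ℕ) -> ℕ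
prod n f = iter (\ i a -> f i * a) 1 n

field# : (ℕ -> ℕ) -> ℕ -> ℕ -> ℕ
field# W q p = (q ÷ prod p W) rem W p

module _ (W : ℕ -> ℕ) (0<W : ∀ p -> 0 < W p) where
 prod-positive : ∀ n -> 0 < prod n W
 prod-positive zero = s≤s z≤n
 prod-positive (suc n) = *-mono-≤ (0<W n) (prod-positive n)
 prod-factor : ∀ {p} n -> p < n -> ∃[ c ] prod n W ≡ c * (W p * prod p W)
 prod-factor {p} (suc n) p<n with m≤n⇒m<n∨m≡n (≤-pred p<n)
 ... | in2 refl = 1 , sym (*-identityˡ _)
 ... | in1 p<n' with prod-factor n p<n'
 ... | c , eq = W n * c , tr (cong (W n *_) eq) (sym (*-assoc (W n) c _))
 prod-mono : ∀ {n m} -> n ≤ m -> prod n W ≤ prod m W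
 prod-mono {n} {zero} z≤n = ≤-refl
 prod-mono {n} {suc m} n≤m with m≤n⇒m<n∨m≡n n≤m
 ... | in1 (s≤s n<=m') = ≤-trans (prod-mono {n} {m} n<=m') (≤-trans (≡⇒≤ (sym (*-identityˡ _))) (*-monoˡ-≤ (prod m W) (0<W m)))
 ... | in2 refl = ≤-refl
 prod-bounded : ∀ L -> (∀ p -> L ≤ p -> W p ≡ 1) -> ∀ n -> prod n W ≤ prod L W
 prod-bounded L flat zero = prod-mono {0} {L} z≤n
 prod-bounded L flat (suc n) with <-≤-connex n L
 ... | in1 n<L = prod-mono {suc n} {L} n<L
 ... | in2 L≤n = ≤-trans (≡⇒≤ (tr (cong (_* prod n W) (flat n L≤n)) (*-identityˡ (prod n W)))) (prod-bounded L flat n)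
 private
  ÷-= : ∀ m n .{{_ : NonZero n}} -> m ÷ n ≡ m ℕ./ n
  ÷-= m (suc n) = refl
  rem-= : ∀ m n .{{_ : NonZero n}} -> m rem n ≡ m ℕ.% n
  rem-= m (suc n) = refl
 encode-fields : ∀ n (d : ℕ -> ℕ) -> (∀ p -> p < n -> d p < W p) -> ∃[ q ] (q < prod n W × (∀ p -> p < n -> field# W q p ≡ d p))
 encode-fields zero d small = 0 , s≤s z≤n , \ _ ()
 encode-fields (suc n) d small with encode-fields n d (\ p p<n -> small p (m<n⇒m<1+n p<n))
 ... | q , q< , fields = q + d n * Pn , (begin-strict q + d n * Pn <⟨ +-monoˡ-< (d n * Pn) q< ⟩ suc (d n) * Pn ≤⟨ *-monoˡ-≤ Pn (small n ≤-refl) ⟩ W n * Pn ∎) , fields'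
  where
  open ℕ.≤-Reasoning
  Pn = prod n W
  fields' : ∀ p -> p < suc n -> field# W (q + d n * Pn) p ≡ d p
  fields' p p<n with m≤n⇒m<n∨m≡n (≤-pred p<n)
  ... | in2 refl = tr (cong (_rem W n) (tr (÷-= (q + d n * Pn) Pn) (tr (DM.+-distrib-/-∣ʳ q (DV.divides (d n) refl))
      (cong2 _+_ (DM.m<n⇒m/n≡0 q<) (DM.m*n/n≡m (d n) Pn))))) (tr (rem-= (d n) (W n)) (DM.m<n⇒m%n≡m (small n ≤-refl)))
   where
   instance
    nz = ℕ.>-nonZero (prod-positive n)
    nz' = ℕ.>-nonZero (0<W n)
  ... | in1 p<n' with prod-factor n p<n'
  ... | c , eq = tr (cong (_rem W p) (tr (÷-= (q + d n * Pn) (prod p W)) (tr (DM.+-distrib-/-∣ʳ q (DV.divides k split))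
       (cong2 _+_ (sym (÷-= q (prod p W))) (tr (cong (ℕ._/ prod p W) split) (DM.m*n/n≡m k (prod p W)))))))
      (tr (rem-= (q ÷ prod p W + k) (W p)) (tr (cong (\ k -> (q ÷ prod p W + k) ℕ.% W p) (tr (sym (*-assoc (d n) c (W p))) refl))
       (tr (DM.[m+kn]%n≡m%n (q ÷ prod p W) (d n * c) (W p)) (tr (sym (rem-= (q ÷ prod p W) (W p))) (fields p p<n')))))
   where
   instance
    nz = ℕ.>-nonZero (prod-positive p)
    nz' = ℕ.>-nonZero (0<W p)
   k = d n * (c * W p)
   split : d n * Pn ≡ k * prod p W
   split = tr (cong (d n *_) (tr eq (sym (*-assoc c (W p) (prod p W))))) (sym (*-assoc (d n) (c * W p) (prod p W)))

-- An inequality holds if minus its total value satisfies `cond`. Its negation asserts the same of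
-- the total value itself, with strict and weak exchanged. Either claim thus becomes a condition of
-- one form, which passes upwards along ≼.
orient : Bool -> ZR -> ZR
orient c z = if c then ⊝ z else z

-- The product of L automata for inequalities, with claims about their truth.
module Product (setting : Setting) (L : ℕ) (e : ℕ -> ℕ -> ZR) (b : ℕ -> ZR) (strict : ℕ -> Bool) (E : ℕ -> ℕ) (verdict : (ℕ -> Bool) -> Bool) where
 open Automata setting
 B H : ℕ -> ℕ
 B p = E p + E p
 H p = suc (B p + B p)
 -- Five fields for each position: the claim, and the four coordinates of `upper` and `lower`,
 -- shifted by `B` so as to be natural numbers.
 widths : ℕ -> ℕ -> ℕ
 widths p i = if i ≡ᵇ 0 then 2 else H p
 W : ℕ -> ℕ
 W p = if suc p ≤ᵇ L then prod 5 (widths p) else 1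
 0<widths : ∀ p i -> 0 < widths p i
 0<widths p zero = s≤s z≤n
 0<widths p (suc i) = s≤s z≤n
 0<W : ∀ p -> 0 < W p
 0<W p with suc p ≤ᵇ L
 ... | true = prod-positive (widths p) (0<widths p) 5
 ... | false = ≤-refl
 W-inside : ∀ {p} -> p < L -> W p ≡ prod 5 (widths p)
 W-inside {p} p<L = cong (\ b -> if b then prod 5 (widths p) else 1) (T-true (≤⇒≤ᵇ p<L))
  where
  T-true : ∀ {b} -> T b -> b ≡ true
  T-true {true} _ = refl
 W-outside : ∀ p -> L ≤ p -> W p ≡ 1
 W-outside p L<=p = cong (\ b -> if b then prod 5 (widths p) else 1) (/=true=>false (\ e -> <⇒≱ (≤ᵇ⇒≤ (suc p) L (subst T (sym e) tt)) L<=p))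
 part : ℕ -> ℕ -> ℕ -> ℕ
 part q p = field# (widths p) (field# W q p)
 coord : ℕ -> ℕ -> ℕ -> ℤ
 coord q p i = Z.+ part q p i Z.- Z.+ B p
 abstract
  claim : ℕ -> ℕ -> Bool
  claim q p = part q p 0 ≡ᵇ 1
  upper lower : ℕ -> ℕ -> ZR
  upper q p = coord q p 1 , coord q p 2
  lower q p = coord q p 3 , coord q p 4
  claim-def : ∀ q p -> claim q p ≡ (part q p 0 ≡ᵇ 1)
  claim-def q p = refl
  upper-def : ∀ q p -> upper q p ≡ (coord q p 1 , coord q p 2)
  upper-def q p = refl
  lower-def : ∀ q p -> lower q p ≡ (coord q p 3 , coord q p 4)
  lower-def q p = refl
 -- The claims are guessed at the start and cannot change along a run, so each component checks one
 -- fixed inequality; the verdict on the formula is drawn from the claims only at the end.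
 product : Auto
 product = record { N = prod L W ; rel = \ q u q' -> every L (\ p -> (claim q p == claim q' p) ∧ next? (orient (claim q p) (e p u)) (upper q p) (lower q p) (upper q' p) (lower q' p))
  ; ini = \ q -> every L (\ p -> initial? (orient (claim q p) (b p)) (upper q p) (lower q p)) ; acc = \ q -> every L (\ p -> final? (strict p == claim q p) (upper q p) (lower q p)) ∧ verdict (claim q)
  }
 truth : List ℕ -> ℕ -> Bool
 truth w p = cond (strict p) (⊝ Atom.total-val (e p) (b p) w)
 orient-total : ∀ c p w -> Atom.total-val (\ u -> orient c (e p u)) (orient c (b p)) w ≡ orient c (Atom.total-val (e p) (b p) w)
 orient-total false p w = refl
 orient-total true p [] = refl
 orient-total true p (u ∷ w) = tr (cong2 _⊕_ (orient-total true p w) (scale-⊝ (Z.+ U (length w)) (e p u))) (sym (⊝-⊕ (Atom.total-val (e p) (b p) w) (scaleR (Z.+ U (length w)) (e p u))))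
  where
  scale-⊝ : ∀ n z -> scaleR n (⊝ z) ≡ ⊝ scaleR n z
  scale-⊝ n (x , y) = cong2 _,_ (sym (Z.neg-distribʳ-* n x)) (sym (Z.neg-distribʳ-* n y))
 cond-not : ∀ s z -> cond (Bool.not s) z ≡ Bool.not (cond s (⊝ z))
 cond-not false z = cong (Bool.not ∘ nnR') (swap z)
  where
  swap : ∀ z -> 0R ⊝ z ≡ ⊝ z ⊝ 0R
  swap (x , y) = cong2 _,_ (Z.+-comm 0ℤ (Z.- x)) (Z.+-comm 0ℤ (Z.- y))
 cond-not true z = tr (cong nnR' (swap z)) (sym (not-not _))
  where
  swap : ∀ z -> z ⊝ 0R ≡ 0R ⊝ ⊝ z
  swap (x , y) = cong2 _,_ (lemma x) (lemma y)
   where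
   open Z-Solver
   lemma : ∀ x -> x Z.- 0ℤ ≡ 0ℤ Z.- (Z.- x)
   lemma = solve 1 (\ x -> x :- con 0ℤ := con 0ℤ :- (:- x)) refl
  not-not : ∀ b -> Bool.not (Bool.not b) ≡ b
  not-not false = refl
  not-not true = refl
 ==-true : ∀ s -> (s == true) ≡ s
 ==-true false = refl
 ==-true true = refl
 ==-false : ∀ s -> (s == false) ≡ Bool.not s
 ==-false false = refl
 ==-false true = refl
 -- A claim is the condition of its own oriented inequality.
 claim-cond : ∀ c p w -> cond (strict p == c) (Atom.total-val (\ u -> orient c (e p u)) (orient c (b p)) w) ≡ (c == truth w p)
 claim-cond true p w = cong2 cond (==-true (strict p)) (orient-total true p w)
 claim-cond false p w = tr (cong2 cond (==-false (strict p)) (orient-total false p w)) (cond-not (strict p) (Atom.total-val (e p) (b p) w))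
 reach-run : ∀ {w q} -> Reach product w q -> ∀ p -> p < L -> Atom.Run (\ u -> orient (claim q p) (e p u)) (orient (claim q p) (b p)) w (upper q p) (lower q p)
 reach-run (start _ i) p p<L = Atom.start (every-elim L _ i p p<L)
 reach-run (next {w} {q} {u} {q'} r _ t) p p<L = subst (\ c -> Atom.Run (\ u -> orient c (e p u)) (orient c (b p)) (u ∷ w) (upper q' p) (lower q' p)) (==-elim (∧-fst tested))
   (Atom.next (reach-run r p p<L) (∧-snd {claim q p == claim q' p} tested))
  where
     tested = every-elim L _ t p p<L
 module _ (verdict-cong : ∀ f g -> (∀ p -> p < L -> f p ≡ g p) -> verdict f ≡ verdict g) where
  accept-sound : ∀ {w} -> Accept product w -> verdict (truth w) ≡ true
  accept-sound {w} (q , r , a) = tr (verdict-cong (truth w) (claim q) (\ p p<L -> sym (==-elim (correct' p p<L)))) (∧-snd {every L _} a)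
   where
   correct' : ∀ p -> p < L -> (claim q p == truth w p) ≡ true
   correct' p p<L = tr (sym (claim-cond (claim q p) p w)) (Atom.sound _ _ (strict p == claim q p) (reach-run r p p<L) (every-elim L _ (∧-fst a) p p<L))
  module _ (1<=E : ∀ p -> 1 ≤ E p) (small : ∀ c p u -> Boxed (E p) (orient c (e p u))) (small-β : ∀ c p u -> Boxed (E p) (⊝ β (orient c (e p u))))
       (small-b : ∀ c p -> Boxed (E p) (⊝ β (Z (orient c (b p))))) (w : List ℕ) (accepted : verdict (truth w) ≡ true) where
   private
    c' : ℕ -> Bool
    c' = truth w
    module C p = Atom.Complete (\ u -> orient (c' p) (e p u)) (orient (c' p) (b p)) (E p) (1<=E p) (small (c' p) p) (small-β (c' p) p) (small-b (c' p) p)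
    claimed : ∀ p -> cond (strict p == c' p) (Atom.total-val (\ u -> orient (c' p) (e p u)) (orient (c' p) (b p)) w) ≡ true
    claimed p = tr (claim-cond (c' p) p w) (==-refl (c' p))
     where
     ==-refl : ∀ c -> (c == c) ≡ true
     ==-refl false = refl
     ==-refl true = refl
    reversed : ∀ (hi lo : List ℕ) -> reverse (hi ʳ++ lo) ≡ lo ʳ++ hi
    reversed hi lo = tr (ʳ++-ʳ++ hi) (cong (lo ʳ++_) (++-identityʳ hi))
    shift : ℕ -> ℤ -> ℕ
    shift p i = Z.∣ i Z.+ Z.+ B p ∣
    shift-back : ∀ p {i} -> Z.∣ i ∣ ≤ B p -> Z.+ shift p i Z.- Z.+ B p ≡ i
    shift-back p {i} i<= = tr (cong (Z._- Z.+ B p) (Z.0≤i⇒+∣i∣≡i (nonnegative i i<=))) (solve 2 (\ i b -> (i :+ b) :- b := i) refl i (Z.+ B p))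
     where
     open Z-Solver
     nonnegative : ∀ i -> Z.∣ i ∣ ≤ B p -> 0ℤ Z.≤ i Z.+ Z.+ B p
     nonnegative (Z.+ n) _ = Z.+≤+ z≤n
     nonnegative -[1+ n ] n< = subst (0ℤ Z.≤_) (sym (Z.⊖-≥ n<)) (Z.+≤+ z≤n)
    shift-small : ∀ p {i} -> Z.∣ i ∣ ≤ B p -> shift p i < H p
    shift-small p {i} i<= = s≤s (≤-trans (Z.∣i+j∣≤∣i∣+∣j∣ i (Z.+ B p)) (+-monoˡ-≤ (B p) i<=))
    digits : ℕ -> ZR -> ZR -> ℕ -> ℕ
    digits p (t1 , t2) (r1 , r2) 0 = b2n (c' p)
    digits p (t1 , t2) (r1 , r2) 1 = shift p t1
    digits p (t1 , t2) (r1 , r2) 2 = shift p t2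
    digits p (t1 , t2) (r1 , r2) 3 = shift p r1
    digits p (t1 , t2) (r1 , r2) _ = shift p r2
    record Encodes (t r : ℕ -> ZR) (q : ℕ) : Set where
     field
      below : q < prod L W
      claims : ∀ p -> p < L -> claim q p ≡ c' p
      uppers : ∀ p -> p < L -> upper q p ≡ t p
      lowers : ∀ p -> p < L -> lower q p ≡ r p
    bounds : ∀ p {z} -> Boxed (B p) z -> Z.∣ fst z ∣ ≤ B p × Z.∣ snd z ∣ ≤ B p
    bounds p {x , y} = boxed-bounds 1<=D
    encode-state : ∀ (t r : ℕ -> ZR) -> (∀ p -> Boxed (B p) (t p)) -> (∀ p -> Boxed (B p) (r p)) -> ∃[ q ] Encodes t r q
    encode-state t r bt br = q , record { below = fst (snd outer) ; claims = \ p p<L -> tr (claim-def q p) (tr (cong (_≡ᵇ 1) (part-= p p<L 0 (s≤s z≤n))) (b2n-= (c' p)))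
     ; uppers = \ p p<L -> tr (upper-def q p) (cong2 _,_ (back p p<L 1 (s≤s (s≤s z≤n)) (fst (bounds p (bt p))) refl) (back p p<L 2 (s≤s (s≤s (s≤s z≤n))) (snd (bounds p (bt p))) refl))
     ; lowers = \ p p<L -> tr (lower-def q p) (cong2 _,_ (back p p<L 3 (s≤s (s≤s (s≤s (s≤s z≤n)))) (fst (bounds p (br p))) refl) (back p p<L 4 ≤-refl (snd (bounds p (br p))) refl)) }
     where
     d : ℕ -> ℕ -> ℕ
     d p = digits p (t p) (r p)
     b2n-< : ∀ c -> b2n c < 2
     b2n-< false = s≤s z≤n
     b2n-< true = s≤s (s≤s z≤n)
     b2n-= : ∀ c -> (b2n c ≡ᵇ 1) ≡ c
     b2n-= false = refl
     b2n-= true = refl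
     d-small : ∀ p i -> i < 5 -> d p i < widths p i
     d-small p 0 _ = b2n-< (c' p)
     d-small p 1 _ = shift-small p {fst (t p)} (fst (bounds p (bt p)))
     d-small p 2 _ = shift-small p {snd (t p)} (snd (bounds p (bt p)))
     d-small p 3 _ = shift-small p {fst (r p)} (fst (bounds p (br p)))
     d-small p (suc (suc (suc (suc i)))) _ = shift-small p {snd (r p)} (snd (bounds p (br p)))
     inner : ∀ p -> ∃[ s ] (s < prod 5 (widths p) × (∀ i -> i < 5 -> field# (widths p) s i ≡ d p i))
     inner p = encode-fields (widths p) (0<widths p) 5 (d p) (d-small p)
     outer : ∃[ q ] (q < prod L W × (∀ p -> p < L -> field# W q p ≡ fst (inner p)))
     outer = encode-fields W 0<W L (\ p -> fst (inner p)) (\ p p<L -> subst (fst (inner p) <_) (sym (W-inside p<L)) (fst (snd (inner p))))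
     q = fst outer
     part-= : ∀ p -> p < L -> ∀ i -> i < 5 -> part q p i ≡ d p i
     part-= p p<L i i<5 = tr (cong (\ s -> field# (widths p) s i) (snd (snd outer) p p<L)) (snd (snd (inner p)) i i<5)
     back : ∀ p -> p < L -> ∀ i -> i < 5 -> ∀ {z} -> Z.∣ z ∣ ≤ B p -> d p i ≡ shift p z -> coord q p i ≡ z
     back p p<L i i<5 z<= eq = tr (cong (\ v -> Z.+ v Z.- Z.+ B p) (tr (part-= p p<L i i<5) eq)) (shift-back p z<=)
    t0 : ℕ -> ZR
    t0 p = C.t0 p (strict p == c' p) w (claimed p)
    encoded : ∀ lo hi -> hi ʳ++ lo ≡ w -> ∃[ q ] Encodes (\ p -> C.upperOf p hi) (\ p -> C.lowerOf p (t0 p) lo) q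
    encoded lo hi eq = encode-state (\ p -> C.upperOf p hi) (\ p -> C.lowerOf p (t0 p) lo) (\ p -> C.boxed-upper p (strict p == c' p) w (claimed p) lo hi (tr (sym (reversed hi lo)) (cong reverse eq)))
     (\ p -> C.boxed-lower p (strict p == c' p) w (claimed p) hi lo eq)
    starts : ∀ hi -> hi ʳ++ [] ≡ w -> ∀ {q} -> Encodes (\ p -> C.upperOf p hi) (\ p -> C.lowerOf p (t0 p) []) q -> Reach product [] q
    starts hi eq {q} st = start (Encodes.below st) (every-intro L _ (\ p p<L -> first p (Encodes.claims st p p<L) (Encodes.uppers st p p<L) (Encodes.lowers st p p<L)))
     where
     upper= : ∀ p -> C.upperOf p hi ≡ t0 p
     upper= p = cong (C.upperOf p) (tr (sym (reversed hi [])) (cong reverse eq))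
     first : ∀ p -> claim q p ≡ c' p -> upper q p ≡ C.upperOf p hi -> lower q p ≡ C.lowerOf p (t0 p) [] -> initial? (orient (claim q p) (b p)) (upper q p) (lower q p) ≡ true
     first p ec eu el = tr (cong (\ c -> initial? (orient c (b p)) (upper q p) (lower q p)) ec)
      (tr (cong2 (initial? (orient (c' p) (b p))) (tr eu (upper= p)) el) (tr (initial?-def (orient (c' p) (b p)) (t0 p) (C.lowerOf p (t0 p) [])) (≼=>leq (C.initial-step p (t0 p)))))
    continues : ∀ u lo hi -> ∀ {q q'} -> Reach product lo q -> Encodes (\ p -> C.upperOf p (u ∷ hi)) (\ p -> C.lowerOf p (t0 p) lo) q ->
            Encodes (\ p -> C.upperOf p hi) (\ p -> C.lowerOf p (t0 p) (u ∷ lo)) q' -> Reach product (u ∷ lo) q'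
    continues u lo hi {q} {q'} reach st st' = next reach (Encodes.below st') (every-intro L _ (\ p p<L -> ∧-both (==-intro (tr (Encodes.claims st p p<L) (sym (Encodes.claims st' p p<L))))
        (advance p (Encodes.claims st p p<L) (Encodes.uppers st p p<L) (Encodes.lowers st p p<L) (Encodes.uppers st' p p<L) (Encodes.lowers st' p p<L))))
     where
     advance : ∀ p -> claim q p ≡ c' p -> upper q p ≡ C.upperOf p (u ∷ hi) -> lower q p ≡ C.lowerOf p (t0 p) lo -> upper q' p ≡ C.upperOf p hi -> lower q' p ≡ C.lowerOf p (t0 p) (u ∷ lo) ->
            next? (orient (claim q p) (e p u)) (upper q p) (lower q p) (upper q' p) (lower q' p) ≡ true
     advance p ec eu el eu' el' = tr (cong (\ c -> next? (orient c (e p u)) (upper q p) (lower q p) (upper q' p) (lower q' p)) ec)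
      (tr (cong2 (\ x y -> next? (orient (c' p) (e p u)) x y (upper q' p) (lower q' p)) eu el) (tr (cong2 (next? (orient (c' p) (e p u)) (C.upperOf p (u ∷ hi)) (C.lowerOf p (t0 p) lo)) eu' el')
          (tr (next?-def (orient (c' p) (e p u)) (C.upperOf p (u ∷ hi)) (C.lowerOf p (t0 p) lo) (C.upperOf p hi) (C.lowerOf p (t0 p) (u ∷ lo)))
           (∧-join (≼=>leq (step-below' p)) (≼=>leq (C.next-step p u (C.lowerOf p (t0 p) lo)))))))
      where
      step-below' : ∀ p -> C.upperOf p (u ∷ hi) ≼ β (C.upperOf p hi) ⊕ orient (c' p) (e p u)
      step-below' p = Bound.step-below (E p) (C.upperOf p hi) (orient (c' p) (e p u))
    -- The state after `lo` also depends on the letters `hi` still to come, which `upper`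
    -- anticipates; so the induction moves through a fixed word.
    reaches : ∀ lo hi -> hi ʳ++ lo ≡ w -> ∃[ q ] (Reach product lo q × Encodes (\ p -> C.upperOf p hi) (\ p -> C.lowerOf p (t0 p) lo) q)
    reaches [] hi eq = fst new , starts hi eq (snd new) , snd new
     where
          new = encoded [] hi eq
    reaches (u ∷ lo) hi eq = fst new , continues u lo hi (fst (snd old)) (snd (snd old)) (snd new) , snd new
     where
     old = reaches lo (u ∷ hi) eq
     new = encoded (u ∷ lo) hi eq
   accept-complete : Accept product w
   accept-complete = q , fst (snd found) , ∧-both (every-intro L _ (\ p p<L -> last p (Encodes.claims st p p<L) (Encodes.uppers st p p<L) (Encodes.lowers st p p<L)))
      (tr (verdict-cong (claim q) c' (Encodes.claims st)) accepted)
    where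
    found = reaches w [] refl
    q = fst found
    st = snd (snd found)
    last : ∀ p -> claim q p ≡ c' p -> upper q p ≡ 0R -> lower q p ≡ C.lowerOf p (t0 p) w -> final? (strict p == claim q p) (upper q p) (lower q p) ≡ true
    last p ec eu el = tr (cong (\ c -> final? (strict p == c) (upper q p) (lower q p)) ec) (tr (cong2 (final? (strict p == c' p)) eu el) (tr (final?-def (strict p == c' p) 0R (C.lowerOf p (t0 p) w))
      (∧-both (≼=>leq (≼-refl {0R})) (C.accepts p (strict p == c' p) w (claimed p)))))

-- The inequalities of a sentence, read off its text

record Sized (m : ℕ) (z : ZR) : Set where
 constructor sized
 field
  first : Z.∣ fst z ∣ ≤ m
  second : Z.∣ snd z ∣ ≤ m

sized-<= : ∀ {m n z} -> m ≤ n -> Sized m z -> Sized n z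
sized-<= m≤n (sized a b) = sized (≤-trans a m≤n) (≤-trans b m≤n)

sized-⊝ : ∀ {m z} -> Sized m z -> Sized m (⊝ z)
sized-⊝ {m} {x , y} (sized a b) = sized (subst (_≤ m) (sym (Z.∣-i∣≡∣i∣ x)) a) (subst (_≤ m) (sym (Z.∣-i∣≡∣i∣ y)) b)

sized-conj : ∀ {m z} -> Sized m z -> Sized m (conj z)
sized-conj {m} {x , y} (sized a b) = sized a (subst (_≤ m) (sym (Z.∣-i∣≡∣i∣ y)) b)

sized-orient : ∀ c {m z} -> Sized m z -> Sized m (orient c z)
sized-orient false s = s
sized-orient true s = sized-⊝ s

∣∣-+-<= : ∀ {i j m n} -> Z.∣ i ∣ ≤ m -> Z.∣ j ∣ ≤ n -> Z.∣ i Z.+ j ∣ ≤ m + n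
∣∣-+-<= {i} {j} a b = ≤-trans (Z.∣i+j∣≤∣i∣+∣j∣ i j) (+-mono-≤ a b)

∣∣-*-<= : ∀ c {i n} -> Z.∣ i ∣ ≤ n -> Z.∣ c Z.* i ∣ ≤ Z.∣ c ∣ * n
∣∣-*-<= c {i} a = ≤-trans (≡⇒≤ (Z.abs-* c i)) (*-monoʳ-≤ Z.∣ c ∣ a)

gain : ℕ -> ℤ -> ℤ -> ℕ
gain D c g = suc (Z.∣ c ∣ + Z.∣ Z.+ D Z.* g ∣ + Z.∣ g ∣)

sized-act : ∀ D c g {m z} -> Sized m z -> Sized (gain D c g * m) (actR D c g z)
sized-act D c g {m} {x , y} (sized a b) = sized (≤-trans (∣∣-+-<= {c Z.* x} {Z.+ D Z.* g Z.* y} (∣∣-*-<= c a) (∣∣-*-<= (Z.+ D Z.* g) b)) (begin Z.∣ c ∣ * m + d * m ≡⟨ *-distribʳ-+ m Z.∣ c ∣ d ⟨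
  (Z.∣ c ∣ + d) * m ≤⟨ *-monoˡ-≤ m (≤-trans (m≤m+n (Z.∣ c ∣ + d) Z.∣ g ∣) (n≤1+n _)) ⟩ gain D c g * m ∎)) (≤-trans (∣∣-+-<= {g Z.* x} {c Z.* y} (∣∣-*-<= g a) (∣∣-*-<= c b)) (begin
  Z.∣ g ∣ * m + Z.∣ c ∣ * m ≡⟨ *-distribʳ-+ m Z.∣ g ∣ Z.∣ c ∣ ⟨ (Z.∣ g ∣ + Z.∣ c ∣) * m ≤⟨ *-monoˡ-≤ m (≤-trans (≡⇒≤ (+-comm Z.∣ g ∣ Z.∣ c ∣))
   (≤-trans (+-monoˡ-≤ Z.∣ g ∣ (m≤m+n Z.∣ c ∣ d)) (n≤1+n _))) ⟩ gain D c g * m ∎))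
 where
 open ℕ.≤-Reasoning
 d = Z.∣ Z.+ D Z.* g ∣

-- The integers P, Q with (1 + k) (P + Q α) = p + q √D.
module Conversion (k : ℕ) (b s : ℤ) where
 conv : ℤ -> ℤ -> ZR
 conv P Q = Z.+ suc k Z.* P Z.- b Z.* Q , s Z.* Q
 spread : ℕ
 spread = suc k + Z.∣ b ∣ + Z.∣ s ∣
 sized-conv : ∀ {P Q m} -> Z.∣ P ∣ ≤ m -> Z.∣ Q ∣ ≤ m -> Sized (spread * m) (conv P Q)
 sized-conv {P} {Q} {m} a a' = sized (≤-trans (∣∣-+-<= {Z.+ suc k Z.* P} {Z.- (b Z.* Q)} (∣∣-*-<= (Z.+ suc k) {P} a) (≤-trans (≡⇒≤ (Z.∣-i∣≡∣i∣ (b Z.* Q))) (∣∣-*-<= b {Q} a')))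
   (≤-trans (≡⇒≤ (sym (*-distribʳ-+ m (suc k) Z.∣ b ∣))) (*-monoˡ-≤ m (m≤m+n (suc k + Z.∣ b ∣) Z.∣ s ∣)))) (≤-trans (∣∣-*-<= s {Q} a') (*-monoˡ-≤ m (m≤n+m Z.∣ s ∣ (suc k + Z.∣ b ∣))))
 conv-⊝ : ∀ P Q -> ⊝ conv P Q ≡ conv (Z.- P) (Z.- Q)
 conv-⊝ P Q = cong2 _,_ (solve 4 (\ k b P Q -> :- (k :* P :- b :* Q) := k :* (:- P) :- b :* (:- Q)) refl (Z.+ suc k) b P Q) (Z.neg-distribʳ-* s Q)
  where
   open Z-Solver
 conv-⊕ : ∀ P Q n P' Q' -> conv P Q ⊕ scaleR n (conv P' Q') ≡ conv (P Z.+ n Z.* P') (Q Z.+ n Z.* Q')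
 conv-⊕ P Q n P' Q' = cong2 _,_ (solve 7 (\ k b P Q n P' Q' -> (k :* P :- b :* Q) :+ n :* (k :* P' :- b :* Q') := k :* (P :+ n :* P') :- b :* (Q :+ n :* Q')) refl (Z.+ suc k) b P Q n P' Q')
  (solve 4 (\ s Q n Q' -> s :* Q :+ n :* (s :* Q') := s :* (Q :+ n :* Q')) refl s Q n Q')
  where
   open Z-Solver

dot : ∀ {n} -> (ℤ[α] -> ℤ) -> List (ℤ[α] × Fin n) -> (Fin n -> ℤ) -> ℤ
dot c t f = List.foldr (\ (a , i) x -> c a Z.* f i Z.+ x) 0ℤ t

dot-zero : ∀ {n} c (t : List (ℤ[α] × Fin n)) -> dot c t (\ _ -> 0ℤ) ≡ 0ℤ
dot-zero c [] = refl
dot-zero c ((a , i) ∷ t) = cong2 Z._+_ (Z.*-zeroʳ (c a)) (dot-zero c t)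

dot-cong : ∀ {n} c (t : List (ℤ[α] × Fin n)) {f g} -> (∀ i -> f i ≡ g i) -> dot c t f ≡ dot c t g
dot-cong c [] h = refl
dot-cong c ((a , i) ∷ t) h = cong2 (\ x y -> c a Z.* x Z.+ y) (h i) (dot-cong c t h)

dot-linear : ∀ {n} c (t : List (ℤ[α] × Fin n)) u f g -> dot c t (\ i -> f i Z.* u Z.+ g i) ≡ dot c t g Z.+ u Z.* dot c t f
dot-linear c [] u f g = sym (tr (Z.+-identityˡ _) (Z.*-zeroʳ u))
dot-linear c ((a , i) ∷ t) u f g = tr (cong (\ y -> c a Z.* (f i Z.* u Z.+ g i) Z.+ y) (dot-linear c t u f g))
 (solve 6 (\ c f u g x y -> c :* (f :* u :+ g) :+ (x :+ u :* y) := (c :* g :+ x) :+ u :* (c :* f :+ y)) refl (c a) (f i) u (g i) (dot c t g) (dot c t f))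
 where
  open Z-Solver

module Constants (setting : Setting) (k : ℕ) (b0 s0 : ℤ) where
 open Automata setting using (D; x; y; X)
 open Conversion k b0 s0 using (spread)
 -- The factors from the size of the coefficients to the bound on a letter: `unit` for the passage
 -- to ℤ[√D] and digits up to 2 X, `gain-Z` and `gain-β` for multiplication by 2 Y √D and by β, and
 -- 1 + D from coordinates to the order.
 gain-β gain-Z unit G : ℕ
 gain-β = gain D x y
 gain-Z = gain D 0ℤ (y Z.+ y)
 unit = spread * suc (X + X)
 G = suc D * (gain-β * (gain-Z * unit))

module Inputs (setting : Setting) (k : ℕ) (b0 s0 : ℤ) (symb : ℕ -> ℕ) (ℓ : ℕ) where
 open Automata setting hiding (start; next)
 open Conversion k b0 s0 public
 open Evaluation symb ℓ public
 -- Where no atom starts, both sides are 0. This permits one component for every position of the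
 -- text instead of a numbering of the atoms.
 lin : (ℕ -> ℤ) -> ℕ -> ℕ -> ℤ
 lin c p u = if start? p then overTms 0ℤ (\ i a -> c i Z.* digitVal (digit (variable# i) u) Z.+ a) p else 0ℤ
 rhs : (ℕ -> ℤ) -> ℕ -> ℤ
 rhs c p = if start? p then c (suc (relation p)) else 0ℤ
 magnitude : ℕ -> ℕ
 magnitude i = Z.∣ c₀ i ∣ + Z.∣ c₁ i ∣
 mass : ℕ -> ℕ
 mass p = if start? p then overTms 0 (\ i a -> magnitude i + a) p + magnitude (suc (relation p)) else 0
 abstract
  lhs : ℕ -> ℕ -> ZR
  lhs p u = conv (lin c₀ p u) (lin c₁ p u)
  bnd : ℕ -> ZR
  bnd p = conv (rhs c₀ p) (rhs c₁ p)
  lhs-def : ∀ p u -> lhs p u ≡ conv (lin c₀ p u) (lin c₁ p u)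
  lhs-def p u = refl
  bnd-def : ∀ p -> bnd p ≡ conv (rhs c₀ p) (rhs c₁ p)
  bnd-def p = refl
 strict : ℕ -> Bool
 strict p = symb (relation p) ≡ᵇ 26
 open Constants setting k b0 s0 public
 E : ℕ -> ℕ
 E p = G * suc (mass p)
 digit-<= : ∀ i u -> Z.∣ digitVal (digit i u) ∣ ≤ X + X
 digit-<= i u = ≤-trans (≡⇒≤ (cong Z.∣_∣ (Z.m-n≡m⊖n (v rem R1) (v ÷ R1)))) (≤-trans (Z.∣m⊝n∣≤m⊔n (v rem R1) (v ÷ R1))
  (⊔-lub (≤-pred (DM.m%n<n v R1)) (≤-pred (DM.m<n*o⇒m/o<n {v} {R1} {R1} (DM.m%n<n (iter (\ _ v -> v ÷ A) u i) A)))))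
  where
   v = digit i u
 overTerms-rel : ∀ {S S' : Set} (R : S -> S' -> Set) z z' F F' -> R z z' -> (∀ i {a a'} -> R a a' -> R (F i a) (F' i a')) -> ∀ p -> R (overTms z F p) (overTms z' F' p)
 overTerms-rel R z z' F F' rz h p = go ℓ
  where
  choose : ∀ i c d {a a'} -> R a a' -> R (if c then z else if d then F i a else a) (if c then z' else if d then F' i a' else a')
  choose i true d r = rz
  choose i false true r = h i r
  choose i false false r = r
  go : ∀ n -> R (iter (\ k a -> termStep z F (p + (ℓ ∸ suc k)) a) z n) (iter (\ k a -> termStep z' F' (p + (ℓ ∸ suc k)) a) z' n)
  go zero = rz
  go (suc n) = choose _ (isRel (symb (p + (ℓ ∸ suc n)))) (isTerm (symb (p + (ℓ ∸ suc n)))) (go n)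
 lin-<= : ∀ c -> (∀ i -> Z.∣ c i ∣ ≤ magnitude i) -> ∀ p u -> Z.∣ lin c p u ∣ ≤ suc (X + X) * mass p
 lin-<= c c<= p u = go (start? p)
  where
  R : ℤ -> ℕ -> Set
  R i n = Z.∣ i ∣ ≤ (X + X) * n
  zero-R : R 0ℤ 0
  zero-R = z≤n
  step-R : ∀ i {a n} -> R a n -> R (c i Z.* digitVal (digit (variable# i) u) Z.+ a) (magnitude i + n)
  step-R i {a} {n} r = ≤-trans (∣∣-+-<= {c i Z.* digitVal (digit (variable# i) u)} {a} (∣∣-*-<= (c i) (digit-<= (variable# i) u)) r)
   (≤-trans (+-monoˡ-≤ ((X + X) * n) (≤-trans (*-monoˡ-≤ (X + X) (c<= i)) (≡⇒≤ (*-comm (magnitude i) (X + X))))) (≡⇒≤ (sym (*-distribˡ-+ (X + X) (magnitude i) n))))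
  termMass = overTms 0 (\ i a -> magnitude i + a) p
  go : ∀ st -> Z.∣ if st then overTms 0ℤ (\ i a -> c i Z.* digitVal (digit (variable# i) u) Z.+ a) p else 0ℤ ∣ ≤ suc (X + X) * (if st then termMass + magnitude (suc (relation p)) else 0)
  go false = z≤n
  go true = ≤-trans (overTerms-rel R 0ℤ 0 (\ i a -> c i Z.* digitVal (digit (variable# i) u) Z.+ a) (\ i a -> magnitude i + a) zero-R (\ i {a} {n} -> step-R i {a} {n}) p)
   (*-mono-≤ (n≤1+n (X + X)) (m≤m+n termMass (magnitude (suc (relation p)))))
 rhs-<= : ∀ c -> (∀ i -> Z.∣ c i ∣ ≤ magnitude i) -> ∀ p -> Z.∣ rhs c p ∣ ≤ suc (X + X) * mass p
 rhs-<= c c<= p with start? p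
 ... | false = z≤n
 ... | true = ≤-trans (c<= (suc (relation p))) (≤-trans (m≤n+m _ (overTms 0 (\ i a -> magnitude i + a) p)) (m≤n*m _ (suc (X + X))))
 boxed-sized : ∀ {m z} -> Sized m z -> Boxed (suc D * m) z
 boxed-sized {m} {z} s = record { upper = above-const s ; lower = below-const s ; upper' = above-const (sized-conj s) ; lower' = below-const (sized-conj s) }
  where
  above-const : ∀ {z} -> Sized m z -> z ≼ constR (suc D * m)
  above-const {x , y} (sized a b) = bounded-above 1<=D m a b
  below-const : ∀ {z} -> Sized m z -> ⊝ constR (suc D * m) ≼ z
  below-const {z} s = subst (⊝ constR (suc D * m) ≼_) (⊝-involutive z) (≼-⊝ (above-const (sized-⊝ s)))
 within-E : ∀ p {n z} -> n ≤ gain-β * (gain-Z * (unit * suc (mass p))) -> Sized n z -> Boxed (E p) z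
 within-E p {n} {z} n<= s = subst (\ m -> Boxed m z) (sym E-=) (boxed-sized (sized-<= n<= s))
  where
  E-= : E p ≡ suc D * (gain-β * (gain-Z * (unit * suc (mass p))))
  E-= = tr (*-assoc (suc D) (gain-β * (gain-Z * unit)) (suc (mass p))) (cong (suc D *_) (tr (*-assoc gain-β (gain-Z * unit) (suc (mass p))) (cong (gain-β *_) (*-assoc gain-Z unit (suc (mass p))))))
 base : ℕ -> ℕ
 base p = unit * suc (mass p)
 sized-base : ∀ p P Q -> Z.∣ P ∣ ≤ suc (X + X) * mass p -> Z.∣ Q ∣ ≤ suc (X + X) * mass p -> Sized (base p) (conv P Q)
 sized-base p P Q a b = sized-<= (≤-trans (≡⇒≤ (sym (*-assoc spread (suc (X + X)) (mass p)))) (*-monoʳ-≤ unit (n≤1+n (mass p)))) (sized-conv {P} {Q} a b)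
 magnitude0 : ∀ i -> Z.∣ c₀ i ∣ ≤ magnitude i
 magnitude0 i = m≤m+n Z.∣ c₀ i ∣ Z.∣ c₁ i ∣
 magnitude1 : ∀ i -> Z.∣ c₁ i ∣ ≤ magnitude i
 magnitude1 i = m≤n+m Z.∣ c₁ i ∣ Z.∣ c₀ i ∣
 sized-lhs : ∀ p u -> Sized (base p) (lhs p u)
 sized-lhs p u = subst (Sized (base p)) (sym (lhs-def p u)) (sized-base p (lin c₀ p u) (lin c₁ p u) (lin-<= c₀ magnitude0 p u) (lin-<= c₁ magnitude1 p u))
 sized-bnd : ∀ p -> Sized (base p) (bnd p)
 sized-bnd p = subst (Sized (base p)) (sym (bnd-def p)) (sized-base p (rhs c₀ p) (rhs c₁ p) (rhs-<= c₀ magnitude0 p) (rhs-<= c₁ magnitude1 p))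
 small : ∀ c p u -> Boxed (E p) (orient c (lhs p u))
 small c p u = within-E p (≤-trans (m≤n*m (base p) gain-Z) (m≤n*m (gain-Z * base p) gain-β)) (sized-orient c (sized-lhs p u))
 small-β : ∀ c p u -> Boxed (E p) (⊝ β (orient c (lhs p u)))
 small-β c p u = within-E p (*-monoʳ-≤ gain-β (m≤n*m (base p) gain-Z)) (sized-⊝ (sized-act D x y (sized-orient c (sized-lhs p u))))
 small-b : ∀ c p -> Boxed (E p) (⊝ β (Z (orient c (bnd p))))
 small-b c p = within-E p ≤-refl (sized-⊝ (sized-act D x y (sized-act D 0ℤ (y Z.+ y) (sized-orient c (sized-bnd p)))))
 1<=E : ∀ p -> 1 ≤ E p
 1<=E p = s≤s z≤n
 verdict-cong : ∀ f g -> (∀ p -> p < ℓ -> f p ≡ g p) -> verdict f ≡ verdict g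
 verdict-cong f g h = cong latest (go ℓ ≤-refl)
  where
  go : ∀ n -> n ≤ ℓ -> iter (\ k a -> evalStep f (ℓ ∸ suc k) a) 0 n ≡ iter (\ k a -> evalStep g (ℓ ∸ suc k) a) 0 n
  go zero _ = refl
  go (suc n) n<ℓ = tr (cong (\ c -> if start? i then c ◂ acc' else connect (symb i) acc') (h i (≤-trans (≡⇒≤ (sym (+-∸-assoc 1 n<ℓ))) (m∸n≤m ℓ n)))) (cong (evalStep g i) (go n (<⇒≤ n<ℓ)))
   where
   i = ℓ ∸ suc n
   acc' = iter (\ k a -> evalStep f (ℓ ∸ suc k) a) 0 n
 open Product setting ℓ lhs bnd strict E (\ f -> verdict f == polarity) public
 accept-verdict : ∀ {w} -> Accept product w -> (verdict (truth w) == polarity) ≡ true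
 accept-verdict = accept-sound (\ f g h -> cong (_== polarity) (verdict-cong f g h))
 verdict-accept : ∀ w -> (verdict (truth w) == polarity) ≡ true -> Accept product w
 verdict-accept = accept-complete (\ f g h -> cong (_== polarity) (verdict-cong f g h)) 1<=E small small-β small-b
 module Meaning (beyond : ∀ i -> ℓ ≤ i -> symb i ≡ 0) where
  open Parsing beyond public
  module _ {n} (t : List (ℤ[α] × Fin n)) (R : Inequality) (a : ℤ[α]) {p rest} (tx : At p (atomText t R a rest)) (st : start? p ≡ true) where
   lin-at : ∀ (c : ℕ -> ℤ) (c' : ℤ[α] -> ℤ) -> (∀ a {p rest} -> At p (23 ∷ inside a ++ rest) -> c p ≡ c' a) -> ∀ u -> lin c p u ≡ dot c' t (\ i -> digitVal (digit (toℕ i) u))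
   lin-at c c' c-at u = tr (cong (\ s -> if s then overTms 0ℤ F p else 0ℤ) st) (overTerms-at 0ℤ F G' terms t R a tx)
    where
    F : ℕ -> ℤ -> ℤ
    F i a = c i Z.* digitVal (digit (variable# i) u) Z.+ a
    G' : ℤ[α] × Fin n -> ℤ -> ℤ
    G' (a , i) x = c' a Z.* digitVal (digit (toℕ i) u) Z.+ x
    terms : ∀ {p a i s rest} -> At p (23 ∷ inside a ++ 17 ∷ numrl (toℕ i) ++ s ∷ rest) -> isDigit s ≡ false -> ∀ x -> F p x ≡ G' (a , i) x
    terms {p} {a} {i} tx e x = cong2 (\ c v -> c Z.* digitVal (digit v u) Z.+ x) (c-at a tx) (variable-at a (toℕ i) tx e)
   rhs-at : ∀ (c : ℕ -> ℤ) (c' : ℤ[α] -> ℤ) -> (∀ a {p rest} -> At p (23 ∷ inside a ++ rest) -> c p ≡ c' a) -> rhs c p ≡ c' a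
   rhs-at c c' c-at = tr (cong (\ s -> if s then c (suc (relation p)) else 0ℤ) st) (c-at a (at-tail (rel-at t R a tx)))
   strict-at : strict p ≡ (relCode R ≡ᵇ 26)
   strict-at = cong (_≡ᵇ 26) (at-head (rel-at t R a tx))
   difference : (ℤ[α] -> ℤ) -> (Fin n -> ℤ) -> ℤ
   difference c f = dot c t f Z.- c a
   total-at : ∀ w -> Atom.total-val (lhs p) (bnd p) w ≡ conv (difference ℤ[α].c₀ (\ i -> value-of (map (digit (toℕ i)) w))) (difference ℤ[α].c₁ (\ i -> value-of (map (digit (toℕ i)) w)))
   total-at [] = tr (cong ⊝_ (tr (bnd-def p) (cong2 conv (rhs-at c₀ ℤ[α].c₀ c0-at) (rhs-at c₁ ℤ[α].c₁ c1-at)))) (tr (conv-⊝ (ℤ[α].c₀ a) (ℤ[α].c₁ a)) (cong2 conv (only ℤ[α].c₀) (only ℤ[α].c₁)))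
    where
    only : ∀ c -> Z.- c a ≡ difference c (\ _ -> 0ℤ)
    only c = sym (tr (cong (Z._- c a) (dot-zero c t)) (Z.+-identityˡ _))
   total-at (u ∷ w) = tr (cong2 (\ z z' -> z ⊕ scaleR (Z.+ U (length w)) z') (total-at w) (tr (lhs-def p u) (cong2 conv (lin-at c₀ ℤ[α].c₀ c0-at u) (lin-at c₁ ℤ[α].c₁ c1-at u))))
    (tr (conv-⊕ (difference ℤ[α].c₀ fw) (difference ℤ[α].c₁ fw) (Z.+ U (length w)) (dot ℤ[α].c₀ t du) (dot ℤ[α].c₁ t du)) (cong2 conv (more ℤ[α].c₀) (more ℤ[α].c₁)))
    where
    fw du : Fin n -> ℤ
    fw i = value-of (map (digit (toℕ i)) w)
    du i = digitVal (digit (toℕ i) u)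
    more : ∀ c -> difference c fw Z.+ Z.+ U (length w) Z.* dot c t du ≡ difference c (\ i -> value-of (map (digit (toℕ i)) (u ∷ w)))
    more c = tr (solve 3 (\ x y z -> (x :- y) :+ z := (x :+ z) :- y) refl (dot c t fw) (c a) (Z.+ U (length w) Z.* dot c t du))
     (cong (Z._- c a) (tr (sym (dot-linear c t (Z.+ U (length w)) du fw)) (dot-cong c t \ i ->
      cong (\ l -> du i Z.* Z.+ U l Z.+ fw i) (sym (tr (length-map digitVal (map (digit (toℕ i)) w)) (length-map (digit (toℕ i)) w))))))
     where
      open Z-Solver
   truth-at : ∀ w {ρ} -> ρ ≡ values n w -> truth w p ≡ cond (relCode R ≡ᵇ 26) (⊝ conv (difference ℤ[α].c₀ (lookup ρ)) (difference ℤ[α].c₁ (lookup ρ)))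
   truth-at w refl = cong2 (\ s z -> cond s (⊝ z)) strict-at (tr (total-at w) (cong2 conv (looked ℤ[α].c₀) (looked ℤ[α].c₁)))
    where
    looked : ∀ c -> difference c (\ i -> value-of (map (digit (toℕ i)) w)) ≡ difference c (lookup (values n w))
    looked c = cong (Z._- c a) (dot-cong c t \ i -> sym (lookup-values i w))
  -- The text of a formula puts exactly one truth value on top of whatever the text after it leaves;
  -- with this invariant the subformulas compose.
  module Evaluate (α : ℝ) {n} (ρ : Vec ℤ n) (V : ℕ -> ℕ) (connective : ∀ {p} s {w} -> (27 ≤ᵇ s) ≡ true -> (isTerm s ∨ isRel s) ≡ false -> At p (s ∷ w) -> V p ≡ connect s (V (suc p)))
   (atoms : ∀ (t : List (ℤ[α] × Fin n)) R a {p rest} -> Free p -> At p (atomText t R a rest) -> ∃[ v ] (Reflects (Truth.formula α ρ (atom t R a)) v × Parsed (\ q -> V p ≡ v ◂ V q) rest))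
   where
   record Value (φ : Formula n) (p : ℕ) (rest : List ℕ) : Set where
    constructor value-is
    field
     {v} : Bool
     truly : Reflects (Truth.formula α ρ φ) v
     {q} : ℕ
     evaluated : V p ≡ v ◂ V q
     follows : At q rest
     free : Free q
   eval-at : ∀ φ {p rest} -> Free p -> At p (formText φ rest) -> Value φ p rest
   eval-and : ∀ φ ψ {p rest} -> At p (27 ∷ formText φ (formText ψ rest)) -> Value φ (suc p) (formText ψ rest) -> Value (and φ ψ) p rest
   eval-or : ∀ φ ψ {p rest} -> At p (28 ∷ formText φ (formText ψ rest)) -> Value φ (suc p) (formText ψ rest) -> Value (or φ ψ) p rest
   eval-at (atom t R a) fr tx = let v , rf , q , e , tx' , fr' = atoms t R a fr tx in value-is rf e tx' fr'
   eval-at (and φ ψ) fr tx = eval-and φ ψ tx (eval-at φ (cong busy (at-head tx)) (at-tail tx))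
   eval-at (or φ ψ) fr tx = eval-or φ ψ tx (eval-at φ (cong busy (at-head tx)) (at-tail tx))
   eval-at (not φ) fr tx = negate (eval-at φ (cong busy (at-head tx)) (at-tail tx))
    where
    negate : Value φ _ _ -> Value (not φ) _ _
    negate (value-is {v} rf {q} e tx' fr') = value-is (¬-reflects rf) (tr (connective 29 refl refl tx) (tr (cong (connect 29) e) (connect-¬ v (V q)))) tx' fr'
   eval-and φ ψ {p} {rest} tx (value-is {v} rf e tx' fr') = combine (eval-at ψ fr' tx')
    where
    combine : Value ψ _ rest -> Value (and φ ψ) p rest
    combine (value-is {v'} rf' {q'} e' tx'' fr'') = value-is (rf ×-reflects rf') (tr (connective 27 refl refl tx) (tr (cong (connect 27) (tr e (cong (v ◂_) e'))) (connect-∧ v v' (V q')))) tx'' fr''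
   eval-or φ ψ {p} {rest} tx (value-is {v} rf e tx' fr') = combine (eval-at ψ fr' tx')
    where
    combine : Value ψ _ rest -> Value (or φ ψ) p rest
    combine (value-is {v'} rf' {q'} e' tx'' fr'') = value-is (rf ⊎-reflects rf') (tr (connective 28 refl refl tx) (tr (cong (connect 28) (tr e (cong (v ◂_) e'))) (connect-∨ v v' (V q')))) tx'' fr''
  module Verdict (claims : ℕ -> Bool) where
   open Scan (evalStep claims) 0 (\ i a e e' -> tr (cong (\ s -> if s then claims i ◂ a else connect (symb i) a) e) (connect-idle (symb i) a e')) public
   connective : ∀ {p} s {w} -> (27 ≤ᵇ s) ≡ true -> (isTerm s ∨ isRel s) ≡ false -> At p (s ∷ w) -> V p ≡ connect s (V (suc p))
   connective {p} s e e' tx = tr (unroll p) (tr (cong (\ b -> if b then claims p ◂ V (suc p) else connect (symb p) (V (suc p)))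
    (start-plain p (tr (cong (\ s -> isTerm s ∨ isRel s) (at-head tx)) e'))) (cong (\ s -> connect s (V (suc p))) (at-head tx)))
   atom-step : ∀ {n} (t : List (ℤ[α] × Fin n)) R a {p rest} -> Free p -> At p (atomText t R a rest) -> start? p ≡ true × Parsed (\ q -> V p ≡ claims p ◂ V q) rest
   atom-step t R a {p} fr tx = let st , q , e , tx' , fr' = atom-scan t R a fr tx in st , q , tr e (cong (\ b -> if b then claims p ◂ V q else connect (symb p) (V q)) st) , tx' , fr'

-- Truth of atoms over the real numbers

module Link {α : ℝ} (quad : Quadratic α) where
 open Quadratic quad
 open Sqrt D θ 1<=θ θ²→D nonsquare
 open Conversion k b s
 abstract
  solved : ∃₂ \ X Y -> X * X ≡ 1 + D * (Y * Y) × 1 ≤ Y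
  solved = Pell.solution D nonsquare
 setting : Setting
 setting = record { D = D ; X = fst solved ; Y = fst (snd solved) ; pell = fst (snd (snd solved)) ; 2<=X = 2<=X (fst (snd (snd solved))) (snd (snd (snd solved)))
  ; 1<=Y = snd (snd (snd solved)) ; 1<=D = ≤-trans (s≤s z≤n) 2<=D ; total = nnR-total ; antisym = nnR-antisym ; add = nonnegR-+ }
  where
  2<=X : ∀ {X Y} -> X * X ≡ 1 + D * (Y * Y) -> 1 ≤ Y -> 2 ≤ X
  2<=X {zero} {Y} e 1<=Y = case e of \ ()
  2<=X {suc zero} {Y} e 1<=Y = contradiction (suc-injective e) (<⇒≢ (*-mono-≤ (≤-trans (s≤s z≤n) 2<=D) (*-mono-≤ 1<=Y 1<=Y)))
  2<=X {suc (suc X)} {Y} e 1<=Y = s≤s (s≤s z≤n)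
 open Order D nnR-total nnR-antisym nonnegR-+ using (nnR'; ⊝-0)
 open Additive using (0-⊝; ⊝-involutive)
 open Truth α
 value' : ℤ -> ℤ -> ℕ -> ℚ
 value' P Q n = ι P Q.+ ι Q Q.* seq α n
 linear-seq : ∀ {n} (ρ : Vec ℤ n) t m -> seq (linear ρ t) m ≡ value' (dot ℤ[α].c₀ t (lookup ρ)) (dot ℤ[α].c₁ t (lookup ρ)) m
 linear-seq ρ [] m = sym (tr (cong2 (\ x y -> x Q.+ y Q.* seq α m) ι-0 ι-0) (tr (cong (0ℚ Q.+_) (Q.*-zeroˡ (seq α m))) refl))
 linear-seq ρ ((a , i) ∷ t) m = tr (cong2 (\ x y -> x Q.+ y) (cong2 Q._*_ (cong2 (\ x y -> x Q.+ y Q.* seq α m) (sym (ι-def (ℤ[α].c₀ a))) (sym (ι-def (ℤ[α].c₁ a)))) (sym (ι-def v)))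
   (linear-seq ρ t m)) (tr (solve 6 (\ c d v p q x -> (c :+ d :* x) :* v :+ (p :+ q :* x) := (c :* v :+ p) :+ (d :* v :+ q) :* x) refl (ι (ℤ[α].c₀ a)) (ι (ℤ[α].c₁ a)) (ι v)
    (ι (dot ℤ[α].c₀ t (lookup ρ))) (ι (dot ℤ[α].c₁ t (lookup ρ))) (seq α m)) (sym (cong2 (\ x y -> x Q.+ y Q.* seq α m) (split ℤ[α].c₀) (split ℤ[α].c₁))))
  where
  open ℚ-Solver
  v = lookup ρ i
  split : ∀ (c : ℤ[α] -> ℤ) -> ι (c a Z.* v Z.+ dot c t (lookup ρ)) ≡ ι (c a) Q.* ι v Q.+ ι (dot c t (lookup ρ))
  split c = tr (ι-+ (c a Z.* v) _) (cong (Q._+ _) (ι-* (c a) v))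
 bound-seq : ∀ a m -> seq ⟦ a ⟧ m ≡ value' (ℤ[α].c₀ a) (ℤ[α].c₁ a) m
 bound-seq a m = cong2 (\ x y -> x Q.+ y Q.* seq α m) (sym (ι-def (ℤ[α].c₀ a))) (sym (ι-def (ℤ[α].c₁ a)))
 value-minus : ∀ P Q P' Q' n -> value' P Q n ≡ value' P' Q' n Q.+ value' (P Z.- P') (Q Z.- Q') n
 value-minus P Q P' Q' n = sym (tr (cong (value' P' Q' n Q.+_) (cong2 (\ x y -> x Q.+ y Q.* seq α n) (minus P P') (minus Q Q')))
  (solve 5 (\ p q p' q' x -> (p' :+ q' :* x) :+ ((p :- p') :+ (q :- q') :* x) := p :+ q :* x) refl (ι P) (ι Q) (ι P') (ι Q') (seq α n)))
  where
  open ℚ-Solver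
  minus : ∀ P P' -> ι (P Z.- P') ≡ ι P Q.- ι P'
  minus P P' = tr (ι-+ P (Z.- P')) (cong (ι P Q.+_) (ι-neg P'))
 value-neg : ∀ P Q n -> value' (Z.- P) (Z.- Q) n ≡ Q.- value' P Q n
 value-neg P Q n = tr (cong2 (\ x y -> x Q.+ y Q.* seq α n) (ι-neg P) (ι-neg Q)) (solve 3 (\ p q x -> (:- p) :+ (:- q) :* x := :- (p :+ q :* x)) refl (ι P) (ι Q) (seq α n))
  where
   open ℚ-Solver
 0<scale : 0ℚ Q.< ι scale
 0<scale = Q.<-≤-trans (Q.positive⁻¹ 1ℚ) (ι-≥1 (Z.+≤+ (s≤s z≤n)))
 unscale : ∀ {p q} -> ι scale Q.* p Q.≤ ι scale Q.* q -> p Q.≤ q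
 unscale = Q.*-cancelˡ-≤-pos (ι scale) {{Q.positive 0<scale}}
 value-nonneg : ∀ P Q -> nnR' (conv P Q) ≡ true -> Evtly (\ n -> 0ℚ Q.≤ value' P Q n)
 value-nonneg P Q e = mapE (\ n 0<= -> unscale (subst2 Q._≤_ (sym (Q.*-zeroʳ (ι scale))) (sym (scaled P Q n)) 0<=)) (eventually-nonneg _ _ e)
 value-positive : ∀ P Q -> nnR' (conv P Q) ≡ true -> fst (conv P Q) ≢ 0ℤ ⊎ snd (conv P Q) ≢ 0ℤ -> PosE (value' P Q)
 value-positive P Q e /=0 with positive _ _ e /=0
 ... | ε , 0<ε , ev with divide (ι scale) ε 0<scale 0<ε
 ... | δ , 0<δ , eq = δ , 0<δ , mapE (\ n ε<= -> unscale (subst2 Q._≤_ (sym eq) (sym (scaled P Q n)) ε<=)) ev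
 -- The sequences differ by P + Q α term by term, so their order is decided by the integer test on
 -- `conv P Q`, a positive multiple of this number. A failed test means a strict sign of the
 -- opposite, hence a margin.
 module Compare (x y : ℝ) (P Q : ℤ) (gap : ∀ n -> seq x n ≡ seq y n Q.+ value' P Q n) where
  gap' : ∀ n -> seq y n ≡ seq x n Q.+ value' (Z.- P) (Z.- Q) n
  gap' n = sym (tr (cong2 Q._+_ (gap n) (value-neg P Q n)) (solve 2 (\ y v -> (y :+ v) :+ (:- v) := y) refl (seq y n) (value' P Q n)))
   where
    open ℚ-Solver
  ahead : ∀ {x v y} -> x ≡ y Q.+ v -> 0ℚ Q.≤ v -> y Q.≤ x
  ahead {x} {v} {y} e 0<=v = subst2 Q._≤_ (Q.+-identityʳ y) (sym e) (Q.+-monoʳ-≤ y 0<=v)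
  le-true : nnR' (conv (Z.- P) (Z.- Q)) ≡ true -> x ≤ᴿ y
  le-true e ε 0<ε = mapE (\ n 0<= -> Q.≤-trans (ahead (gap' n) 0<=) (subst (Q._≤ seq y n Q.+ ε) (Q.+-identityʳ (seq y n)) (Q.+-monoʳ-≤ (seq y n) (Q.<⇒≤ 0<ε)))) (value-nonneg (Z.- P) (Z.- Q) e)
  le-false : PosE (value' P Q) -> ¬ (x ≤ᴿ y)
  le-false (ε , 0<ε , ev) le' with Q.<-dense 0<ε
  ... | δ , 0<δ , δ<ε with both ev (le' δ 0<δ)
  ... | N , h = contradict (h N ≤-refl)
   where
   contradict : ε Q.≤ value' P Q N × seq x N Q.≤ seq y N Q.+ δ -> ⊥
   contradict (a , c) = Q.<-irrefl refl (Q.<-≤-trans (Q.+-monoʳ-< (seq y N) δ<ε) (Q.≤-trans (Q.+-monoʳ-≤ (seq y N) a) (subst (Q._≤ seq y N Q.+ δ) (gap N) c)))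
  lt-true : PosE (value' (Z.- P) (Z.- Q)) -> x <ᴿ y
  lt-true (ε , 0<ε , ev) = ε , 0<ε , mapE (\ n ε<= -> subst (seq x n Q.+ ε Q.≤_) (sym (gap' n)) (Q.+-monoʳ-≤ (seq x n) ε<=)) ev
  lt-false : nnR' (conv P Q) ≡ true -> ¬ (x <ᴿ y)
  lt-false e (ε , 0<ε , ev) with both (value-nonneg P Q e) ev
  ... | N , h = contradict (h N ≤-refl)
   where
   contradict : 0ℚ Q.≤ value' P Q N × seq x N Q.+ ε Q.≤ seq y N -> ⊥
   contradict (a , c) = Q.<-irrefl refl (Q.<-≤-trans (subst (Q._< seq x N Q.+ ε) (Q.+-identityʳ (seq x N)) (Q.+-monoʳ-< (seq x N) 0<ε)) (Q.≤-trans c (ahead (gap N) a)))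
  le-reflects : Reflects (x ≤ᴿ y) (nnR' (conv (Z.- P) (Z.- Q)))
  le-reflects = go (nnR' (conv (Z.- P) (Z.- Q))) refl
   where
   go : ∀ c -> nnR' (conv (Z.- P) (Z.- Q)) ≡ c -> Reflects (x ≤ᴿ y) c
   go true e = ofʸ (le-true e)
   go false e = ofⁿ (le-false (opposite (nnR-total (fst z') (snd z') e)))
    where
    z' = conv (Z.- P) (Z.- Q)
    back : ⊝ z' ≡ conv P Q
    back = tr (conv-⊝ (Z.- P) (Z.- Q)) (cong2 conv (Z.neg-involutive P) (Z.neg-involutive Q))
    opposite : nnR' (⊝ z') ≡ true × (fst z' ≢ 0ℤ ⊎ snd z' ≢ 0ℤ) -> PosE (value' P Q)
    opposite (t , /=0) = value-positive P Q (tr (cong nnR' (sym back)) t) (Sum.map (\ h c -> h (zero-neg (cong fst back) c)) (\ h c -> h (zero-neg (cong snd back) c)) /=0)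
     where
     zero-neg : ∀ {i j} -> Z.- i ≡ j -> j ≡ 0ℤ -> i ≡ 0ℤ
     zero-neg {i} e e' = tr (sym (Z.neg-involutive i)) (cong Z.-_ (tr e e'))
  lt-reflects : Reflects (x <ᴿ y) (Bool.not (nnR' (conv P Q)))
  lt-reflects = go (nnR' (conv P Q)) refl
   where
   go : ∀ c -> nnR' (conv P Q) ≡ c -> Reflects (x <ᴿ y) (Bool.not c)
   go true e = ofⁿ (lt-false e)
   go false e = ofʸ (lt-true (opposite (nnR-total (fst (conv P Q)) (snd (conv P Q)) e)))
    where
    opposite : nnR' (⊝ conv P Q) ≡ true × (fst (conv P Q) ≢ 0ℤ ⊎ snd (conv P Q) ≢ 0ℤ) -> PosE (value' (Z.- P) (Z.- Q))
    opposite (t , /=0) = value-positive (Z.- P) (Z.- Q) (tr (cong nnR' (sym (conv-⊝ P Q))) t)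
     (Sum.map (\ h c -> h (zero-neg (tr (cong fst (conv-⊝ P Q)) c))) (\ h c -> h (zero-neg (tr (cong snd (conv-⊝ P Q)) c))) /=0)
     where
     zero-neg : ∀ {i} -> Z.- i ≡ 0ℤ -> i ≡ 0ℤ
     zero-neg {i} e = tr (sym (Z.neg-involutive i)) (cong Z.-_ e)
 open Inequalities setting using (cond)
 atom-reflects : ∀ {n} (ρ : Vec ℤ n) t R a -> Reflects (formula ρ (atom t R a)) (cond (relCode R ≡ᵇ 26) (⊝ conv (dot ℤ[α].c₀ t (lookup ρ) Z.- ℤ[α].c₀ a) (dot ℤ[α].c₁ t (lookup ρ) Z.- ℤ[α].c₁ a)))
 atom-reflects ρ t R a = go R
  where
  P Q : ℤ
  P = dot ℤ[α].c₀ t (lookup ρ) Z.- ℤ[α].c₀ a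
  Q = dot ℤ[α].c₁ t (lookup ρ) Z.- ℤ[α].c₁ a
  open Compare (linear ρ t) ⟦ a ⟧ P Q (\ n -> tr (linear-seq ρ t n) (tr (value-minus _ _ (ℤ[α].c₀ a) (ℤ[α].c₁ a) n) (cong (Q._+ value' P Q n) (sym (bound-seq a n)))))
  go : ∀ R -> Reflects (holds R (linear ρ t) ⟦ a ⟧) (cond (relCode R ≡ᵇ 26) (⊝ conv P Q))
  go le = subst (Reflects (linear ρ t ≤ᴿ ⟦ a ⟧)) (cong nnR' (sym (tr (⊝-0 (⊝ conv P Q)) (conv-⊝ P Q)))) le-reflects
  go lt = subst (Reflects (linear ρ t <ᴿ ⟦ a ⟧)) (cong (Bool.not ∘ nnR') (sym (tr (0-⊝ (⊝ conv P Q)) (⊝-involutive (conv P Q))))) lt-reflects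

-- Quantifier blocks and correctness of their elimination

dual-involutive : ∀ Q -> dual (dual Q) ≡ Q
dual-involutive all = refl
dual-involutive ex = refl

sizeOf : ∀ {Q n r} -> Prenex Q n r -> ℕ -> ℕ
sizeOf (matrix φ) j = 0
sizeOf (block {r = r} m S) j = if r ≡ᵇ j then m else sizeOf S j

innermost : ∀ {Q n r} -> Prenex Q n r -> Quantifier
innermost (matrix {Q} φ) = Q
innermost (block m S) = innermost S

<=>/=b : ∀ {m n} -> m < n -> (n ≡ᵇ m) ≡ false
<=>/=b {zero} {suc n} _ = refl
<=>/=b {suc m} {suc n} (s≤s m<n) = <=>/=b m<n

sizeOf-≥ : ∀ {Q n r} (S : Prenex Q n r) j -> r ≤ j -> sizeOf S j ≡ 0
sizeOf-≥ (matrix φ) j r<=j = refl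
sizeOf-≥ (block {r = r} m S) j r<j = tr (cong (\ b -> if b then m else sizeOf S j) (flip {j} {r} (<=>/=b r<j))) (sizeOf-≥ S j (<⇒≤ r<j))
 where
 flip : ∀ {m n} -> (m ≡ᵇ n) ≡ false -> (n ≡ᵇ m) ≡ false
 flip {zero} {suc n} _ = refl
 flip {suc m} {zero} _ = refl
 flip {suc m} {suc n} e = flip {m} {n} e

module Structure (symb : ℕ -> ℕ) (ℓ : ℕ) (beyond : ∀ i -> ℓ ≤ i -> symb i ≡ 0) where
 open Evaluation symb ℓ
 open Parsing beyond
 module FormulaWalk {A : Set} (V : ℕ -> A) (h : ∀ {p} -> (18 ≤ᵇ symb p) ≡ true -> V p ≡ V (suc p)) (h17 : ∀ {p} -> symb p ≡ 17 -> symb (p ∸ 1) ≡ 24 -> V p ≡ V (suc p)) where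
  open Walk V (\ s -> (18 ≤ᵇ s) ≡ true) h h17 refl refl refl refl refl refl
  Walked : ℕ -> List ℕ -> Set
  Walked p rest = ∃[ q ] (V p ≡ V q × At q rest)
  h-at : ∀ {p s w} -> At p (s ∷ w) -> (18 ≤ᵇ s) ≡ true -> V p ≡ V (suc p)
  h-at tx e = h (tr (cong (18 ≤ᵇ_) (at-head tx)) e)
  walk-atom : ∀ {n} (t : List (ℤ[α] × Fin n)) R a {p rest} -> At p (atomText t R a rest) -> Walked p rest
  walk-atom [] R a {p} tx with walk-inside a (at-tail (at-tail tx))
  ... | q , e , tx' , _ = suc q , tr (h-at tx (large R)) (tr (h-at (at-tail tx) refl) e) , tx'
   where
   large : ∀ R -> (18 ≤ᵇ relCode R) ≡ true
   large le = refl
   large lt = refl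
  walk-atom ((a' , i) ∷ t) R a tx with walk-term a' (toℕ i) (at-tail tx)
  ... | q , e , tx' , _ with walk-atom t R a tx'
  ... | q' , e' , tx'' = q' , tr (h-at tx refl) (tr e e') , tx''
  walk-formula : ∀ {n} (φ : Formula n) {p rest} -> At p (formText φ rest) -> Walked p rest
  walk-two : ∀ {n} (φ ψ : Formula n) {p rest} -> At p (formText φ (formText ψ rest)) -> Walked p rest
  walk-formula (atom t R a) tx = walk-atom t R a tx
  walk-formula (and φ ψ) tx with walk-two φ ψ (at-tail tx)
  ... | q , e , tx' = q , tr (h-at tx refl) e , tx'
  walk-formula (or φ ψ) tx with walk-two φ ψ (at-tail tx)
  ... | q , e , tx' = q , tr (h-at tx refl) e , tx'
  walk-formula (not φ) tx with walk-formula φ (at-tail tx)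
  ... | q , e , tx' = q , tr (h-at tx refl) e , tx'
  walk-two φ ψ tx with walk-formula φ tx
  ... | q , e , tx' with walk-formula ψ tx'
  ... | q' , e' , tx'' = q' , tr e e' , tx''
 skipTo : ℕ -> ℕ -> ℕ
 skipTo p m = p + length (replicate m 17)
 all-17 : ∀ m -> All (_≡ 17) (replicate m 17)
 all-17 zero = []
 all-17 (suc m) = refl ∷ all-17 m
 at-skip : ∀ m {p w} -> At p (replicate m 17 ++ w) -> At (skipTo p m) w
 at-skip m = at-drop (replicate m 17)
 free-skip : ∀ m {p w} -> At p (replicate m 17 ++ w) -> Free p -> Free (skipTo p m)
 free-skip zero {p} tx fr = subst Free (sym (+-identityʳ p)) fr
 free-skip (suc m) {p} tx fr = subst Free (sym (+-suc p _)) (free-skip m {suc p} (at-tail tx) (cong busy (at-head tx)))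
 module Qn = Unroll quantStep 0 (\ i e -> cong (\ s -> if isQuant s then 1 else 0) e)
 module L = Unroll lastStep 0 (\ i e -> cong (\ s -> if isQuant s ∧ true then s else 0) e)
 module B j = Unroll (blockStep j) 0 (\ i e -> cong (\ s -> if ((s ≡ᵇ 17) ∧ Bool.not (symb (i ∸ 1) ≡ᵇ 24)) ∧ (quants (suc i) ≡ᵇ j) then 1 else 0) e)
 quantifier-no : ∀ s -> (17 ≤ᵇ s) ≡ true -> isQuant s ≡ false
 quantifier-no s e with s ≡ᵇ 15 in e1 | s ≡ᵇ 16 in e2
 ... | false | false = refl
 ... | true | _ = ⊥-elim (true/=false e (cong (17 ≤ᵇ_) (≡ᵇ⇒≡ s 15 (subst T (sym e1) tt))))
 ... | false | true = ⊥-elim (true/=false e (cong (17 ≤ᵇ_) (≡ᵇ⇒≡ s 16 (subst T (sym e2) tt))))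
 17-no : ∀ s -> (18 ≤ᵇ s) ≡ true -> (s ≡ᵇ 17) ≡ false
 17-no s e with s ≡ᵇ 17 in e1
 ... | false = refl
 ... | true = ⊥-elim (true/=false e (cong (18 ≤ᵇ_) (≡ᵇ⇒≡ s 17 (subst T (sym e1) tt))))
 17<= : ∀ s -> (18 ≤ᵇ s) ≡ true -> (17 ≤ᵇ s) ≡ true
 17<= s e = T-true (≤⇒≤ᵇ (<⇒≤ (≤ᵇ⇒≤ 18 s (subst T (sym e) tt))))
  where
  T-true : ∀ {b} -> T b -> b ≡ true
  T-true {true} _ = refl
 quants-idle : ∀ {p} -> (17 ≤ᵇ symb p) ≡ true -> quants p ≡ quants (suc p)
 quants-idle {p} e = tr (Qn.unroll p) (cong (\ b -> if b then suc (quants (suc p)) else quants (suc p)) (quantifier-no (symb p) e))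
 lastQ-idle : ∀ {p} -> (17 ≤ᵇ symb p) ≡ true -> lastQ p ≡ lastQ (suc p)
 lastQ-idle {p} e = tr (L.unroll p) (cong (\ b -> if b ∧ (lastQ (suc p) ≡ᵇ 0) then symb p else lastQ (suc p)) (quantifier-no (symb p) e))
 idle-17 : ∀ {A : Set} {V : ℕ -> A} -> (∀ {p} -> (17 ≤ᵇ symb p) ≡ true -> V p ≡ V (suc p)) -> ∀ {p} -> symb p ≡ 17 -> V p ≡ V (suc p)
 idle-17 h e = h (cong (17 ≤ᵇ_) e)
 block-no : ∀ j {p} -> (symb p ≡ᵇ 17) ≡ false -> bsize j p ≡ bsize j (suc p)
 block-no j {p} e = tr (B.unroll j p) (cong (\ b -> if (b ∧ Bool.not (symb (p ∸ 1) ≡ᵇ 24)) ∧ (quants (suc p) ≡ᵇ j) then suc (bsize j (suc p)) else bsize j (suc p)) e)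
 block-term : ∀ j {p} -> symb p ≡ 17 -> symb (p ∸ 1) ≡ 24 -> bsize j p ≡ bsize j (suc p)
 block-term j {p} e e' = tr (B.unroll j p) (tr (cong (\ s -> if ((symb p ≡ᵇ 17) ∧ Bool.not (s ≡ᵇ 24)) ∧ (quants (suc p) ≡ᵇ j) then suc (bsize j (suc p)) else bsize j (suc p)) e')
  (cong (\ b -> if (b ∧ false) ∧ (quants (suc p) ≡ᵇ j) then suc (bsize j (suc p)) else bsize j (suc p)) (cong (_≡ᵇ 17) e)))
 -- A quantified variable follows its quantifier or another quantified variable, never the bracket
 -- 24; the hypothesis on the preceding symbol starts this off.
 block-xs : ∀ j r m {p w} -> At p (replicate m 17 ++ w) -> (symb (p ∸ 1) ≡ᵇ 24) ≡ false -> quants (skipTo p m) ≡ r -> bsize j p ≡ (if r ≡ᵇ j then m else 0) + bsize j (skipTo p m)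
 block-xs j r zero {p} tx nb eq = tr (cong (bsize j) (sym (+-identityʳ p))) (none' (r ≡ᵇ j))
  where
  none' : ∀ b -> bsize j (p + 0) ≡ (if b then 0 else 0) + bsize j (p + 0)
  none' false = refl
  none' true = refl
 block-xs j r (suc m) {p} tx nb eq = tr (B.unroll j p) (tr (cong (\ c -> if c ∧ (quants (suc p) ≡ᵇ j) then suc (bsize j (suc p)) else bsize j (suc p))
   (cong2 (\ s b -> (s ≡ᵇ 17) ∧ Bool.not b) (at-head tx) nb)) (tr (cong (\ q -> if q ≡ᵇ j then suc (bsize j (suc p)) else bsize j (suc p)) quants-=)
   (tr (cong (\ b -> if r ≡ᵇ j then suc b else b) (block-xs j r m {suc p} (at-tail tx) (cong (_≡ᵇ 24) (at-head tx)) (tr (cong quants (sym (+-suc p _))) eq)))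
    (tr (add (r ≡ᵇ j) (bsize j (skipTo (suc p) m))) (cong (\ q -> (if r ≡ᵇ j then suc m else 0) + bsize j q) (sym (+-suc p _)))))))
  where
  add : ∀ b v -> (if b then suc ((if b then m else 0) + v) else (if b then m else 0) + v) ≡ (if b then suc m else 0) + v
  add false v = refl
  add true v = refl
  quants-= : quants (suc p) ≡ r
  quants-= = tr (pass quants (idle-17 {V = quants} quants-idle) (replicate m 17) (all-17 m) (at-tail tx)) (tr (cong quants (sym (+-suc p _))) eq)
 is-quantifier : ∀ Q -> isQuant (quantCode Q) ≡ true
 is-quantifier all = refl
 is-quantifier ex = refl
 not-17 : ∀ Q -> (quantCode Q ≡ᵇ 17) ≡ false
 not-17 all = refl
 not-17 ex = refl
 not-24 : ∀ Q -> (quantCode Q ≡ᵇ 24) ≡ false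
 not-24 all = refl
 not-24 ex = refl
 not-busy : ∀ Q -> busy (quantCode Q) ≡ false
 not-busy all = refl
 not-busy ex = refl
 positive-code : ∀ Q -> (quantCode Q ≡ᵇ 0) ≡ false
 positive-code all = refl
 positive-code ex = refl
 formula-zero : ∀ {n} (φ : Formula n) (V : ℕ -> ℕ) -> (∀ q -> At q [] -> V q ≡ 0) -> (∀ {p} -> (18 ≤ᵇ symb p) ≡ true -> V p ≡ V (suc p)) ->
  (∀ {p} -> symb p ≡ 17 -> symb (p ∸ 1) ≡ 24 -> V p ≡ V (suc p)) -> ∀ {p} -> At p (formText φ []) -> V p ≡ 0
 formula-zero φ V end h h17 tx with FormulaWalk.walk-formula V h h17 φ tx
 ... | q , e , tx' = tr e (end q tx')
 quants-at : ∀ {Q n r} (S : Prenex Q n r) {p} -> At p (preText S) -> quants p ≡ r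
 quants-at (matrix φ) tx = formula-zero φ quants Qn.past (\ {p} e -> quants-idle (17<= (symb p) e)) (\ e _ -> idle-17 {V = quants} quants-idle e) tx
 quants-at {Q} (block m S) {p} tx = tr (Qn.unroll p) (tr (cong (\ b -> if b then suc (quants (suc p)) else quants (suc p)) (tr (cong isQuant (at-head tx)) (is-quantifier Q)))
   (cong suc (tr (pass quants (idle-17 {V = quants} quants-idle) (replicate m 17) (all-17 m) (at-tail tx)) (quants-at S (at-skip m (at-tail tx))))))
 lastQ-at : ∀ {Q n r} (S : Prenex Q n r) {p} -> At p (preText S) -> lastQ p ≡ (if r ≡ᵇ 0 then 0 else quantCode (dual (innermost S)))
 lastQ-at (matrix φ) tx = formula-zero φ lastQ L.past (\ {p} e -> lastQ-idle (17<= (symb p) e)) (\ e _ -> idle-17 {V = lastQ} lastQ-idle e) tx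
 lastQ-at {Q} (block {r = r} m S) {p} tx = tr (L.unroll p) (tr (cong (\ b -> if b ∧ (lastQ (suc p) ≡ᵇ 0) then symb p else lastQ (suc p)) (tr (cong isQuant (at-head tx)) (is-quantifier Q)))
   (tr (cong (\ v -> if v ≡ᵇ 0 then symb p else v) (tr (pass lastQ (idle-17 {V = lastQ} lastQ-idle) (replicate m 17) (all-17 m) (at-tail tx)) (lastQ-at S (at-skip m (at-tail tx))))) (choose S)))
  where
  choose : ∀ {r} (S : Prenex (dual Q) _ r) -> (if (if r ≡ᵇ 0 then 0 else quantCode (dual (innermost S))) ≡ᵇ 0 then symb p
   else (if r ≡ᵇ 0 then 0 else quantCode (dual (innermost S)))) ≡ quantCode (dual (innermost S))
  choose (matrix φ) = tr (at-head tx) (cong quantCode (sym (dual-involutive Q)))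
  choose (block m S) = cong (\ b -> if b then symb p else quantCode (dual (innermost S))) (positive-code (dual (innermost S)))
 blockSize-at : ∀ {Q n r} (S : Prenex Q n r) j {p} -> At p (preText S) -> bsize j p ≡ sizeOf S j
 blockSize-at (matrix φ) j tx = formula-zero φ (bsize j) (B.past j) (\ {p} e -> block-no j (17-no (symb p) e)) (block-term j) tx
 blockSize-at {Q} (block {r = r} m S) j {p} tx = tr (block-no j (tr (cong (_≡ᵇ 17) (at-head tx)) (not-17 Q)))
  (tr (block-xs j r m (at-tail tx) (tr (cong (_≡ᵇ 24) (at-head tx)) (not-24 Q)) (quants-at S (at-skip m (at-tail tx))))
   (tr (cong ((if r ≡ᵇ j then m else 0) +_) (blockSize-at S j (at-skip m (at-tail tx)))) (choose (r ≡ᵇ j) refl)))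
  where
  choose : ∀ b -> (r ≡ᵇ j) ≡ b -> (if b then m else 0) + sizeOf S j ≡ (if b then m else sizeOf S j)
  choose false _ = refl
  choose true e = tr (cong (m +_) (sizeOf-≥ S j (≡⇒≤ (≡ᵇ⇒≡ r j (subst T (sym e) tt))))) (+-identityʳ m)

module Decision {α : ℝ} (quad : Quadratic α) (symb : ℕ -> ℕ) (ℓ : ℕ) where
 open Quadratic quad using (k; b; s)
 open Link quad using (setting; atom-reflects)
 open Automata setting using (Spec; Accept; det; alive; values; A; module Projection) public
 open Inputs setting k b s symb ℓ public
 open Truth α using (formula; prenex)
 level : ℕ -> Auto
 level zero = product
 level (suc j) = det (level j) (bsize j 0)
 outer : ℕ
 outer = ℕ.pred (quants 0)
 -- A sentence has no outer variables, so the outermost block is tested on the empty word: the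
 -- initial states are searched for one from which acceptance can be reached. For a universal block
 -- this finds a counterexample.
 answer : Bool
 answer = (symb 0 ≡ᵇ 16) == alive (level outer) (bsize outer 0) (Auto.ini (level outer))
 -- Elimination complements, so the automaton of an existential formula accepts the assignments that
 -- refute it, while that of a universal formula accepts those that satisfy it.
 Says Denies : Quantifier -> Set -> Set
 Says all P = P
 Says ex P = ¬ P
 Denies all P = ¬ P
 Denies ex P = P
 isAll : Quantifier -> Bool
 isAll all = true
 isAll ex = false
 module Correct (beyond : ∀ i -> ℓ ≤ i -> symb i ≡ 0) where
  open Meaning beyond
  open Structure symb ℓ beyond using (skipTo; at-skip; free-skip; all-17; not-busy; quants-at; lastQ-at; blockSize-at)
  module _ {n} (φ : Formula n) (Q : Quantifier) {p} (tx : At p (formText φ [])) (fr : Free p) (prefix : ∀ claims -> Verdict.V claims 0 ≡ Verdict.V claims p) (pol : polarity ≡ isAll Q) where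
   -- The assignment is kept a variable, as unfolding the decoded values is costly.
   verdict-reflects : ∀ w {ρ : Vec ℤ n} -> ρ ≡ values n w -> Reflects (formula ρ φ) (verdict (truth w))
   verdict-reflects w {ρ} ρ= = extract (eval-at φ fr tx)
    where
    open Verdict (truth w)
    atoms : ∀ (t : List (ℤ[α] × Fin n)) R a {p rest} -> Free p -> At p (atomText t R a rest) -> ∃[ v ] (Reflects (formula ρ (atom t R a)) v × Parsed (\ q -> V p ≡ v ◂ V q) rest)
    atoms t R a fr tx = let st , rest = atom-step t R a fr tx in truth w _ , subst (Reflects _) (sym (truth-at t R a tx st w ρ=)) (atom-reflects ρ t R a) , rest
    open Evaluate α ρ V connective atoms
    extract : Value φ p [] -> Reflects (formula ρ φ) (verdict (truth w))
    extract (value-is {v} rf {q} e _ _) = subst (Reflects _) (sym (tr (cong latest (tr (prefix (truth w)) e)) (latest-◂ v (V q)))) rf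
   base-says : ∀ Q {P : Set} {v} -> Reflects P v -> (v == isAll Q) ≡ true -> Says Q P
   base-says all (ofʸ p) _ = p
   base-says ex (ofⁿ ¬p) _ = ¬p
   base-says all (ofⁿ ¬p) ()
   base-says ex (ofʸ p) ()
   base-denies : ∀ Q {P : Set} {v} -> Reflects P v -> (v == isAll Q) ≢ true -> Denies Q P
   base-denies all (ofʸ p) h = contradiction refl h
   base-denies ex (ofⁿ ¬p) h = contradiction refl h
   base-denies all (ofⁿ ¬p) _ = ¬p
   base-denies ex (ofʸ p) _ = p
   matrix-spec : Spec product n (\ ρ -> Says Q (formula ρ φ)) (\ ρ -> Denies Q (formula ρ φ))
   matrix-spec w _ = (\ a -> base-says Q (verdict-reflects w refl) (tr (cong (verdict (truth w) ==_) (sym pol)) (accept-verdict a))) ,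
    (\ na -> base-denies Q (verdict-reflects w refl) (\ e -> na (verdict-accept w (tr (cong (verdict (truth w) ==_) pol) e))))
  skip-prefix : ∀ Q m {p w} claims -> At p (quantCode Q ∷ replicate m 17 ++ w) -> Verdict.V claims p ≡ Verdict.V claims (skipTo (suc p) m)
  skip-prefix Q m {p} claims tx = tr (walks (subst Plain (sym (at-head tx)) (plain Q))) (pass V {Plain} walks (replicate m 17) (All.map (\ { refl -> refl , refl }) (all-17 m)) (at-tail tx))
   where
   open Verdict claims
   plain : ∀ Q -> Plain (quantCode Q)
   plain all = refl , refl
   plain ex = refl , refl
  Spec-map : ∀ {M n P P̄ P' P̄'} -> (∀ ρ -> P ρ -> P' ρ) -> (∀ ρ -> P̄ ρ -> P̄' ρ) -> Spec M n P P̄ -> Spec M n P' P̄'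
  Spec-map {n = n} f g spec w small = (\ a -> f (values n w) (fst (spec w small) a)) , (\ na -> g (values n w) (snd (spec w small) na))
  level-spec : ∀ {Q n r} (S : Prenex Q n r) {p} -> At p (preText S) -> Free p -> (∀ claims -> Verdict.V claims 0 ≡ Verdict.V claims p) -> (∀ j -> j < r -> bsize j 0 ≡ sizeOf S j) ->
   polarity ≡ isAll (innermost S) -> Spec (level r) n (\ ρ -> Says Q (prenex ρ S)) (\ ρ -> Denies Q (prenex ρ S))
  level-spec {Q} (matrix φ) tx fr pre sizes' pol = matrix-spec φ Q tx fr pre pol
  level-spec {Q} {n} (block {r = r} m S) {p} tx fr pre sizes' pol =
   subst (\ m' -> Spec (det (level r) m') n (\ ρ -> Says Q (prenex ρ (block m S))) (\ ρ -> Denies Q (prenex ρ (block m S)))) (sym size-=)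
    (Spec-map (says Q S) (denies Q S) (det-spec {n} {\ ρ -> Says (dual Q) (prenex ρ S)} {\ ρ -> Denies (dual Q) (prenex ρ S)} inner))
   where
   open Projection (level r) m
   tx' : At (skipTo (suc p) m) (preText S)
   tx' = at-skip m (at-tail tx)
   size-= : bsize r 0 ≡ m
   size-= = tr (sizes' r ≤-refl) (cong (\ b -> if b then m else sizeOf S r) (=b-refl r))
   inner : Spec (level r) (m + n) (\ ρ -> Says (dual Q) (prenex ρ S)) (\ ρ -> Denies (dual Q) (prenex ρ S))
   inner = level-spec S tx' (free-skip m (at-tail tx) (tr (cong busy (at-head tx)) (not-busy Q))) (\ claims -> tr (pre claims) (skip-prefix Q m claims tx))
    (\ j j<r -> tr (sizes' j (m<n⇒m<1+n j<r)) (cong (\ b -> if b then m else sizeOf S j) (<=>/=b j<r))) pol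
   says : ∀ Q {r} (S : Prenex (dual Q) (m + n) r) ρ -> (∀ x -> Denies (dual Q) (prenex (x Vec.++ ρ) S)) -> Says Q (prenex ρ (block m S))
   says all S ρ h = h
   says ex S ρ h (x , p) = h x p
   denies : ∀ Q {r} (S : Prenex (dual Q) (m + n) r) ρ -> ∃[ x ] Says (dual Q) (prenex (x Vec.++ ρ) S) -> Denies Q (prenex ρ (block m S))
   denies all S ρ (x , ¬p) h = ¬p (h x)
   denies ex S ρ h = h
  answer-correct : ∀ {r} (S : Sentence (suc r)) -> At 0 (preText (Sentence.prenex S)) -> Reflects (α ⊨ S) answer
  answer-correct {r} (sentence Q (block m S)) tx = subst2 (\ o b -> Reflects (α ⊨ sentence Q (block m S)) ((symb 0 ≡ᵇ 16) == alive (level o) b (Auto.ini (level o))))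
    (sym outer-=) (sym (tr (cong (\ o -> bsize o 0) outer-=) size-=)) (subst (\ c -> Reflects _ ((c ≡ᵇ 16) == found)) (sym (at-head tx)) (final Q S found refl inner))
   where
   open Projection (level r) m
   tx' : At (skipTo 1 m) (preText S)
   tx' = at-skip m (at-tail tx)
   outer-= : outer ≡ r
   outer-= = cong ℕ.pred (quants-at (block {Q} {0} m S) tx)
   size-= : bsize r 0 ≡ m
   size-= = tr (blockSize-at (block {Q} {0} m S) r tx) (cong (\ b -> if b then m else sizeOf S r) (=b-refl r))
   found : Bool
   found = alive (level r) m (Auto.ini (level r))
   polarity-= : polarity ≡ isAll (innermost S)
   polarity-= = tr (cong (_≡ᵇ 16) (lastQ-at (block {Q} {0} m S) tx)) (last-ex (innermost S))
    where
    last-ex : ∀ Q -> (quantCode (dual Q) ≡ᵇ 16) ≡ isAll Q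
    last-ex all = refl
    last-ex ex = refl
   inner : Spec (level r) (m + 0) (\ ρ -> Says (dual Q) (prenex ρ S)) (\ ρ -> Denies (dual Q) (prenex ρ S))
   inner = level-spec S tx' (free-skip m (at-tail tx) (tr (cong busy (at-head tx)) (not-busy Q))) (\ claims -> skip-prefix Q m claims tx)
    (\ j j<r -> tr (blockSize-at (block {Q} {0} m S) j tx) (cong (\ b -> if b then m else sizeOf S j) (<=>/=b j<r))) polarity-=
   final : ∀ Q (S : Prenex (dual Q) (m + 0) r) b -> found ≡ b -> Spec (level r) (m + 0) (\ ρ -> Says (dual Q) (prenex ρ S)) (\ ρ -> Denies (dual Q) (prenex ρ S)) ->
     Reflects (prenex [] (block {Q} {0} m S)) ((quantCode Q ≡ᵇ 16) == b)
   final all S true e spec = ofⁿ (\ h -> let x , ¬p = alive-true {0} {\ ρ -> ¬ prenex ρ S} {\ ρ -> prenex ρ S} spec {[]} [] lifts-[] e in ¬p (h x))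
   final all S false e spec = ofʸ (alive-false {0} {\ ρ -> ¬ prenex ρ S} {\ ρ -> prenex ρ S} spec {[]} [] lifts-[] e)
   final ex S true e spec = ofʸ (alive-true {0} {\ ρ -> prenex ρ S} {\ ρ -> ¬ prenex ρ S} spec {[]} [] lifts-[] e)
   final ex S false e spec = ofⁿ (\ (x , p) -> alive-false {0} {\ ρ -> prenex ρ S} {\ ρ -> ¬ prenex ρ S} spec {[]} [] lifts-[] e x p)

-- Automata as arrays

every-cong : ∀ n {f g} -> (∀ i -> i < n -> f i ≡ g i) -> every n f ≡ every n g
every-cong zero h = refl
every-cong (suc n) h = cong2 _∧_ (h n ≤-refl) (every-cong n (\ i p -> h i (m<n⇒m<1+n p)))

entryAt : (Λ N : ℕ) -> (ℕ -> Bool) -> (ℕ -> Bool) -> (ℕ -> ℕ -> ℕ -> Bool) -> ℕ -> Bool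
entryAt Λ N ini acc rel k = if suc k ≤ᵇ N then ini k else if suc k ≤ᵇ N + N then acc (k ∸ N) else rel ((k ∸ (N + N)) ÷ N ÷ Λ) ((k ∸ (N + N)) ÷ N rem Λ) ((k ∸ (N + N)) rem N)

tabSize : ℕ -> ℕ -> ℕ
tabSize Λ N = N + N + N * Λ * N

-- `Λ` is the stride for letters. One value that bounds the alphabets of all levels is used
-- throughout, although the alphabets shrink.
table : ℕ -> Auto -> List ℕ
table Λ M = N ∷ tab (tabSize Λ N) (\ k -> b2n (entryAt Λ N ini acc rel k))
 where
  open Auto M

auto : ℕ -> List ℕ -> Auto
auto Λ t = record { N = t ‼ 0 ; ini = \ q -> t ‼ suc q ≡ᵇ 1 ; acc = \ q -> t ‼ suc (t ‼ 0 + q) ≡ᵇ 1 ; rel = \ q u q' -> t ‼ suc (t ‼ 0 + t ‼ 0 + ((q * Λ + u) * t ‼ 0 + q')) ≡ᵇ 1 }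

-- An array determines an automaton only on states below `N` and letters below `Λ`; beyond these its
-- entries are arbitrary.
record Agree (Λ : ℕ) (M M' : Auto) : Set where
 private
  module M = Auto M
  module M' = Auto M'
 field
  N-= : M.N ≡ M'.N
  ini-= : ∀ q -> q < M.N -> M.ini q ≡ M'.ini q
  acc-= : ∀ q -> q < M.N -> M.acc q ≡ M'.acc q
  rel-= : ∀ q u q' -> q < M.N -> u < Λ -> q' < M.N -> M.rel q u q' ≡ M'.rel q u q'

agree-trans : ∀ {Λ M1 M2 M3} -> Agree Λ M1 M2 -> Agree Λ M2 M3 -> Agree Λ M1 M3
agree-trans a b = record { N-= = tr A.N-= B.N-= ; ini-= = \ q p -> tr (A.ini-= q p) (B.ini-= q (subst (q <_) A.N-= p)) ; acc-= = \ q p -> tr (A.acc-= q p) (B.acc-= q (subst (q <_) A.N-= p))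
 ; rel-= = \ q u q' p l p' -> tr (A.rel-= q u q' p l p') (B.rel-= q u q' (subst (q <_) A.N-= p) l (subst (q' <_) A.N-= p')) }
 where
 module A = Agree a
 module B = Agree b

agree-<= : ∀ {Λ Λ' M M'} -> Λ' ≤ Λ -> Agree Λ M M' -> Agree Λ' M M'
agree-<= Λ'<=Λ a = record { N-= = N-= ; ini-= = ini-= ; acc-= = acc-= ; rel-= = \ q u q' p l p' -> rel-= q u q' p (<-≤-trans l Λ'<=Λ) p' }
 where
  open Agree a

<=b-true : ∀ {m n} -> m ≤ n -> (m ≤ᵇ n) ≡ true
<=b-true p = T-true (≤⇒≤ᵇ p)
 where
 T-true : ∀ {b} -> T b -> b ≡ true
 T-true {true} _ = refl

<=b-false : ∀ {m n} -> n < m -> (m ≤ᵇ n) ≡ false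
<=b-false {m} {n} p = /=true=>false (\ e -> <⇒≱ p (≤ᵇ⇒≤ m n (subst T (sym e) tt)))

b2n-=b : ∀ b -> (b2n b ≡ᵇ 1) ≡ b
b2n-=b false = refl
b2n-=b true = refl

÷-radix : ∀ n {a b} -> b < n -> (a * n + b) ÷ n ≡ a
÷-radix (suc n) {a} {b} b<n = tr (cong (ℕ._/ suc n) (+-comm (a * suc n) b)) (tr (DM.+-distrib-/-∣ʳ b (DV.divides a refl)) (cong2 _+_ (DM.m<n⇒m/n≡0 b<n) (DM.m*n/n≡m a (suc n))))

rem-radix : ∀ n {a b} -> b < n -> (a * n + b) rem n ≡ b
rem-radix (suc n) {a} {b} b<n = tr (cong (ℕ._% suc n) (+-comm (a * suc n) b)) (tr (DM.[m+kn]%n≡m%n b a (suc n)) (DM.m<n⇒m%n≡m b<n))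

radix-< : ∀ {m n a b} -> a < m -> b < n -> a * n + b < m * n
radix-< {m} {n} {a} {b} a<m b<n = <-≤-trans (+-monoʳ-< (a * n) b<n) (≤-trans (≡⇒≤ (+-comm (a * n) n)) (*-monoˡ-≤ n a<m))

table-agree : ∀ Λ M -> Agree Λ M (auto Λ (table Λ M))
table-agree Λ M = record { N-= = refl ; ini-= = \ q q<N -> sym (tr (look (<-≤-trans q<N (≤-trans (m≤m+n N N) (m≤m+n (N + N) (N * Λ * N)))))
  (cong (\ b -> if b then ini q else (if suc q ≤ᵇ N + N then acc (q ∸ N) else rest q)) (<=b-true q<N))) ; acc-= = \ q q<N -> sym (tr (look (<-≤-trans (+-monoʳ-< N q<N) (m≤m+n (N + N) (N * Λ * N))))
  (tr (cong2 (\ b c -> if b then ini (N + q) else (if c then acc (N + q ∸ N) else rest (N + q))) (<=b-false (s≤s (m≤m+n N q))) (<=b-true (+-monoʳ-< N q<N))) (cong acc (m+n∸m≡n N q))))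
 ; rel-= = \ q u q' q<N u<Λ q'<N -> let i = (q * Λ + u) * N + q' in sym (tr (look (+-monoʳ-< (N + N) (radix-< {N * Λ} {N} (radix-< {N} {Λ} q<N u<Λ) q'<N)))
  (tr (cong2 (\ b c -> if b then ini (N + N + i) else (if c then acc (N + N + i ∸ N) else rest (N + N + i)))
    (<=b-false (s≤s (≤-trans (m≤m+n N N) (m≤m+n (N + N) i)))) (<=b-false (s≤s (m≤m+n (N + N) i)))) (tr (cong (\ j -> rel (j ÷ N ÷ Λ) (j ÷ N rem Λ) (j rem N)) (m+n∸m≡n (N + N) i))
    (tr (cong2 (\ x y -> rel (x ÷ Λ) (x rem Λ) y) (÷-radix N {q * Λ + u} q'<N) (rem-radix N {q * Λ + u} q'<N)) (cong2 (\ x y -> rel x y q') (÷-radix Λ {q} u<Λ) (rem-radix Λ {q} u<Λ)))))) }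
 where
 open Auto M
 rest : ℕ -> Bool
 rest k = rel ((k ∸ (N + N)) ÷ N ÷ Λ) ((k ∸ (N + N)) ÷ N rem Λ) ((k ∸ (N + N)) rem N)
 look : ∀ {k} -> k < tabSize Λ N -> (tab (tabSize Λ N) (\ k -> b2n (entryAt Λ N ini acc rel k)) ‼ k ≡ᵇ 1) ≡ entryAt Λ N ini acc rel k
 look {k} k< = tr (cong (_≡ᵇ 1) (tab-‼ (tabSize Λ N) (\ k -> b2n (entryAt Λ N ini acc rel k)) k<)) (b2n-=b (entryAt Λ N ini acc rel k))

module Tables (setting : Setting) where
 open Automata setting using (A; join; join-small; det; alive; closure; closStep)
 module _ {Λ M M'} (agree : Agree Λ M M') where
  open Agree agree
  private
   module M = Auto M
   module M' = Auto M'
  closure-agree : ∀ m -> A ^ m ≤ Λ -> ∀ q -> q < M.N -> closure M m q ≡ closure M' m q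
  closure-agree m m<= q q<N = tr (go M.N q q<N) (cong (\ n -> iter (\ _ f -> closStep M' m f) M'.acc n q) N-=)
   where
   go : ∀ k q -> q < M.N -> iter (\ _ f -> closStep M m f) M.acc k q ≡ iter (\ _ f -> closStep M' m f) M'.acc k q
   go zero q q<N = acc-= q q<N
   go (suc k) q q<N = cong2 _∨_ (go k q q<N) (any-cong (A ^ m) (\ d d< -> tr (any-cong M.N (\ q' q'<N -> cong2 _∧_ (rel-= q d q' q<N (<-≤-trans d< m<=) q'<N) (go k q' q'<N)))
    (cong (\ n -> any n (\ q' -> M'.rel q d q' ∧ iter (\ _ f -> closStep M' m f) M'.acc k q')) N-=)))
  alive-agree : ∀ m -> A ^ m ≤ Λ -> ∀ {S S'} -> (∀ q -> q < M.N -> S q ≡ S' q) -> alive M m S ≡ alive M' m S'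
  alive-agree m m<= {S} {S'} h = tr (any-cong M.N (\ q q<N -> cong2 _∧_ (h q q<N) (closure-agree m m<= q q<N))) (cong (\ n -> any n (\ q -> S' q ∧ closure M' m q)) N-=)
 det-agree : ∀ m n {M M'} -> Agree (A ^ (m + n)) M M' -> Agree (A ^ n) (det M m) (det M' m)
 det-agree m n {M} {M'} agree = record { N-= = cong (2 ^_) N-=
  ; ini-= = \ X _ -> tr (every-cong M.N (\ q q<N -> cong (bit? X q ==_) (ini-= q q<N))) (cong (\ n -> every n (\ q -> bit? X q == M'.ini q)) N-=)
  ; acc-= = \ X _ -> cong Bool.not (alive-agree agree m (^-monoʳ-≤ A (m≤m+n m n)) (\ _ _ -> refl)) ; rel-= = \ X u Y _ u< _ -> tr (every-cong M.N (\ q' q'<N -> cong (bit? Y q' ==_) (tr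
    (any-cong M.N (\ q q<N -> cong (bit? X q ∧_) (any-cong (A ^ m) (\ d d< -> rel-= q (join m d u) q' q<N (join-small m n d< u<) q'<N))))
    (cong (\ n -> any n (\ q -> bit? X q ∧ any (A ^ m) (\ d -> M'.rel q (join m d u) q'))) N-=))))
   (cong (\ n -> every n (\ q' -> bit? Y q' == any M'.N (\ q -> bit? X q ∧ any (A ^ m) (\ d -> M'.rel q (join m d u) q')))) N-=) }
  where
  open Agree agree
  module M = Auto M
  module M' = Auto M'
 -- Each level is stored before the next one is built; otherwise a query to the last automaton would
 -- unfold through all levels.
 tables : (Λ : ℕ) -> Auto -> (ℕ -> ℕ) -> ℕ -> List ℕ
 tables Λ M0 m = iter (\ i t -> table Λ (det (auto Λ t) (m i))) (table Λ M0)
 -- The number of variables of the outermost j blocks; the outermost one is block o.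
 scope : (ℕ -> ℕ) -> ℕ -> ℕ -> ℕ
 scope m o j = sum j (\ i -> m (o ∸ i))
 module Levels (M0 : Auto) (m : ℕ -> ℕ) (o : ℕ) (Λ : ℕ) (scope<= : A ^ scope m o (suc o) ≤ Λ) where
  levels : ℕ -> Auto
  levels zero = M0
  levels (suc j) = det (levels j) (m j)
  scope-mono : ∀ {i j} -> i ≤ j -> scope m o i ≤ scope m o j
  scope-mono {i} {zero} z≤n = z≤n
  scope-mono {i} {suc j} i≤j with m≤n⇒m<n∨m≡n i≤j
  ... | in1 (s≤s i<=j') = ≤-trans (scope-mono i<=j') (m≤n+m (scope m o j) (m (o ∸ j)))
  ... | in2 refl = ≤-refl
  scope-step : ∀ {j} -> j ≤ o -> scope m o (suc o ∸ j) ≡ m j + scope m o (o ∸ j)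
  scope-step {j} j<=o = tr (cong (scope m o) (+-∸-assoc 1 j<=o)) (cong (\ i -> m i + scope m o (o ∸ j)) (m∸[m∸n]≡n j<=o))
  -- At level j only the outer blocks remain. A letter for them, joined with the digits of block j,
  -- is a letter of the previous level, whose scope is larger by exactly `m j`.
  tables-agree : ∀ j -> j ≤ o -> Agree (A ^ scope m o (suc o ∸ j)) (levels j) (auto Λ (tables Λ M0 m j))
  tables-agree zero _ = agree-<= scope<= (table-agree Λ M0)
  tables-agree (suc j) j<o = agree-trans (det-agree (m j) (scope m o (o ∸ j)) (subst (\ n -> Agree (A ^ n) (levels j) (auto Λ (tables Λ M0 m j))) (scope-step (<⇒≤ j<o)) (tables-agree j (<⇒≤ j<o))))
   (agree-<= (≤-trans (^-monoʳ-≤ A (scope-mono (≤-trans (m∸n≤m o j) (n≤1+n o)))) scope<=) (table-agree Λ (det (auto Λ (tables Λ M0 m j)) (m j))))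
  alive-tables : alive (levels o) (m o) (Auto.ini (levels o)) ≡ alive (auto Λ (tables Λ M0 m o)) (m o) (Auto.ini (auto Λ (tables Λ M0 m o)))
  alive-tables = alive-agree last (m o) (^-monoʳ-≤ A (≤-trans (m≤m+n (m o) (scope m o (o ∸ o))) (≡⇒≤ (sym (scope-step ≤-refl))))) (Agree.ini-= last)
   where
    last = tables-agree o ≤-refl

-- Programs that read a sentence, given as an array with its length

Text0 : List Ty
Text0 = arr ∷ nat ∷ []

module Programs (B0 : Env Text0 -> ℕ) (exp<= : ∀ ρ -> 2 ^ fst (snd ρ) ≤ B0 ρ) where
 Prog : ∀ {Γ} -> Thin Γ Text0 -> (Env Γ -> ℕ) -> Set
 Prog θ f = Poly (B0 ∘ prj θ) nat f
 ProgZ : ∀ {Γ} -> Thin Γ Text0 -> (Env Γ -> ℤ) -> Set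
 ProgZ θ f = PolyZ (B0 ∘ prj θ) f
 Check : ∀ {Γ} -> Thin Γ Text0 -> (Env Γ -> Bool) -> Set
 Check θ f = Test (B0 ∘ prj θ) f
 call : ∀ {Γ} (θ : Thin Γ Text0) {f g} -> Prog (drop ident) f -> Prog θ g -> Prog θ (\ ρ -> f (g ρ , prj θ ρ))
 call θ f g = bind g (thin (keep θ) f)
 callZ : ∀ {Γ} (θ : Thin Γ Text0) {f g} -> ProgZ (drop ident) f -> Prog θ g -> ProgZ θ (\ ρ -> f (g ρ , prj θ ρ))
 callZ θ f g = bindZ g (thinZ (keep θ) f)
 module _ {Γ} (θ : Thin Γ Text0) where
  word : Env Γ -> List ℕ
  word ρ = fst (prj θ ρ)
  size' : Env Γ -> ℕ
  size' ρ = fst (snd (prj θ ρ))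
  symbol : Env Γ -> ℕ -> ℕ
  symbol ρ = symAt (word ρ)
  wordP : Poly (B0 ∘ prj θ) arr word
  wordP = thin {B = B0} θ #0
  sizeP : Prog θ size'
  sizeP = thin {B = B0} θ #1
  symbolP : ∀ {p} -> Prog θ p -> Prog θ (\ ρ -> symbol ρ (p ρ))
  symbolP p = litP 8 *P getP wordP (p *P litP 4) +P litP 4 *P getP wordP (litP 1 +P p *P litP 4) +P litP 2 *P getP wordP (litP 2 +P p *P litP 4) +P getP wordP (litP 3 +P p *P litP 4)
  2<= : ∀ ρ -> 2 ≤ bud (B0 ∘ prj θ) ρ
  2<= = 2<=bud (B0 ∘ prj θ)
  exp-within : ∀ {x} ρ -> x ≤ 2 ^ size' ρ -> Within (bud (B0 ∘ prj θ) ρ) 1 x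
  exp-within ρ x<= = self (2<= ρ) (≤-trans x<= (≤-trans (exp<= (prj θ ρ)) (B<=bud (B0 ∘ prj θ) ρ)))
  backwardsP : ∀ {p : Env Γ -> ℕ} {s : Env Γ -> ℕ -> ℕ -> ℕ} {z : ℕ} -> Prog θ p -> Prog (drop (drop θ)) (\ (i , a , ρ) -> s ρ i a) ->
   ∀ j -> (∀ ρ k -> k ≤ size' ρ -> Within (bud (B0 ∘ prj θ) ρ) j (iter (\ k a -> s ρ (p ρ + (size' ρ ∸ suc k)) a) z k)) -> Prog θ (\ ρ -> iter (\ k a -> s ρ (p ρ + (size' ρ ∸ suc k)) a) z (size' ρ))
  backwardsP {p} {s} {z} pp ps j small = iterN {s = \ ρ k a -> s ρ (p ρ + (size' ρ ∸ suc k)) a} sizeP (litP z)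
   (bind (wk (wk pp) +P (wk (wk sizeP) ∸P sucP #1)) (thin (keep (keep (drop ident))) ps)) j small
 -- Covers several passes over the text at once: numerals, distances, counts and the stack of truth
 -- values at most double and grow by one at each symbol.
 doubling : ∀ (s : ℕ -> ℕ -> ℕ) -> (∀ k a -> s k a ≤ suc (2 * a)) -> ∀ k -> suc (iter s 0 k) ≤ 2 ^ k
 doubling s h zero = ≤-refl
 doubling s h (suc k) = ≤-trans (s≤s (h k _)) (≤-trans (≡⇒≤ (sym (*-suc 2 (iter s 0 k)))) (*-monoʳ-≤ 2 (doubling s h k)))
 dbl-within : ∀ {Γ} (θ : Thin Γ Text0) s -> (∀ k a -> s k a ≤ suc (2 * a)) -> ∀ ρ k -> k ≤ size' θ ρ -> Within (bud (B0 ∘ prj θ) ρ) 1 (iter s 0 k)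
 dbl-within θ s h ρ k k≤ = exp-within θ ρ (≤-trans (n≤1+n _) (≤-trans (doubling s h k) (^-monoʳ-≤ 2 k≤)))
 isDigitP : ∀ {Γ} {B : Env Γ -> ℕ} {f} -> Poly B nat f -> Test B (\ ρ -> isDigit (f ρ))
 isDigitP p = (p =bP litP 18) ∨P (p =bP litP 19)
 isRelationP : ∀ {Γ} {B : Env Γ -> ℕ} {f} -> Poly B nat f -> Test B (\ ρ -> isRel (f ρ))
 isRelationP p = (p =bP litP 25) ∨P (p =bP litP 26)
 isTermP : ∀ {Γ} {B : Env Γ -> ℕ} {f} -> Poly B nat f -> Test B (\ ρ -> isTerm (f ρ))
 isTermP p = p =bP litP 23
 one : Thin (nat ∷ Text0) Text0
 one = drop ident
 two : Thin (nat ∷ nat ∷ Text0) Text0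
 two = drop (drop ident)
 module E (ρ : Env Text0) = Evaluation (symAt (fst ρ)) (fst (snd ρ))
 <=1+2 : ∀ {a b} -> a ≤ suc b -> a ≤ suc (2 * b)
 <=1+2 {a} {b} p = ≤-trans p (s≤s (m≤m+n b (b + 0)))
 if-<= : ∀ c {x y n} -> x ≤ n -> y ≤ n -> (if c then x else y) ≤ n
 if-<= false p q = q
 if-<= true p q = p
 digit-value : ∀ s a -> (if isDigit s then (s ∸ 18) + 2 * a else 0) ≤ suc (2 * a)
 digit-value s a with s ≡ᵇ 18 in e | s ≡ᵇ 19 in e'
 ... | true | _ = +-monoˡ-≤ (2 * a) (subst (\ s -> s ∸ 18 ≤ 1) (sym (≡ᵇ⇒≡ s 18 (subst T (sym e) tt))) z≤n)
 ... | false | true = +-monoˡ-≤ (2 * a) (subst (\ s -> s ∸ 18 ≤ 1) (sym (≡ᵇ⇒≡ s 19 (subst T (sym e') tt))) ≤-refl)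
 ... | false | false = z≤n
 numP : Prog one (\ (p , ρ) -> E.num ρ p)
 numP = backwardsP one {s = \ (p , ρ) i a -> numStep' ρ i a} #0 (ifP (isDigitP sP) ((sP ∸P litP 18) +P litP 2 *P #1) (litP 0)) 1
  (\ (p , ρ) -> dbl-within one (\ k a -> numStep' ρ (p + (fst (snd ρ) ∸ suc k)) a) (\ k a -> digit-value (symAt (fst ρ) (p + (fst (snd ρ) ∸ suc k))) a) (p , ρ))
  where
  numStep' : Env Text0 -> ℕ -> ℕ -> ℕ
  numStep' ρ i a = E.numStep ρ (symAt (fst ρ) i) a
  three : Thin (nat ∷ nat ∷ nat ∷ Text0) Text0
  three = drop (drop (drop ident))
  sP : Prog three (\ (i , a , p , ρ) -> symAt (fst ρ) i)
  sP = symbolP three #0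
 intP : ProgZ one (\ (p , ρ) -> E.int ρ p)
 intP = ifZ (symbolP one #0 =bP litP 20) (negZ (natZ (call one numP (sucP #0)))) (natZ numP)
 distP : ∀ c -> (∀ {Γ} {B : Env Γ -> ℕ} {f} -> Poly B nat f -> Test B (\ ρ -> c (f ρ))) -> Prog one (\ (p , ρ) -> E.dist ρ c p)
 distP c cP = backwardsP one {s = \ (p , ρ) i a -> E.distStep ρ c (symAt (fst ρ) i) a} #0 (ifP (cP sP ∨P (sP =bP litP 0)) (litP 0) (sucP #1)) 1
  (\ (p , ρ) -> dbl-within one (\ k a -> E.distStep ρ c (symAt (fst ρ) (p + (fst (snd ρ) ∸ suc k))) a)
   (\ k a -> if-<= (c (symAt (fst ρ) (p + (fst (snd ρ) ∸ suc k))) ∨ (symAt (fst ρ) (p + (fst (snd ρ) ∸ suc k)) ≡ᵇ 0)) z≤n (<=1+2 ≤-refl)) (p , ρ))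
  where
  three : Thin (nat ∷ nat ∷ nat ∷ Text0) Text0
  three = drop (drop (drop ident))
  sP : Prog three (\ (i , a , p , ρ) -> symAt (fst ρ) i)
  sP = symbolP three #0
 c0P : ProgZ one (\ (p , ρ) -> E.c₀ ρ p)
 c0P = callZ one intP (sucP #0)
 c1P : ProgZ one (\ (p , ρ) -> E.c₁ ρ p)
 c1P = callZ one intP (#0 +P sucP (distP (_≡ᵇ 21) (_=bP litP 21)))
 variableP : Prog one (\ (p , ρ) -> E.variable# ρ p)
 variableP = call one numP (#0 +P sucP (distP (_≡ᵇ 17) (_=bP litP 17)))
 relationP : Prog one (\ (p , ρ) -> E.relation ρ p)
 relationP = #0 +P distP isRel isRelationP
 startP : Check one (\ (p , ρ) -> E.start? ρ p)
 startP = (isTermP s ∨P isRelationP s) ∧P notP (isDigitP s' ∨P isRelationP s')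
  where
  s = symbolP one #0
  s' = symbolP one (#0 ∸P litP 1)
 isQuantifierP : ∀ {Γ} {B : Env Γ -> ℕ} {f} -> Poly B nat f -> Test B (\ ρ -> (f ρ ≡ᵇ 15) ∨ (f ρ ≡ᵇ 16))
 isQuantifierP p = (p =bP litP 15) ∨P (p =bP litP 16)
 quantsP : Prog one (\ (p , ρ) -> E.quants ρ p)
 quantsP = backwardsP one {s = \ (p , ρ) i a -> E.quantStep ρ i a} #0 (ifP (isQuantifierP (symbolP (drop (drop one)) #0)) (sucP #1) #1) 1
  (\ (p , ρ) -> dbl-within one (\ k a -> E.quantStep ρ (p + (fst (snd ρ) ∸ suc k)) a)
   (\ k a -> if-<= (E.isQuant ρ (symAt (fst ρ) (p + (fst (snd ρ) ∸ suc k)))) (<=1+2 ≤-refl) (<=1+2 (n≤1+n a))) (p , ρ))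
 lastP : Prog one (\ (p , ρ) -> E.lastQ ρ p)
 lastP = backwardsP one {s = \ (p , ρ) i a -> E.lastStep ρ i a} #0 (ifP (isQuantifierP (symbolP (drop (drop one)) #0) ∧P (#1 =bP litP 0)) (symbolP (drop (drop one)) #0) #1) 16
  (\ (p , ρ) k _ -> shrink (2<= one (p , ρ)) (small p ρ k) (const (2<= one (p , ρ)) 16))
  where
  step-≤ : ∀ s a -> a ≤ 16 -> (if ((s ≡ᵇ 15) ∨ (s ≡ᵇ 16)) ∧ (a ≡ᵇ 0) then s else a) ≤ 16
  step-≤ s a a<= with s ≡ᵇ 15 in e | s ≡ᵇ 16 in e'
  ... | true | _ = if-<= (a ≡ᵇ 0) (subst (_≤ 16) (sym (≡ᵇ⇒≡ s 15 (subst T (sym e) tt))) (n≤1+n 15)) a<=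
  ... | false | true = if-<= (a ≡ᵇ 0) (subst (_≤ 16) (sym (≡ᵇ⇒≡ s 16 (subst T (sym e') tt))) ≤-refl) a<=
  ... | false | false = a<=
  small : ∀ p ρ k -> iter (\ k a -> E.lastStep ρ (p + (fst (snd ρ) ∸ suc k)) a) 0 k ≤ 16
  small p ρ zero = z≤n
  small p ρ (suc k) = step-≤ (symAt (fst ρ) (p + (fst (snd ρ) ∸ suc k))) _ (small p ρ k)
 blockSizeP : Prog one (\ (j , ρ) -> E.bsize ρ j 0)
 blockSizeP = backwardsP one {p = \ _ -> 0} {s = \ (j , ρ) i a -> E.blockStep ρ j i a} (litP 0) body 1 (\ (j , ρ) -> dbl-within one (\ k a -> E.blockStep ρ j (fst (snd ρ) ∸ suc k) a)
   (\ k a -> block-<= ρ j (fst (snd ρ) ∸ suc k) a) (j , ρ))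
  where
  three : Thin (nat ∷ nat ∷ nat ∷ Text0) Text0
  three = drop (drop (drop ident))
  condition : Env Text0 -> ℕ -> ℕ -> Bool
  condition ρ j i = ((symAt (fst ρ) i ≡ᵇ 17) ∧ Bool.not (symAt (fst ρ) (i ∸ 1) ≡ᵇ 24)) ∧ (E.quants ρ (suc i) ≡ᵇ j)
  conditionP : Check three (\ (i , a , j , ρ) -> condition ρ j i)
  conditionP = ((symbolP three #0 =bP litP 17) ∧P notP (symbolP three (#0 ∸P litP 1) =bP litP 24)) ∧P (call three quantsP (sucP #0) =bP #2)
  body : Prog three (\ (i , a , j , ρ) -> E.blockStep ρ j i a)
  body = ifP {c = \ (i , a , j , ρ) -> condition ρ j i} conditionP (sucP #1) #1
  block-<= : ∀ ρ j i a -> E.blockStep ρ j i a ≤ suc (2 * a)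
  block-<= ρ j i a = if-<= (condition ρ j i) (<=1+2 ≤-refl) (<=1+2 (n≤1+n a))
 polarityP : Check ident (\ ρ -> E.polarity ρ)
 polarityP = call ident lastP (litP 0) =bP litP 16

-- Programs for the inequalities and for the product automaton

ifᵗ : ∀ {Γ} {B : Env Γ -> ℕ} {c f g : Env Γ -> Bool} -> Test B c -> Test B f -> Test B g -> Test B (\ ρ -> if c ρ then f ρ else g ρ)
ifᵗ {c = c} {f} {g} p q r = ext (\ ρ -> choose (c ρ) (f ρ) (g ρ)) (ifP {c = c} p q r)
 where
 choose : ∀ c f g -> (if c then b2n f else b2n g) ≡ b2n (if c then f else g)
 choose false f g = refl
 choose true f g = refl

infix 4 _==P_

_==P_ : ∀ {Γ} {B : Env Γ -> ℕ} {c d : Env Γ -> Bool} -> Test B c -> Test B d -> Test B (\ ρ -> c ρ == d ρ)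
_==P_ {c = c} {d} p q = ext (\ ρ -> lemma (c ρ) (d ρ)) (ifᵗ {c = c} {d} p q (notP {c = d} q))
 where
 lemma : ∀ c d -> b2n (if c then d else Bool.not d) ≡ b2n (c == d)
 lemma false d = refl
 lemma true d = refl

record PolyR {Γ} (B : Env Γ -> ℕ) (f : Env Γ -> ZR) : Set where
 constructor _,P_
 field
  firstP : PolyZ B (\ ρ -> fst (f ρ))
  secondP : PolyZ B (\ ρ -> snd (f ρ))

open PolyR public

module _ {Γ} {B : Env Γ -> ℕ} where
 extR : ∀ {f g : Env Γ -> ZR} -> (∀ ρ -> f ρ ≡ g ρ) -> PolyR B f -> PolyR B g
 extR eq p = extZ (\ ρ -> cong fst (eq ρ)) (firstP p) ,P extZ (\ ρ -> cong snd (eq ρ)) (secondP p)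
 ⊕P : ∀ {f g} -> PolyR B f -> PolyR B g -> PolyR B (\ ρ -> f ρ ⊕ g ρ)
 ⊕P p q = (firstP p +Z firstP q) ,P (secondP p +Z secondP q)
 ⊝P : ∀ {f g} -> PolyR B f -> PolyR B g -> PolyR B (\ ρ -> f ρ ⊝ g ρ)
 ⊝P p q = (firstP p -Z firstP q) ,P (secondP p -Z secondP q)
 zeroR : PolyR B (\ _ -> 0R)
 zeroR = litZ 0ℤ ,P litZ 0ℤ
 actP : ∀ D c g {f} -> PolyR B f -> PolyR B (\ ρ -> actR D c g (f ρ))
 actP D c g p = (litZ c *Z firstP p +Z litZ (Z.+ D) *Z litZ g *Z secondP p) ,P (litZ g *Z firstP p +Z litZ c *Z secondP p)
 orientP : ∀ {c : Env Γ -> Bool} {f} -> Test B c -> PolyR B f -> PolyR B (\ ρ -> orient (c ρ) (f ρ))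
 orientP {c} {f} t p = extZ (\ ρ -> fst-choose (c ρ) (f ρ)) (ifZ {c = c} t (negZ (firstP p)) (firstP p)) ,P extZ (\ ρ -> snd-choose (c ρ) (f ρ)) (ifZ {c = c} t (negZ (secondP p)) (secondP p))
  where
  fst-choose : ∀ c z -> (if c then Z.- fst z else fst z) ≡ fst (orient c z)
  fst-choose false z = refl
  fst-choose true z = refl
  snd-choose : ∀ c z -> (if c then Z.- snd z else snd z) ≡ snd (orient c z)
  snd-choose false z = refl
  snd-choose true z = refl
 leqP : ∀ D {f g : Env Γ -> ZR} -> PolyR B f -> PolyR B g -> Test B (\ ρ -> OrderTest.leq D (f ρ) (g ρ))
 leqP D {f} {g} p q = nonnegRP (firstP gap) (secondP gap)
  where
  gap : PolyR B (\ ρ -> g ρ ⊝ f ρ)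
  gap = ⊝P q p
  nonnegRP : ∀ {P Q : Env Γ -> ℤ} -> PolyZ B P -> PolyZ B Q -> Test B (\ ρ -> Sign.nnR D (P ρ) (Q ρ))
  nonnegRP {P} {Q} p q = ifᵗ {c = \ ρ -> nonneg (P ρ)} {\ ρ -> if nonneg (Q ρ) then true else nonneg (P ρ Z.* P ρ Z.- Z.+ D Z.* (Q ρ Z.* Q ρ))}
     {\ ρ -> if nonneg (Q ρ) then nonneg (Z.+ D Z.* (Q ρ Z.* Q ρ) Z.- P ρ Z.* P ρ) else false} (nonnegP p)
    (ifᵗ {c = \ ρ -> nonneg (Q ρ)} {\ _ -> true} {\ ρ -> nonneg (P ρ Z.* P ρ Z.- Z.+ D Z.* (Q ρ Z.* Q ρ))} (nonnegP q) trueP (nonnegP (p *Z p -Z litZ (Z.+ D) *Z (q *Z q))))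
    (ifᵗ {c = \ ρ -> nonneg (Q ρ)} {\ ρ -> nonneg (Z.+ D Z.* (Q ρ Z.* Q ρ) Z.- P ρ Z.* P ρ)} {\ _ -> false} (nonnegP q) (nonnegP (litZ (Z.+ D) *Z (q *Z q) -Z p *Z p)) falseP)

module TestPrograms (setting : Setting) {Γ} {B : Env Γ -> ℕ} where
 open Automata setting
 βP : ∀ {f} -> PolyR B f -> PolyR B (\ ρ -> β (f ρ))
 βP = actP D x y
 ZP : ∀ {f} -> PolyR B f -> PolyR B (\ ρ -> Z (f ρ))
 ZP = actP D 0ℤ (y Z.+ y)
 condP : ∀ {c : Env Γ -> Bool} {f} -> Test B c -> PolyR B f -> Test B (\ ρ -> cond (c ρ) (f ρ))
 condP {c} {f} t p = ifᵗ {c = c} {\ ρ -> Bool.not (leq (f ρ) 0R)} {\ ρ -> leq 0R (f ρ)} t (notP {c = \ ρ -> leq (f ρ) 0R} (leqP D p zeroR)) (leqP D zeroR p)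
 initialP : ∀ {b t r} -> PolyR B b -> PolyR B t -> PolyR B r -> Test B (\ ρ -> initial? (b ρ) (t ρ) (r ρ))
 initialP {b} {t} {r} pb pt pr = ext (\ ρ -> cong b2n (sym (initial?-def (b ρ) (t ρ) (r ρ)))) (leqP D {r} {\ ρ -> β (β (t ρ) ⊝ Z (b ρ))} pr (βP (⊝P (βP pt) (ZP pb))))
 nextP : ∀ {e t r t' r'} -> PolyR B e -> PolyR B t -> PolyR B r -> PolyR B t' -> PolyR B r' -> Test B (\ ρ -> next? (e ρ) (t ρ) (r ρ) (t' ρ) (r' ρ))
 nextP {e} {t} {r} {t'} {r'} pe pt pr pt' pr' = ext (\ ρ -> cong b2n (sym (next?-def (e ρ) (t ρ) (r ρ) (t' ρ) (r' ρ)))) (leqP D {t} {\ ρ -> β (t' ρ) ⊕ e ρ} pt (⊕P (βP pt') pe) ∧P leqP D {r'} {\ ρ -> β (r ρ ⊝ e ρ)} pr' (βP (⊝P pr pe)))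
 finalP : ∀ {c : Env Γ -> Bool} {t r} -> Test B c -> PolyR B t -> PolyR B r -> Test B (\ ρ -> final? (c ρ) (t ρ) (r ρ))
 finalP {c} {t} {r} tc pt pr = ext (\ ρ -> cong b2n (sym (final?-def (c ρ) (t ρ) (r ρ)))) (leqP D {t} {\ _ -> 0R} pt zeroR ∧P condP {c} {r} tc pr)

module InputPrograms (setting : Setting) (k : ℕ) (b s : ℤ) (B0 : Env Text0 -> ℕ) (exp<= : ∀ ρ -> 2 ^ fst (snd ρ) ≤ B0 ρ) where
 open Programs B0 exp<= public
 open Automata setting using (A; D; X; Y; digit; digitVal; R1)
 module I (ρ : Env Text0) = Inputs setting k b s (symAt (fst ρ)) (fst (snd ρ))
 module _ {Γ} (θ : Thin Γ Text0) where
  private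
   module T (ρ : Env Γ) = Evaluation (symAt (word θ ρ)) (size' θ ρ)
  -- At most ℓ terms are added and each is bounded by the same power of the budget, which bounds the
  -- iterates.
  termSumP : ∀ {p : Env Γ -> ℕ} {f : Env (nat ∷ Γ) -> ℕ} -> Prog θ p -> Prog (drop θ) f -> Prog θ (\ ρ -> T.overTms ρ 0 (\ i a -> f (i , ρ) + a) (p ρ))
  termSumP {p} {f} pp pf = backwardsP θ {p = p} {s = stepᶠ} {z = 0} pp body (deg (sizeP θ) + K) small
   where
   stepᶠ : Env Γ -> ℕ -> ℕ -> ℕ
   stepᶠ ρ i a = T.termStep ρ 0 (\ i a -> f (i , ρ) + a) i a
   body : Prog (drop (drop θ)) (\ (i , a , ρ) -> stepᶠ ρ i a)
   body = ifP {c = \ (i , a , ρ) -> isRel (symbol θ ρ i)} (isRelationP (symbolP (drop (drop θ)) #0)) (litP 0)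
    (ifP {c = \ (i , a , ρ) -> isTerm (symbol θ ρ i)} (isTermP (symbolP (drop (drop θ)) #0)) (thin (keep (drop ident)) pf +P #1) #1)
   K = suc (2 + suc (suc (deg (pp +P sizeP θ) + 1) + 1)) * deg pf
   step-≤ : ∀ c d {x a} n m -> x ≤ m -> a ≤ n * m -> (if c then 0 else if d then x + a else a) ≤ suc n * m
   step-≤ true d n m p q = z≤n
   step-≤ false true n m p q = +-mono-≤ p q
   step-≤ false false n m p q = ≤-trans q (m≤n+m _ m)
   below : ∀ ρ k -> k ≤ size' θ ρ -> iter (\ k a -> stepᶠ ρ (p ρ + (size' θ ρ ∸ suc k)) a) 0 k ≤ k * bud (B0 ∘ prj θ) ρ ^ K
   below ρ zero _ = z≤n
   below ρ (suc k) k≤ = step-≤ (isRel (symbol θ ρ i)) (isTerm (symbol θ ρ i)) {f (i , ρ)} k (bud (B0 ∘ prj θ) ρ ^ K)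
    (bound (index-within (pp +P sizeP θ) ρ i (+-monoʳ-≤ (p ρ) (m∸n≤m (size' θ ρ) (suc k))) (value-bound pf (i , ρ)))) (below ρ k (<⇒≤ k≤))
    where
     i = p ρ + (size' θ ρ ∸ suc k)
   small : ∀ ρ k -> k ≤ size' θ ρ -> Within (bud (B0 ∘ prj θ) ρ) (deg (sizeP θ) + K) (iter (\ k a -> stepᶠ ρ (p ρ + (size' θ ρ ∸ suc k)) a) 0 k)
   small ρ k k≤ = shrink (2<= θ ρ) (below ρ k k≤) (times (2<= θ ρ) (shrink (2<= θ ρ) k≤ (value-bound (sizeP θ) ρ)) (within ≤-refl))
  termSumZ : ∀ {p : Env Γ -> ℕ} {f : Env (nat ∷ Γ) -> ℤ} -> Prog θ p -> ProgZ (drop θ) f -> ProgZ θ (\ ρ -> T.overTms ρ 0ℤ (\ i a -> f (i , ρ) Z.+ a) (p ρ))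
  termSumZ {p} {f} pp pf = record { posP = termSumP pp (posP pf) ; negP = termSumP pp (negP pf) ; differ = \ ρ -> go ρ (size' θ ρ) }
   where
   choose : ∀ c d {z x y z' x' y'} -> z ≡ Z.+ x Z.- Z.+ y -> z' ≡ Z.+ x' Z.- Z.+ y' -> (if c then 0ℤ else if d then z Z.+ z' else z') ≡
    Z.+ (if c then 0 else if d then x + x' else x') Z.- Z.+ (if c then 0 else if d then y + y' else y')
   choose true d e e' = refl
   choose false true {x = x} {y} {x' = x'} {y'} e e' = tr (cong2 Z._+_ e e') (+-differ x y x' y')
   choose false false e e' = e'
   go : ∀ ρ n -> iter (\ k a -> T.termStep ρ 0ℤ (\ i a -> f (i , ρ) Z.+ a) (p ρ + (size' θ ρ ∸ suc k)) a) 0ℤ n ≡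
    Z.+ iter (\ k a -> T.termStep ρ 0 (\ i a -> pos pf (i , ρ) + a) (p ρ + (size' θ ρ ∸ suc k)) a) 0 n Z.-
    Z.+ iter (\ k a -> T.termStep ρ 0 (\ i a -> neg pf (i , ρ) + a) (p ρ + (size' θ ρ ∸ suc k)) a) 0 n
   go ρ zero = refl
   go ρ (suc n) = choose (isRel (symbol θ ρ i)) (isTerm (symbol θ ρ i)) (differ pf (i , ρ)) (go ρ n)
    where
     i = p ρ + (size' θ ρ ∸ suc n)
  verdictP : ∀ {c : Env (nat ∷ Γ) -> Bool} -> Check (drop θ) c -> Check θ (\ ρ -> T.verdict ρ (\ p -> c (p , ρ)))
  verdictP {c} pc = (backwardsP θ {p = \ _ -> 0} {s = stepᶠ} {z = 0} (litP 0) body 1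
    (\ ρ -> dbl-within θ (\ k a -> stepᶠ ρ (size' θ ρ ∸ suc k) a) (\ k a -> step-≤ ρ (size' θ ρ ∸ suc k) a) ρ)) remP litP 2 =bP litP 1
   where
   stepᶠ : Env Γ -> ℕ -> ℕ -> ℕ
   stepᶠ ρ i a = T.evalStep ρ (\ p -> c (p , ρ)) i a
   two' : Thin (nat ∷ nat ∷ Γ) Text0
   two' = drop (drop θ)
   ◂P : ∀ {b : Env (nat ∷ nat ∷ Γ) -> Bool} {a} -> Check two' b -> Prog two' a -> Prog two' (\ ρ -> b ρ ◂ a ρ)
   ◂P p q = p +P q *P litP 2
   latestP : ∀ {a} -> Prog two' a -> Check two' (\ ρ -> latest (a ρ))
   latestP p = p remP litP 2 =bP litP 1
   earlierP : ∀ {a} -> Prog two' a -> Prog two' (\ ρ -> earlier (a ρ))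
   earlierP p = p ÷P litP 2
   sP : Prog two' (\ (i , a , ρ) -> symbol θ ρ i)
   sP = symbolP two' #0
   aP : Prog two' (\ (i , a , ρ) -> a)
   aP = #1
   and-poly : Check two' (\ (i , a , ρ) -> latest a ∧ latest (earlier a))
   and-poly = latestP aP ∧P latestP (earlierP aP)
   or-poly : Check two' (\ (i , a , ρ) -> latest a ∨ latest (earlier a))
   or-poly = latestP aP ∨P latestP (earlierP aP)
   connectP : Prog two' (\ (i , a , ρ) -> connect (symbol θ ρ i) a)
   connectP = ifP {c = \ (i , a , ρ) -> symbol θ ρ i ≡ᵇ 27} (sP =bP litP 27) (◂P and-poly (earlierP (earlierP aP)))
    (ifP {c = \ (i , a , ρ) -> symbol θ ρ i ≡ᵇ 28} (sP =bP litP 28) (◂P or-poly (earlierP (earlierP aP)))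
     (ifP {c = \ (i , a , ρ) -> symbol θ ρ i ≡ᵇ 29} (sP =bP litP 29) (◂P (notP (latestP aP)) (earlierP aP)) aP))
   body : Prog two' (\ (i , a , ρ) -> stepᶠ ρ i a)
   body = ifP {c = \ (i , a , ρ) -> T.start? ρ i} (call two' startP #0) (◂P (thin (keep (drop ident)) pc) aP) connectP
   ◂-<= : ∀ b {a n} -> a ≤ n -> b ◂ a ≤ suc (2 * n)
   ◂-<= b {a} {n} p = +-mono-≤ {b2n b} {1} (b<= b) (≤-trans (≡⇒≤ (*-comm a 2)) (*-monoʳ-≤ 2 p))
    where
    b<= : ∀ b -> b2n b ≤ 1
    b<= false = z≤n
    b<= true = ≤-refl
   ÷-<= : ∀ a -> earlier a ≤ a
   ÷-<= a = DM.m/n≤m a 2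
   step-≤ : ∀ ρ i a -> stepᶠ ρ i a ≤ suc (2 * a)
   step-≤ ρ i a = if-<= (T.start? ρ i) (◂-<= (c (i , ρ)) {a} ≤-refl) (if-<= (symbol θ ρ i ≡ᵇ 27) (◂-<= (latest a ∧ latest (earlier a)) {earlier (earlier a)} (≤-trans (÷-<= (earlier a)) (÷-<= a)))
     (if-<= (symbol θ ρ i ≡ᵇ 28) (◂-<= (latest a ∨ latest (earlier a)) {earlier (earlier a)} (≤-trans (÷-<= (earlier a)) (÷-<= a)))
      (if-<= (symbol θ ρ i ≡ᵇ 29) (◂-<= (Bool.not (latest a)) {earlier a} (÷-<= a)) (<=1+2 (n≤1+n a)))))
  digitP : ∀ {i u} -> Prog θ i -> Prog θ u -> Prog θ (\ ρ -> digit (i ρ) (u ρ))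
  digitP {i} {u} pi pu = iterN {z = u} {s = \ ρ _ v -> v ÷ A} pi pu (#0 ÷P litP A) (deg pu) (\ ρ k _ -> shrink (2<= θ ρ) (shrinking (u ρ) k) (value-bound pu ρ)) remP litP A
   where
   shrinking : ∀ v k -> iter (\ _ v -> v ÷ A) v k ≤ v
   shrinking v zero = ≤-refl
   shrinking v (suc k) = ≤-trans (DM.m/n≤m (iter (\ _ v -> v ÷ A) v k) A) (shrinking v k)
  digitValueZ : ∀ {u} -> Prog θ u -> ProgZ θ (\ ρ -> digitVal (u ρ))
  digitValueZ p = natZ (p remP litP R1) -Z natZ (p ÷P litP R1)
 linZ : ∀ (c : Env Text0 -> ℕ -> ℤ) -> ProgZ one (\ (p , ρ) -> c ρ p) -> ProgZ two (\ (p , u , ρ) -> I.lin ρ (c ρ) p u)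
 linZ c pc = ifZ {c = \ (p , u , ρ) -> I.start? ρ p} (call two startP #0)
  (termSumZ two {p = fst} #0 (callZ (drop two) pc #0 *Z digitValueZ (drop two) (digitP (drop two) (call (drop two) variableP #0) #2))) (litZ 0ℤ)
 rhsZ : ∀ (c : Env Text0 -> ℕ -> ℤ) -> ProgZ one (\ (p , ρ) -> c ρ p) -> ProgZ one (\ (p , ρ) -> I.rhs ρ (c ρ) p)
 rhsZ c pc = ifZ {c = \ (p , ρ) -> I.start? ρ p} startP (callZ one pc (sucP relationP)) (litZ 0ℤ)
 magnitudeP : Prog one (\ (p , ρ) -> I.magnitude ρ p)
 magnitudeP = absP c0P +P absP c1P
 massP : Prog one (\ (p , ρ) -> I.mass ρ p)
 massP = ifP {c = \ (p , ρ) -> I.start? ρ p} startP (termSumP one {p = fst} #0 (call (drop one) magnitudeP #0) +P call one magnitudeP (sucP relationP)) (litP 0)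
 convP : ∀ {Γ} {B : Env Γ -> ℕ} {P Q} -> PolyZ B P -> PolyZ B Q -> PolyR B (\ ρ -> Conversion.conv k b s (P ρ) (Q ρ))
 convP p q = (litZ (Z.+ suc k) *Z p -Z litZ b *Z q) ,P (litZ s *Z q)
 lhsP : PolyR (B0 ∘ prj two) (\ (p , u , ρ) -> I.lhs ρ p u)
 lhsP = extR {f = \ (p , u , ρ) -> Conversion.conv k b s (I.lin ρ (I.c₀ ρ) p u) (I.lin ρ (I.c₁ ρ) p u)} {\ (p , u , ρ) -> I.lhs ρ p u} (\ (p , u , ρ) -> sym (I.lhs-def ρ p u))
  (convP {P = \ (p , u , ρ) -> I.lin ρ (I.c₀ ρ) p u} {\ (p , u , ρ) -> I.lin ρ (I.c₁ ρ) p u} (linZ (\ ρ -> I.c₀ ρ) c0P) (linZ (\ ρ -> I.c₁ ρ) c1P))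
 bndP : PolyR (B0 ∘ prj one) (\ (p , ρ) -> I.bnd ρ p)
 bndP = extR {f = \ (p , ρ) -> Conversion.conv k b s (I.rhs ρ (I.c₀ ρ) p) (I.rhs ρ (I.c₁ ρ) p)} {\ (p , ρ) -> I.bnd ρ p} (\ (p , ρ) -> sym (I.bnd-def ρ p))
  (convP {P = \ (p , ρ) -> I.rhs ρ (I.c₀ ρ) p} {\ (p , ρ) -> I.rhs ρ (I.c₁ ρ) p} (rhsZ (\ ρ -> I.c₀ ρ) c0P) (rhsZ (\ ρ -> I.c₁ ρ) c1P))
 strictP : Check one (\ (p , ρ) -> I.strict ρ p)
 strictP = symbolP one relationP =bP litP 26

module ProductPrograms (setting : Setting) (B0 : Env Text0 -> ℕ) (exp<= : ∀ ρ -> 2 ^ fst (snd ρ) ≤ B0 ρ)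
 (e : Env Text0 -> ℕ -> ℕ -> ZR) (b : Env Text0 -> ℕ -> ZR) (strict : Env Text0 -> ℕ -> Bool) (E : Env Text0 -> ℕ -> ℕ) (verdict : Env Text0 -> (ℕ -> Bool) -> Bool) where
 open Programs B0 exp<=
 open Automata setting using (initial?; next?; final?)
 module I (ρ : Env Text0) = Product setting (fst (snd ρ)) (e ρ) (b ρ) (strict ρ) (E ρ) (verdict ρ)
 module Tests (lhsP : PolyR (B0 ∘ prj two) (\ (p , u , ρ) -> e ρ p u)) (bndP : PolyR (B0 ∘ prj one) (\ (p , ρ) -> b ρ p))
  (strictP : Check one (\ (p , ρ) -> strict ρ p)) (EP : Prog one (\ (p , ρ) -> E ρ p))
  (verdictP : ∀ {c : Env (nat ∷ nat ∷ Text0) -> Bool} -> Check two c -> Check one (\ (q , ρ) -> verdict ρ (\ p -> c (p , q , ρ)))) (states<= : ∀ ρ -> Auto.N (I.product ρ) ≤ B0 ρ) where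
  BP : Prog one (\ (p , ρ) -> I.B ρ p)
  BP = EP +P EP
  HP : Prog one (\ (p , ρ) -> I.H ρ p)
  HP = sucP (BP +P BP)
  WP : Prog one (\ (p , ρ) -> I.W ρ p)
  WP = ifP {c = \ (p , ρ) -> suc p ≤ᵇ fst (snd ρ)} (sucP #0 <=bP sizeP one) (HP *P (HP *P (HP *P (HP *P litP 2)))) (litP 1)
  -- Widths past the text are 1, so even for an arbitrary argument n the product cannot exceed the
  -- number of states, which the budget contains.
  prod-<= : ∀ ρ n -> prod n (I.W ρ) ≤ prod (fst (snd ρ)) (I.W ρ)
  prod-<= ρ = prod-bounded (I.W ρ) (I.0<W ρ) (fst (snd ρ)) (I.W-outside ρ)
  prodP : Prog one (\ (p , ρ) -> prod p (I.W ρ))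
  prodP = iterN {s = \ (p , ρ) i a -> I.W ρ i * a} #0 (litP 1) (call (drop (drop one)) WP #1 *P #0) 1
   (\ (p , ρ) i _ -> self (2<= one (p , ρ)) (≤-trans (prod-<= ρ i) (≤-trans (states<= ρ) (B<=bud (B0 ∘ prj one) (p , ρ)))))
  fieldP : Prog two (\ (p , q , ρ) -> field# (I.W ρ) q p)
  fieldP = (#1 ÷P call two prodP #0) remP call two WP #0
  private
   h : Prog two (\ (p , q , ρ) -> I.H ρ p)
   h = call two HP #0
  claimP : Check two (\ (p , q , ρ) -> I.claim ρ q p)
  claimP = ext (\ (p , q , ρ) -> cong b2n (sym (I.claim-def ρ q p))) ((fieldP ÷P litP 1) remP litP 2 =bP litP 1)
  coordZ : ∀ i -> Prog two (\ (p , q , ρ) -> I.part ρ q p i) -> ProgZ two (\ (p , q , ρ) -> I.coord ρ q p i)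
  coordZ i part = natZ part -Z natZ (call two BP #0)
  upperP : PolyR (B0 ∘ prj two) (\ (p , q , ρ) -> I.upper ρ q p)
  upperP = extR {f = \ (p , q , ρ) -> I.coord ρ q p 1 , I.coord ρ q p 2} {\ (p , q , ρ) -> I.upper ρ q p} (\ (p , q , ρ) -> sym (I.upper-def ρ q p)) (coordZ 1 ((fieldP ÷P litP 2) remP h) ,P coordZ 2 ((fieldP ÷P (h *P litP 2)) remP h))
  lowerP : PolyR (B0 ∘ prj two) (\ (p , q , ρ) -> I.lower ρ q p)
  lowerP = extR {f = \ (p , q , ρ) -> I.coord ρ q p 3 , I.coord ρ q p 4} {\ (p , q , ρ) -> I.lower ρ q p} (\ (p , q , ρ) -> sym (I.lower-def ρ q p)) (coordZ 3 ((fieldP ÷P (h *P (h *P litP 2))) remP h) ,P coordZ 4 ((fieldP ÷P (h *P (h *P (h *P litP 2)))) remP h))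
  module _ {Γ} (θ : Thin Γ Text0) where
   callR : ∀ {f g} -> PolyR (B0 ∘ prj one) f -> Prog θ g -> PolyR (B0 ∘ prj θ) (\ ρ -> f (g ρ , prj θ ρ))
   callR p q = callZ θ (firstP p) q ,P callZ θ (secondP p) q
   call2 : ∀ {f g h} -> Prog two f -> Prog θ g -> Prog θ h -> Prog θ (\ ρ -> f (g ρ , h ρ , prj θ ρ))
   call2 f g h = bind h (bind (wk g) (thin (keep (keep θ)) f))
   callZ2 : ∀ {f g h} -> ProgZ two f -> Prog θ g -> Prog θ h -> ProgZ θ (\ ρ -> f (g ρ , h ρ , prj θ ρ))
   callZ2 f g h = bindZ h (bindZ (wk g) (thinZ (keep (keep θ)) f))
   callR2 : ∀ {f g h} -> PolyR (B0 ∘ prj two) f -> Prog θ g -> Prog θ h -> PolyR (B0 ∘ prj θ) (\ ρ -> f (g ρ , h ρ , prj θ ρ))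
   callR2 p q r = callZ2 (firstP p) q r ,P callZ2 (secondP p) q r
  iniP : Check one (\ (q , ρ) -> Auto.ini (I.product ρ) q)
  iniP = allP (sizeP one) {f = \ (p , q , ρ) -> initial? (orient (I.claim ρ q p) (b ρ p)) (I.upper ρ q p) (I.lower ρ q p)}
   (initialP (orientP {c = \ (p , q , ρ) -> I.claim ρ q p} claimP (callR two bndP #0)) upperP lowerP)
   where
    open TestPrograms setting
  accP : Check one (\ (q , ρ) -> Auto.acc (I.product ρ) q)
  accP = allP (sizeP one) {f = \ (p , q , ρ) -> final? (strict ρ p == I.claim ρ q p) (I.upper ρ q p) (I.lower ρ q p)}
    (finalP {c = \ (p , q , ρ) -> strict ρ p == I.claim ρ q p} (call two strictP #0 ==P claimP) upperP lowerP) ∧P verdictP {c = \ (p , q , ρ) -> I.claim ρ q p} claimP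
   where
     open TestPrograms setting
  relP : Check (drop (drop one)) (\ (q , u , q' , ρ) -> Auto.rel (I.product ρ) q u q')
  relP = allP (sizeP (drop (drop one))) {f = \ (p , q , u , q' , ρ) -> (I.claim ρ q p == I.claim ρ q' p) ∧
     next? (orient (I.claim ρ q p) (e ρ p u)) (I.upper ρ q p) (I.lower ρ q p) (I.upper ρ q' p) (I.lower ρ q' p)} ((call2 four claimP #0 #1 ==P call2 four claimP #0 #3) ∧P
    nextP (orientP {c = \ (p , q , u , q' , ρ) -> I.claim ρ q p} (call2 four claimP #0 #1) (callR2 four lhsP #0 #2))
      (callR2 four upperP #0 #1) (callR2 four lowerP #0 #1) (callR2 four upperP #0 #3) (callR2 four lowerP #0 #3))
   where
   open TestPrograms setting
   four : Thin (nat ∷ nat ∷ nat ∷ nat ∷ Text0) Text0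
   four = drop (drop (drop one))
  statesP : Prog ident (\ ρ -> Auto.N (I.product ρ))
  statesP = call ident prodP (sizeP ident)

-- Programs for determinization and reachability

record AutoProg {Γ} (B : Env Γ -> ℕ) (M : Env Γ -> Auto) : Set where
 field
  NP : Poly B nat (\ ρ -> Auto.N (M ρ))
  iniP : Test {nat ∷ Γ} (\ (_ , ρ) -> B ρ) (\ (q , ρ) -> Auto.ini (M ρ) q)
  accP : Test {nat ∷ Γ} (\ (_ , ρ) -> B ρ) (\ (q , ρ) -> Auto.acc (M ρ) q)
  relP : Test {nat ∷ nat ∷ nat ∷ Γ} (\ (_ , _ , _ , ρ) -> B ρ) (\ (q , u , q' , ρ) -> Auto.rel (M ρ) q u q')

weakenAuto : ∀ {Γ B M τ} -> AutoProg {Γ} B M -> AutoProg {τ ∷ Γ} (B ∘ snd) (M ∘ snd)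
weakenAuto p = record { NP = wk NP ; iniP = thin (keep (drop ident)) iniP ; accP = thin (keep (drop ident)) accP ; relP = thin (keep (keep (keep (drop ident)))) relP }
 where
  open AutoProg p

module _ {Γ} {B : Env Γ -> ℕ} where
 rel-call : ∀ {M : Env Γ -> Auto} -> Test {nat ∷ nat ∷ nat ∷ Γ} (\ (_ , _ , _ , ρ) -> B ρ) (\ (q , u , q' , ρ) -> Auto.rel (M ρ) q u q') ->
  ∀ {Δ} (θ : Thin Δ Γ) {q u q'} -> Poly (B ∘ prj θ) nat q -> Poly (B ∘ prj θ) nat u -> Poly (B ∘ prj θ) nat q' -> Test {Δ} (B ∘ prj θ) (\ ρ -> Auto.rel (M (prj θ ρ)) (q ρ) (u ρ) (q' ρ))
 rel-call p θ q u q' = bind q' (bind (wk u) (bind (wk (wk q)) (thin (keep (keep (keep θ))) p)))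
 tableP : ∀ {Λ : Env Γ -> ℕ} {M : Env Γ -> Auto} -> Poly B nat Λ -> AutoProg B M -> Poly B arr (\ ρ -> table (Λ ρ) (M ρ))
 tableP {Λ} {M} pΛ p = consP NP (tabP (NP +P NP +P NP *P pΛ *P NP) entryP)
  where
  open AutoProg p
  module M ρ = Auto (M ρ)
  n : Poly {nat ∷ Γ} (B ∘ snd) nat (\ (k , ρ) -> M.N ρ)
  n = wk NP
  l : Poly {nat ∷ Γ} (B ∘ snd) nat (\ (k , ρ) -> Λ ρ)
  l = wk pΛ
  i : Poly {nat ∷ Γ} (B ∘ snd) nat (\ (k , ρ) -> k ∸ (M.N ρ + M.N ρ))
  i = #0 ∸P (n +P n)
  entryP : Test {nat ∷ Γ} (B ∘ snd) (\ (k , ρ) -> entryAt (Λ ρ) (M.N ρ) (M.ini ρ) (M.acc ρ) (M.rel ρ) k)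
  entryP = ifᵗ {c = \ (k , ρ) -> suc k ≤ᵇ M.N ρ} (sucP #0 <=bP n) iniP (ifᵗ {c = \ (k , ρ) -> suc k ≤ᵇ M.N ρ + M.N ρ} (sucP #0 <=bP n +P n) (bind (#0 ∸P n) (thin (keep (drop ident)) accP))
    (rel-call {M = M} relP (drop ident) (i ÷P n ÷P l) (i ÷P n remP l) (i remP n)))
 autoP : ∀ {Λ : Env Γ -> ℕ} {t : Env Γ -> List ℕ} -> Poly B nat Λ -> Poly B arr t -> AutoProg B (\ ρ -> auto (Λ ρ) (t ρ))
 autoP {Λ} {t} pΛ pt = record { NP = getP pt (litP 0) ; iniP = getP (wk pt) (sucP #0) =bP litP 1 ; accP = getP (wk pt) (sucP (getP (wk pt) (litP 0) +P #0)) =bP litP 1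
  ; relP = getP t3 (sucP (getP t3 (litP 0) +P getP t3 (litP 0) +P ((#0 *P thin (drop (drop (drop ident))) pΛ +P #1) *P getP t3 (litP 0) +P #2))) =bP litP 1 }
  where
  t3 : Poly {nat ∷ nat ∷ nat ∷ Γ} (\ (_ , _ , _ , ρ) -> B ρ) arr (\ (_ , _ , _ , ρ) -> t ρ)
  t3 = thin (drop (drop (drop ident))) pt

bit?P : ∀ {Γ} {B : Env Γ -> ℕ} {X q : Env Γ -> ℕ} -> Poly B nat X -> Poly B nat q -> Test B (\ ρ -> bit? (X ρ) (q ρ))
bit?P {B = B} {X} {q} pX pq = iterN {z = X} {s = \ ρ _ v -> v ÷ 2} pq pX (#0 ÷P litP 2) (deg pX) (\ ρ k _ -> shrink (2<=bud B ρ) (shrinking (X ρ) k) (value-bound pX ρ)) remP litP 2 =bP litP 1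
 where
 shrinking : ∀ v k -> iter (\ _ v -> v ÷ 2) v k ≤ v
 shrinking v zero = ≤-refl
 shrinking v (suc k) = ≤-trans (DM.m/n≤m (iter (\ _ v -> v ÷ 2) v k) 2) (shrinking v k)

module AutoPrograms (setting : Setting) where
 open Automata setting using (A; det; alive; closure; closStep; join)
 closureEntry : Auto -> ℕ -> List ℕ -> ℕ -> Bool
 closureEntry M m t q = (t ‼ q ≡ᵇ 1) ∨ any (A ^ m) (\ d -> any N (\ q' -> rel q d q' ∧ (t ‼ q' ≡ᵇ 1)))
  where
   open Auto M
 -- Every round is stored as an array. Evaluated as nested functions, each round would recompute the
 -- previous one for every state it looks up, and N rounds would take exponential time.
 closTab : Auto -> ℕ -> ℕ -> List ℕ
 closTab M m = iter (\ _ t -> tab N (\ q -> b2n (closureEntry M m t q))) (tab N (\ q -> b2n (acc q)))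
  where
   open Auto M
 closureTable-‼ : ∀ M m k q -> q < Auto.N M -> (closTab M m k ‼ q ≡ᵇ 1) ≡ iter (\ _ f -> closStep M m f) (Auto.acc M) k q
 closureTable-‼ M m zero q q<N = tr (cong (_≡ᵇ 1) (tab-‼ N (\ q -> b2n (acc q)) q<N)) (b2n-=b (acc q))
  where
   open Auto M
 closureTable-‼ M m (suc k) q q<N = tr (cong (_≡ᵇ 1) (tab-‼ N (\ q -> b2n (closureEntry M m (closTab M m k) q)) q<N)) (tr (b2n-=b (closureEntry M m (closTab M m k) q))
   (cong2 _∨_ (closureTable-‼ M m k q q<N) (any-cong (A ^ m) (\ d _ -> any-cong N (\ q' q'<N -> cong (rel q d q' ∧_) (closureTable-‼ M m k q' q'<N))))))
  where
    open Auto M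
 module _ {Γ} {B : Env Γ -> ℕ} {M : Env Γ -> Auto} {m : Env Γ -> ℕ} (p : AutoProg B M) (pA : Poly B nat (\ ρ -> A ^ m ρ)) where
  open AutoProg p
  private
   module M ρ = Auto (M ρ)
   stepTable : Env Γ -> List ℕ -> List ℕ
   stepTable ρ t = tab (M.N ρ) (\ q -> b2n (closureEntry (M ρ) (m ρ) t q))
   Γ2 : List Ty
   Γ2 = arr ∷ nat ∷ Γ
   B2 : Env Γ2 -> ℕ
   B2 (_ , _ , ρ) = B ρ
   n2 : Poly B2 nat (\ (t , i , ρ) -> M.N ρ)
   n2 = thin (drop (drop ident)) NP
   A2 : Poly B2 nat (\ (t , i , ρ) -> A ^ m ρ)
   A2 = thin (drop (drop ident)) pA
   stepP : Poly B2 arr (\ (t , i , ρ) -> stepTable ρ t)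
   stepP = tabP n2 ((getP #1 #0 =bP litP 1) ∨P anyP (wk A2) (anyP (wk (wk n2)) (rel-call {M = M} relP (drop (drop (drop (drop (drop ident))))) #2 #1 #0 ∧P (getP #3 #0 =bP litP 1))))
   b2n-<= : ∀ b -> b2n b ≤ 1
   b2n-<= false = z≤n
   b2n-<= true = ≤-refl
   small : ∀ ρ i -> i ≤ M.N ρ -> Within (bud B ρ) (deg NP + 2) (size arr (closTab (M ρ) (m ρ) i))
   small ρ i _ = shrink 2<= (fits i) (times 2<= (value-bound NP ρ) (const 2<= 2))
    where
    2<= = 2<=bud B ρ
    fits : ∀ i -> size arr (closTab (M ρ) (m ρ) i) ≤ M.N ρ * 2
    fits zero = tab-size (M.N ρ) (\ q -> b2n (M.acc ρ q)) {1} (M.N ρ) (\ k -> b2n-<= (M.acc ρ (M.N ρ ∸ suc k)))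
    fits (suc i) = tab-size (M.N ρ) (\ q -> b2n (closureEntry (M ρ) (m ρ) (closTab (M ρ) (m ρ) i) q)) {1} (M.N ρ) (\ k -> b2n-<= (closureEntry (M ρ) (m ρ) (closTab (M ρ) (m ρ) i) (M.N ρ ∸ suc k)))
   closureP : Poly B arr (\ ρ -> closTab (M ρ) (m ρ) (M.N ρ))
   closureP = iterP {Bₛ = B2} {s = \ ρ _ t -> stepTable ρ t} NP (tabP NP accP) stepP (deg NP + 2) small 1 (\ ρ _ _ -> self (2<=bud B ρ) (B<=bud B ρ))
  aliveP : ∀ {S : Env (nat ∷ Γ) -> Bool} -> Test {nat ∷ Γ} (\ (_ , ρ) -> B ρ) S -> Test B (\ ρ -> alive (M ρ) (m ρ) (\ q -> S (q , ρ)))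
  aliveP {S} pS = ext (\ ρ -> cong b2n (any-cong (M.N ρ) (\ q q<N -> cong (S (q , ρ) ∧_) (closureTable-‼ (M ρ) (m ρ) (M.N ρ) q q<N))))
   (bind closureP (anyP (wk NP) (thin (keep (drop ident)) pS ∧P (getP #1 #0 =bP litP 1))))
 module _ {Γ} {B : Env Γ -> ℕ} {M : Env Γ -> Auto} {m : Env Γ -> ℕ} (p : AutoProg B M) (pA : Poly B nat (\ ρ -> A ^ m ρ)) (j : ℕ) (power<= : ∀ ρ -> Within (bud B ρ) j (2 ^ Auto.N (M ρ))) where
  open AutoProg p
  private
   module M ρ = Auto (M ρ)
   three : Thin (nat ∷ nat ∷ nat ∷ Γ) Γ
   three = drop (drop (drop ident))
   #4 : ∀ {Γ τ0 τ1 τ2 τ3 τ} {B : Env (τ0 ∷ τ1 ∷ τ2 ∷ τ3 ∷ τ ∷ Γ) -> ℕ} -> Poly B τ (fst ∘ snd ∘ snd ∘ snd ∘ snd)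
   #4 = var (there (there (there (there here))))
  detP : AutoProg B (\ ρ -> det (M ρ) (m ρ))
  detP = record { NP = powP 1 j power<= NP ; iniP = allP (wk NP) {f = \ (q , X , ρ) -> bit? X q == M.ini ρ q} (bit?P #1 #0 ==P thin (keep (drop ident)) iniP)
   ; accP = notP (aliveP {m = m ∘ snd} (weakenAuto p) (wk pA) {S = \ (q , X , ρ) -> bit? X q} (bit?P #1 #0)) ; relP = allP (thin three NP) {f = \ (q' , X , u , Y , ρ) -> bit? Y q' ==
       any (M.N ρ) (\ q -> bit? X q ∧ any (A ^ m ρ) (\ d -> M.rel ρ q (join (m ρ) d u) q'))} (bit?P #3 #0 ==P anyP (thin (drop three) NP) (bit?P #2 #0 ∧P anyP (thin (drop (drop three)) pA)
      (rel-call {M = M} relP (drop (drop (drop three))) #1 (#0 +P #4 *P thin (drop (drop (drop three))) pA) #2))) }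

-- The decision procedure as a program

<=2^ : ∀ n -> n ≤ 2 ^ n
<=2^ zero = z≤n
<=2^ (suc n) = ≤-trans (+-mono-≤ (m^n>0 2 n) (<=2^ n)) (≡⇒≤ (cong (2 ^ n +_) (sym (+-identityʳ _))))

exponentials : ℕ -> ℕ -> ℕ
exponentials n = iter (\ _ x -> 2 ^ x) n

exponentials-mono : ∀ n {i j} -> i ≤ j -> exponentials n i ≤ exponentials n j
exponentials-mono n {i} {zero} z≤n = ≤-refl
exponentials-mono n {i} {suc j} i≤j with m≤n⇒m<n∨m≡n i≤j
... | in1 (s≤s i<=j') = ≤-trans (exponentials-mono n i<=j') (<=2^ (exponentials n j))
... | in2 refl = ≤-refl

module Procedure {α : ℝ} (quad : Quadratic α) where
 open Quadratic quad using (k; b; s)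
 open Link quad using (setting)
 open Automata setting using (A; a; X; 2<=X; det; alive)
 open Tables setting using (tables; scope; module Levels)
 open AutoPrograms setting
 module Dn (ρ : Env Text0) = Decision quad (symAt (fst ρ)) (fst (snd ρ))
 2<=A : 2 ≤ A
 2<=A = s≤s (≤-trans (≤-trans (s≤s z≤n) 2<=X) (≤-trans (m≤m+n X X) (m≤m+n (X + X) _)))
 Λ : Env Text0 -> ℕ
 Λ ρ = A ^ fst (snd ρ)
 block# : Env Text0 -> ℕ -> ℕ
 block# ρ j = Dn.bsize ρ j 0
 block<= : ∀ ρ j -> block# ρ j ≤ fst (snd ρ)
 block<= ρ j = go (fst (snd ρ))
  where
  choose : ∀ c {x n} -> x ≤ n -> (if c then suc x else x) ≤ suc n
  choose false p = m≤n⇒m≤1+n p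
  choose true p = s≤s p
  go : ∀ n -> iter (\ k a -> Dn.blockStep ρ j (fst (snd ρ) ∸ suc k) a) 0 n ≤ n
  go zero = z≤n
  go (suc n) = choose (((symAt (fst ρ) (fst (snd ρ) ∸ suc n) ≡ᵇ 17) ∧ Bool.not (symAt (fst ρ) (fst (snd ρ) ∸ suc n ∸ 1) ≡ᵇ 24)) ∧ (Dn.quants ρ (suc (fst (snd ρ) ∸ suc n)) ≡ᵇ j)) (go n)
 product0 : Env Text0 -> Auto
 product0 ρ = Dn.product ρ
 states : Env Text0 -> ℕ -> ℕ
 states ρ = exponentials (Auto.N (product0 ρ))
 -- The number of states grows with the level, so that of the last automaton, together with the
 -- alphabet, bounds everything that is computed.
 B0 : Env Text0 -> ℕ
 B0 ρ = Λ ρ + states ρ (Dn.outer ρ)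
 exp<= : ∀ ρ -> 2 ^ fst (snd ρ) ≤ B0 ρ
 exp<= ρ = ≤-trans (^-monoˡ-≤ (fst (snd ρ)) 2<=A) (m≤m+n (Λ ρ) _)
 states<= : ∀ ρ {i} -> i ≤ Dn.outer ρ -> states ρ i ≤ B0 ρ
 states<= ρ i<= = ≤-trans (exponentials-mono (Auto.N (product0 ρ)) i<=) (m≤n+m _ (Λ ρ))
 tables' : Env Text0 -> ℕ -> List ℕ
 tables' ρ = tables (Λ ρ) (product0 ρ) (block# ρ)
 tables-N : ∀ ρ i -> tables' ρ i ‼ 0 ≡ states ρ i
 tables-N ρ zero = refl
 tables-N ρ (suc i) = cong (2 ^_) (tables-N ρ i)
 open InputPrograms setting k b s B0 exp<= using (lhsP; bndP; strictP; massP; verdictP; module I)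
 open Programs B0 exp<=
 module PP = ProductPrograms setting B0 exp<= (\ ρ -> I.lhs ρ) (\ ρ -> I.bnd ρ) (\ ρ -> I.strict ρ) (\ ρ -> I.E ρ) (\ ρ f -> I.verdict ρ f == I.polarity ρ)
 module TP = PP.Tests lhsP bndP strictP (litP (Constants.G setting k b s) *P sucP massP) (\ {c} pc -> verdictP one {c = \ (p , q , ρ) -> c (p , q , ρ)} pc ==P wk polarityP) (\ ρ -> states<= ρ {0} z≤n)
 productP : AutoProg B0 product0
 productP = record { NP = TP.statesP ; iniP = TP.iniP ; accP = TP.accP ; relP = TP.relP }
 Λ-within : ∀ {Γ} (θ : Thin Γ Text0) ρ {n} -> n ≤ fst (snd (prj θ ρ)) -> Within (bud (B0 ∘ prj θ) ρ) 1 (A ^ n)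
 Λ-within θ ρ n<= = self (2<= θ ρ) (≤-trans (^-monoʳ-≤ A n<=) (≤-trans (m≤m+n (Λ (prj θ ρ)) _) (B<=bud (B0 ∘ prj θ) ρ)))
 ΛP : Poly B0 nat Λ
 ΛP = powP a 1 (\ ρ -> Λ-within ident ρ ≤-refl) (sizeP ident)
 blockPowerP : Prog one (\ (j , ρ) -> A ^ block# ρ j)
 blockPowerP = powP a 1 (\ (j , ρ) -> Λ-within one (j , ρ) (block<= ρ j)) blockSizeP
 -- In the body of the loop the array is an arbitrary argument, so the states of its determinization
 -- are budgeted through its first entry.
 Bₛ : Env (arr ∷ nat ∷ Text0) -> ℕ
 Bₛ (t , i , ρ) = B0 ρ + 2 ^ (t ‼ 0)
 raise : ∀ {τ f} -> Poly {arr ∷ nat ∷ Text0} (B0 ∘ prj (drop (drop ident))) τ f -> Poly Bₛ τ f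
 raise = rebudget 1 (\ ρ -> self (2<=bud Bₛ ρ) (≤-trans (m≤m+n _ _) (B<=bud Bₛ ρ)))
 bodyP : Poly {arr ∷ nat ∷ Text0} Bₛ arr (\ (t , i , ρ) -> table (Λ ρ) (det (auto (Λ ρ) t) (block# ρ i)))
 bodyP = tableP {M = \ (t , i , ρ) -> det (auto (Λ ρ) t) (block# ρ i)} Λ' (detP {M = \ (t , i , ρ) -> auto (Λ ρ) t} {m = \ (t , i , ρ) -> block# ρ i} (autoP Λ' #0) (raise (thin (drop ident) blockPowerP)) 1
   (\ ρ -> self (2<=bud Bₛ ρ) (≤-trans (m≤n+m _ (B0 (snd (snd ρ)))) (B<=bud Bₛ ρ))))
  where
  Λ' : Poly Bₛ nat (\ (t , i , ρ) -> Λ ρ)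
  Λ' = raise (thin (drop (drop ident)) ΛP)
 outerP : Poly B0 nat (\ ρ -> Dn.outer ρ)
 outerP = app1 pred-poly (call ident quantsP (litP 0))
 table-size : ∀ Λ M -> size arr (table Λ M) ≤ Auto.N M + suc (tabSize Λ (Auto.N M) * 2)
 table-size Λ M = ≤-trans (≡⇒≤ (tr (length-++ (replicate N true) {false ∷ enc arr (tab (tabSize Λ N) (\ k -> b2n (entryAt Λ N ini acc rel k)))}) (cong (_+ suc (size arr (tab (tabSize Λ N) (\ k -> b2n (entryAt Λ N ini acc rel k))))) (length-replicate N))))
  (+-monoʳ-≤ N (s≤s (tab-size (tabSize Λ N) (\ k -> b2n (entryAt Λ N ini acc rel k)) {1} (tabSize Λ N) (\ k -> b2n-<= (entryAt Λ N ini acc rel (tabSize Λ N ∸ suc k))))))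
  where
  open Auto M
  b2n-<= : ∀ b -> b2n b ≤ 1
  b2n-<= false = z≤n
  b2n-<= true = ≤-refl
 tablesP : Poly B0 arr (\ ρ -> tables' ρ (Dn.outer ρ))
 tablesP = iterP {Bₛ = Bₛ} {s = \ ρ i t -> table (Λ ρ) (det (auto (Λ ρ) t) (block# ρ i))} outerP (tableP {M = product0} ΛP productP) bodyP _ small 3 small'
  where
  bounded : ∀ ρ n -> n ≤ B0 ρ -> Within (bud B0 ρ) _ (n + suc (tabSize (Λ ρ) n * 2))
  bounded ρ n n<= = plus bb (w n<=) (plus bb (const bb 1) (times bb (plus bb (plus bb (w n<=) (w n<=)) (times bb (times bb (w n<=) (Λ-within ident ρ ≤-refl)) (w n<=))) (const bb 2)))
   where
   bb = 2<=bud B0 ρ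
   w : ∀ {n} -> n ≤ B0 ρ -> Within (bud B0 ρ) 1 n
   w n<= = self bb (≤-trans n<= (B<=bud B0 ρ))
  sizes<= : ∀ ρ i -> size arr (tables' ρ i) ≤ states ρ i + suc (tabSize (Λ ρ) (states ρ i) * 2)
  sizes<= ρ zero = table-size (Λ ρ) (product0 ρ)
  sizes<= ρ (suc i) = subst (\ n -> size arr (tables' ρ (suc i)) ≤ n + suc (tabSize (Λ ρ) n * 2)) (cong (2 ^_) (tables-N ρ i)) (table-size (Λ ρ) (det (auto (Λ ρ) (tables' ρ i)) (block# ρ i)))
  small : ∀ ρ i -> i ≤ Dn.outer ρ -> Within (bud B0 ρ) _ (size arr (tables' ρ i))
  small ρ i i<= = shrink (2<=bud B0 ρ) (sizes<= ρ i) (bounded ρ (states ρ i) (states<= ρ i<=))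
  small' : ∀ ρ i -> i < Dn.outer ρ -> Within (bud B0 ρ) 3 (B0 ρ + 2 ^ (tables' ρ i ‼ 0))
  small' ρ i i< = plus bb (self bb (B<=bud B0 ρ)) (self bb (≤-trans (subst (\ n -> 2 ^ n ≤ B0 ρ) (sym (tables-N ρ i)) (states<= ρ i<)) (B<=bud B0 ρ)))
   where
    bb = 2<=bud B0 ρ
 answer' : Env Text0 -> Bool
 answer' ρ = (symAt (fst ρ) 0 ≡ᵇ 16) == alive (auto (Λ ρ) (tables' ρ (Dn.outer ρ))) (block# ρ (Dn.outer ρ)) (Auto.ini (auto (Λ ρ) (tables' ρ (Dn.outer ρ))))
 answerP : Test B0 answer'
 answerP = (symbolP ident (litP 0) =bP litP 16) ==P bind tablesP (aliveP {M = \ (t , ρ) -> auto (Λ ρ) t} {m = \ (t , ρ) -> block# ρ (Dn.outer ρ)} machine' (wk (call ident blockPowerP outerP))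
    {S = \ (q , t , ρ) -> Auto.ini (auto (Λ ρ) t) q} (AutoProg.iniP machine'))
  where
  machine' : AutoProg {arr ∷ Text0} (B0 ∘ snd) (\ (t , ρ) -> auto (Λ ρ) t)
  machine' = autoP (wk ΛP) #0
 answer-= : ∀ ρ -> scope (block# ρ) (Dn.outer ρ) (suc (Dn.outer ρ)) ≤ fst (snd ρ) -> Dn.answer ρ ≡ answer' ρ
 answer-= ρ scope<= = cong ((symAt (fst ρ) 0 ≡ᵇ 16) ==_) (tr (cong (\ M -> alive M (block# ρ o) (Auto.ini M)) (levels-= o)) alive-tables)
  where
  o = Dn.outer ρ
  open Levels (product0 ρ) (block# ρ) o (Λ ρ) (^-monoʳ-≤ A scope<=)
  levels-= : ∀ j -> Dn.level ρ j ≡ levels j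
  levels-= zero = refl
  levels-= (suc j) = cong (\ M -> det M (block# ρ j)) (levels-= j)

-- The Turing machine of a test on texts

-- The scan leaves the word reversed on stack 0; prepending its bits one by one to the array on
-- stack 1 restores their order, and stack 2 counts them.
readBit : Bool -> Cmd
readBit false = push 1 false ﹔ push 1 true ﹔ push 2 true
readBit true = push 1 false ﹔ push 1 true ﹔ push 1 true ﹔ push 2 true

prelude : Cmd
prelude = loop 0 readBit

record Loaded (w : List ℕ) (n : ℕ) (σ σ' : Store) : Set where
 field
  array : σ' 1 ≡ enc arr w
  number : σ' 2 ≡ replicate n true
  others : ∀ j -> 3 ≤ j -> σ' j ≡ σ j

readBit-exec : ∀ b {w n σ} -> σ 1 ≡ enc arr w -> σ 2 ≡ replicate n true -> ∃₂ \ σ' t -> Exec (readBit b) σ σ' t × t ≤ 4 × σ' 0 ≡ σ 0 × Loaded (bitCode b ∷ w) (suc n) σ σ'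
readBit-exec false {σ = σ} e1 e2 = set 2 (true ∷ σ2 2) σ2 , _ , push u1 ﹔ (push u2 ﹔ push (upd-set 2 (true ∷ σ2 2) σ2)) , n≤1+n 3 , refl ,
 record { array = cong (\ s -> true ∷ false ∷ s) e1 ; number = cong (true ∷_) e2 ; others = \ { (suc (suc (suc j))) _ -> refl ; (suc (suc zero)) (s≤s (s≤s ())) ; (suc zero) (s≤s ()) } }
 where
 σ1 = set 1 (false ∷ σ 1) σ
 u1 = upd-set 1 (false ∷ σ 1) σ
 σ2 = set 1 (true ∷ σ1 1) σ1
 u2 = upd-set 1 (true ∷ σ1 1) σ1
readBit-exec true {σ = σ} e1 e2 = set 2 (true ∷ σ3 2) σ3 , _ , push u1 ﹔ (push u2 ﹔ (push u3 ﹔ push (upd-set 2 (true ∷ σ3 2) σ3))) , ≤-refl , refl ,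
 record { array = cong (\ s -> true ∷ true ∷ false ∷ s) e1 ; number = cong (true ∷_) e2 ; others = \ { (suc (suc (suc j))) _ -> refl ; (suc (suc zero)) (s≤s (s≤s ())) ; (suc zero) (s≤s ()) } }
 where
 σ1 = set 1 (false ∷ σ 1) σ
 u1 = upd-set 1 (false ∷ σ 1) σ
 σ2 = set 1 (true ∷ σ1 1) σ1
 u2 = upd-set 1 (true ∷ σ1 1) σ1
 σ3 = set 1 (true ∷ σ2 1) σ2
 u3 = upd-set 1 (true ∷ σ2 1) σ2

prelude-exec : ∀ s {w n σ} -> σ 0 ≡ s -> σ 1 ≡ enc arr w -> σ 2 ≡ replicate n true -> ∃₂ \ σ' t -> Exec prelude σ σ' t × t ≤ 2 + 6 * length s × Loaded (bitCodes s ʳ++ w) (length s + n) σ σ'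
prelude-exec [] {σ = σ} e0 e1 e2 = σ , 2 , loop∅ e0 (\ _ -> refl) , ≤-refl , record { array = e1 ; number = e2 ; others = \ _ _ -> refl }
prelude-exec (b ∷ s) {w} {n} {σ} e0 e1 e2 = finish (readBit-exec b {w} {n} {set 0 s σ} e1 e2)
 where
 finish : (∃₂ \ σ' t -> Exec (readBit b) (set 0 s σ) σ' t × t ≤ 4 × σ' 0 ≡ s × Loaded (bitCode b ∷ w) (suc n) (set 0 s σ) σ') ->
  ∃₂ \ σ' t -> Exec prelude σ σ' t × t ≤ 2 + 6 * length (b ∷ s) × Loaded (bitCodes (b ∷ s) ʳ++ w) (length (b ∷ s) + n) σ σ'
 finish (σ2 , t1 , p1 , t1<= , e0' , l) with prelude-exec s {bitCode b ∷ w} {suc n} {σ2} e0' (Loaded.array l) (Loaded.number l)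
 ... | σ' , t2 , p2 , t2<= , l' = σ' , 2 + (t1 + t2) , loop:: e0 (upd-set 0 s σ) p1 p2 , (begin 2 + (t1 + t2) ≤⟨ +-monoʳ-≤ 2 (+-mono-≤ t1<= t2<=) ⟩ 2 + (4 + (2 + 6 * length s)) ≡⟨⟩
    2 + (6 + 6 * length s) ≡⟨ cong (2 +_) (*-suc 6 (length s)) ⟨ 2 + 6 * suc (length s) ∎) , record { array = Loaded.array l'
   ; number = tr (Loaded.number l') (cong (\ m -> replicate m true) (+-suc (length s) n))
   ; others = \ j 3<=j -> tr (Loaded.others l' j 3<=j) (tr (Loaded.others l j 3<=j) (frame (upd-set 0 s σ) j (>⇒≢ (≤-trans (s≤s z≤n) 3<=j)))) }
  where
  open ℕ.≤-Reasoning

module TestMachine {B : Env Text0 -> ℕ} {f : Env Text0 -> Bool} (p : Test B f) where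
 program : Cmd
 program = prelude ﹔ prog p (1 , 2 , tt) 3 4
 open Decider program 3 using (machine)
 envOf : List Bool -> Env Text0
 envOf bs = bitCodes bs , length bs , tt
 decides-test : ∀ bs {m} -> length bs + (2 + 6 * length bs + bud B (envOf bs) ^ deg p) + 3 ≤ m -> run machine m (initial machine bs) ≡ just (f (envOf bs))
 decides-test bs {m} fits with prelude-exec (reverse bs) {[]} {0} {Decider.input program 3 (reverse bs)} refl refl refl
 ... | σ1 , t1 , p1 , t1<= , l = tr (Decider.decides program 3 bs (p1 ﹔ fst (snd (snd executed))) enough)
   (cong just (tr (cong (Decider.nonempty program 3) (Result.output (fst (snd (snd (snd executed)))))) (nonempty-b2n (f (envOf bs)))))
  where
  text-= : bitCodes (reverse bs) ʳ++ [] ≡ bitCodes bs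
  text-= = tr (cong (List._ʳ++ []) (reverse-map bitCode bs)) (tr (reverse-ʳ++ (bitCodes bs) []) (++-identityʳ (bitCodes bs)))
  length-= : length (reverse bs) + 0 ≡ length bs
  length-= = tr (+-identityʳ _) (length-reverse bs)
  ready : Ready Text0 (1 , 2 , tt) 3 4 σ1 (envOf bs)
  ready = record { holds = tr (Loaded.array l) (cong (enc arr) text-=) , tr (Loaded.number l) (cong (\ n -> replicate n true) length-=) , tt
   ; avoids = (s≤s (s≤s z≤n) , \ ()) , (s≤s (s≤s (s≤s z≤n)) , \ ()) , tt ; o<k = ≤-refl ; empty = Loaded.others l 3 ≤-refl
   ; clean = \ { (suc j) 4<=j -> Loaded.others l (suc j) (≤-trans (n≤1+n 3) 4<=j) } }
  executed = correct p ready
  t2 = fst (snd executed)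
  enough : length bs + (t1 + t2) + 3 ≤ m
  enough = ≤-trans (+-monoˡ-≤ 3 (+-monoʳ-≤ (length bs) (+-mono-≤ (≤-trans t1<= (≡⇒≤ (cong (\ n -> 2 + 6 * n) (length-reverse bs)))) (bound (snd (snd (snd (snd executed)))))))) fits
  nonempty-b2n : ∀ b -> Decider.nonempty program 3 (replicate (b2n b) true) ≡ b
  nonempty-b2n false = refl
  nonempty-b2n true = refl
 abstract
  exponent : ℕ
  exponent = deg p
  testMachine : TM
  testMachine = machine
  test-decides : ∀ bs {m P} -> length bs + (2 + 6 * length bs + bud B (envOf bs) ^ exponent) + 3 ≤ m -> Reflects P (f (envOf bs)) -> DecidesWithin testMachine bs m P
  test-decides bs fits rf = f (envOf bs) , decides-test bs fits , rf

-- Towers absorb factors, powers and sums in their argument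

tower-mono : ∀ r {x y} -> x ≤ y -> tower r x ≤ tower r y
tower-mono zero p = p
tower-mono (suc r) p = ^-monoʳ-≤ 2 (tower-mono r p)

tower-≥ : ∀ r x -> x ≤ tower r x
tower-≥ zero x = ≤-refl
tower-≥ (suc r) x = ≤-trans (tower-≥ r x) (<=2^ (tower r x))

-- A factor 1 + d is at most 2 to the power d, hence becomes a summand one level higher, is bounded
-- by a factor there, and so moves up to the top.
tower-* : ∀ r d {x} -> 1 ≤ x -> suc d * tower r x ≤ tower r (suc d * x)
tower-* zero d 1<=x = ≤-refl
tower-* (suc r) d {x} 1<=x = begin suc d * 2 ^ n ≤⟨ *-monoˡ-≤ (2 ^ n) (suc<=2^ d) ⟩ 2 ^ d * 2 ^ n ≡⟨ ^-distribˡ-+-* 2 d n ⟨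
 2 ^ (d + n) ≤⟨ ^-monoʳ-≤ 2 (≤-trans (+-monoˡ-≤ n (m≤m*n d n)) (≡⇒≤ (+-comm (d * n) n))) ⟩ 2 ^ (suc d * n) ≤⟨ ^-monoʳ-≤ 2 (tower-* r d 1<=x) ⟩ 2 ^ tower r (suc d * x) ∎
 where
 open ℕ.≤-Reasoning
 n = tower r x
 instance
  n≢0 : NonZero n
  n≢0 = ℕ.>-nonZero (≤-trans 1<=x (tower-≥ r x))
 suc<=2^ : ∀ d -> suc d ≤ 2 ^ d
 suc<=2^ zero = ≤-refl
 suc<=2^ (suc d) = ≤-trans (+-mono-≤ (m^n>0 2 d) (suc<=2^ d)) (≡⇒≤ (cong (2 ^ d +_) (sym (+-identityʳ _))))

tower-^ : ∀ r d {x} -> 1 ≤ x -> tower (suc r) x ^ suc d ≤ tower (suc r) (suc d * x)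
tower-^ r d {x} 1<=x = ≤-trans (≡⇒≤ (tr (^-*-assoc 2 (tower r x) (suc d)) (cong (2 ^_) (*-comm (tower r x) (suc d))))) (^-monoʳ-≤ 2 (tower-* r d 1<=x))

tower-+ : ∀ r {a b x} -> 1 ≤ x -> a ≤ tower r x -> b ≤ tower r x -> a + b ≤ tower r (2 * x)
tower-+ r {x = x} 1<=x p q = ≤-trans (+-mono-≤ p (≤-trans q (≡⇒≤ (sym (+-identityʳ _))))) (tower-* r 1 1<=x)

exponentials-tower : ∀ {n x} r -> n ≤ 2 ^ x -> exponentials n r ≤ tower (suc r) x
exponentials-tower zero p = p
exponentials-tower (suc r) p = ^-monoʳ-≤ 2 (exponentials-tower r p)

-- The number of states of the product automaton

suc-+-<= : ∀ {x y i j} -> suc x ≤ 2 ^ i -> suc y ≤ 2 ^ j -> suc (x + y) ≤ 2 ^ (i + j)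
suc-+-<= {x} {y} {i} {j} p q = ≤-trans (s≤s (≤-trans (+-monoʳ-≤ x (m≤m+n y (x * y))) (≡⇒≤ (lemma x y)))) (≤-trans (*-mono-≤ p q) (≡⇒≤ (sym (^-distribˡ-+-* 2 i j))))
 where
 open ℕ-Solver
 lemma : ∀ x y -> x + (y + x * y) ≡ y + x * suc y
 lemma = solve 2 (\ x y -> x :+ (y :+ x :* y) := y :+ x :* (con 1 :+ y)) refl

digits-< : ∀ ds -> suc (fromDigits {2} ds) ≤ 2 ^ length (digCodes ds)
digits-< [] = ≤-refl
digits-< (d ∷ ds) = begin suc (toℕ d + fromDigits ds * 2) ≤⟨ s≤s (+-monoˡ-≤ (fromDigits ds * 2) (≤-pred (Fin.toℕ<n d))) ⟩ suc (fromDigits {2} ds) * 2 ≤⟨ *-monoˡ-≤ 2 (digits-< ds) ⟩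
 2 ^ length (digCodes ds) * 2 ≡⟨ *-comm (2 ^ length (digCodes ds)) 2 ⟩ 2 ^ suc (length (digCodes ds)) ∎
 where
  open ℕ.≤-Reasoning

numeral-< : ∀ n -> suc n ≤ 2 ^ length (numrl n)
numeral-< n with numeral-digits n
... | ds , eq , val = subst2 (\ m v -> suc m ≤ 2 ^ length v) val (sym eq) (digits-< ds)

integer-< : ∀ z -> suc Z.∣ z ∣ ≤ 2 ^ length (integer z)
integer-< (Z.+ n) = subst (\ v -> suc n ≤ 2 ^ length v) (sym (integer-nonneg n)) (numeral-< n)
integer-< -[1+ n ] = subst (\ v -> suc (suc n) ≤ 2 ^ length v) (sym (integer-neg n)) (≤-trans (numeral-< (suc n)) (^-monoʳ-≤ 2 (n≤1+n (length (numrl (suc n))))))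

norm1 : ℤ[α] -> ℕ
norm1 (c + d ·α) = Z.∣ c ∣ + Z.∣ d ∣

norm1-< : ∀ a -> suc (norm1 a) ≤ 2 ^ length (inside a)
norm1-< (c + d ·α) = ≤-trans (suc-+-<= {i = length (integer c)} (integer-< c) (integer-< d)) (^-monoʳ-≤ 2 (begin
 length (integer c) + length (integer d) ≤⟨ +-monoʳ-≤ (length (integer c)) (≤-trans (m≤m+n _ 2) (≤-trans (≡⇒≤ (sym (length-++ (integer d)))) (n≤1+n _))) ⟩
 length (integer c) + length (21 ∷ integer d ++ 22 ∷ 24 ∷ []) ≡⟨ length-++ (integer c) ⟨ length (inside (c + d ·α)) ∎))
 where
  open ℕ.≤-Reasoning

termsNorm : ∀ {n} -> List (ℤ[α] × Fin n) -> ℕ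
termsNorm = List.foldr (\ (a , _) x -> norm1 a + x) 0

-- By `suc-+-<=` one plus a sum of norms is at most a product of such numbers, each bounded through
-- the length of its own piece of text; these lengths add up.
atom-< : ∀ {n} (t : List (ℤ[α] × Fin n)) R a rest -> suc (termsNorm t + norm1 a) * 2 ^ length rest ≤ 2 ^ length (atomText t R a rest)
atom-< {n} t R a rest = ≤-trans (*-monoˡ-≤ (2 ^ length rest) (text-< t)) (≤-trans (≡⇒≤ (sym (^-distribˡ-+-* 2 (length (atomText t R a [])) (length rest)))) (^-monoʳ-≤ 2 (≡⇒≤ (splits t))))
 where
 text-< : ∀ t -> suc (termsNorm t + norm1 a) ≤ 2 ^ length (atomText t R a [])
 text-< [] = ≤-trans (norm1-< a) (^-monoʳ-≤ 2 (≤-trans (≡⇒≤ (cong length (sym (++-identityʳ (inside a))))) (≤-trans (n≤1+n _) (n≤1+n _))))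
 text-< ((a' , i) ∷ t) = ≤-trans (≡⇒≤ (cong suc (+-assoc (norm1 a') (termsNorm t) (norm1 a)))) (≤-trans (suc-+-<= {i = length (inside a')} (norm1-< a') (text-< t)) (^-monoʳ-≤ 2 (≤-trans
   (+-monoʳ-≤ (length (inside a')) (≤-trans (≤-trans (m≤n+m _ (length (numrl (toℕ i)))) (≡⇒≤ (sym (length-++ (numrl (toℕ i)))))) (n≤1+n _))) (≤-trans (≡⇒≤ (sym (length-++ (inside a')))) (n≤1+n _)))))
 atom-++ : ∀ t -> atomText t R a [] ++ rest ≡ atomText t R a rest
 atom-++ [] = cong (\ v -> relCode R ∷ 23 ∷ v ++ rest) (++-identityʳ (inside a))
 atom-++ ((a' , i) ∷ t) = cong (23 ∷_) (tr (++-assoc (inside a') _ rest) (cong (\ v -> inside a' ++ 17 ∷ v) (tr (++-assoc (numrl (toℕ i)) _ rest) (cong (numrl (toℕ i) ++_) (atom-++ t)))))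
 splits : ∀ t -> length (atomText t R a []) + length rest ≡ length (atomText t R a rest)
 splits t = tr (sym (length-++ (atomText t R a []))) (cong length (atom-++ t))

prod-first : ∀ n f -> prod (suc n) f ≡ f 0 * prod n (f ∘ suc)
prod-first zero f = refl
prod-first (suc n) f = tr (cong (f (suc n) *_) (prod-first n f)) (solve 3 (\ a b c -> a :* (b :* c) := b :* (a :* c)) refl (f (suc n)) (f 0) (prod n (f ∘ suc)))
 where
  open ℕ-Solver

prod-cong : ∀ n {f g} -> (∀ i -> f i ≡ g i) -> prod n f ≡ prod n g
prod-cong zero h = refl
prod-cong (suc n) h = cong2 _*_ (h n) (prod-cong n h)

-- A coordinate ranges over 1 + 4 E values, at most `h` times one plus the mass; two claims and four
-- coordinates per position give `g`. It is opaque because it is a large number once unfolded.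
module StateFactor (setting : Setting) (k : ℕ) (b s : ℤ) where
 h : ℕ
 h = suc (4 * Constants.G setting k b s)
 abstract
  g : ℕ
  g = 2 * (h * (h * (h * h)))
  g-def : 2 * (h * (h * (h * h))) ≡ g
  g-def = refl

module StateBound (setting : Setting) (k : ℕ) (b s : ℤ) (symb : ℕ -> ℕ) (ℓ : ℕ) (beyond : ∀ i -> ℓ ≤ i -> symb i ≡ 0) where
 open Inputs setting k b s symb ℓ
 open Meaning beyond
 open Structure symb ℓ beyond using (at-skip; free-skip; skipTo; all-17; not-busy)
 -- The product over all positions is bounded as a whole by 2 to the length of the text. Bounding
 -- each factor by the whole length would give an exponential of a square, and the tower would no
 -- longer be linear in ℓ at its top.
 massStep : ℕ -> ℕ -> ℕ
 massStep i v = suc (mass i) * v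
 open Scan massStep 1 (\ i v e _ -> tr (cong (\ c -> suc (if c then overTms 0 (\ i x -> magnitude i + x) i + magnitude (suc (relation i)) else 0) * v) e) (*-identityˡ v))
 mass-at : ∀ {n} (t : List (ℤ[α] × Fin n)) R a {p rest} -> At p (atomText t R a rest) -> start? p ≡ true -> mass p ≡ termsNorm t + norm1 a
 mass-at t R a {p} tx st = tr (cong (\ c -> if c then overTms 0 (\ i x -> magnitude i + x) p + magnitude (suc (relation p)) else 0) st)
  (cong2 _+_ (overTerms-at 0 (\ i x -> magnitude i + x) (\ (a , _) x -> norm1 a + x) (\ {p} {a} tx _ x -> cong (_+ x) (magnitude-at a tx)) t R a tx) (magnitude-at a (at-tail (rel-at t R a tx))))
  where
  magnitude-at : ∀ a {p rest} -> At p (23 ∷ inside a ++ rest) -> magnitude p ≡ norm1 a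
  magnitude-at a tx = cong2 (\ x y -> Z.∣ x ∣ + Z.∣ y ∣) (c0-at a tx) (c1-at a tx)
 Small : List ℕ -> Set
 Small u = ∀ {p} -> At p u -> Free p -> V p ≤ 2 ^ length u
 small-:: : ∀ {s u} -> busy s ≡ false -> Plain s -> Small u -> Small (s ∷ u)
 small-:: {s} {u} nb pl h {p} tx fr = ≤-trans (≡⇒≤ (walks (subst Plain (sym (at-head tx)) pl))) (≤-trans (h (at-tail tx) (tr (cong busy (at-head tx)) nb)) (^-monoʳ-≤ 2 (n≤1+n (length u))))
 small-connective : ∀ {s u} -> busy s ≡ false -> isTerm s ∨ isRel s ≡ false -> Small u -> Small (s ∷ u)
 small-connective {s} {u} nb pl h {p} tx fr = ≤-trans (≡⇒≤ (tr (unroll p)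
   (tr (cong (\ c -> suc (if c then overTms 0 (\ i x -> magnitude i + x) p + magnitude (suc (relation p)) else 0) * V (suc p)) (start-plain p (tr (cong (\ s -> isTerm s ∨ isRel s) (at-head tx)) pl)))
    (*-identityˡ (V (suc p)))))) (≤-trans (h (at-tail tx) (tr (cong busy (at-head tx)) nb)) (^-monoʳ-≤ 2 (n≤1+n (length u))))
 small-form : ∀ {n} (φ : Formula n) {rest} -> Small rest -> Small (formText φ rest)
 small-form (atom t R a) {rest} h {p} tx fr = bounded (atom-scan t R a fr tx)
  where
  bounded : start? p ≡ true × Parsed (\ q -> V p ≡ massStep p (V q)) rest -> V p ≤ 2 ^ length (atomText t R a rest)
  bounded (st , q , e , tx' , fr') = ≤-trans (≡⇒≤ (tr e (cong (\ m -> suc m * V q) (mass-at t R a tx st)))) (≤-trans (*-monoʳ-≤ (suc (termsNorm t + norm1 a)) (h tx' fr')) (atom-< t R a rest))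
 small-form (and φ ψ) h = small-connective refl refl (small-form φ (small-form ψ h))
 small-form (or φ ψ) h = small-connective refl refl (small-form φ (small-form ψ h))
 small-form (not φ) h = small-connective refl refl (small-form φ h)
 small-prenex : ∀ {Q n r} (S : Prenex Q n r) -> Small (preText S)
 small-prenex (matrix φ) = small-form φ (\ {p} tx _ -> ≡⇒≤ (past p tx))
 small-prenex {Q} (block m S) = small-:: (not-busy Q) (plain Q) (small-xs m)
  where
  plain : ∀ Q -> Plain (quantCode Q)
  plain all = refl , refl
  plain ex = refl , refl
  small-xs : ∀ m -> Small (replicate m 17 ++ preText S)
  small-xs zero = small-prenex S
  small-xs (suc m) = small-:: refl (refl , refl) (small-xs m)
 upTo-prod : ∀ n p -> upTo n p ≡ prod n (\ i -> suc (mass (p + i)))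
 upTo-prod zero p = refl
 upTo-prod (suc n) p = tr (grow n p) (tr (cong (suc (mass p) *_) (tr (upTo-prod n (suc p)) (prod-cong n (\ i -> cong (suc ∘ mass) (sym (+-suc p i))))))
  (tr (cong (\ j -> suc (mass j) * prod n (\ i -> suc (mass (p + suc i)))) (sym (+-identityʳ p))) (sym (prod-first n (\ i -> suc (mass (p + i)))))))
 open StateFactor setting k b s public
 H-<= : ∀ p -> H p ≤ h * suc (mass p)
 H-<= p = +-mono-≤ {1} (s≤s z≤n) (≡⇒≤ (lemma G (suc (mass p))))
  where
  open ℕ-Solver
  lemma : ∀ G M -> (G * M + G * M) + (G * M + G * M) ≡ 4 * G * M
  lemma = solve 2 (\ G M -> (G :* M :+ G :* M) :+ (G :* M :+ G :* M) := con 4 :* G :* M) refl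
 fifth : ℕ -> ℕ
 fifth x = x * (x * (x * (x * 2)))
 W-<= : ∀ p -> W p ≤ fifth (h * suc (mass p))
 W-<= p = ≤-trans (choose (suc p ≤ᵇ ℓ)) (*-mono-≤ (H-<= p) (*-mono-≤ (H-<= p) (*-mono-≤ (H-<= p) (*-monoˡ-≤ 2 (H-<= p)))))
  where
  choose : ∀ c -> (if c then prod 5 (widths p) else 1) ≤ fifth (H p)
  choose true = ≤-refl
  choose false = prod-positive (widths p) (0<widths p) 5
 -- Fourth powers, one factor for each coordinate of the two elements carried.
 prod-W : ∀ n -> prod n W ≤ (2 * (h * (h * (h * h)))) ^ n * (prod n (suc ∘ mass) ^ 4)
 prod-W zero = ≤-refl
 prod-W (suc n) = ≤-trans (*-mono-≤ (W-<= n) (prod-W n)) (≡⇒≤ (lemma h (suc (mass n)) ((2 * (h * (h * (h * h)))) ^ n) (prod n (suc ∘ mass))))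
  where
  open ℕ-Solver
  lemma : ∀ h M G P -> h * M * (h * M * (h * M * (h * M * 2))) * (G * (P * (P * (P * (P * 1))))) ≡ 2 * (h * (h * (h * h))) * G * (M * P * (M * P * (M * P * (M * P * 1))))
  lemma = solve 4 (\ h M G P -> h :* M :* (h :* M :* (h :* M :* (h :* M :* con 2))) :* (G :* (P :* (P :* (P :* (P :* con 1))))) :=
   con 2 :* (h :* (h :* (h :* h))) :* G :* (M :* P :* (M :* P :* (M :* P :* (M :* P :* con 1))))) refl
 states-<= : ∀ {Q n r} (S : Prenex Q n r) -> At 0 (preText S) -> Free 0 -> length (preText S) ≤ ℓ -> Auto.N product ≤ 2 ^ ((g + 4) * ℓ)
 states-<= S tx fr len<= = begin prod ℓ W ≤⟨ subst (\ g -> prod ℓ W ≤ g ^ ℓ * (prod ℓ (suc ∘ mass) ^ 4)) g-def (prod-W ℓ) ⟩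
  g ^ ℓ * (prod ℓ (suc ∘ mass) ^ 4) ≤⟨ *-mono-≤ (^-monoˡ-≤ ℓ (<=2^ g)) (^-monoˡ-≤ 4 (≤-trans (≡⇒≤ (sym (upTo-prod ℓ 0))) (≤-trans (small-prenex S tx fr) (^-monoʳ-≤ 2 len<=)))) ⟩
  (2 ^ g) ^ ℓ * ((2 ^ ℓ) ^ 4) ≡⟨ cong2 _*_ (^-*-assoc 2 g ℓ) (tr (^-*-assoc 2 ℓ 4) (cong (2 ^_) (*-comm ℓ 4))) ⟩ 2 ^ (g * ℓ) * 2 ^ (4 * ℓ) ≡⟨ ^-distribˡ-+-* 2 (g * ℓ) (4 * ℓ) ⟨
  2 ^ (g * ℓ + 4 * ℓ) ≡⟨ cong (2 ^_) (*-distribʳ-+ ℓ g 4) ⟨ 2 ^ ((g + 4) * ℓ) ∎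
  where
   open ℕ.≤-Reasoning

‼-beyond : ∀ xs {i} -> length xs ≤ i -> xs ‼ i ≡ 0
‼-beyond [] _ = refl
‼-beyond (x ∷ xs) (s≤s p) = ‼-beyond xs p

length-bits : ∀ ss -> length (List.concatMap bits ss) ≡ length ss * 4
length-bits [] = refl
length-bits (s ∷ ss) = tr (length-++ (bits s)) (cong2 _+_ (four s) (length-bits ss))
 where
 four : ∀ s -> length (bits s) ≡ 4
 four ‵∀ = refl
 four ‵∃ = refl
 four ‵x = refl
 four ‵0 = refl
 four ‵1 = refl
 four ‵- = refl
 four ‵+ = refl
 four ‵α = refl
 four ‵⟨ = refl
 four ‵⟩ = refl
 four ‵≤ = refl
 four ‵< = refl
 four ‵∧ = refl
 four ‵∨ = refl
 four ‵¬ = refl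

sum-first : ∀ n f -> sum (suc n) f ≡ f 0 + sum n (f ∘ suc)
sum-first zero f = refl
sum-first (suc n) f = tr (cong (f (suc n) +_) (sum-first n f)) (solve 3 (\ a b c -> a :+ (b :+ c) := b :+ (a :+ c)) refl (f (suc n)) (f 0) (sum n (f ∘ suc)))
 where
  open ℕ-Solver

sum-cong : ∀ n {f g} -> (∀ i -> i < n -> f i ≡ g i) -> sum n f ≡ sum n g
sum-cong zero h = refl
sum-cong (suc n) h = cong2 _+_ (h n ≤-refl) (sum-cong n (\ i p -> h i (m<n⇒m<1+n p)))

sizes-<= : ∀ {Q n r} (S : Prenex Q n r) -> sum r (\ i -> sizeOf S (r ∸ suc i)) ≤ length (preText S)
sizes-<= (matrix φ) = z≤n
sizes-<= {Q} (block {r = r} m S) = begin sum (suc r) (\ i -> sizeOf (block {Q} m S) (r ∸ i)) ≡⟨ sum-first r (\ i -> sizeOf (block {Q} m S) (r ∸ i)) ⟩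
 sizeOf (block {Q} m S) r + sum r (\ i -> sizeOf (block {Q} m S) (r ∸ suc i)) ≡⟨ cong2 _+_ (cong (\ b -> if b then m else sizeOf S r) (=b-refl r))
   (sum-cong r (\ i i<r -> cong (\ b -> if b then m else sizeOf S (r ∸ suc i)) (<=>/=b (∸-monoʳ-< (s≤s z≤n) i<r)))) ⟩ m + sum r (\ i -> sizeOf S (r ∸ suc i)) ≤⟨ +-monoʳ-≤ m (sizes-<= S) ⟩
 m + length (preText S) ≡⟨ cong (_+ length (preText S)) (length-replicate m) ⟨ length (replicate m 17) + length (preText S) ≡⟨ length-++ (replicate m 17) ⟨
 length (replicate m 17 ++ preText S) ≤⟨ n≤1+n _ ⟩ length (preText (block {Q} m S)) ∎
 where
  open ℕ.≤-Reasoning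

size-bitCodes : ∀ bs -> size arr (bitCodes bs) ≤ 3 * length bs
size-bitCodes [] = z≤n
size-bitCodes (false ∷ bs) = ≤-trans (s≤s (s≤s (size-bitCodes bs))) (≤-trans (n≤1+n _) (≡⇒≤ (sym (*-suc 3 (length bs)))))
size-bitCodes (true ∷ bs) = ≤-trans (s≤s (s≤s (s≤s (size-bitCodes bs)))) (≡⇒≤ (sym (*-suc 3 (length bs))))

-- The running time

time-bound : ∀ r d c L b {u v w} -> b ≤ u + (v + w) -> 1 ≤ L -> 6 ≤ c -> u ≤ tower (suc r) (c * L) -> v ≤ tower (suc r) (c * L) -> w ≤ tower (suc r) (c * L) ->
 L + (2 + 6 * L + b ^ d) + 3 ≤ tower (suc r) (2 * (12 + suc d * (2 * (2 * c))) * L)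
time-bound r d c L b {u} {v} {w} b<=' 1<=L 6<=c u<= v<= w<= = begin L + (2 + 6 * L + P) + 3 ≡⟨ solve 2 (\ L P -> L :+ (con 2 :+ con 6 :* L :+ P) :+ con 3 := (con 5 :+ con 7 :* L) :+ P) refl L P ⟩
 (5 + 7 * L) + P ≤⟨ tower-+ (suc r) {5 + 7 * L} {P} {z} (≤-trans 1<=y (≤-trans (m≤m+n y (d * y)) (m≤n+m (suc d * y) (12 * L))))
  (≤-trans linear-<= (≤-trans (tower-≥ (suc r) (12 * L)) (tower-mono (suc r) (m≤m+n (12 * L) (suc d * y))))) (≤-trans power-<= (tower-mono (suc r) (m≤n+m (suc d * y) (12 * L)))) ⟩
 tower (suc r) (2 * z) ≡⟨ cong (tower (suc r)) (solve 3 (\ d c L -> con 2 :* (con 12 :* L :+ d :* (con 2 :* (con 2 :* (c :* L)))) :=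
  con 2 :* (con 12 :+ d :* (con 2 :* (con 2 :* c))) :* L) refl (suc d) c L) ⟩ tower (suc r) (2 * (12 + suc d * (2 * (2 * c))) * L) ∎
 where
 open ℕ.≤-Reasoning
 open ℕ-Solver
 x y z P : ℕ
 x = c * L
 y = 2 * (2 * x)
 z = 12 * L + suc d * y
 P = b ^ d
 1<=x : 1 ≤ x
 1<=x = *-mono-≤ {1} {c} (≤-trans (s≤s z≤n) 6<=c) 1<=L
 1<=y : 1 ≤ y
 1<=y = ≤-trans 1<=x (≤-trans (m≤m+n x _) (m≤m+n (2 * x) _))
 b<= : b ≤ tower (suc r) y
 b<= = ≤-trans b<=' (tower-+ (suc r) {u} {v + w} (≤-trans 1<=x (m≤m+n x _)) (≤-trans u<= (tower-mono (suc r) (m≤m+n x _))) (tower-+ (suc r) {v} {w} 1<=x v<= w<=))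
 power-<= : P ≤ tower (suc r) (suc d * y)
 power-<= = ≤-trans (grow b) (≤-trans (^-monoˡ-≤ (suc d) (⊔-lub b<= (≤-trans 1<=y (tower-≥ (suc r) y)))) (tower-^ r d 1<=y))
  where
  grow : ∀ b -> b ^ d ≤ (b ℕ.⊔ 1) ^ suc d
  grow b = ≤-trans (^-monoˡ-≤ d (m≤m⊔n b 1)) (m≤n*m ((b ℕ.⊔ 1) ^ d) (b ℕ.⊔ 1) {{ℕ.>-nonZero (m≤n⊔m b 1)}})
 linear-<= : 5 + 7 * L ≤ 12 * L
 linear-<= = ≤-trans (+-monoˡ-≤ (7 * L) (*-monoʳ-≤ 5 1<=L)) (≡⇒≤ (solve 1 (\ L -> con 5 :* L :+ con 7 :* L := con 12 :* L) refl L))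

budget-split : ∀ {Γ} (f g : Env Γ -> ℕ) ρ -> bud (\ ρ -> f ρ + g ρ) ρ ≤ (2 + sizes Γ ρ) + (f ρ + g ρ)
budget-split f g ρ = ≤-refl

module Main {α : ℝ} (quad : Quadratic α) where
 open Quadratic quad using (k; b; s)
 open Link quad using (setting)
 open Automata setting using (A)
 open Procedure quad
 open TestMachine {B0} {answer'} answerP public using (envOf; testMachine; test-decides; exponent)
 open StateFactor setting k b s using (g)
 abstract
  -- Dominates the rates of the three parts of the budget: `A` since A to the power L is at most 2
  -- to the power A L, `g + 4` for the states, and 6 for the size of the input.
  c : ℕ
  c = A + (g + 4) + 6
  A<=c : A ≤ c
  A<=c = ≤-trans (m≤m+n A (g + 4)) (m≤m+n (A + (g + 4)) 6)
  g<=c : g + 4 ≤ c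
  g<=c = ≤-trans (m≤n+m (g + 4) A) (m≤m+n (A + (g + 4)) 6)
  6<=c : 6 ≤ c
  6<=c = m≤n+m 6 (A + (g + 4))
 -- As it comes out of `time-bound`: two doublings for the three parts of the budget, `suc exponent`
 -- for its power, 12 for the linear terms, and a last doubling for their sum with the power.
 C : ℕ
 C = 2 * (12 + suc exponent * (2 * (2 * c)))
 module _ {r} (Q : Quantifier) (m : ℕ) .{{_ : NonZero m}} (S : Prenex (dual Q) (m + 0) r) where
  private
   prefix : Prenex Q 0 (suc r)
   prefix = block m S
   S0 : Sentence (suc r)
   S0 = sentence Q prefix
   bs : List Bool
   bs = encode S0
   ρ : Env Text0
   ρ = envOf bs
   L : ℕ
   L = length bs
   symb-= : ∀ p -> symAt (bitCodes bs) p ≡ preText prefix ‼ p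
   symb-= p = tr (symbol-codes (Write.prenex prefix) p) (cong (_‼ p) (prenexText-= prefix))
   length<= : length (preText prefix) ≤ L
   length<= = begin length (preText prefix) ≡⟨ cong length (prenexText-= prefix) ⟨ length (codes (Write.prenex prefix)) ≡⟨ length-map code (Write.prenex prefix) ⟩
    length (Write.prenex prefix) ≤⟨ m≤m*n (length (Write.prenex prefix)) 4 ⟩ length (Write.prenex prefix) * 4 ≡⟨ length-bits (Write.prenex prefix) ⟨ L ∎
    where
     open ℕ.≤-Reasoning
   1<=L : 1 ≤ L
   1<=L = ≤-trans (s≤s z≤n) length<=
   beyond : ∀ i -> L ≤ i -> symAt (bitCodes bs) i ≡ 0
   beyond i L<=i = tr (symb-= i) (‼-beyond (preText prefix) (≤-trans length<= L<=i))
   open Decision.Correct quad (symAt (bitCodes bs)) L beyond using (answer-correct)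
   open Structure (symAt (bitCodes bs)) L beyond using (quants-at; blockSize-at; not-busy)
   tx : Evaluation.Parsing.At (symAt (bitCodes bs)) L beyond 0 (preText prefix)
   tx = Text.Reading.text symb-=
   outer-= : Dn.outer ρ ≡ r
   outer-= = cong ℕ.pred (quants-at prefix tx)
   scope-<= : Tables.scope setting (block# ρ) (Dn.outer ρ) (suc (Dn.outer ρ)) ≤ L
   scope-<= = subst (\ o -> Tables.scope setting (block# ρ) o (suc o) ≤ L) (sym outer-=)
    (≤-trans (≡⇒≤ (sum-cong (suc r) (\ i _ -> blockSize-at prefix (r ∸ i) tx))) (≤-trans (sizes-<= prefix) length<=))
   correct-answer : Reflects (α ⊨ S0) (answer' ρ)
   correct-answer = subst (Reflects (α ⊨ S0)) (answer-= ρ scope-<=) (answer-correct S0 tx)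
   x : ℕ
   x = c * L
   below-x : ∀ {n} -> n ≤ c -> tower (suc r) (n * L) ≤ tower (suc r) x
   below-x n<=c = tower-mono (suc r) (*-monoˡ-≤ L n<=c)
   sizes-small : 2 + sizes Text0 ρ ≤ tower (suc r) x
   sizes-small = ≤-trans (begin 2 + (size arr (bitCodes bs) + (size nat L + 0)) ≤⟨ +-monoʳ-≤ 2 (+-mono-≤ (size-bitCodes bs) (≡⇒≤ (tr (+-identityʳ _) (size-nat L)))) ⟩
    2 + (3 * L + L) ≤⟨ +-monoˡ-≤ (3 * L + L) (*-monoʳ-≤ 2 1<=L) ⟩ 2 * L + (3 * L + L) ≡⟨ solve 1 (\ L -> con 2 :* L :+ (con 3 :* L :+ L) := con 6 :* L) refl L ⟩
    6 * L ∎) (≤-trans (tower-≥ (suc r) (6 * L)) (below-x {6} 6<=c))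
    where
    open ℕ.≤-Reasoning
    open ℕ-Solver
   alphabet-small : A ^ L ≤ tower (suc r) x
   alphabet-small = ≤-trans (^-monoˡ-≤ L (<=2^ A)) (≤-trans (≡⇒≤ (^-*-assoc 2 A L)) (≤-trans (^-monoʳ-≤ 2 (tower-≥ r (A * L))) (below-x {A} A<=c)))
   states-small : states ρ (Dn.outer ρ) ≤ tower (suc r) x
   states-small = subst (\ o -> states ρ o ≤ tower (suc r) x) (sym outer-=) (≤-trans (exponentials-tower r (StateBound.states-<= setting k b s (symAt (bitCodes bs)) L beyond prefix tx free length<=))
     (below-x {g + 4} g<=c))
    where
    open Text (symAt (bitCodes bs)) L using (busy)
    free : busy (symAt (bitCodes bs) 0) ≡ false
    free = tr (cong busy (symb-= 0)) (not-busy Q)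
   budget-<= : bud B0 ρ ≤ (2 + sizes Text0 ρ) + (A ^ L + states ρ (Dn.outer ρ))
   budget-<= = budget-split Λ (\ ρ -> states ρ (Dn.outer ρ)) ρ
   time-small : L + (2 + 6 * L + bud B0 ρ ^ exponent) + 3 ≤ tower (suc r) (C * L)
   time-small = time-bound r exponent c L (bud B0 ρ) {2 + sizes Text0 ρ} {A ^ L} {states ρ (Dn.outer ρ)} budget-<= 1<=L 6<=c sizes-small alphabet-small states-small
  decided : DecidesWithin testMachine (encode S0) (1 * tower (suc r) (C * ℓ S0)) (α ⊨ S0)
  decided = test-decides bs {1 * tower (suc r) (C * ℓ S0)} {α ⊨ S0} (≤-trans time-small (≡⇒≤ (sym (*-identityˡ _)))) correct-answer

theorem1p2 :
  (α : ℝ) → QuadraticIrrational α →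
  Σ[ M ∈ TM ] Σ[ K ∈ ℕ ] Σ[ C ∈ ℕ ] (0 < K × 0 < C ×
    (∀ (r : ℕ) → 1 ≤ r → ∀ (S : Sentence r) →
      DecidesWithin M (encode S) (K * tower r (C * ℓ S)) (α ⊨ S)))
-- All constant factors have moved into the argument of the tower, so K = 1.
theorem1p2 α qi = Main.testMachine quad , 1 , Main.C quad , s≤s z≤n , s≤s z≤n , decided
 where
 quad = quadratic qi
 decided : ∀ r -> 1 ≤ r -> ∀ (S : Sentence r) -> DecidesWithin (Main.testMachine quad) (encode S) (1 * tower r (Main.C quad * ℓ S)) (α ⊨ S)
 -- Only the r inner blocks cost an exponential each; with that of the product automaton the height
 -- is `suc r`.
 decided (suc r) _ (sentence Q (block m S)) = Main.decided quad Q m S
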